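{- Let $G$ be the $xy$-sum of connected graphs $G_1,G_2\in\mathcal{G}^\circ_{xy}$. The subgraph $G_1$ is $\widehat{g}$-tight in $G$ if and only if: (i) if $\eta(G_1,G_2)=0$ then $G_1\in\mathcal{C}^\circ(\widehat{g}^+)$; (ii) if $\eta(G_1,G_2)=1$ then $G_1\in\mathcal{C}^\circ(\widehat{g}^+)\cup\mathcal{H}^{\rm w}(\widehat{g})$; (iii) if $\eta(G_1,G_2)=2$ then $G_1\in\mathcal{C}^\circ(\widehat{g}^+)\cup\mathcal{C}^\circ(\widehat{g})\cup\mathcal{S}$; (iv) if $\eta(G_1,G_2)=3$ then $G_1\in\mathcal{C}^\circ(\widehat{g})\cup\mathcal{H}^{\rm w}(\widehat{g}^+)$; (v) if $\eta(G_1,G_2)=4$ then $G_1\in\mathcal{C}^\circ(\widehat{g})$.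
   Context: All graphs are finite and simple. The Euler genus $\widehat{g}(G)$ is the minimum Euler genus of a surface in which $G$ embeds. $\mathcal{G}_{xy}$ is the class of graphs with two distinguished vertices $x,y$ (terminals). The set $\mathcal{M}(G)$ of minor-operations consists of deleting any edge, or contracting any edge other than $xy$ (a vertex obtained by contracting an edge incident with a terminal becomes a terminal; parallel edges are removed); $\mu G$ is the result of $\mu\in\mathcal{M}(G)$. $\mathcal{G}^\circ_{xy}$ is the subclass of graphs not containing the edge $xy$. $G^+$ is $G$ with the edge $xy$ added (if absent); $\widehat{g}^+(G)=\widehat{g}(G^+)$ and $\theta(G)=\widehat{g}^+(G)-\widehat{g}(G)$. For $G_1,G_2\in\mathcal{G}_{xy}$ with $V(G_1)\cap V(G_2)=\{x,y\}$, their $xy$-sum is $(V(G_1)\cup V(G_2),E(G_1)\cup E(G_2))$; $\eta(G_1,G_2)=\theta(G_1)+\theta(G_2)$. A subgraph $H$ of $G$ is $\mathcal{P}$-tight (for a parameter $\mathcal{P}$) if $\mathcal{P}(\mu G)<\mathcal{P}(G)$ for every minor-operation $\mu\in\mathcal{M}(H)$. For $\mathcal{P}\in\{\widehat{g},\widehat{g}^+\}$ and $k\ge1$, $D_k(\mathcal{P},G)=\{\mu\in\mathcal{M}(G):\mathcal{P}(\mu G)\le\mathcal{P}(G)-k\}$. $G$ is $\mathcal{P}$-critical if $\mathcal{M}(G)=D_1(\mathcal{P},G)$; $\mathcal{C}^\circ(\mathcal{P})$ is the class of $\mathcal{P}$-critical graphs in $\mathcal{G}^\circ_{xy}$. $\mathcal{S}$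 (cascades) is the class of $G\in\mathcal{G}^\circ_{xy}$ with $\mathcal{M}(G)=D_1(\widehat{g},G)\cup D_1(\widehat{g}^+,G)$ and $G\notin\mathcal{C}^\circ(\widehat{g})\cup\mathcal{C}^\circ(\widehat{g}^+)$. $\mathcal{H}^{\rm w}(\widehat{g})$ (weak $\widehat{g}$-hoppers) is the class of $G\in\mathcal{G}^\circ_{xy}$ with $G\notin\mathcal{C}^\circ(\widehat{g}^+)$ and $\mathcal{M}(G)=D_1(\widehat{g}^+,G)\cup D_2(\widehat{g},G)$. $\mathcal{H}^{\rm w}(\widehat{g}^+)$ (weak $\widehat{g}^+$-hoppers) is the class of $G\in\mathcal{G}^\circ_{xy}$ with $G\notin\mathcal{C}^\circ(\widehat{g})$ and $\mathcal{M}(G)=D_1(\widehat{g},G)\cup D_2(\widehat{g}^+,G)$. -}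

module Defs where

open import Data.Nat using (ℕ; zero; suc; _+_; _*_; _∸_; _⊓_; _≤_; _<_; _<ᵇ_)
open import Data.Bool using (Bool; true; false; _∧_; _∨_; not; T; if_then_else_)
open import Data.Fin using (Fin; zero; suc; toℕ; opposite; combine; remQuot; punchOut; _≟_)
open import Data.List using (List; []; _∷_; [_]; map; concatMap; allFin; lookup; length; filterᵇ)
open import Data.Product using (Σ; _×_; _,_; proj₁; proj₂)
open import Data.Sum using (_⊎_)
open import Relation.Nullary using (¬_)
open import Relation.Nullary.Decidable using (isYes)
open import Relation.Binary.PropositionalEquality using (_≡_; _≢_; sym)
open import Function.Bundles using (_⇔_)

eqF : ∀ {n} → Fin n → Fin n → Bool
eqF i j = isYes (i ≟ j)

anyFin : ∀ {n} → (Fin n → Bool) → Bool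
anyFin {zero}  p = false
anyFin {suc n} p = p zero ∨ anyFin (λ i → p (suc i))

allFinᵇ : ∀ {n} → (Fin n → Bool) → Bool
allFinᵇ {zero}  p = true
allFinᵇ {suc n} p = p zero ∧ allFinᵇ (λ i → p (suc i))

countFin : ∀ {n} → (Fin n → Bool) → ℕ
countFin {zero}  p = 0
countFin {suc n} p = (if p zero then 1 else 0) + countFin (λ i → p (suc i))

allFuns : (N M : ℕ) → List (Fin N → Fin M)
allFuns zero    M = [ (λ ()) ]
allFuns (suc N) M =
  concatMap (λ f → map (λ i → cons i f) (allFin M)) (allFuns N M)
  where
  cons : Fin M → (Fin N → Fin M) → Fin (suc N) → Fin M
  cons i f zero    = i
  cons i f (suc j) = f j

minList : List ℕ → ℕ
minList []           = 0
minList (a ∷ [])     = a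
minList (a ∷ b ∷ l)  = a ⊓ minList (b ∷ l)

reachᵇ : ∀ {N} → (Fin N → Fin N → Bool) → ℕ → Fin N → Fin N → Bool
reachᵇ R zero    f g = eqF f g
reachᵇ R (suc k) f g =
  reachᵇ R k f g ∨ anyFin (λ h → reachᵇ R k f h ∧ (R h g ∨ R g h))

sameClassᵇ : ∀ {N} → (Fin N → Fin N → Bool) → Fin N → Fin N → Bool
sameClassᵇ {N} R = reachᵇ R N

classCount : ∀ N → (Fin N → Fin N → Bool) → ℕ
classCount N R =
  countFin (λ f → not (anyFin (λ g → (toℕ g <ᵇ toℕ f) ∧ sameClassᵇ R g f)))

-- Graphs with two terminals x, y.  Vertex set Fin n; the (simple)
-- edge set is {p,q} with p ≠ q and (adj p q or adj q p).

record Graph : Set where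
  constructor graph
  field
    n   : ℕ
    adj : Fin n → Fin n → Bool
    x   : Fin n
    y   : Fin n

open Graph public

Eraw : ∀ {k} → (Fin k → Fin k → Bool) → Fin k → Fin k → Bool
Eraw adj p q = not (eqF p q) ∧ (adj p q ∨ adj q p)

E : (G : Graph) → Fin (n G) → Fin (n G) → Bool
E G = Eraw (adj G)

plus : Graph → Graph
plus (graph k a x y) = graph k (λ p q → a p q ∨ (eqF p x ∧ eqF q y)) x y

delete : (G : Graph) → Fin (n G) → Fin (n G) → Graph
delete (graph k a x y) u v =
  graph k (λ p q → a p q ∧ not ((eqF p u ∧ eqF q v) ∨ (eqF p v ∧ eqF q u))) x y

mergeMap : ∀ {k} (u v : Fin (suc k)) → u ≢ v → Fin (suc k) → Fin k
mergeMap u v u≢v w with v ≟ w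
... | Relation.Nullary.yes _ = punchOut {i = v} {j = u} (λ e → u≢v (sym e))
... | Relation.Nullary.no v≢w = punchOut v≢w

contractWith : ∀ k (a : Fin (suc k) → Fin (suc k) → Bool) (x y : Fin (suc k))
  (u v : Fin (suc k)) → u ≢ v → Graph
contractWith k a x y u v u≢v = graph k a' (f x) (f y)
  where
  f : Fin (suc k) → Fin k
  f = mergeMap u v u≢v
  a' : Fin k → Fin k → Bool
  a' c d = not (eqF c d) ∧
    anyFin (λ p → anyFin (λ q → Eraw a p q ∧ eqF (f p) c ∧ eqF (f q) d))

-- contract the edge uv (vertex obtained is a terminal if u or v was;
-- parallel edges are automatically removed).  If u = v nothing happens
-- (never used for genuine edges).
contract : (G : Graph) → Fin (n G) → Fin (n G) → Graph
contract (graph zero a x y) () v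
contract (graph (suc k) a x y) u v with u ≟ v
... | Relation.Nullary.yes _ = graph (suc k) a x y
... | Relation.Nullary.no u≢v = contractWith k a x y u v u≢v

data Kind : Set where
  del con : Kind

apply : Kind → (G : Graph) → Fin (n G) → Fin (n G) → Graph
apply del G u v = delete G u v
apply con G u v = contract G u v

IsOp : (G : Graph) → Kind → Fin (n G) → Fin (n G) → Set
IsOp G k u v =
  T (E G u v) × (k ≡ con → ¬ ((u ≡ x G × v ≡ y G) ⊎ (u ≡ y G × v ≡ x G)))

-- Euler genus via generalized embedding schemes, encoded as graph-encoded
-- maps (gems).  Flags of edge e are (e, a, s) with a ∈ Fin 2 the end of e
-- and s ∈ Fin 2 the side.  τ0 switches the end, τ2 switches the side;
-- an embedding is an involution τ1 without fixed points preserving the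
-- vertex, such that the flags at each vertex form one ⟨τ1,τ2⟩-orbit.
-- Faces are the ⟨τ0,τ1⟩-orbits.

edgeList : (G : Graph) → List (Fin (n G) × Fin (n G))
edgeList G = concatMap (λ i → concatMap (λ j →
    if (toℕ i <ᵇ toℕ j) ∧ E G i j then [ (i , j) ] else [])
  (allFin (n G))) (allFin (n G))

nEdges : Graph → ℕ
nEdges G = length (edgeList G)

nFlags : Graph → ℕ
nFlags G = (nEdges G * 2) * 2

Flag : Graph → Set
Flag G = Fin (nFlags G)

decode : (G : Graph) → Flag G → Fin (nEdges G) × Fin 2 × Fin 2
decode G f with remQuot 2 f
... | (ea , s) with remQuot 2 ea
... | (e , a) = e , a , s

encode : (G : Graph) → Fin (nEdges G) → Fin 2 → Fin 2 → Flag G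
encode G e a s = combine (combine e a) s

τ0 : (G : Graph) → Flag G → Flag G
τ0 G f with decode G f
... | (e , a , s) = encode G e (opposite a) s

τ2 : (G : Graph) → Flag G → Flag G
τ2 G f with decode G f
... | (e , a , s) = encode G e a (opposite s)

flagVertex : (G : Graph) → Flag G → Fin (n G)
flagVertex G f with decode G f
... | (e , zero , s) = proj₁ (lookup (edgeList G) e)
... | (e , suc _ , s) = proj₂ (lookup (edgeList G) e)

genRel : ∀ {N} → (Fin N → Fin N) → (Fin N → Fin N) → Fin N → Fin N → Bool
genRel σ ρ h g = eqF (σ h) g ∨ eqF (ρ h) g

validEmb : (G : Graph) → (Flag G → Flag G) → Bool
validEmb G t =
  allFinᵇ (λ f → eqF (t (t f)) f ∧ not (eqF (t f) f)
                 ∧ eqF (flagVertex G (t f)) (flagVertex G f))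
  ∧ allFinᵇ (λ f → allFinᵇ (λ g →
      not (eqF (flagVertex G f) (flagVertex G g))
      ∨ sameClassᵇ (genRel t (τ2 G)) f g))

faces : (G : Graph) → (Flag G → Flag G) → ℕ
faces G t = classCount (nFlags G) (genRel (τ0 G) t)

components : Graph → ℕ
components G = classCount (n G) (E G)

isolated : Graph → ℕ
isolated G = countFin (λ v → not (anyFin (λ u → E G v u)))

-- Euler genus of the embedding: Σ over components (2 - χ)
-- = 2c - |V| + |E| - |F|  (an isolated vertex is a sphere with one face)
embGenus : (G : Graph) → (Flag G → Flag G) → ℕ
embGenus G t = (2 * components G + nEdges G) ∸ (n G + faces G t + isolated G)

eg : Graph → ℕ
eg G = minList (map (embGenus G) (filterᵇ (validEmb G) (allFuns (nFlags G) (nFlags G))))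

eg⁺ : Graph → ℕ
eg⁺ G = eg (plus G)

θ : Graph → ℕ
θ G = eg⁺ G ∸ eg G

η : Graph → Graph → ℕ
η G₁ G₂ = θ G₁ + θ G₂

D : ℕ → (Graph → ℕ) → (G : Graph) → Kind → Fin (n G) → Fin (n G) → Set
D k P G o u v = P (apply o G u v) + k ≤ P G

Critical : (Graph → ℕ) → Graph → Set
Critical P G = ∀ o u v → IsOp G o u v → D 1 P G o u v

NoXY : Graph → Set
NoXY G = ¬ T (E G (x G) (y G))

CritO : (Graph → ℕ) → Graph → Set
CritO P G = NoXY G × Critical P G

Cascade : Graph → Set
Cascade G = NoXY G
  × (∀ o u v → IsOp G o u v → D 1 eg G o u v ⊎ D 1 eg⁺ G o u v)
  × ¬ CritO eg G × ¬ CritO eg⁺ G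

HopW : Graph → Set
HopW G = NoXY G × ¬ CritO eg⁺ G
  × (∀ o u v → IsOp G o u v → D 1 eg⁺ G o u v ⊎ D 2 eg G o u v)

HopW⁺ : Graph → Set
HopW⁺ G = NoXY G × ¬ CritO eg G
  × (∀ o u v → IsOp G o u v → D 1 eg G o u v ⊎ D 2 eg⁺ G o u v)

data Reach (G : Graph) : Fin (n G) → Fin (n G) → Set where
  here : ∀ {a} → Reach G a a
  step : ∀ {a b c} → T (E G a b) → Reach G b c → Reach G a c

Connected : Graph → Set
Connected G = ∀ a b → Reach G a b

Injective : ∀ {A B : Set} → (A → B) → Set
Injective f = ∀ {a b} → f a ≡ f b → a ≡ b

IsXYSum : (G G₁ G₂ : Graph) → (Fin (n G₁) → Fin (n G)) → (Fin (n G₂) → Fin (n G)) → Set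
IsXYSum G G₁ G₂ ι₁ ι₂ =
  Injective ι₁ × Injective ι₂
  × ι₁ (x G₁) ≡ x G × ι₁ (y G₁) ≡ y G
  × ι₂ (x G₂) ≡ x G × ι₂ (y G₂) ≡ y G
  × (∀ p → Σ (Fin (n G₁)) (λ a → ι₁ a ≡ p) ⊎ Σ (Fin (n G₂)) (λ b → ι₂ b ≡ p))
  × (∀ a b → ι₁ a ≡ ι₂ b → (a ≡ x G₁ × b ≡ x G₂) ⊎ (a ≡ y G₁ × b ≡ y G₂))
  × (∀ p q → T (E G p q) ⇔
       (Σ (Fin (n G₁)) (λ a → Σ (Fin (n G₁)) (λ b → ι₁ a ≡ p × ι₁ b ≡ q × T (E G₁ a b)))
        ⊎ Σ (Fin (n G₂)) (λ a → Σ (Fin (n G₂)) (λ b → ι₂ a ≡ p × ι₂ b ≡ q × T (E G₂ a b)))))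

Tight : (Graph → ℕ) → (G H : Graph) → (Fin (n H) → Fin (n G)) → Set
Tight P G H ι = ∀ o u v → IsOp H o u v → P (apply o G (ι u) (ι v)) < P G

-- The Euler genus of an xy-sum is min (eg G₁ + eg G₂ + 2) (eg⁺ G₁ + eg⁺ G₂).  For the upper bounds, embeddings of
-- the summands are glued at a corner of x and a corner of y, or along the edge xy.  For the lower bound, the two
-- sides of an optimal embedding are re-embedded independently, which gains two faces or leaves x and y cofacial on
-- both sides; in terms of flags this is a statement about matchings on the places where the faces and the rotations
-- change sides.  A minor operation on a nonbridge of G₁, or a contraction, keeps G₁ connected, so that the formula
-- applies before and after and tightness becomes a comparison of numbers.  Contracting a bridge of G₁ lowers neither
-- eg G₁ nor eg⁺ G₁, hence when G₁ has a bridge it is not tight and lies in none of the classes.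
module Submission where

open import Defs
open import Data.Nat using (ℕ; zero; suc; _+_; _≤_; z≤n; s≤s; _*_; _∸_; _<_; _<ᵇ_; _≤?_)
open import Data.Nat.Properties using (≤-refl; ≤-trans; ≤-antisym; ≤-reflexive; +-suc; n≤1+n; suc-injective; +-identityʳ; +-comm; +-mono-≤; +-monoˡ-≤; +-monoʳ-≤; *-monoʳ-≤; +-cancelʳ-≤; m≤m+n; module ≤-Reasoning; +-assoc; +-cancelˡ-≤; <ᵇ⇒<; <⇒<ᵇ; m⊓n≤m; m⊓n≤n; ⊓-sel; m≤n+o⇒m∸n≤o; m+[n∸m]≡n; *-cancelˡ-≤; ≤-pred; +-cancelˡ-≡)
open import Data.Fin using (Fin; zero; suc; punchIn; punchOut; _≟_; _↑ˡ_; _↑ʳ_; splitAt; join; _<?_; toℕ; opposite; combine; remQuot)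
open import Data.Fin.Properties using (injective⇒≤; punchOut-injective; punchInᵢ≢i; punchOut-punchIn; splitAt-↑ˡ; splitAt-↑ʳ; join-splitAt; punchOut-cong; punchIn-punchOut; punchIn-injective; any?; <-cmp; toℕ-injective; remQuot-combine; combine-remQuot; opposite-involutive; all?)
open import Data.Product using (Σ; _×_; _,_; proj₁; proj₂)
open import Data.Sum using (_⊎_; inj₁; inj₂; [_,_]′; map₂) renaming (map to map⊎; swap to swap⊎; map₁ to map₁⊎; assocˡ to assoc⊎; assocʳ to unassoc⊎)
open import Data.Empty using (⊥; ⊥-elim)
open import Relation.Nullary using (¬_; Dec; yes; no)
open import Relation.Nullary.Decidable using (map′; ¬?; _×-dec_; isYes; T?; toWitness; fromWitness; _⊎-dec_; _→-dec_)
open import Relation.Binary.PropositionalEquality using (_≡_; _≢_; refl; sym; trans; cong; subst; subst₂; cong₂)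
open import Function using (id; _∘_)
open import Data.Sum.Properties using (inj₁-injective; inj₂-injective)
open import Data.Nat.Tactic.RingSolver using (solve-∀)
open import Data.Bool using (Bool; true; false; T; _∧_; _∨_; not; if_then_else_)
open import Relation.Binary.Definitions using (tri<; tri≈; tri>)
open import Data.Bool.Properties using (T-∧; T-∨)
open import Data.List using (List; []; _∷_; map; concatMap; allFin; lookup; filterᵇ)
open import Data.List.Membership.Propositional using (_∈_)
open import Data.List.Membership.Propositional.Properties using (∈-map⁺; ∈-map⁻; ∈-allFin; ∈-concatMap⁺; ∈-filter⁺; ∈-filter⁻; ∈-concatMap⁻; ∈-lookup)
open import Data.List.Relation.Unary.Any using (Any)
open import Data.Unit using (tt)
open import Function.Bundles using (Equivalence; _⇔_; mk⇔)
open import Data.List.Relation.Unary.AllPairs using ([]; _∷_)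
open import Data.List.Relation.Unary.Unique.Propositional using (Unique)
open import Data.List.Relation.Unary.Unique.Propositional.Properties using (allFin⁺; ++⁺)
import Data.Bool as Bool
import Data.Nat.Properties as ℕₚ
import Data.Fin.Properties as Finₚ
import Data.Fin as Fin
import Data.List.Relation.Unary.Any as Any
import Data.List.Relation.Unary.Any.Properties as Anyₚ
import Data.List.Relation.Unary.All as All

-- All that an embedding offers is a matching of flags; vertices, edges, faces and components are
-- the classes generated by two or three matchings. Surface arguments thus become statements on how
-- a number of classes changes when two pairs of a matching are reconnected (`Swap`) or two points
-- are eliminated (`Elim`). Two obstacles shape the proof. The genus is a truncated difference, so V
-- + F ≤ E + 2 must be known before it can be used as an equation. And a face may pass through x and
-- y arbitrarily often, so there is no simple closed curve along which to cut. Only the corners at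
-- which the embedding changes sides are kept. On them each side leaves two matchings, one of its
-- faces and one of its rotations. When the sides are taken apart, the rotations of one side are
-- closed up by the face matching of the other. If this matching respects the two vertices, that
-- yields a new face for each of them. A pair leading from x to y is a stretch of a face on that
-- side, and if both sides have one, x and y are cofacial on both; what remains is to close up the
-- rotations without losing faces.

Rel : Set → Set₁
Rel A = A → A → Set

infixr 5 _∪_
_∪_ : ∀ {A : Set} → Rel A → Rel A → Rel A
(R ∪ S) a b = R a b ⊎ S a b

∅ : ∀ {A : Set} → Rel A
∅ _ _ = ⊥

data Pair {A : Set} (a b : A) : Rel A where
  pair : Pair a b a b

data Family {A : Set} {m : ℕ} (p q : Fin m → A) : Rel A where
  member : ∀ i → Family p q (p i) (q i)

gr : ∀ {A : Set} → (A → A) → Rel A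
gr f a b = f a ≡ b

data _⊎ʳ_ {A B : Set} (R : Rel A) (S : Rel B) : Rel (A ⊎ B) where
  inl : ∀ {a b} → R a b → (R ⊎ʳ S) (inj₁ a) (inj₁ b)
  inr : ∀ {a b} → S a b → (R ⊎ʳ S) (inj₂ a) (inj₂ b)

-- Equivalence closures and exact numbers of classes

data Cl {A : Set} (R : Rel A) : Rel A where
  ε   : ∀ {a} → Cl R a a
  fwd : ∀ {a b c} → R a b → Cl R b c → Cl R a c
  bwd : ∀ {a b c} → R b a → Cl R b c → Cl R a c

module _ {A : Set} {R : Rel A} where

  [_] : ∀ {a b} → R a b → Cl R a b
  [ r ] = fwd r ε

  [_]⁻ : ∀ {a b} → R a b → Cl R b a
  [ r ]⁻ = bwd r ε

  infixr 4 _∙_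
  _∙_ : ∀ {a b c} → Cl R a b → Cl R b c → Cl R a c
  ε ∙ q = q
  fwd r p ∙ q = fwd r (p ∙ q)
  bwd r p ∙ q = bwd r (p ∙ q)

  infix 8 _⁻
  _⁻ : ∀ {a b} → Cl R a b → Cl R b a
  ε ⁻ = ε
  fwd r p ⁻ = p ⁻ ∙ [ r ]⁻
  bwd r p ⁻ = p ⁻ ∙ [ r ]

  Cl-≡ : ∀ {a b} → a ≡ b → Cl R a b
  Cl-≡ refl = ε

  Cl-inv : ∀ {B : Set} (q : A → B) → (∀ {a b} → R a b → q a ≡ q b) → ∀ {a b} → Cl R a b → q a ≡ q b
  Cl-inv q h ε = refl
  Cl-inv q h (fwd r p) = trans (h r) (Cl-inv q h p)
  Cl-inv q h (bwd r p) = trans (sym (h r)) (Cl-inv q h p)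

Cl-map : ∀ {A B : Set} {R : Rel A} {S : Rel B} (f : A → B) →
         (∀ {a b} → R a b → Cl S (f a) (f b)) → ∀ {a b} → Cl R a b → Cl S (f a) (f b)
Cl-map f h ε = ε
Cl-map f h (fwd r p) = h r ∙ Cl-map f h p
Cl-map f h (bwd r p) = (h r) ⁻ ∙ Cl-map f h p

Cl-bind : ∀ {A : Set} {R S : Rel A} → (∀ {a b} → R a b → Cl S a b) → ∀ {a b} → Cl R a b → Cl S a b
Cl-bind = Cl-map id

Cl-mono : ∀ {A : Set} {R S : Rel A} → (∀ {a b} → R a b → S a b) → ∀ {a b} → Cl R a b → Cl S a b
Cl-mono h = Cl-bind (λ r → [ h r ])

gr-∈ : ∀ {A : Set} {f : A → A} {S : Rel A} a → Cl (gr f ∪ S) a (f a)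
gr-∈ a = [ inj₁ refl ]

-- A quotient onto `Fin k` with chosen representatives. As the index set is concrete, the closure is
-- decidable (`Cl?`) and the number of classes is unique (`NCl-unique`); faces, vertices, edges and
-- components are all counted in this way.
record NCl {A : Set} (R : Rel A) (k : ℕ) : Set where
  field
    cls      : A → Fin k
    rep      : Fin k → A
    cls-rep  : ∀ i → cls (rep i) ≡ i
    sound    : ∀ {a b} → R a b → cls a ≡ cls b
    complete : ∀ {a b} → cls a ≡ cls b → Cl R a b

  sound* : ∀ {a b} → Cl R a b → cls a ≡ cls b
  sound* = Cl-inv cls sound

  rep-cls : ∀ a → Cl R (rep (cls a)) a
  rep-cls a = complete (cls-rep (cls a))

  Cl? : ∀ a b → Dec (Cl R a b)
  Cl? a b = map′ complete sound* (cls a ≟ cls b)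

-- The representative of each class of R is carried over by g, and f pulls coincidences back, so
-- distinct classes of R stay distinct. Only f has to respect the relations.
NCl-≤ : ∀ {A B : Set} {R : Rel A} {S : Rel B} {k l} → NCl R k → NCl S l →
        (f : B → A) → (∀ {b b'} → S b b' → Cl R (f b) (f b')) →
        (g : A → B) → (∀ a → Cl R (f (g a)) a) → k ≤ l
NCl-≤ P Q f h g fg = injective⇒≤ {f = λ i → NCl.cls Q (g (NCl.rep P i))} λ {i} {j} e →
  trans (sym (P.cls-rep i))
   (trans (P.sound* ((fg _) ⁻ ∙ Cl-map f h (Q.complete e) ∙ fg _)) (P.cls-rep j))
  where
  module P = NCl P
  module Q = NCl Q

NCl-unique : ∀ {A : Set} {R : Rel A} {k l} → NCl R k → NCl R l → k ≡ l
NCl-unique P Q = ≤-antisym (NCl-≤ P Q id [_] id λ _ → ε) (NCl-≤ Q P id [_] id λ _ → ε)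

record Equiv {A B : Set} (R : Rel A) (S : Rel B) : Set where
  field
    to      : A → B
    from    : B → A
    to-R    : ∀ {a b} → R a b → Cl S (to a) (to b)
    from-S  : ∀ {a b} → S a b → Cl R (from a) (from b)
    from-to : ∀ a → Cl R (from (to a)) a
    to-from : ∀ b → Cl S (to (from b)) b

  to* : ∀ {a b} → Cl R a b → Cl S (to a) (to b)
  to* = Cl-map to to-R

  from* : ∀ {a b} → Cl S a b → Cl R (from a) (from b)
  from* = Cl-map from from-S

  to-inv : ∀ {a b} → Cl S (to a) (to b) → Cl R a b
  to-inv p = (from-to _) ⁻ ∙ from* p ∙ from-to _

  from-inv : ∀ {a b} → Cl R (from a) (from b) → Cl S a b
  from-inv p = (to-from _) ⁻ ∙ to* p ∙ to-from _

Equiv-sym : ∀ {A B : Set} {R : Rel A} {S : Rel B} → Equiv R S → Equiv S R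
Equiv-sym E = record { to = from ; from = to ; to-R = from-S ; from-S = to-R ; from-to = to-from ; to-from = from-to }
  where open Equiv E

Equiv-trans : ∀ {A B C : Set} {R : Rel A} {S : Rel B} {T : Rel C} → Equiv R S → Equiv S T → Equiv R T
Equiv-trans E F = record
  { to = F.to ∘ E.to ; from = E.from ∘ F.from
  ; to-R = F.to* ∘ E.to-R ; from-S = E.from* ∘ F.from-S
  ; from-to = λ a → E.from* (F.from-to _) ∙ E.from-to a
  ; to-from = λ b → F.to* (E.to-from _) ∙ F.to-from b }
  where
  module E = Equiv E
  module F = Equiv F

Equiv-id : ∀ {A : Set} {R S : Rel A} → (∀ {a b} → R a b → Cl S a b) → (∀ {a b} → S a b → Cl R a b) → Equiv R S
Equiv-id h k = record { to = id ; from = id ; to-R = h ; from-S = k ; from-to = λ _ → ε ; to-from = λ _ → ε }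

NCl-Equiv : ∀ {A B : Set} {R : Rel A} {S : Rel B} {k} → Equiv R S → NCl R k → NCl S k
NCl-Equiv E P = record
  { cls = cls ∘ from ; rep = to ∘ rep
  ; cls-rep = λ i → trans (sound* (from-to _)) (cls-rep i)
  ; sound = λ s → sound* (from-S s)
  ; complete = λ e → from-inv (complete e) }
  where
  open NCl P
  open Equiv E

Equiv-extend : ∀ {A B : Set} {R R⁺ : Rel A} {S S⁺ : Rel B} → (E : Equiv R S) →
  (∀ {a b} → R⁺ a b → Cl (S ∪ S⁺) (Equiv.to E a) (Equiv.to E b)) →
  (∀ {a b} → S⁺ a b → Cl (R ∪ R⁺) (Equiv.from E a) (Equiv.from E b)) →
  Equiv (R ∪ R⁺) (S ∪ S⁺)
Equiv-extend E h k = record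
  { to = to ; from = from
  ; to-R = λ { (inj₁ r) → Cl-mono inj₁ (to-R r) ; (inj₂ r) → h r }
  ; from-S = λ { (inj₁ s) → Cl-mono inj₁ (from-S s) ; (inj₂ s) → k s }
  ; from-to = λ a → Cl-mono inj₁ (from-to a)
  ; to-from = λ b → Cl-mono inj₁ (to-from b) }
  where open Equiv E

Equiv-inj₁ : ∀ {A : Set} {R S : Rel A} → (∀ {a b} → S a b → Cl R a b) → Equiv R (R ∪ S)
Equiv-inj₁ h = Equiv-id (λ r → [ inj₁ r ]) λ { (inj₁ r) → [ r ] ; (inj₂ s) → h s }

module _ {k : ℕ} (u v : Fin (suc k)) (u≢v : u ≢ v) where

  merge-punchIn : ∀ c → mergeMap u v u≢v (punchIn v c) ≡ c
  merge-punchIn c with v ≟ punchIn v c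
  ... | yes e = ⊥-elim (punchInᵢ≢i v c (sym e))
  ... | no ne = trans (punchOut-cong v refl) (punchOut-punchIn v)

  merge-uv : mergeMap u v u≢v u ≡ mergeMap u v u≢v v
  merge-uv with v ≟ u | v ≟ v
  ... | yes e | _ = ⊥-elim (u≢v (sym e))
  ... | no _ | no ne = ⊥-elim (ne refl)
  ... | no _ | yes _ = punchOut-cong v refl

  merge-inj : ∀ p q → mergeMap u v u≢v p ≡ mergeMap u v u≢v q → (p ≡ q) ⊎ ((p ≡ u × q ≡ v) ⊎ (p ≡ v × q ≡ u))
  merge-inj p q e with v ≟ p | v ≟ q
  ... | yes a | yes b = inj₁ (trans (sym a) b)
  ... | yes a | no b = inj₂ (inj₂ (sym a , sym (punchOut-injective _ b e)))
  ... | no a | yes b = inj₂ (inj₁ (punchOut-injective a _ e , sym b))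
  ... | no a | no b = inj₁ (punchOut-injective a b e)

  merge-section : ∀ p → mergeMap u v u≢v (punchIn v (mergeMap u v u≢v p)) ≡ mergeMap u v u≢v p
  merge-section p = merge-punchIn (mergeMap u v u≢v p)

NCl-addPair : ∀ {A : Set} {R : Rel A} {k} → NCl R k → ∀ a b →
  (Cl R a b × NCl (R ∪ Pair a b) k) ⊎ (¬ Cl R a b × Σ ℕ λ k' → k ≡ suc k' × NCl (R ∪ Pair a b) k')
NCl-addPair {A} {R} {k} P a b with NCl.Cl? P a b
... | yes p = inj₁ (p , NCl-Equiv (Equiv-inj₁ λ { pair → p }) P)
... | no np = inj₂ (np , go k P np)
  where
  go : ∀ k (P : NCl R k) → ¬ Cl R a b → Σ ℕ λ k' → k ≡ suc k' × NCl (R ∪ Pair a b) k'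
  go zero P _ with NCl.cls P a
  ... | ()
  go (suc k') P np = k' , refl , record
    { cls = λ c → m (cls c) ; rep = λ i → rep (punchIn v i)
    ; cls-rep = λ i → trans (cong m (cls-rep _)) (merge-punchIn u v u≢v i)
    ; sound = λ { (inj₁ r) → cong m (sound r) ; (inj₂ pair) → merge-uv u v u≢v }
    ; complete = λ {c} {d} e → comp c d (merge-inj u v u≢v _ _ e) }
    where
    open NCl P
    u = cls a
    v = cls b
    u≢v : u ≢ v
    u≢v e = np (complete e)
    m = mergeMap u v u≢v
    up : ∀ {c d} → cls c ≡ cls d → Cl (R ∪ Pair a b) c d
    up e = Cl-mono inj₁ (complete e)
    comp : ∀ c d → (cls c ≡ cls d) ⊎ ((cls c ≡ u × cls d ≡ v) ⊎ (cls c ≡ v × cls d ≡ u)) → Cl (R ∪ Pair a b) c d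
    comp c d (inj₁ e) = up e
    comp c d (inj₂ (inj₁ (e , f))) = up e ∙ fwd (inj₂ pair) (up (sym f))
    comp c d (inj₂ (inj₂ (e , f))) = up e ∙ bwd (inj₂ pair) (up (sym f))

NCl-addPair-≤ : ∀ {A : Set} {R : Rel A} {k} → NCl R k → ∀ a b → Σ ℕ λ k' → NCl (R ∪ Pair a b) k' × k ≤ suc k'
NCl-addPair-≤ P a b with NCl-addPair P a b
... | inj₁ (_ , Q) = _ , Q , n≤1+n _
... | inj₂ (_ , k' , refl , Q) = k' , Q , ≤-refl

-- Adding one pair merges at most two classes, so S may be compared with R up to one extra pair.
NCl-≤1 : ∀ {A B : Set} {R : Rel A} {S : Rel B} {k l} → NCl R k → NCl S l → ∀ x y →
        (f : B → A) → (∀ {b b'} → S b b' → Cl (R ∪ Pair x y) (f b) (f b')) →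
        (g : A → B) → (∀ a → Cl (R ∪ Pair x y) (f (g a)) a) → k ≤ suc l
NCl-≤1 P Q x y f h g fg with NCl-addPair-≤ P x y
... | k' , P' , k≤ = ≤-trans k≤ (s≤s (NCl-≤ P' Q f h g fg))

NCl-addFamily : ∀ {A : Set} {R : Rel A} {k} → NCl R k → ∀ {m} (p q : Fin m → A) →
  Σ ℕ λ k' → NCl (R ∪ Family p q) k' × k ≤ m + k'
NCl-addFamily P {zero} p q = _ , NCl-Equiv (Equiv-inj₁ λ { (member ()) }) P , ≤-refl
NCl-addFamily {R = R} {k} P {suc m} p q with NCl-addPair-≤ P (p zero) (q zero)
... | k₁ , P₁ , k≤ with NCl-addFamily P₁ (λ i → p (suc i)) (λ i → q (suc i))
... | k' , P' , k₁≤ = k' , NCl-Equiv (Equiv-id there back) P' , ≤-trans k≤ (s≤s k₁≤)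
  where
  there : ∀ {a b} → ((R ∪ Pair (p zero) (q zero)) ∪ Family (p ∘ suc) (q ∘ suc)) a b → Cl (R ∪ Family p q) a b
  there (inj₁ (inj₁ r)) = [ inj₁ r ]
  there (inj₁ (inj₂ pair)) = [ inj₂ (member zero) ]
  there (inj₂ (member i)) = [ inj₂ (member (suc i)) ]
  back : ∀ {a b} → (R ∪ Family p q) a b → Cl ((R ∪ Pair (p zero) (q zero)) ∪ Family (p ∘ suc) (q ∘ suc)) a b
  back (inj₁ r) = [ inj₁ (inj₁ r) ]
  back (inj₂ (member zero)) = [ inj₁ (inj₂ pair) ]
  back (inj₂ (member (suc i))) = [ inj₂ (member i) ]

-- Finite types

record Finite (A : Set) : Set where
  field
    size    : ℕ
    enum    : Fin size → A
    index   : A → Fin size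
    enum-index : ∀ a → enum (index a) ≡ a
    index-enum : ∀ i → index (enum i) ≡ i

  infix 4 _≟ᶠ_
  _≟ᶠ_ : (a b : A) → Dec (a ≡ b)
  a ≟ᶠ b = map′ (λ e → trans (sym (enum-index a)) (trans (cong enum e) (enum-index b))) (cong index) (index a ≟ index b)

open Finite public using (size)

Fin-finite : ∀ n → Finite (Fin n)
Fin-finite n = record { size = n ; enum = id ; index = id ; enum-index = λ _ → refl ; index-enum = λ _ → refl }

⊎-finite : ∀ {A B : Set} → Finite A → Finite B → Finite (A ⊎ B)
⊎-finite FA FB = record
  { size = size FA + size FB
  ; enum = λ i → en (splitAt (size FA) i)
  ; index = ix
  ; enum-index = λ { (inj₁ a) → trans (cong en (splitAt-↑ˡ _ (FA.index a) _)) (cong inj₁ (FA.enum-index a))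
                   ; (inj₂ b) → trans (cong en (splitAt-↑ʳ (size FA) _ (FB.index b))) (cong inj₂ (FB.enum-index b)) }
  ; index-enum = λ i → trans (ix-en (splitAt (size FA) i)) (join-splitAt (size FA) _ i) }
  where
  module FA = Finite FA
  module FB = Finite FB
  en : Fin (size FA) ⊎ Fin (size FB) → _
  en (inj₁ i) = inj₁ (FA.enum i)
  en (inj₂ j) = inj₂ (FB.enum j)
  ix : _ → Fin (size FA + size FB)
  ix (inj₁ a) = FA.index a ↑ˡ size FB
  ix (inj₂ b) = size FA ↑ʳ FB.index b
  ix-en : ∀ s → ix (en s) ≡ join (size FA) (size FB) s
  ix-en (inj₁ i) = cong (_↑ˡ size FB) (FA.index-enum i)
  ix-en (inj₂ j) = cong (size FA ↑ʳ_) (FB.index-enum j)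

NCl-∅ : ∀ {A : Set} (F : Finite A) → NCl {A} ∅ (size F)
NCl-∅ F = record
  { cls = index ; rep = enum ; cls-rep = index-enum ; sound = λ ()
  ; complete = λ e → Cl-≡ (trans (sym (enum-index _)) (trans (cong enum e) (enum-index _))) }
  where open Finite F

NCl-gr : ∀ {A : Set} → Finite A → {R : Rel A} → ∀ {k} → NCl R k → (f : A → A) → Σ ℕ (NCl (R ∪ gr f))
NCl-gr F P f with NCl-addFamily P (Finite.enum F) (f ∘ Finite.enum F)
... | k' , P' , _ = k' , NCl-Equiv (Equiv-id
      (λ { (inj₁ r) → [ inj₁ r ] ; (inj₂ (member i)) → [ inj₂ refl ] })
      (λ { (inj₁ r) → [ inj₁ r ] ; {a} (inj₂ refl) →
            subst (λ z → Cl _ z (f z)) (Finite.enum-index F a) [ inj₂ (member (Finite.index F a)) ] })) P'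

abstract
  -- The source of all face numbers that are not known in advance: the classes are found by adding
  -- one pair at a time. It is opaque, so that no such number is ever computed.
  NCl-gr₂ : ∀ {A : Set} → Finite A → (f g : A → A) → Σ ℕ (NCl (gr f ∪ gr g))
  NCl-gr₂ F f g with NCl-gr F (NCl-∅ F) f
  ... | _ , P with NCl-gr F (NCl-Equiv (Equiv-id (λ { (inj₁ ()) ; (inj₂ r) → [ r ] }) (λ r → [ inj₂ r ])) P) g
  ... | _ , Q = _ , Q

NCl-⊎ : ∀ {A B : Set} {R : Rel A} {S : Rel B} {k l} → NCl R k → NCl S l → NCl (R ⊎ʳ S) (k + l)
NCl-⊎ {A} {B} {R} {S} {k} {l} P Q = record
  { cls = c ; rep = λ i → r (splitAt k i) ; cls-rep = λ i → trans (cr (splitAt k i)) (join-splitAt k l i)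
  ; sound = s
  ; complete = λ {a} {b} → co a b }
  where
  module P = NCl P
  module Q = NCl Q
  c : A ⊎ B → Fin (k + l)
  c (inj₁ a) = P.cls a ↑ˡ l
  c (inj₂ b) = k ↑ʳ Q.cls b
  r : Fin k ⊎ Fin l → A ⊎ B
  r (inj₁ i) = inj₁ (P.rep i)
  r (inj₂ j) = inj₂ (Q.rep j)
  cr : ∀ s → c (r s) ≡ join k l s
  cr (inj₁ i) = cong (_↑ˡ l) (P.cls-rep i)
  cr (inj₂ j) = cong (k ↑ʳ_) (Q.cls-rep j)
  s : ∀ {a b} → (R ⊎ʳ S) a b → c a ≡ c b
  s (inl e) = cong (_↑ˡ l) (P.sound e)
  s (inr e) = cong (k ↑ʳ_) (Q.sound e)
  inj₁-≡ : ∀ {i j : Fin k} → _≡_ {A = Fin k ⊎ Fin l} (inj₁ i) (inj₁ j) → i ≡ j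
  inj₁-≡ refl = refl
  inj₂-≡ : ∀ {i j : Fin l} → _≡_ {A = Fin k ⊎ Fin l} (inj₂ i) (inj₂ j) → i ≡ j
  inj₂-≡ refl = refl
  ll : ∀ i → splitAt k {l} (i ↑ˡ l) ≡ inj₁ i
  ll i = splitAt-↑ˡ k i l
  rr : ∀ i → splitAt k {l} (k ↑ʳ i) ≡ inj₂ i
  rr i = splitAt-↑ʳ k l i
  co : ∀ a b → c a ≡ c b → Cl (R ⊎ʳ S) a b
  co (inj₁ a) (inj₁ b) e = Cl-map inj₁ (λ x → [ inl x ]) (P.complete (inj₁-≡ (trans (sym (ll _)) (trans (cong (splitAt k) e) (ll _)))))
  co (inj₂ a) (inj₂ b) e = Cl-map inj₂ (λ x → [ inr x ]) (Q.complete (inj₂-≡ (trans (sym (rr _)) (trans (cong (splitAt k) e) (rr _)))))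
  co (inj₁ a) (inj₂ b) e with trans (sym (ll (P.cls a))) (trans (cong (splitAt k) e) (rr (Q.cls b)))
  ... | ()
  co (inj₂ a) (inj₁ b) e with trans (sym (ll (P.cls b))) (trans (cong (splitAt k) (sym e)) (rr (Q.cls a)))
  ... | ()

-- The size is the number of classes of the empty relation, so the uniqueness of class numbers
-- applies.
size-unique : ∀ {A B : Set} (F : Finite A) (G : Finite B) (f : A → B) (g : B → A) →
  (∀ a → g (f a) ≡ a) → (∀ b → f (g b) ≡ b) → size F ≡ size G
size-unique F G f g gf fg = NCl-unique (NCl-∅ F) (NCl-Equiv (record
  { to = g ; from = f ; to-R = λ () ; from-S = λ () ; from-to = λ b → Cl-≡ (fg b) ; to-from = λ a → Cl-≡ (gf a) }) (NCl-∅ G))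

-- Matchings: elimination of points, paths, and reconnection of two pairs

record Matching {A : Set} (f : A → A) : Set where
  field
    inv : ∀ a → f (f a) ≡ a
    irr : ∀ a → f a ≢ a

  inj : ∀ {a b} → f a ≡ f b → a ≡ b
  inj e = trans (sym (inv _)) (trans (cong f e) (inv _))

  flip : ∀ {a b} → f a ≡ b → f b ≡ a
  flip refl = inv _

-- A' plays the part of A without a and b. A separate type instead of a subtype lets `Fin (2 + n)`
-- pass to `Fin n`, and the flags of a graph with an additional edge to those of the graph without
-- it.
record Removal {A : Set} (A' : Set) (a b : A) : Set where
  field
    ins     : A' → A
    ins-inj : ∀ {k l} → ins k ≡ ins l → k ≡ l
    ins≢a   : ∀ {k} → ins k ≢ a
    ins≢b   : ∀ {k} → ins k ≢ b
    cover   : ∀ z → z ≡ a ⊎ (z ≡ b ⊎ Σ A' λ k → ins k ≡ z)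
    a≢b     : a ≢ b

  out : ∀ z → z ≢ a → z ≢ b → Σ A' λ k → ins k ≡ z
  out z z≢a z≢b with cover z
  ... | inj₁ e = ⊥-elim (z≢a e)
  ... | inj₂ (inj₁ e) = ⊥-elim (z≢b e)
  ... | inj₂ (inj₂ p) = p

Fin-removal : ∀ {n} {a b : Fin (suc (suc n))} → a ≢ b → Removal (Fin n) a b
Fin-removal {n} {a} {b} a≢b = record
  { ins = λ k → punchIn a (punchIn b' k)
  ; ins-inj = λ e → punchIn-injective b' _ _ (punchIn-injective a _ _ e)
  ; ins≢a = λ {k} → punchInᵢ≢i a _
  ; ins≢b = λ {k} e → punchInᵢ≢i b' k (punchIn-injective a _ _ (trans e (sym (punchIn-punchOut a≢b))))
  ; cover = cov
  ; a≢b = a≢b }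
  where
  b' = punchOut a≢b
  cov : ∀ z → z ≡ a ⊎ (z ≡ b ⊎ Σ (Fin n) λ k → punchIn a (punchIn b' k) ≡ z)
  cov z with a ≟ z
  ... | yes e = inj₁ (sym e)
  ... | no a≢z with b' ≟ punchOut a≢z
  ... | yes e = inj₂ (inj₁ (trans (sym (punchIn-punchOut a≢z)) (trans (cong (punchIn a) (sym e)) (punchIn-punchOut a≢b))))
  ... | no ne = inj₂ (inj₂ (punchOut ne , trans (cong (punchIn a) (punchIn-punchOut ne)) (punchIn-punchOut a≢z)))

-- Eliminating the points a and b from a matching τ: the partners of a and b become partners.
module Elim {A A' : Set} {a b : A} (r : Removal A' a b) {τ : A → A} (τm : Matching τ) where
  open Removal r
  open Matching τm

  Spec : A' → A' → Set
  Spec k k' = τ (ins k) ≡ ins k' ⊎ ((τ (ins k) ≡ a × ins k' ≡ τ b) ⊎ (τ (ins k) ≡ b × ins k' ≡ τ a))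

  private
    elim : ∀ k → Σ A' (Spec k)
    elim k with cover (τ (ins k))
    ... | inj₂ (inj₂ (k' , e)) = k' , inj₁ (sym e)
    ... | inj₁ e with out (τ b) (λ f → ins≢b (trans (sym (flip e)) (flip f))) (irr b)
    ... | k' , f = k' , inj₂ (inj₁ (e , f))
    elim k | inj₂ (inj₁ e) with out (τ a) (irr a) (λ f → ins≢a (trans (sym (flip e)) (flip f)))
    ... | k' , f = k' , inj₂ (inj₂ (e , f))

  τ' : A' → A'
  τ' k = proj₁ (elim k)

  spec : ∀ k → Spec k (τ' k)
  spec k = proj₂ (elim k)

  spec-ins : ∀ {k k'} → τ (ins k) ≡ ins k' → τ' k ≡ k'
  spec-ins {k} e with spec k
  ... | inj₁ f = ins-inj (trans (sym f) e)
  ... | inj₂ (inj₁ (f , _)) = ⊥-elim (ins≢a (trans (sym e) f))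
  ... | inj₂ (inj₂ (f , _)) = ⊥-elim (ins≢b (trans (sym e) f))

  spec-a : ∀ {k} → τ (ins k) ≡ a → ins (τ' k) ≡ τ b
  spec-a {k} e with spec k
  ... | inj₁ f = ⊥-elim (ins≢a (trans (sym f) e))
  ... | inj₂ (inj₁ (_ , g)) = g
  ... | inj₂ (inj₂ (f , _)) = ⊥-elim (a≢b (trans (sym e) f))

  spec-b : ∀ {k} → τ (ins k) ≡ b → ins (τ' k) ≡ τ a
  spec-b {k} e with spec k
  ... | inj₁ f = ⊥-elim (ins≢b (trans (sym f) e))
  ... | inj₂ (inj₁ (f , _)) = ⊥-elim (a≢b (trans (sym f) e))
  ... | inj₂ (inj₂ (_ , g)) = g

  τ'-matching : Matching τ'
  τ'-matching = record { inv = inv' ; irr = irr' }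
    where
    inv' : ∀ k → τ' (τ' k) ≡ k
    inv' k with spec k
    ... | inj₁ f = spec-ins (flip f)
    ... | inj₂ (inj₁ (f , g)) = ins-inj (trans (spec-b (trans (cong τ g) (inv b))) (flip f))
    ... | inj₂ (inj₂ (f , g)) = ins-inj (trans (spec-a (trans (cong τ g) (inv a))) (flip f))
    irr' : ∀ k → τ' k ≢ k
    irr' k e with spec k
    ... | inj₁ f = irr _ (trans f (cong ins e))
    ... | inj₂ (inj₁ (f , g)) = a≢b (inj (trans (flip f) (trans (cong ins (sym e)) g)))
    ... | inj₂ (inj₂ (f , g)) = a≢b (inj (trans (sym g) (trans (cong ins e) (sym (flip f)))))

  from-τ' : ∀ {S : Rel A} → Cl (gr τ ∪ S) a b → ∀ k → Cl (gr τ ∪ S) (ins k) (ins (τ' k))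
  from-τ' ab k with spec k
  ... | inj₁ f = [ inj₁ f ]
  ... | inj₂ (inj₁ (f , g)) = fwd (inj₁ f) (ab ∙ [ inj₁ (sym g) ])
  ... | inj₂ (inj₂ (f , g)) = fwd (inj₁ f) (ab ⁻ ∙ [ inj₁ (sym g) ])

  -- If a and b are not partners, each is absorbed into its partner; no class disappears as long as
  -- a and b are connected anyway.
  module Join (τa≢b : τ a ≢ b) where
    ka : Σ A' λ k → ins k ≡ τ a
    ka = out (τ a) (irr a) τa≢b
    kb : Σ A' λ k → ins k ≡ τ b
    kb = out (τ b) (τa≢b ∘ flip) (irr b)

    to : A → A'
    to z with cover z
    ... | inj₁ _ = proj₁ ka
    ... | inj₂ (inj₁ _) = proj₁ kb
    ... | inj₂ (inj₂ (k , _)) = k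

    to-ins : ∀ k → to (ins k) ≡ k
    to-ins k with cover (ins k)
    ... | inj₁ e = ⊥-elim (ins≢a e)
    ... | inj₂ (inj₁ e) = ⊥-elim (ins≢b e)
    ... | inj₂ (inj₂ (_ , e)) = ins-inj e

    to-a : to a ≡ proj₁ ka
    to-a with cover a
    ... | inj₁ _ = refl
    ... | inj₂ (inj₁ e) = ⊥-elim (a≢b e)
    ... | inj₂ (inj₂ (_ , e)) = ⊥-elim (ins≢a e)

    to-b : to b ≡ proj₁ kb
    to-b with cover b
    ... | inj₁ e = ⊥-elim (a≢b (sym e))
    ... | inj₂ (inj₁ _) = refl
    ... | inj₂ (inj₂ (_ , e)) = ⊥-elim (ins≢b e)

    τ'-ab : τ' (to a) ≡ to b
    τ'-ab = ins-inj (trans (spec-a (flip (trans (sym (proj₂ ka)) (cong ins (sym to-a)))))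
                           (trans (sym (proj₂ kb)) (cong ins (sym to-b))))

    to-τ : ∀ {S : Rel A'} z → Cl (gr τ' ∪ S) (to z) (to (τ z))
    to-τ z with cover z in eq
    ... | inj₁ refl = Cl-≡ (sym (trans (cong to (sym (proj₂ ka))) (to-ins _)))
    ... | inj₂ (inj₁ refl) = Cl-≡ (sym (trans (cong to (sym (proj₂ kb))) (to-ins _)))
    ... | inj₂ (inj₂ (k , refl)) with spec k
    ... | inj₁ f = [ inj₁ (trans (sym (to-ins _)) (cong to (sym f))) ]
    ... | inj₂ (inj₁ (f , _)) = Cl-≡ (sym (trans (cong to f) (trans to-a (ins-inj (trans (proj₂ ka) (flip f))))))
    ... | inj₂ (inj₂ (f , _)) = Cl-≡ (sym (trans (cong to f) (trans to-b (ins-inj (trans (proj₂ kb) (flip f))))))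

    from-to : ∀ {S : Rel A} z → Cl (gr τ ∪ S) (ins (to z)) z
    from-to z with cover z
    ... | inj₁ refl = [ inj₁ (sym (proj₂ ka)) ]⁻
    ... | inj₂ (inj₁ refl) = [ inj₁ (sym (proj₂ kb)) ]⁻
    ... | inj₂ (inj₂ (k , refl)) = ε

    equiv : ∀ {S : Rel A} {S' : Rel A'} → Cl (gr τ ∪ S) a b →
      (∀ {z w} → S z w → Cl (gr τ' ∪ S') (to z) (to w)) →
      (∀ {z w} → S' z w → Cl (gr τ ∪ S) (ins z) (ins w)) →
      Equiv (gr τ ∪ S) (gr τ' ∪ S')
    equiv ab h k = record
      { to = to ; from = ins
      ; to-R = λ { {z} (inj₁ refl) → to-τ z ; (inj₂ s) → h s }
      ; from-S = λ { {z} (inj₁ refl) → from-τ' ab z ; (inj₂ s) → k s }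
      ; from-to = from-to ; to-from = λ k → Cl-≡ (to-ins k) }

  -- If a and b are partners, their pair is closed under τ; the extra point of `Fin 1` remembers it
  -- after the elimination.
  module Loop (τa≡b : τ a ≡ b) where
    to : A → A' ⊎ Fin 1
    to z with cover z
    ... | inj₁ _ = inj₂ zero
    ... | inj₂ (inj₁ _) = inj₂ zero
    ... | inj₂ (inj₂ (k , _)) = inj₁ k

    to-ins : ∀ k → to (ins k) ≡ inj₁ k
    to-ins k with cover (ins k)
    ... | inj₁ e = ⊥-elim (ins≢a e)
    ... | inj₂ (inj₁ e) = ⊥-elim (ins≢b e)
    ... | inj₂ (inj₂ (_ , e)) = cong inj₁ (ins-inj e)

    to-a : to a ≡ inj₂ zero
    to-a with cover a
    ... | inj₁ _ = refl
    ... | inj₂ (inj₁ _) = refl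
    ... | inj₂ (inj₂ (_ , e)) = ⊥-elim (ins≢a e)

    to-b : to b ≡ inj₂ zero
    to-b with cover b
    ... | inj₁ _ = refl
    ... | inj₂ (inj₁ _) = refl
    ... | inj₂ (inj₂ (_ , e)) = ⊥-elim (ins≢b e)

    to-τ : ∀ z → (Σ A' λ k → ins k ≡ z × to (τ z) ≡ inj₁ (τ' k)) ⊎ (to z ≡ inj₂ zero × to (τ z) ≡ inj₂ zero)
    to-τ z with cover z
    ... | inj₁ refl = inj₂ (refl , trans (cong to τa≡b) to-b)
    ... | inj₂ (inj₁ refl) = inj₂ (refl , trans (cong to (flip τa≡b)) to-a)
    ... | inj₂ (inj₂ (k , refl)) with spec k
    ... | inj₁ f = inj₁ (k , refl , trans (cong to f) (to-ins _))
    ... | inj₂ (inj₁ (f , _)) = ⊥-elim (ins≢b (trans (sym (flip f)) τa≡b))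
    ... | inj₂ (inj₂ (f , _)) = ⊥-elim (ins≢a (trans (sym (flip f)) (flip τa≡b)))

    loop-ins : ∀ k → τ (ins k) ≡ ins (τ' k)
    loop-ins k with spec k
    ... | inj₁ f = f
    ... | inj₂ (inj₁ (f , _)) = ⊥-elim (ins≢b (trans (sym (flip f)) τa≡b))
    ... | inj₂ (inj₂ (f , _)) = ⊥-elim (ins≢a (trans (sym (flip f)) (flip τa≡b)))

-- The graph with edges {a , τ a} and {a , t a}, where τ is a matching and t an involution with
-- fixed points enumerated by e, consists of ℓ cycles and of paths joining e m to e (μ m).
record Paths {A M : Set} (τ t : A → A) (e : M → A) : Set where
  field
    μ        : M → M
    matching : Matching μ
    ℓ        : ℕ
    to       : A → M ⊎ Fin ℓ
    loop     : Fin ℓ → A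
    to-e     : ∀ m → to (e m) ≡ inj₁ m
    to-loop  : ∀ l → to (loop l) ≡ inj₂ l
    to-τ     : ∀ a → Cl (gr μ ⊎ʳ ∅) (to a) (to (τ a))
    to-t     : ∀ a → Cl (gr μ ⊎ʳ ∅) (to a) (to (t a))
    from-μ   : ∀ m → Cl (gr τ ∪ gr t) (e m) (e (μ m))
    from-to  : ∀ a → Cl (gr τ ∪ gr t) ([ e , loop ]′ (to a)) a

  equiv : Equiv (gr τ ∪ gr t) (gr μ ⊎ʳ ∅)
  equiv = record
    { to = to ; from = [ e , loop ]′
    ; to-R = λ { {a} (inj₁ refl) → to-τ a ; {a} (inj₂ refl) → to-t a }
    ; from-S = λ { (inl refl) → from-μ _ }
    ; from-to = from-to
    ; to-from = λ { (inj₁ m) → Cl-≡ (to-e m) ; (inj₂ l) → Cl-≡ (to-loop l) } }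

  equiv⁺ : ∀ {R : Rel A} {S : Rel M} →
    (∀ {a b} → R a b → Cl ((gr μ ∪ S) ⊎ʳ ∅) (to a) (to b)) →
    (∀ {m n} → S m n → Cl ((gr τ ∪ gr t) ∪ R) (e m) (e n)) →
    Equiv ((gr τ ∪ gr t) ∪ R) ((gr μ ∪ S) ⊎ʳ (∅ {Fin ℓ}))
  equiv⁺ {R} {S} h k = Equiv-trans
    (Equiv-extend {S⁺ = S ⊎ʳ ∅} equiv (λ r → Cl-mono spl (h r)) λ { (inl s) → k s })
    (Equiv-id uni (λ s → [ spl s ]))
    where
    spl : ∀ {a b} → ((gr μ ∪ S) ⊎ʳ (∅ {Fin ℓ})) a b → ((gr μ ⊎ʳ ∅) ∪ (S ⊎ʳ ∅)) a b
    spl (inl (inj₁ x)) = inj₁ (inl x)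
    spl (inl (inj₂ x)) = inj₂ (inl x)
    uni : ∀ {a b} → ((gr μ ⊎ʳ ∅) ∪ (S ⊎ʳ ∅)) a b → Cl ((gr μ ∪ S) ⊎ʳ (∅ {Fin ℓ})) a b
    uni (inj₁ (inl x)) = [ inl (inj₁ x) ]
    uni (inj₂ (inl x)) = [ inl (inj₂ x) ]

  NCl-paths : ∀ {R : Rel A} {S : Rel M} {k} →
    (∀ {a b} → R a b → Cl ((gr μ ∪ S) ⊎ʳ ∅) (to a) (to b)) →
    (∀ {m n} → S m n → Cl ((gr τ ∪ gr t) ∪ R) (e m) (e n)) →
    NCl (gr μ ∪ S) k → NCl ((gr τ ∪ gr t) ∪ R) (k + ℓ)
  NCl-paths h k P = NCl-Equiv (Equiv-sym (equiv⁺ h k)) (NCl-⊎ P (NCl-∅ (Fin-finite ℓ)))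

  private
    μ-class : ∀ {m x} → Cl (gr μ ⊎ʳ (∅ {Fin ℓ})) (inj₁ m) x → x ≡ inj₁ m ⊎ x ≡ inj₁ (μ m)
    μ-class ε = inj₁ refl
    μ-class {m} (fwd (inl refl) p) with μ-class p
    ... | inj₁ e = inj₂ e
    ... | inj₂ e = inj₁ (trans e (cong inj₁ (Matching.inv matching m)))
    μ-class (bwd (inl refl) p) with μ-class p
    ... | inj₁ e = inj₂ (trans e (cong inj₁ (sym (Matching.inv matching _))))
    ... | inj₂ e = inj₁ e

  ends : ∀ {m n} → Cl (gr τ ∪ gr t) (e m) (e n) → n ≡ m ⊎ n ≡ μ m
  ends {m} {n} p with μ-class (subst₂ (Cl _) (to-e m) (to-e n) (Equiv.to* equiv p))
  ... | inj₁ f = inj₁ (inj₁-injective f)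
  ... | inj₂ f = inj₂ (inj₁-injective f)

private
  -- Puts one eliminated pair {a , t a} back. If a and t a are not partners under τ, they subdivide
  -- a path or a cycle; otherwise they are one more cycle.
  paths-step : ∀ {A A' M : Set} {a b : A} (r : Removal A' a b) {τ t : A → A} {t' : A' → A'} {e : M → A} {e' : M → A'}
    (τm : Matching τ) → t a ≡ b → t b ≡ a → (∀ k → t (Removal.ins r k) ≡ Removal.ins r (t' k)) → (∀ m → Removal.ins r (e' m) ≡ e m) →
    Dec (τ a ≡ b) → Paths (Elim.τ' r τm) t' e' → Paths τ t e
  paths-step {A} {A'} {M} {a} {b} r {τ} {t} {t'} {e} {e'} τm ta tb tins e-ins (no ne) P = record
    { μ = P.μ ; matching = P.matching ; ℓ = P.ℓ
    ; to = λ z → P.to (to z) ; loop = λ l → ins (P.loop l)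
    ; to-e = λ m → trans (cong P.to (trans (cong to (sym (e-ins m))) (to-ins _))) (P.to-e m)
    ; to-loop = λ l → trans (cong P.to (to-ins _)) (P.to-loop l)
    ; to-τ = λ z → Cl-map P.to P-to {to z} {to (τ z)} (to-τ {∅} z)
    ; to-t = t-step
    ; from-μ = λ m → subst₂ (Cl _) (e-ins m) (e-ins _) (down (P.from-μ m))
    ; from-to = λ z → subst (λ w → Cl _ w (ins (to z))) (ft (P.to (to z))) (down (P.from-to (to z))) ∙ from-to z }
    where
    open Elim r τm
    open Removal r
    open Join ne
    module P = Paths P
    ab : Cl (gr τ ∪ gr t) a b
    ab = [ inj₂ ta ]
    down : ∀ {k l} → Cl (gr τ' ∪ gr t') k l → Cl (gr τ ∪ gr t) (ins k) (ins l)
    down = Cl-map ins λ { {k} (inj₁ refl) → from-τ' ab k ; {k} (inj₂ refl) → [ inj₂ (tins k) ] }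
    P-to : ∀ {k l} → (gr τ' ∪ ∅) k l → Cl (gr P.μ ⊎ʳ ∅) (P.to k) (P.to l)
    P-to {k} (inj₁ refl) = P.to-τ k
    ft : ∀ x → ins ([ e' , P.loop ]′ x) ≡ [ e , (λ l → ins (P.loop l)) ]′ x
    ft (inj₁ m) = e-ins m
    ft (inj₂ l) = refl
    abP : Cl (gr P.μ ⊎ʳ ∅) (P.to (to a)) (P.to (to b))
    abP = subst (λ w → Cl _ (P.to (to a)) (P.to w)) τ'-ab (P.to-τ (to a))
    t-step : ∀ z → Cl (gr P.μ ⊎ʳ ∅) (P.to (to z)) (P.to (to (t z)))
    t-step z with cover z
    ... | inj₁ refl = subst₂ (λ v w → Cl _ (P.to v) (P.to w)) to-a (cong to (sym ta)) abP
    ... | inj₂ (inj₁ refl) = subst₂ (λ v w → Cl _ (P.to v) (P.to w)) to-b (cong to (sym tb)) (abP ⁻)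
    ... | inj₂ (inj₂ (k , refl)) = P.to-t k ∙ Cl-≡ (cong P.to (sym (trans (cong to (tins k)) (to-ins _))))
  paths-step {A} {A'} {M} {a} {b} r {τ} {t} {t'} {e} {e'} τm ta tb tins e-ins (yes eq) P = record
    { μ = P.μ ; matching = P.matching ; ℓ = suc P.ℓ
    ; to = λ z → up (to z) ; loop = lp
    ; to-e = λ m → trans (cong up (trans (cong to (sym (e-ins m))) (to-ins _))) (cong (map₂ suc) (P.to-e m))
    ; to-loop = λ { zero → cong up to-a ; (suc l) → trans (cong up (to-ins _)) (cong (map₂ suc) (P.to-loop l)) }
    ; to-τ = tτ
    ; to-t = t-step
    ; from-μ = λ m → subst₂ (Cl _) (e-ins m) (e-ins _) (down (P.from-μ m))
    ; from-to = ft }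
    where
    open Elim r τm
    open Removal r
    open Loop eq
    module P = Paths P
    up : A' ⊎ Fin 1 → M ⊎ Fin (suc P.ℓ)
    up (inj₁ k) = map₂ suc (P.to k)
    up (inj₂ _) = inj₂ zero
    lp : Fin (suc P.ℓ) → A
    lp zero = a
    lp (suc l) = ins (P.loop l)
    sc : ∀ {x y} → Cl (gr P.μ ⊎ʳ ∅) x y → Cl (gr P.μ ⊎ʳ (∅ {Fin (suc P.ℓ)})) (map₂ suc x) (map₂ suc y)
    sc = Cl-map (map₂ suc) λ { (inl r) → [ inl r ] }
    ab : Cl (gr τ ∪ gr t) a b
    ab = [ inj₂ ta ]
    down : ∀ {k l} → Cl (gr τ' ∪ gr t') k l → Cl (gr τ ∪ gr t) (ins k) (ins l)
    down = Cl-map ins λ { {k} (inj₁ refl) → from-τ' ab k ; {k} (inj₂ refl) → [ inj₂ (tins k) ] }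
    tτ : ∀ z → Cl (gr P.μ ⊎ʳ ∅) (up (to z)) (up (to (τ z)))
    tτ z with to-τ z
    ... | inj₁ (k , refl , f) = subst₂ (λ x y → Cl _ (up x) (up y)) (sym (to-ins k)) (sym f) (sc (P.to-τ k))
    ... | inj₂ (f , g) = Cl-≡ (cong up (trans f (sym g)))
    t-step : ∀ z → Cl (gr P.μ ⊎ʳ ∅) (up (to z)) (up (to (t z)))
    t-step z with cover z
    ... | inj₁ refl = Cl-≡ (cong up (sym (trans (cong to ta) to-b)))
    ... | inj₂ (inj₁ refl) = Cl-≡ (cong up (sym (trans (cong to tb) to-a)))
    ... | inj₂ (inj₂ (k , refl)) = sc (P.to-t k) ∙ Cl-≡ (cong up (sym (trans (cong to (tins k)) (to-ins _))))
    fk : ∀ x → ins ([ e' , P.loop ]′ x) ≡ [ e , lp ]′ (map₂ suc x)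
    fk (inj₁ m) = e-ins m
    fk (inj₂ l) = refl
    ft : ∀ z → Cl (gr τ ∪ gr t) ([ e , lp ]′ (up (to z))) z
    ft z with cover z
    ... | inj₁ refl = ε
    ... | inj₂ (inj₁ refl) = ab
    ... | inj₂ (inj₂ (k , refl)) = subst (λ w → Cl _ w (ins k)) (fk (P.to k)) (down (P.from-to k))

  -- By induction on the number of points: a pair that t moves is eliminated. Once t fixes
  -- everything, every point is an end and the paths are the pairs of τ.
  paths-Fin : ∀ n {M : Set} {τ t : Fin n → Fin n} {e : M → Fin n} → Matching τ → (∀ i → t (t i) ≡ i) →
    (∀ {m m'} → e m ≡ e m' → m ≡ m') → (∀ m → t (e m) ≡ e m) → (∀ i → t i ≡ i → Σ M λ m → e m ≡ i) → Paths τ t e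
  paths-Fin n {M} {τ} {t} {e} τm t-step e-inj te et with any? (λ i → ¬? (t i ≟ i))
  ... | no none = record
    { μ = λ m → g (τ (e m))
    ; matching = record
      { inv = λ m → e-inj (trans (e∘g _) (trans (cong τ (e∘g _)) (inv _)))
      ; irr = λ m f → irr (e m) (trans (sym (e∘g _)) (cong e f)) }
    ; ℓ = 0 ; to = λ i → inj₁ (g i) ; loop = λ () ; to-e = λ m → cong inj₁ (ge m) ; to-loop = λ ()
    ; to-τ = λ i → [ inl (cong (g ∘ τ) (e∘g i)) ]
    ; to-t = λ i → Cl-≡ (cong (inj₁ ∘ g) (sym (fix i)))
    ; from-μ = λ m → [ inj₁ (sym (e∘g _)) ]
    ; from-to = λ i → Cl-≡ (e∘g i) }
    where
    open Matching τm
    fix : ∀ i → t i ≡ i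
    fix i with t i ≟ i
    ... | yes p = p
    ... | no np = ⊥-elim (none (i , np))
    g : Fin n → M
    g i = proj₁ (et i (fix i))
    e∘g : ∀ i → e (g i) ≡ i
    e∘g i = proj₂ (et i (fix i))
    ge : ∀ m → g (e m) ≡ m
    ge m = e-inj (e∘g (e m))
  paths-Fin zero τm t-step e-inj te et | yes (() , _)
  paths-Fin (suc zero) {t = t} τm t-step e-inj te et | yes (zero , ne) with t zero
  ... | zero = ⊥-elim (ne refl)
  paths-Fin (suc (suc n)) {M} {τ} {t} {e} τm t-step e-inj te et | yes (a , ne) =
    paths-step r τm refl (t-step a) (λ k → sym (proj₂ (t∘ k))) (λ m → proj₂ (e∘ m)) (τ a ≟ t a)
      (paths-Fin n (Elim.τ'-matching r τm)
        (λ k → ins-inj (trans (proj₂ (t∘ _)) (trans (cong t (proj₂ (t∘ k))) (t-step _))))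
        (λ f → e-inj (trans (sym (proj₂ (e∘ _))) (trans (cong ins f) (proj₂ (e∘ _)))))
        (λ m → ins-inj (trans (proj₂ (t∘ _)) (trans (cong t (proj₂ (e∘ m))) (trans (te m) (sym (proj₂ (e∘ m)))))))
        λ k f → let m , p = et (ins k) (trans (sym (proj₂ (t∘ k))) (cong ins f)) in m , ins-inj (trans (proj₂ (e∘ m)) p))
    where
    r : Removal (Fin n) a (t a)
    r = Fin-removal (ne ∘ sym)
    open Removal r
    t∘ : ∀ k → Σ (Fin n) λ l → ins l ≡ t (ins k)
    t∘ k = out _ (λ f → ins≢b (trans (sym (t-step _)) (cong t f))) (λ f → ins≢a (trans (sym (t-step _)) (trans (cong t f) (t-step a))))
    e∘ : ∀ m → Σ (Fin n) λ l → ins l ≡ e m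
    e∘ m = out _ (λ f → ne (trans (cong t (sym f)) (trans (te m) f)))
                 (λ f → ne (sym (trans (sym (t-step a)) (trans (cong t (sym f)) (trans (te m) f)))))

abstract
  paths : ∀ {A M : Set} → Finite A → {τ t : A → A} {e : M → A} → Matching τ → (∀ a → t (t a) ≡ a) →
    (∀ {m m'} → e m ≡ e m' → m ≡ m') → (∀ m → t (e m) ≡ e m) → (∀ a → t a ≡ a → Σ M λ m → e m ≡ a) → Paths τ t e
  paths {A} {M} F {τ} {t} {e} τm t-step e-inj te et = record
    { μ = P.μ ; matching = P.matching ; ℓ = P.ℓ ; to = P.to ∘ index ; loop = enum ∘ P.loop
    ; to-e = P.to-e
    ; to-loop = λ l → trans (cong P.to (index-enum _)) (P.to-loop l)
    ; to-τ = λ a → subst (λ w → Cl _ (P.to (index a)) (P.to (index (τ w)))) (enum-index a) (P.to-τ (index a))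
    ; to-t = λ a → subst (λ w → Cl _ (P.to (index a)) (P.to (index (t w)))) (enum-index a) (P.to-t (index a))
    ; from-μ = λ m → subst₂ (Cl _) (enum-index _) (enum-index _) (up (P.from-μ m))
    ; from-to = λ a → subst₂ (Cl _) (ft (P.to (index a))) (enum-index a) (up (P.from-to (index a))) }
    where
    open Finite F
    open Matching τm
    conj : (A → A) → Fin (size F) → Fin (size F)
    conj f i = index (f (enum i))
    conj-inv : ∀ {f : A → A} → (∀ a → f (f a) ≡ a) → ∀ i → conj f (conj f i) ≡ i
    conj-inv {f} ff i = trans (cong (index ∘ f) (enum-index _)) (trans (cong index (ff _)) (index-enum i))
    P : Paths (conj τ) (conj t) (index ∘ e)
    P = paths-Fin (size F)
      (record { inv = conj-inv {τ} inv ; irr = λ i f → irr (enum i) (trans (sym (enum-index _)) (cong enum f)) })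
      (conj-inv {t} t-step)
      (λ f → e-inj (trans (sym (enum-index _)) (trans (cong enum f) (enum-index _))))
      (λ m → trans (cong (index ∘ t) (enum-index _)) (cong index (te m)))
      (λ i f → let m , p = et (enum i) (trans (sym (enum-index _)) (cong enum f)) in m , trans (cong index p) (index-enum i))
    module P = Paths P
    up : ∀ {i j} → Cl (gr (conj τ) ∪ gr (conj t)) i j → Cl (gr τ ∪ gr t) (enum i) (enum j)
    up = Cl-map enum λ { (inj₁ refl) → [ inj₁ (sym (enum-index _)) ] ; (inj₂ refl) → [ inj₂ (sym (enum-index _)) ] }
    ft : ∀ x → enum ([ index ∘ e , P.loop ]′ x) ≡ [ e , enum ∘ P.loop ]′ x
    ft (inj₁ m) = enum-index _
    ft (inj₂ l) = refl

-- The pairs {a , t a} and {c , t c} of a matching t are replaced by {a , c} and {t a , t c}.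
module Swap {A : Set} (F : Finite A) {t : A → A} (tm : Matching t) {a c : A} (a≢c : a ≢ c) (ta≢c : t a ≢ c) where
  open Finite F using (_≟ᶠ_)
  open Matching tm

  a≢tc : a ≢ t c
  a≢tc e = ta≢c (flip (sym e))

  private
    σ : A → A
    σ z with z ≟ᶠ t a
    ... | yes _ = c
    ... | no _ with z ≟ᶠ c
    ... | yes _ = t a
    ... | no _ = z

    σ-ta : σ (t a) ≡ c
    σ-ta with t a ≟ᶠ t a
    ... | yes _ = refl
    ... | no ne = ⊥-elim (ne refl)

    σ-c : σ c ≡ t a
    σ-c with c ≟ᶠ t a
    ... | yes e = ⊥-elim (ta≢c (sym e))
    ... | no _ with c ≟ᶠ c
    ... | yes _ = refl
    ... | no ne = ⊥-elim (ne refl)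

    σ-off : ∀ {z} → z ≢ t a → z ≢ c → σ z ≡ z
    σ-off {z} p q with z ≟ᶠ t a
    ... | yes e = ⊥-elim (p e)
    ... | no _ with z ≟ᶠ c
    ... | yes e = ⊥-elim (q e)
    ... | no _ = refl

    σσ : ∀ z → σ (σ z) ≡ z
    σσ z with z ≟ᶠ t a
    ... | yes e = trans σ-c (sym e)
    ... | no p with z ≟ᶠ c
    ... | yes e = trans σ-ta (sym e)
    ... | no q = σ-off p q

  -- Conjugation of t by the transposition of `t a` and `c` gives a matching without any case
  -- distinction.
  swap : A → A
  swap z = σ (t (σ z))

  swap-matching : Matching swap
  swap-matching = record
    { inv = λ z → trans (cong (σ ∘ t) (σσ _)) (trans (cong σ (inv _)) (σσ z))
    ; irr = λ z e → irr (σ z) (trans (sym (σσ _)) (cong σ e)) }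

  record Off (z : A) : Set where
    constructor off
    field
      ≢a  : z ≢ a
      ≢c  : z ≢ c
      ≢ta : z ≢ t a
      ≢tc : z ≢ t c

  data View : A → Set where
    at-a  : ∀ {z} → z ≡ a → View z
    at-c  : ∀ {z} → z ≡ c → View z
    at-ta : ∀ {z} → z ≡ t a → View z
    at-tc : ∀ {z} → z ≡ t c → View z
    other : ∀ {z} → Off z → View z

  view : ∀ z → View z
  view z with z ≟ᶠ a
  ... | yes e = at-a e
  ... | no p with z ≟ᶠ c
  ... | yes e = at-c e
  ... | no q with z ≟ᶠ t a
  ... | yes e = at-ta e
  ... | no r with z ≟ᶠ t c
  ... | yes e = at-tc e
  ... | no s = other (off p q r s)

  swap-a : swap a ≡ c
  swap-a = trans (cong (σ ∘ t) (σ-off (λ e → irr a (sym e)) a≢c)) σ-ta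

  swap-c : swap c ≡ a
  swap-c = Matching.flip swap-matching swap-a

  swap-ta : swap (t a) ≡ t c
  swap-ta = trans (cong (σ ∘ t) σ-ta) (σ-off (λ e → a≢c (sym (inj e))) (irr c))

  swap-tc : swap (t c) ≡ t a
  swap-tc = Matching.flip swap-matching swap-ta

  swap-off : ∀ {z} → Off z → swap z ≡ t z
  swap-off (off p q r s) = trans (cong (σ ∘ t) (σ-off r q)) (σ-off (p ∘ inj) (λ e → s (sym (flip e))))

  Off-t : ∀ {z} → Off z → Off (t z)
  Off-t (off p q r s) = off (λ e → r (sym (flip e))) (λ e → s (sym (flip e))) (p ∘ inj) (q ∘ inj)

  swap-preserves : ∀ {B : Set} (f : A → B) → f a ≡ f c → (∀ z → f (t z) ≡ f z) → ∀ z → f (swap z) ≡ f z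
  swap-preserves f ac ft z with view z
  ... | at-a refl = trans (cong f swap-a) (sym ac)
  ... | at-c refl = trans (cong f swap-c) ac
  ... | at-ta refl = trans (cong f swap-ta) (trans (ft c) (trans (sym ac) (sym (ft a))))
  ... | at-tc refl = trans (cong f swap-tc) (trans (ft a) (trans ac (sym (ft c))))
  ... | other o = trans (cong f (swap-off o)) (ft z)

  -- The two pairs are removed rather than reconnected. The four fixed points are the ends of the
  -- paths that t and `swap` close up in different ways.
  cut : A → A
  cut z with view z
  ... | other _ = t z
  ... | _ = z

  cut-off : ∀ {z} → Off z → cut z ≡ t z
  cut-off {z} (off p q r s) with view z
  ... | at-a e = ⊥-elim (p e)
  ... | at-c e = ⊥-elim (q e)
  ... | at-ta e = ⊥-elim (r e)
  ... | at-tc e = ⊥-elim (s e)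
  ... | other _ = refl

  cut-inv : ∀ z → cut (cut z) ≡ z
  cut-inv z with view z in eq
  ... | other o = trans (cut-off (Off-t o)) (inv z)
  ... | at-a e rewrite eq = refl
  ... | at-c e rewrite eq = refl
  ... | at-ta e rewrite eq = refl
  ... | at-tc e rewrite eq = refl

  module _ {X : Rel A} (off-⊆ : ∀ {z} → Off z → Cl X z (t z)) where
    t-⊆ : Cl X a (t a) → Cl X c (t c) → ∀ z → Cl X z (t z)
    t-⊆ p q z with view z
    ... | at-a refl = p
    ... | at-c refl = q
    ... | at-ta refl = p ⁻ ∙ Cl-≡ (sym (inv a))
    ... | at-tc refl = q ⁻ ∙ Cl-≡ (sym (inv c))
    ... | other o = off-⊆ o

    swap-⊆ : Cl X a c → Cl X (t a) (t c) → ∀ z → Cl X z (swap z)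
    swap-⊆ p q z with view z
    ... | at-a refl = p ∙ Cl-≡ (sym swap-a)
    ... | at-c refl = p ⁻ ∙ Cl-≡ (sym swap-c)
    ... | at-ta refl = q ∙ Cl-≡ (sym swap-ta)
    ... | at-tc refl = q ⁻ ∙ Cl-≡ (sym swap-tc)
    ... | other o = off-⊆ o ∙ Cl-≡ (sym (swap-off o))

  cut-⊆ : ∀ {X : Rel A} → (∀ {z} → Off z → Cl X z (t z)) → ∀ z → Cl X z (cut z)
  cut-⊆ h z with view z
  ... | at-a _ = ε
  ... | at-c _ = ε
  ... | at-ta _ = ε
  ... | at-tc _ = ε
  ... | other o = h o

  module _ {Q : Rel A} where
    private
      R R' : Rel A
      R = Q ∪ gr t
      R' = Q ∪ gr swap

    -- One additional pair {a , c} also connects `t a` with `t c`, by way of t, and thus all of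
    -- `swap` is recovered.
    swap-≤1 : ∀ {k k'} → NCl R k → NCl R' k' → k ≤ suc k'
    swap-≤1 P P' = NCl-≤1 P P' a c id h id (λ _ → ε)
      where
      t∈ : ∀ z → Cl (R ∪ Pair a c) z (t z)
      t∈ z = [ inj₁ (inj₂ refl) ]
      h : ∀ {z w} → R' z w → Cl (R ∪ Pair a c) z w
      h (inj₁ q) = [ inj₁ (inj₁ q) ]
      h {z} (inj₂ refl) = swap-⊆ (λ _ → t∈ _) [ inj₂ pair ] (t∈ a ⁻ ∙ fwd (inj₂ pair) (t∈ c)) z

    R-off : ∀ {z} → Off z → Cl R z (t z)
    R-off _ = [ inj₂ refl ]

    R'-off : ∀ {z} → Off z → Cl R' z (t z)
    R'-off o = [ inj₂ (swap-off o) ]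

  module Outcome {τ : A → A} (τm : Matching τ) where
    R R' R₀ : Rel A
    R = gr τ ∪ gr t
    R' = gr τ ∪ gr swap
    R₀ = gr τ ∪ gr cut

    private
      e : Fin 4 → A
      e zero = a
      e (suc zero) = t a
      e (suc (suc zero)) = c
      e (suc (suc (suc zero))) = t c

      e-inj : ∀ {i j} → e i ≡ e j → i ≡ j
      e-inj {zero} {zero} p = refl
      e-inj {zero} {suc zero} p = ⊥-elim (irr a (sym p))
      e-inj {zero} {suc (suc zero)} p = ⊥-elim (a≢c p)
      e-inj {zero} {suc (suc (suc zero))} p = ⊥-elim (a≢tc p)
      e-inj {suc zero} {zero} p = ⊥-elim (irr a p)
      e-inj {suc zero} {suc zero} p = refl
      e-inj {suc zero} {suc (suc zero)} p = ⊥-elim (ta≢c p)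
      e-inj {suc zero} {suc (suc (suc zero))} p = ⊥-elim (a≢c (inj p))
      e-inj {suc (suc zero)} {zero} p = ⊥-elim (a≢c (sym p))
      e-inj {suc (suc zero)} {suc zero} p = ⊥-elim (ta≢c (sym p))
      e-inj {suc (suc zero)} {suc (suc zero)} p = refl
      e-inj {suc (suc zero)} {suc (suc (suc zero))} p = ⊥-elim (irr c (sym p))
      e-inj {suc (suc (suc zero))} {zero} p = ⊥-elim (a≢tc (sym p))
      e-inj {suc (suc (suc zero))} {suc zero} p = ⊥-elim (a≢c (inj (sym p)))
      e-inj {suc (suc (suc zero))} {suc (suc zero)} p = ⊥-elim (irr c p)
      e-inj {suc (suc (suc zero))} {suc (suc (suc zero))} p = refl

      cut-e : ∀ i → cut (e i) ≡ e i
      cut-e i with view (e i)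
      ... | at-a _ = refl
      ... | at-c _ = refl
      ... | at-ta _ = refl
      ... | at-tc _ = refl
      cut-e zero | other o = ⊥-elim (Off.≢a o refl)
      cut-e (suc zero) | other o = ⊥-elim (Off.≢ta o refl)
      cut-e (suc (suc zero)) | other o = ⊥-elim (Off.≢c o refl)
      cut-e (suc (suc (suc zero))) | other o = ⊥-elim (Off.≢tc o refl)

      e-cut : ∀ z → cut z ≡ z → Σ (Fin 4) λ i → e i ≡ z
      e-cut z p with view z
      ... | at-a f = zero , sym f
      ... | at-c f = suc (suc zero) , sym f
      ... | at-ta f = suc zero , sym f
      ... | at-tc f = suc (suc (suc zero)) , sym f
      ... | other o = ⊥-elim (irr z p)

      P : Paths τ cut e
      P = paths F τm cut-inv e-inj cut-e e-cut
      module P = Paths P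
      module M = Matching P.matching

    R₀-off : ∀ {z} → Off z → Cl R₀ z (t z)
    R₀-off o = [ inj₂ (cut-off o) ]

    R₀⊆ : ∀ {X : Rel A} → (∀ {z} → Off z → Cl X z (t z)) → (∀ z → Cl X z (τ z)) → ∀ {z w} → Cl R₀ z w → Cl X z w
    R₀⊆ h k = Cl-bind λ { {z} (inj₁ refl) → k z ; {z} (inj₂ refl) → cut-⊆ h z }

    R⊆ : ∀ {X : Rel A} → (∀ {z} → Off z → Cl X z (t z)) → (∀ z → Cl X z (τ z)) →
         Cl X a (t a) → Cl X c (t c) → ∀ {z w} → Cl R z w → Cl X z w
    R⊆ h k p q = Cl-bind λ { {z} (inj₁ refl) → k z ; {z} (inj₂ refl) → t-⊆ h p q z }

    R'⊆ : ∀ {X : Rel A} → (∀ {z} → Off z → Cl X z (t z)) → (∀ z → Cl X z (τ z)) →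
         Cl X a c → Cl X (t a) (t c) → ∀ {z w} → Cl R' z w → Cl X z w
    R'⊆ h k p q = Cl-bind λ { {z} (inj₁ refl) → k z ; {z} (inj₂ refl) → swap-⊆ h p q z }

    R₀⊆R : ∀ {z w} → Cl R₀ z w → Cl R z w
    R₀⊆R = R₀⊆ R-off gr-∈

    R₀⊆R' : ∀ {z w} → Cl R₀ z w → Cl R' z w
    R₀⊆R' = R₀⊆ R'-off gr-∈

    ac∈R' : Cl R' a c
    ac∈R' = [ inj₂ swap-a ]

    -- The three ways in which the paths left by `cut` can pair up the four ends: a with `t a` (two
    -- cycles, merged by the swap), a with c (one cycle, split by the swap), a with `t c` (one
    -- cycle, part of which is reversed while the number stays the same).
    data Result : Set where
      merge : Cl R₀ a (t a) → ¬ Cl R a c → (∀ {z w} → Cl R z w → Cl R' z w) →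
              (∀ {k} → NCl R k → Σ ℕ λ k' → k ≡ suc k' × NCl R' k') → Result
      split : Cl R₀ a c → (∀ {k} → NCl R k → NCl R' (suc k)) → Result
      twist : Cl R₀ a (t c) → Result

    private
      four : P.μ zero ≡ suc zero ⊎ (P.μ zero ≡ suc (suc zero) ⊎ P.μ zero ≡ suc (suc (suc zero)))
      four with P.μ zero in eq
      ... | zero = ⊥-elim (M.irr zero eq)
      ... | suc zero = inj₁ refl
      ... | suc (suc zero) = inj₂ (inj₁ refl)
      ... | suc (suc (suc zero)) = inj₂ (inj₂ refl)

      conn : ∀ i {j} → P.μ i ≡ j → Cl R₀ (e i) (e j)
      conn i refl = P.from-μ i

      two-three : P.μ zero ≡ suc zero → P.μ (suc (suc zero)) ≡ suc (suc (suc zero))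
      two-three p with P.μ (suc (suc zero)) in eq
      ... | zero with () ← trans (sym p) (M.flip eq)
      ... | suc zero with () ← M.inj (trans p (sym eq))
      ... | suc (suc zero) = ⊥-elim (M.irr _ eq)
      ... | suc (suc (suc zero)) = refl

      one-three : P.μ zero ≡ suc (suc zero) → P.μ (suc zero) ≡ suc (suc (suc zero))
      one-three p with P.μ (suc zero) in eq
      ... | zero with () ← trans (sym p) (M.flip eq)
      ... | suc zero = ⊥-elim (M.irr _ eq)
      ... | suc (suc zero) with () ← M.inj (trans p (sym eq))
      ... | suc (suc (suc zero)) = refl

    result : Result
    result with four
    ... | inj₁ μ0 = merge aa a≁c up λ N → count (NCl-addPair N a c)
      where
      aa : Cl R₀ a (t a)
      aa = conn zero μ0
      cc : Cl R₀ c (t c)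
      cc = conn (suc (suc zero)) (two-three μ0)
      a≁c : ¬ Cl R a c
      a≁c p with P.ends {zero} {suc (suc zero)} (R⊆ R₀-off gr-∈ aa cc p)
      ... | inj₂ q with () ← trans q μ0
      up : ∀ {z w} → Cl R z w → Cl R' z w
      up = R⊆ R'-off gr-∈ (R₀⊆R' aa) (R₀⊆R' cc)
      count : ∀ {k} → (Cl R a c × NCl (R ∪ Pair a c) k) ⊎ (¬ Cl R a c × Σ ℕ λ k' → k ≡ suc k' × NCl (R ∪ Pair a c) k') →
        Σ ℕ λ k' → k ≡ suc k' × NCl R' k'
      count (inj₁ (p , _)) = ⊥-elim (a≁c p)
      count (inj₂ (_ , k' , e , N)) = k' , e , NCl-Equiv (Equiv-id
        (λ { (inj₁ r) → up [ r ] ; (inj₂ pair) → ac∈R' })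
        (λ r → R'⊆ {R ∪ Pair a c} (λ o → [ inj₁ (inj₂ refl) ]) (λ z → [ inj₁ (inj₁ refl) ]) [ inj₂ pair ]
          (bwd (inj₁ (inj₂ refl)) (fwd (inj₂ pair) [ inj₁ (inj₂ refl) ])) [ r ])) N
    ... | inj₂ (inj₂ μ0) = twist (conn zero μ0)
    ... | inj₂ (inj₁ μ0) = split ac λ N → count N (proj₂ ex) (NCl-addPair (proj₂ ex) a (t a))
      where
      -- The number after the swap is taken as unknown. Connecting a and `t a` again has to lose one
      -- class and restores the classes of t, which determines it.
      ex : Σ ℕ (NCl R')
      ex = NCl-gr₂ F τ swap
      ac : Cl R₀ a c
      ac = conn zero μ0
      far-joined : Cl R₀ (t a) (t c)
      far-joined = conn (suc zero) (one-three μ0)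
      down : ∀ {z w} → Cl R' z w → Cl R₀ z w
      down = R'⊆ R₀-off gr-∈ ac far-joined
      a≁ta : ¬ Cl R' a (t a)
      a≁ta p with P.ends {zero} {suc zero} (down p)
      ... | inj₂ q with () ← trans q μ0
      count : ∀ {k k'} → NCl R k → NCl R' k' → (Cl R' a (t a) × NCl (R' ∪ Pair a (t a)) k') ⊎
        (¬ Cl R' a (t a) × Σ ℕ λ l → k' ≡ suc l × NCl (R' ∪ Pair a (t a)) l) → NCl R' (suc k)
      count N _ (inj₁ (p , _)) = ⊥-elim (a≁ta p)
      count N E (inj₂ (_ , l , refl , N')) = subst (λ x → NCl R' (suc x)) (NCl-unique N″ N) E
        where
        N″ : NCl R l
        N″ = NCl-Equiv (Equiv-id
          (λ { (inj₁ r) → R₀⊆R (down [ r ]) ; (inj₂ pair) → [ inj₂ refl ] })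
          (λ r → R⊆ {R' ∪ Pair a (t a)} (λ o → [ inj₁ (inj₂ (swap-off o)) ]) (λ z → [ inj₁ (inj₁ refl) ]) [ inj₂ pair ]
            (bwd (inj₁ (inj₂ swap-a)) (fwd (inj₂ pair) [ inj₁ (inj₂ swap-ta) ])) [ r ])) N'

    R₀-ends : Cl R₀ a c → ¬ Cl R₀ a (t c)
    R₀-ends p q with P.ends {zero} {suc (suc zero)} p | P.ends {zero} {suc (suc (suc zero))} q
    ... | inj₂ x | inj₂ y with () ← trans x (sym y)

    swap-merge : ¬ Cl R a c → (∀ {z w} → Cl R z w → Cl R' z w) ×
                 (∀ {k} → NCl R k → Σ ℕ λ k' → k ≡ suc k' × NCl R' k')
    swap-merge ne with result
    ... | merge _ _ p q = p , q
    ... | split p _ = ⊥-elim (ne (R₀⊆R p))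
    ... | twist p = ⊥-elim (ne (R₀⊆R p ∙ [ inj₂ (inv c) ]))

    swap-split : Cl R₀ a c → ∀ {k} → NCl R k → NCl R' (suc k)
    swap-split p with result
    ... | merge _ ne _ _ = ⊥-elim (ne (R₀⊆R p))
    ... | split _ q = q
    ... | twist q = ⊥-elim (R₀-ends p q)

module _ {A : Set} (F : Finite A) {τ t : A → A} (τm : Matching τ) (tm : Matching t) {a c : A} (a≢c : a ≢ c) (ta≢c : t a ≢ c) where
  private
    ta≢tc : t a ≢ t c
    ta≢tc e = a≢c (Matching.inj tm e)
    module S = Swap F tm a≢c ta≢c
    module S' = Swap F tm (S.a≢tc) ta≢tc
    module O = S.Outcome τm
    module O' = S'.Outcome τm

  -- In a common cycle of τ and t, one of the two ways of reconnecting the pairs of a and c splits the cycle.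
  swap-either : Cl O.R a c → (∀ {k} → NCl O.R k → NCl O.R' (suc k)) ⊎ (∀ {k} → NCl O.R k → NCl O'.R' (suc k))
  swap-either p with O.result | O'.result
  ... | O.merge _ ne _ _ | _ = ⊥-elim (ne p)
  ... | O.split _ q | _ = inj₁ q
  ... | O.twist _ | O'.merge _ ne _ _ = ⊥-elim (ne (p ∙ [ inj₂ refl ]))
  ... | O.twist _ | O'.split _ q = inj₂ q
  ... | O.twist x | O'.twist y = ⊥-elim (O.R₀-ends (subst (Cl O.R₀ a) (Matching.inv tm c)
          (O'.R₀⊆ (λ (S'.off p q r s) → O.R₀-off (S.off p (λ e → s (trans e (sym (Matching.inv tm c)))) r q)) gr-∈ y)) x)

-- The Euler inequality for three matchings

∪-comm : ∀ {A : Set} {R S : Rel A} {k} → NCl (R ∪ S) k → NCl (S ∪ R) k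
∪-comm = NCl-Equiv (Equiv-id (λ { (inj₁ r) → [ inj₂ r ] ; (inj₂ s) → [ inj₁ s ] })
                             (λ { (inj₁ r) → [ inj₂ r ] ; (inj₂ s) → [ inj₁ s ] }))

module _ {A A' : Set} (F' : Finite A') {a b : A} (r : Removal A' a b) {τ t : A → A} {t' : A' → A'}
  (τm : Matching τ) (ta : t a ≡ b) (tb : t b ≡ a) (t-ins : ∀ k → t (Removal.ins r k) ≡ Removal.ins r (t' k)) where
  open Removal r
  open Elim r τm

  private
    back : ∀ {z w} → gr t' z w → Cl (gr τ ∪ gr t) (ins z) (ins w)
    back {z} refl = [ inj₂ (t-ins z) ]

  -- Removing the t-pair {a , b} shortens an alternating cycle if the partners of a and b under τ
  -- lie elsewhere. Otherwise a and b are the whole cycle, and it vanishes, as in `loop-equiv`.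
  join-equiv : τ a ≢ b → Equiv (gr τ ∪ gr t) (gr τ' ∪ gr t')
  join-equiv ne = equiv [ inj₂ ta ] (λ { {z} refl → go z }) back
    where
    open Join ne
    go : ∀ z → Cl (gr τ' ∪ gr t') (to z) (to (t z))
    go z with cover z
    ... | inj₁ refl = [ inj₁ (subst₂ (λ v w → τ' v ≡ w) to-a (cong to (sym ta)) τ'-ab) ]
    ... | inj₂ (inj₁ refl) = [ inj₁ (subst₂ (λ v w → τ' v ≡ w) (cong to (sym tb)) to-b τ'-ab) ]⁻
    ... | inj₂ (inj₂ (k , refl)) = [ inj₂ (trans (sym (to-ins _)) (cong to (sym (t-ins k)))) ]

  loop-equiv : τ a ≡ b → Equiv (gr τ ∪ gr t) ((gr τ' ∪ gr t') ⊎ʳ (∅ {Fin 1}))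
  loop-equiv eq = record
    { to = to ; from = [ ins , (λ _ → a) ]′
    ; to-R = λ { {z} (inj₁ refl) → go₁ z ; {z} (inj₂ refl) → go₂ z }
    ; from-S = λ { {inj₁ z} (inl (inj₁ refl)) → from-τ' [ inj₂ ta ] z ; (inl (inj₂ p)) → back p }
    ; from-to = ft
    ; to-from = λ { (inj₁ k) → Cl-≡ (to-ins k) ; (inj₂ zero) → Cl-≡ to-a } }
    where
    open Loop eq
    S = (gr τ' ∪ gr t') ⊎ʳ (∅ {Fin 1})
    go₁ : ∀ z → Cl S (to z) (to (τ z))
    go₁ z with to-τ z
    ... | inj₁ (k , refl , f) = subst₂ (Cl S) (sym (to-ins k)) (sym f) [ inl (inj₁ refl) ]
    ... | inj₂ (f , g) = Cl-≡ (trans f (sym g))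
    go₂ : ∀ z → Cl S (to z) (to (t z))
    go₂ z with cover z
    ... | inj₁ refl = Cl-≡ (sym (trans (cong to ta) to-b))
    ... | inj₂ (inj₁ refl) = Cl-≡ (sym (trans (cong to tb) to-a))
    ... | inj₂ (inj₂ (k , refl)) = [ inl (inj₂ refl) ] ∙ Cl-≡ (sym (trans (cong to (t-ins k)) (to-ins _)))
    ft : ∀ z → Cl (gr τ ∪ gr t) ([ ins , (λ _ → a) ]′ (to z)) z
    ft z with cover z
    ... | inj₁ refl = ε
    ... | inj₂ (inj₁ refl) = [ inj₂ ta ]
    ... | inj₂ (inj₂ (k , refl)) = ε

  NCl-loop : τ a ≡ b → ∀ {k} → NCl (gr τ ∪ gr t) k → Σ ℕ λ k' → k ≡ suc k' × NCl (gr τ' ∪ gr t') k'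
  NCl-loop eq P = let k' , Q = NCl-gr₂ F' τ' t' in
    k' , trans (NCl-unique (NCl-Equiv (loop-equiv eq) P) (NCl-⊎ Q (NCl-∅ (Fin-finite 1)))) (+-comm k' 1) , Q

  NCl-join : τ a ≢ b → ∀ {k} → NCl (gr τ ∪ gr t) k → NCl (gr τ' ∪ gr t') k
  NCl-join ne = NCl-Equiv (join-equiv ne)

three-loops : ∀ {x y z w x' y' z' w'} → y ≡ suc y' → z ≡ suc z' → x ≡ suc x' → w' + 1 ≤ w → x + y + z + 2 * w' ≤ suc (x' + y' + z' + 2 * w)
three-loops {w = w} {x'} {y'} {z'} {w'} refl refl refl le = begin
  suc x' + suc y' + suc z' + 2 * w' ≡⟨ lem x' y' z' w' ⟩
  suc (x' + y' + z' + 2 * (w' + 1)) ≤⟨ s≤s (+-monoʳ-≤ (x' + y' + z') (*-monoʳ-≤ 2 le)) ⟩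
  suc (x' + y' + z' + 2 * w) ∎
  where
  open ≤-Reasoning
  lem : ∀ x y z w → suc x + suc y + suc z + 2 * w ≡ suc (x + y + z + 2 * (w + 1))
  lem = solve-∀

-- A graph-encoded map: n vertices, 3n/2 edges in three colours, and the two-coloured cycles as
-- faces. The bound is n - 3n/2 + (x + y + z) ≤ 2w without fractions.
Euler : ℕ → Set
Euler n = ∀ {a b c : Fin n → Fin n} → Matching a → Matching b → Matching c → ∀ {x y z w} →
  NCl (gr a ∪ gr b) x → NCl (gr b ∪ gr c) y → NCl (gr a ∪ gr c) z → NCl ((gr a ∪ gr b) ∪ gr c) w →
  2 * (x + y + z) ≤ n + 4 * w

private
  -- One elimination step of the Euler inequality, for the counts with and without the pair {p , c p}.
  module Step {n : ℕ} {a b c : Fin (suc (suc n)) → Fin (suc (suc n))} (am : Matching a) (bm : Matching b) (cm : Matching c)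
    {x y z w : ℕ} (X : NCl (gr a ∪ gr b) x) (Y : NCl (gr b ∪ gr c) y) (Z : NCl (gr a ∪ gr c) z)
    (W : NCl ((gr a ∪ gr b) ∪ gr c) w) where
    module am = Matching am
    module bm = Matching bm
    module cm = Matching cm
    p q : Fin (suc (suc n))
    p = zero
    q = c zero
    r : Removal (Fin n) p q
    r = Fin-removal (cm.irr zero ∘ sym)
    open Removal r
    module EA = Elim r am
    module EB = Elim r bm
    a' b' : Fin n → Fin n
    a' = EA.τ'
    b' = EB.τ'
    cp = refl {x = c p}
    c∘ : ∀ k → Σ (Fin n) λ l → ins l ≡ c (ins k)
    c∘ k = out _ (λ f → ins≢b (sym (cm.flip f))) (λ f → ins≢a (cm.inj f))
    c' : Fin n → Fin n
    c' k = proj₁ (c∘ k)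
    c-ins : ∀ k → c (ins k) ≡ ins (c' k)
    c-ins k = sym (proj₂ (c∘ k))
    c'm : Matching c'
    c'm = record
      { inv = λ k → ins-inj (trans (sym (c-ins _)) (trans (cong c (sym (c-ins k))) (cm.inv _)))
      ; irr = λ k e → cm.irr (ins k) (trans (c-ins k) (cong ins e)) }
    X' : Σ ℕ (NCl (gr a' ∪ gr b'))
    X' = NCl-gr₂ (Fin-finite n) a' b'
    Y' : Σ ℕ (NCl (gr b' ∪ gr c'))
    Y' = NCl-gr₂ (Fin-finite n) b' c'
    Z' : Σ ℕ (NCl (gr a' ∪ gr c'))
    Z' = NCl-gr₂ (Fin-finite n) a' c'
    W' : Σ ℕ (NCl ((gr a' ∪ gr b') ∪ gr c'))
    W' = NCl-gr (Fin-finite n) (proj₂ X') c'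
    x' y' z' w' : ℕ
    x' = proj₁ X'
    y' = proj₁ Y'
    z' = proj₁ Z'
    w' = proj₁ W'
    -- Twice this inequality, added to the induction hypothesis for n points, gives the one for n +
    -- 2 points.
    Goal : Set
    Goal = x + y + z + 2 * w' ≤ suc (x' + y' + z' + 2 * w)

    F = Fin-finite n
    T' = (gr a' ∪ gr b') ∪ gr c'
    a∈ : ∀ {k l} → a' k ≡ l → Cl T' k l
    a∈ e = [ inj₁ (inj₁ e) ]
    b∈ : ∀ {k l} → b' k ≡ l → Cl T' k l
    b∈ e = [ inj₁ (inj₂ e) ]
    c∈ : ∀ {k l} → c' k ≡ l → Cl T' k l
    c∈ e = [ inj₂ e ]

    loop-y : b p ≡ q → y ≡ suc y'
    loop-y e = let _ , f , N = NCl-loop F r bm cp (cm.inv p) c-ins e Y in trans f (cong suc (NCl-unique N (proj₂ Y')))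
    join-y : b p ≢ q → y ≡ y'
    join-y ne = NCl-unique (NCl-join F r bm cp (cm.inv p) c-ins ne Y) (proj₂ Y')
    loop-z : a p ≡ q → z ≡ suc z'
    loop-z e = let _ , f , N = NCl-loop F r am cp (cm.inv p) c-ins e Z in trans f (cong suc (NCl-unique N (proj₂ Z')))
    join-z : a p ≢ q → z ≡ z'
    join-z ne = NCl-unique (NCl-join F r am cp (cm.inv p) c-ins ne Z) (proj₂ Z')

    -- The points p and q are a component by themselves: each of the three numbers of cycles drops
    -- by one, and so does that of components.
    both : a p ≡ q → b p ≡ q → Goal
    both ea eb = three-loops (loop-y eb) (loop-z ea) xs (NCl-≤ (NCl-⊎ (proj₂ W') (NCl-∅ (Fin-finite 1))) W to to-T [ ins , (λ _ → p) ]′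
        λ { (inj₁ k) → Cl-≡ (to-ins k) ; (inj₂ zero) → Cl-≡ to-a })
      where
      open EA.Loop ea
      xs : x ≡ suc x'
      xs = let _ , f , N = NCl-loop F r am eb (bm.flip eb) (EB.Loop.loop-ins eb) ea X in trans f (cong suc (NCl-unique N (proj₂ X')))
      go : ∀ (f : Fin (suc (suc n)) → Fin (suc (suc n))) (f' : Fin n → Fin n) → f p ≡ q → f q ≡ p → (∀ k → f (ins k) ≡ ins (f' k)) →
           (∀ {k l} → f' k ≡ l → Cl T' k l) → ∀ z → Cl (T' ⊎ʳ (∅ {Fin 1})) (to z) (to (f z))
      go f f' fp fq fi h z with cover z
      ... | inj₁ refl = Cl-≡ (sym (trans (cong to fp) to-b))
      ... | inj₂ (inj₁ refl) = Cl-≡ (sym (trans (cong to fq) to-a))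
      ... | inj₂ (inj₂ (k , refl)) = Cl-map inj₁ (λ s → [ inl s ]) (h refl) ∙ Cl-≡ (sym (trans (cong to (fi k)) (to-ins _)))
      to-T : ∀ {u v} → ((gr a ∪ gr b) ∪ gr c) u v → Cl (T' ⊎ʳ (∅ {Fin 1})) (to u) (to v)
      to-T {u} (inj₁ (inj₁ refl)) = go a a' ea (am.flip ea) (EA.Loop.loop-ins ea) a∈ u
      to-T {u} (inj₁ (inj₂ refl)) = go b b' eb (bm.flip eb) (EB.Loop.loop-ins eb) b∈ u
      to-T {u} (inj₂ refl) = go c c' cp (cm.inv p) c-ins c∈ u

    module _ {τ : Fin (suc (suc n)) → Fin (suc (suc n))} (τm : Matching τ) (τ'∈ : ∀ {k l} → Elim.τ' r τm k ≡ l → Cl T' k l) (ne : τ p ≢ q) where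
      open Elim r τm
      open Join ne
      to-p~q : Cl T' (to p) (to q)
      to-p~q = τ'∈ τ'-ab
      to-self : ∀ z → Cl T' (to z) (to (τ z))
      to-self z = Cl-bind (λ { (inj₁ e) → τ'∈ e ; (inj₂ ()) }) (to-τ {∅} z)
      to-pq : ∀ (f : Fin (suc (suc n)) → Fin (suc (suc n))) (f' : Fin n → Fin n) → f p ≡ q → f q ≡ p → (∀ k → f (ins k) ≡ ins (f' k)) →
           (∀ {k l} → f' k ≡ l → Cl T' k l) → ∀ z → Cl T' (to z) (to (f z))
      to-pq f f' fp fq fi h z with cover z
      ... | inj₁ refl = subst₂ (Cl T') to-a (cong to (sym fp)) to-p~q
      ... | inj₂ (inj₁ refl) = subst₂ (Cl T') to-b (cong to (sym fq)) (to-p~q ⁻)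
      ... | inj₂ (inj₂ (k , refl)) = h refl ∙ Cl-≡ (sym (trans (cong to (fi k)) (to-ins _)))

    one-loop : x ≡ x' → y + z ≡ suc (y' + z') → w' ≤ w → Goal
    one-loop refl e le = begin
      x + y + z + 2 * w' ≡⟨ lem₁ x y z (2 * w') ⟩
      x + (y + z) + 2 * w' ≡⟨ cong (λ u → x + u + 2 * w') e ⟩
      x + suc (y' + z') + 2 * w' ≡⟨ lem₂ x y' z' (2 * w') ⟩
      suc (x + y' + z' + 2 * w') ≤⟨ s≤s (+-monoʳ-≤ (x + y' + z') (*-monoʳ-≤ 2 le)) ⟩
      suc (x + y' + z' + 2 * w) ∎
      where
      open ≤-Reasoning
      lem₁ : ∀ x y z w → x + y + z + w ≡ x + (y + z) + w
      lem₁ = solve-∀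
      lem₂ : ∀ x y z w → x + suc (y + z) + w ≡ suc (x + y + z + w)
      lem₂ = solve-∀

    -- Only the cycle of a and c through p vanishes; the other cycles are shortened and the
    -- component survives.
    a-loop : a p ≡ q → b p ≢ q → Goal
    a-loop ea nb = one-loop xs (trans (cong (y +_) (loop-z ea)) (trans (+-comm y _) (cong suc (trans (+-comm z' y) (cong (_+ z') (join-y nb))))))
        (NCl-≤ (proj₂ W') W to to-T ins (λ k → Cl-≡ (to-ins k)))
      where
      open EB.Join nb
      xs : x ≡ x'
      xs = NCl-unique (∪-comm (NCl-join F r bm ea (am.flip ea) (EA.Loop.loop-ins ea) nb (∪-comm X))) (proj₂ X')
      to-T : ∀ {u v} → ((gr a ∪ gr b) ∪ gr c) u v → Cl T' (to u) (to v)
      to-T {u} (inj₁ (inj₁ refl)) = to-pq bm b∈ nb a a' ea (am.flip ea) (EA.Loop.loop-ins ea) a∈ u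
      to-T {u} (inj₁ (inj₂ refl)) = to-self bm b∈ nb u
      to-T {u} (inj₂ refl) = to-pq bm b∈ nb c c' cp (cm.inv p) c-ins c∈ u

    b-loop : a p ≢ q → b p ≡ q → Goal
    b-loop na eb = one-loop xs (trans (cong (_+ z) (loop-y eb)) (cong (λ u → suc (y' + u)) (join-z na)))
        (NCl-≤ (proj₂ W') W to to-T ins (λ k → Cl-≡ (to-ins k)))
      where
      open EA.Join na
      xs : x ≡ x'
      xs = NCl-unique (NCl-join F r am eb (bm.flip eb) (EB.Loop.loop-ins eb) na X) (proj₂ X')
      to-T : ∀ {u v} → ((gr a ∪ gr b) ∪ gr c) u v → Cl T' (to u) (to v)
      to-T {u} (inj₁ (inj₁ refl)) = to-self am a∈ na u
      to-T {u} (inj₁ (inj₂ refl)) = to-pq am a∈ na b b' eb (bm.flip eb) (EB.Loop.loop-ins eb) b∈ u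
      to-T {u} (inj₂ refl) = to-pq am a∈ na c c' cp (cm.inv p) c-ins c∈ u

    -- Reconnecting the b-pairs of p and q so that p and q become partners, and then removing both,
    -- leads to a' and b'. Hence x' is the number of cycles of a and the swapped b, and the outcome
    -- of the swap decides.
    no-loop : a p ≢ q → b p ≢ q → Goal
    no-loop na nb = goal (NCl.Cl? (proj₂ W') (to p) (to (b p)))
      where
      open EA.Join na
      module S = Swap (Fin-finite (suc (suc n))) bm a≢b nb
      module O = S.Outcome am
      s-ins : ∀ k → S.swap (ins k) ≡ ins (b' k)
      s-ins k with EB.spec k
      ... | inj₁ f = trans (S.swap-off (S.off ins≢a ins≢b (λ e → ins≢a (trans (sym f) (trans (cong b e) (bm.inv p))))
                                              (λ e → ins≢b (trans (sym f) (trans (cong b e) (bm.inv q)))))) f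
      ... | inj₂ (inj₁ (f , g)) = trans (cong S.swap (sym (bm.flip f))) (trans S.swap-ta (sym g))
      ... | inj₂ (inj₂ (f , g)) = trans (cong S.swap (sym (bm.flip f))) (trans S.swap-tc (sym g))
      x'≡ : ∀ {k} → NCl O.R' k → k ≡ x'
      x'≡ N = NCl-unique (NCl-join F r am S.swap-a S.swap-c s-ins na N) (proj₂ X')
      xs≤ : x ≤ suc x'
      xs≤ with NCl-gr₂ (Fin-finite (suc (suc n))) a S.swap
      ... | k , N = subst (λ u → x ≤ suc u) (x'≡ N) (S.swap-≤1 X N)
      off-T : ∀ {z} → S.Off z → Cl T' (to z) (to (b z))
      off-T {z} o with cover z
      ... | inj₁ e = ⊥-elim (S.Off.≢a o e)
      ... | inj₂ (inj₁ e) = ⊥-elim (S.Off.≢c o e)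
      ... | inj₂ (inj₂ (k , refl)) with EB.spec k
      ... | inj₁ f = b∈ (trans (sym (to-ins _)) (cong to (sym f)))
      ... | inj₂ (inj₁ (f , _)) = ⊥-elim (S.Off.≢ta o (sym (bm.flip f)))
      ... | inj₂ (inj₂ (f , _)) = ⊥-elim (S.Off.≢tc o (sym (bm.flip f)))
      bpq : Cl T' (to (b p)) (to (b q))
      bpq with out (b p) (bm.irr p) nb | out (b q) (nb ∘ bm.flip) (bm.irr q)
      ... | k , e | l , f = subst₂ (Cl T') (trans (sym (to-ins k)) (cong to e)) (trans (sym (to-ins l)) (cong to f))
              (b∈ (ins-inj (trans (EB.spec-a (trans (cong b e) (bm.inv p))) (sym f))))
      module _ {T″ : Rel (Fin n)} (up : ∀ {u v} → Cl T' u v → Cl T″ u v) (pbp : Cl T″ (to p) (to (b p))) where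
        to-T : ∀ {u v} → ((gr a ∪ gr b) ∪ gr c) u v → Cl T″ (to u) (to v)
        to-T {u} (inj₁ (inj₁ refl)) = up (to-self am a∈ na u)
        to-T {u} (inj₂ refl) = up (to-pq am a∈ na c c' cp (cm.inv p) c-ins c∈ u)
        to-T {u} (inj₁ (inj₂ refl)) with S.view u
        ... | S.at-a refl = pbp
        ... | S.at-c refl = up (to-p~q am a∈ na ⁻) ∙ pbp ∙ up bpq
        ... | S.at-ta refl = pbp ⁻ ∙ Cl-≡ (cong to (sym (bm.inv p)))
        ... | S.at-tc refl = (up bpq) ⁻ ∙ pbp ⁻ ∙ up (to-p~q am a∈ na) ∙ Cl-≡ (cong to (sym (bm.inv q)))
        ... | S.other o = up (off-T o)
      R₀-T : ∀ {u v} → Cl O.R₀ u v → Cl T' (to u) (to v)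
      R₀-T = Cl-map to λ { {u} (inj₁ refl) → to-self am a∈ na u
                         ; {u} (inj₂ refl) → cut-T u }
        where
        cut-T : ∀ u → Cl T' (to u) (to (S.cut u))
        cut-T u with S.view u
        ... | S.at-a _ = ε
        ... | S.at-c _ = ε
        ... | S.at-ta _ = ε
        ... | S.at-tc _ = ε
        ... | S.other o = off-T o
      goal : Dec (Cl T' (to p) (to (b p))) → Goal
      -- If p and `b p` remain connected, no component arises, and the swap costs at most the one
      -- cycle that the goal allows.
      goal (yes pbp) = begin
        x + y + z + 2 * w' ≤⟨ +-mono-≤ (+-mono-≤ (+-mono-≤ xs≤ (≤-reflexive (join-y nb))) (≤-reflexive (join-z na)))
                                (*-monoʳ-≤ 2 (NCl-≤ (proj₂ W') W to (to-T id pbp) ins (λ k → Cl-≡ (to-ins k)))) ⟩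
        suc (x' + y' + z' + 2 * w) ∎
        where open ≤-Reasoning
      -- If the component falls apart, a merge or a twist would leave a path from p to `b p` in the
      -- rest. So the swap splits a cycle: x' = x + 1 makes up for w' ≤ w + 1.
      goal (no npbp) = cases O.result
        where
        cases : O.Result → Goal
        cases (O.merge p _ _ _) = ⊥-elim (npbp (R₀-T p))
        cases (O.twist p) = ⊥-elim (npbp (R₀-T p ∙ bpq ⁻))
        cases (O.split _ up) = begin
          x + y + z + 2 * w' ≤⟨ +-mono-≤ (≤-reflexive (trans (cong (λ u → x + u + z) (join-y nb)) (cong (x + y' +_) (join-z na)))) (*-monoʳ-≤ 2 w'≤) ⟩
          x + y' + z' + 2 * suc w ≡⟨ lem x y' z' w ⟩
          suc (suc x + y' + z' + 2 * w) ≡⟨ cong (λ u → suc (u + y' + z' + 2 * w)) (x'≡ (up X)) ⟩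
          suc (x' + y' + z' + 2 * w) ∎
          where
          open ≤-Reasoning
          w'≤ : w' ≤ suc w
          w'≤ = NCl-≤1 (proj₂ W') W (to p) (to (b p)) to (to-T (Cl-mono inj₁) [ inj₂ pair ]) ins (λ k → Cl-≡ (to-ins k))
          lem : ∀ x y z w → x + y + z + 2 * suc w ≡ suc (suc x + y + z + 2 * w)
          lem = solve-∀

    reduced : Goal
    reduced = cases (a p ≟ q) (b p ≟ q)
      where
      cases : Dec (a p ≡ q) → Dec (b p ≡ q) → Goal
      cases (yes ea) (yes eb) = both ea eb
      cases (yes ea) (no nb) = a-loop ea nb
      cases (no na) (yes eb) = b-loop na eb
      cases (no na) (no nb) = no-loop na nb

    euler-step : Euler n → 2 * (x + y + z) ≤ suc (suc n) + 4 * w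
    euler-step ih = +-cancelʳ-≤ (4 * w') _ _ (begin
      2 * (x + y + z) + 4 * w' ≡⟨ lem₁ x y z w' ⟩
      2 * (x + y + z + 2 * w') ≤⟨ *-monoʳ-≤ 2 reduced ⟩
      2 * suc (x' + y' + z' + 2 * w) ≡⟨ lem₂ x' y' z' w ⟩
      2 * (x' + y' + z') + (2 + 4 * w) ≤⟨ +-monoˡ-≤ (2 + 4 * w) (ih EA.τ'-matching EB.τ'-matching c'm (proj₂ X') (proj₂ Y') (proj₂ Z') (proj₂ W')) ⟩
      n + 4 * w' + (2 + 4 * w) ≡⟨ lem₃ n w w' ⟩
      suc (suc n) + 4 * w + 4 * w' ∎)
      where
      open ≤-Reasoning
      lem₁ : ∀ x y z w → 2 * (x + y + z) + 4 * w ≡ 2 * (x + y + z + 2 * w)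
      lem₁ = solve-∀
      lem₂ : ∀ x y z w → 2 * suc (x + y + z + 2 * w) ≡ 2 * (x + y + z) + (2 + 4 * w)
      lem₂ = solve-∀
      lem₃ : ∀ n w w' → n + 4 * w' + (2 + 4 * w) ≡ suc (suc n) + 4 * w + 4 * w'
      lem₃ = solve-∀

-- The Euler characteristic of a closed surface with w components, glued from the three families of orbits, is at most 2 w.
euler : ∀ n → Euler n
euler zero _ _ _ X Y Z W = ≤-trans (≤-reflexive (cong₃ (emp X) (emp Y) (emp Z))) z≤n
  where
  emp : ∀ {R : Rel (Fin 0)} {k} → NCl R k → k ≡ 0
  emp {k = zero} _ = refl
  emp {k = suc k} N with NCl.rep N zero
  ... | ()
  cong₃ : ∀ {x y z} → x ≡ 0 → y ≡ 0 → z ≡ 0 → 2 * (x + y + z) ≡ 0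
  cong₃ refl refl refl = refl
euler (suc zero) {a} am _ _ _ _ _ _ with a zero in eq
... | zero = ⊥-elim (Matching.irr am zero eq)
euler (suc (suc n)) am bm cm X Y Z W = Step.euler-step am bm cm X Y Z W (euler n)

-- Reconnection within colours, transversals, and cut matchings

abstract
  exists? : ∀ {A : Set} (F : Finite A) {P : A → Set} → (∀ a → Dec (P a)) → Dec (Σ A P)
  exists? F {P} P? = map′ (λ (i , p) → enum i , p) (λ (a , p) → index a , subst P (sym (enum-index a)) p) (any? (λ i → P? (enum i)))
    where open Finite F

-- β' arises from β by d reconnections, each of which merges two classes of π and β of one colour.
-- For any other matching α every reconnection costs at most one class, which is the content of
-- `bound`.
record Joined {A C : Set} (col : A → C) (π β : A → A) : Set where
  field
    β'       : A → A
    matching : Matching β'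
    pure     : ∀ a → col (β' a) ≡ col a
    conn     : ∀ a b → col a ≡ col b → Cl (gr π ∪ gr β') a b
    d e      : ℕ
    count    : NCl (gr π ∪ gr β') e
    total    : ∀ {k} → NCl (gr π ∪ gr β) k → k ≡ d + e
    bound    : ∀ {α k l} → Matching α → NCl (gr α ∪ gr β) k → NCl (gr α ∪ gr β') l → k ≤ d + l

abstract
  connect : ∀ {A C : Set} (F : Finite A) (_≟ᶜ_ : (x y : C) → Dec (x ≡ y)) (col : A → C) {π β : A → A} →
    Matching π → Matching β → (∀ a → col (β a) ≡ col a) → ∀ {k} → NCl (gr π ∪ gr β) k → Joined col π β
  connect {A} F _≟ᶜ_ col {π} πm βm₀ pure₀ {k₀} N₀ = go k₀ βm₀ pure₀ N₀
    where
    open Finite F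
    go : ∀ k {β} → Matching β → (∀ a → col (β a) ≡ col a) → NCl (gr π ∪ gr β) k → Joined col π β
    go k {β} βm pure N with exists? F (λ a → exists? F (λ b → (col a ≟ᶜ col b) ×-dec ¬? (NCl.Cl? N a b)))
    ... | no none = record
      { β' = β ; matching = βm ; pure = pure
      ; conn = λ a b e → decide (NCl.Cl? N a b) λ ne → none (a , b , e , ne)
      ; d = 0 ; e = k ; count = N ; total = λ N' → NCl-unique N' N ; bound = λ _ P Q → ≤-reflexive (NCl-unique P Q) }
      where
      decide : ∀ {P : Set} → Dec P → ¬ ¬ P → P
      decide (yes p) _ = p
      decide (no np) h = ⊥-elim (h np)
    go k {β} βm pure N | yes (a , b , e , ne) with S.Outcome.swap-merge πm ne
      where module S = Swap F βm {a} {b} (λ f → ne (Cl-≡ f)) (λ f → ne [ inj₂ f ])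
    ... | _ , count with count N
    ... | k' , refl , N' = record
      { β' = R.β' ; matching = R.matching ; pure = R.pure ; conn = R.conn
      ; d = suc R.d ; e = R.e ; count = R.count
      ; total = λ M → trans (NCl-unique M N) (cong suc (R.total N'))
      ; bound = λ {α} αm P Q → let _ , M = NCl-gr₂ F α S.swap in ≤-trans (S.swap-≤1 P M) (s≤s (R.bound αm M Q)) }
      where
      module S = Swap F βm {a} {b} (λ f → ne (Cl-≡ f)) (λ f → ne [ inj₂ f ])
      R : Joined col π S.swap
      R = go k' S.swap-matching (S.swap-preserves col e pure) N'
      module R = Joined R

-- A matching P whose union with either of two given matchings is a Hamiltonian cycle.
record Transversal {c : ℕ} (κ λ' : Fin c → Fin c) : Set where
  field
    P        : Fin c → Fin c
    matching : Matching P
    connˡ    : ∀ i j → Cl (gr κ ∪ gr P) i j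
    connʳ    : ∀ i j → Cl (gr λ' ∪ gr P) i j
    s        : ℕ
    size≡    : c ≡ s + s
    p        : Fin s → Fin c
    idx      : Fin c → Fin s
    idx-p    : ∀ k → idx (p k) ≡ k
    idx-P    : ∀ i → idx (P i) ≡ idx i
    p-idx    : ∀ i → i ≡ p (idx i) ⊎ P i ≡ p (idx i)

module Extend {A A' : Set} {a b : A} (r : Removal A' a b) {f : A' → A'} (fm : Matching f) where
  open Removal r

  extend : A → A
  extend z with cover z
  ... | inj₁ _ = b
  ... | inj₂ (inj₁ _) = a
  ... | inj₂ (inj₂ (k , _)) = ins (f k)

  extend-a : extend a ≡ b
  extend-a with cover a
  ... | inj₁ _ = refl
  ... | inj₂ (inj₁ e) = ⊥-elim (a≢b e)
  ... | inj₂ (inj₂ (_ , e)) = ⊥-elim (ins≢a e)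

  extend-b : extend b ≡ a
  extend-b with cover b
  ... | inj₁ e = ⊥-elim (a≢b (sym e))
  ... | inj₂ (inj₁ _) = refl
  ... | inj₂ (inj₂ (_ , e)) = ⊥-elim (ins≢b e)

  extend-ins : ∀ k → extend (ins k) ≡ ins (f k)
  extend-ins k with cover (ins k)
  ... | inj₁ e = ⊥-elim (ins≢a e)
  ... | inj₂ (inj₁ e) = ⊥-elim (ins≢b e)
  ... | inj₂ (inj₂ (_ , e)) = cong (ins ∘ f) (ins-inj e)

  extend-matching : Matching extend
  extend-matching = record { inv = inv' ; irr = irr' }
    where
    inv' : ∀ z → extend (extend z) ≡ z
    inv' z with cover z
    ... | inj₁ e = trans extend-b (sym e)
    ... | inj₂ (inj₁ e) = trans extend-a (sym e)
    ... | inj₂ (inj₂ (k , e)) = trans (extend-ins _) (trans (cong ins (Matching.inv fm k)) e)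
    irr' : ∀ z → extend z ≢ z
    irr' z e with cover z
    ... | inj₁ e' = a≢b (trans (sym e') (sym e))
    ... | inj₂ (inj₁ e') = a≢b (trans e e')
    ... | inj₂ (inj₂ (k , e')) = Matching.irr fm k (ins-inj (trans e (sym e')))

private
  -- Among at least four points some j is neither 0 nor a partner of 0 in one of the two matchings.
  -- Pairing 0 with such a j closes neither of the future Hamiltonian cycles too early.
  choose : ∀ {n} (x y : Fin (suc (suc (suc (suc n))))) → Σ (Fin (suc (suc (suc (suc n))))) λ j → zero ≢ j × x ≢ j × y ≢ j
  choose x y with x ≟ suc zero | y ≟ suc zero
  ... | no p | no q = suc zero , (λ ()) , p , q
  ... | yes refl | q with y ≟ suc (suc zero)
  ... | no q' = suc (suc zero) , (λ ()) , (λ ()) , q'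
  ... | yes refl = suc (suc (suc zero)) , (λ ()) , (λ ()) , (λ ())
  choose x y | no p | yes refl with x ≟ suc (suc zero)
  ... | no p' = suc (suc zero) , (λ ()) , p' , (λ ())
  ... | yes refl = suc (suc (suc zero)) , (λ ()) , (λ ()) , (λ ())

  matching-2 : ∀ {f : Fin 2 → Fin 2} → Matching f → f zero ≡ suc zero
  matching-2 {f} fm with f zero in eq
  ... | zero = ⊥-elim (Matching.irr fm zero eq)
  ... | suc zero = refl

private
  -- As j is not the partner of 0 in either matching, eliminating 0 and j keeps the classes, and
  -- connectedness lifts from the smaller instance.
  transversal-step : ∀ {c} {j : Fin (suc (suc c))} (r : Removal (Fin c) zero j) {κ λ' : Fin (suc (suc c)) → Fin (suc (suc c))}
    (κm : Matching κ) (λm : Matching λ') → κ zero ≢ j → λ' zero ≢ j → Transversal (Elim.τ' r κm) (Elim.τ' r λm) → Transversal κ λ'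
  transversal-step {c} {j} r {κ} {λ'} κm λm κ≢j λ≢j T = record
    { P = E.extend ; matching = E.extend-matching
    ; connˡ = λ i j → Equiv.to-inv (join-equiv (Fin-finite _) r κm E.extend-a E.extend-b E.extend-ins κ≢j) (T.connˡ _ _)
    ; connʳ = λ i j → Equiv.to-inv (join-equiv (Fin-finite _) r λm E.extend-a E.extend-b E.extend-ins λ≢j) (T.connʳ _ _)
    ; s = suc T.s ; size≡ = cong suc (trans (cong suc T.size≡) (sym (+-suc T.s T.s))) ; p = p' ; idx = idx' ; idx-p = idx-p' ; idx-P = idx-P' ; p-idx = p-idx' }
    where
    module T = Transversal T
    module E = Extend r T.matching
    open Removal r
    p' : Fin (suc T.s) → Fin (suc (suc c))
    p' zero = zero
    p' (suc k) = ins (T.p k)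
    idx' : Fin (suc (suc c)) → Fin (suc T.s)
    idx' z with cover z
    ... | inj₁ _ = zero
    ... | inj₂ (inj₁ _) = zero
    ... | inj₂ (inj₂ (k , _)) = suc (T.idx k)
    idx-0 : idx' zero ≡ zero
    idx-0 with cover zero
    ... | inj₁ _ = refl
    ... | inj₂ (inj₁ _) = refl
    ... | inj₂ (inj₂ (_ , e)) = ⊥-elim (ins≢a e)
    idx-j : idx' j ≡ zero
    idx-j with cover j
    ... | inj₁ _ = refl
    ... | inj₂ (inj₁ _) = refl
    ... | inj₂ (inj₂ (_ , e)) = ⊥-elim (ins≢b e)
    idx-ins : ∀ k → idx' (ins k) ≡ suc (T.idx k)
    idx-ins k with cover (ins k)
    ... | inj₁ e = ⊥-elim (ins≢a e)
    ... | inj₂ (inj₁ e) = ⊥-elim (ins≢b e)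
    ... | inj₂ (inj₂ (_ , e)) = cong (suc ∘ T.idx) (ins-inj e)
    idx-p' : ∀ k → idx' (p' k) ≡ k
    idx-p' zero = idx-0
    idx-p' (suc k) = trans (idx-ins _) (cong suc (T.idx-p k))
    idx-P' : ∀ i → idx' (E.extend i) ≡ idx' i
    idx-P' i with cover i
    ... | inj₁ _ = idx-j
    ... | inj₂ (inj₁ _) = idx-0
    ... | inj₂ (inj₂ (k , _)) = trans (idx-ins _) (cong suc (T.idx-P k))
    p-idx' : ∀ i → i ≡ p' (idx' i) ⊎ E.extend i ≡ p' (idx' i)
    p-idx' i with cover i
    ... | inj₁ e = inj₁ e
    ... | inj₂ (inj₁ e) = inj₂ refl
    ... | inj₂ (inj₂ (k , e)) with T.p-idx k
    ... | inj₁ f = inj₁ (trans (sym e) (cong ins f))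
    ... | inj₂ f = inj₂ (cong ins f)

abstract
  transversal : ∀ c {κ λ' : Fin c → Fin c} → Matching κ → Matching λ' → Transversal κ λ'
  transversal zero {κ} κm _ = record
    { P = κ ; matching = κm ; connˡ = λ () ; connʳ = λ () ; s = 0 ; size≡ = refl ; p = λ () ; idx = λ () ; idx-p = λ () ; idx-P = λ () ; p-idx = λ () }
  transversal (suc zero) {κ} κm _ with κ zero in eq
  ... | zero = ⊥-elim (Matching.irr κm zero eq)
  transversal (suc (suc zero)) {κ} {λ'} κm λm = record
    { P = κ ; matching = κm ; connˡ = conn ; connʳ = conn
    ; s = 1 ; size≡ = refl ; p = λ _ → zero ; idx = λ _ → zero ; idx-p = λ { zero → refl } ; idx-P = λ _ → refl
    ; p-idx = λ { zero → inj₁ refl ; (suc zero) → inj₂ (Matching.flip κm κ0) } }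
    where
    κ0 : κ zero ≡ suc zero
    κ0 = matching-2 κm
    conn : ∀ {R : Rel (Fin 2)} i j → Cl (R ∪ gr κ) i j
    conn zero zero = ε
    conn zero (suc zero) = [ inj₂ κ0 ]
    conn (suc zero) zero = [ inj₂ κ0 ]⁻
    conn (suc zero) (suc zero) = ε
  -- Three points carry no matching, since the elimination of 0 and its partner would leave a
  -- matching of a single point.
  transversal (suc (suc (suc zero))) {κ} κm _ = ⊥-elim (one (Elim.τ'-matching (Fin-removal {a = zero} (Matching.irr κm zero ∘ sym)) κm))
    where
    one : ∀ {f : Fin 1 → Fin 1} → Matching f → ⊥
    one {f} fm with f zero in eq
    ... | zero = Matching.irr fm zero eq
  transversal (suc (suc (suc (suc n)))) {κ} {λ'} κm λm =
    let j , 0≢j , κ≢j , λ≢j = choose (κ zero) (λ' zero) in transversal-step (Fin-removal 0≢j) κm λm κ≢j λ≢j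
    (transversal (suc (suc n)) (Elim.τ'-matching (Fin-removal 0≢j) κm) (Elim.τ'-matching (Fin-removal 0≢j) λm))

-- A matching f is cut at the points e m, whose partners are e (ν m); the loose ends may be glued according to another matching of M.
module Cut {A M : Set} (FA : Finite A) (FM : Finite M) {f : A → A} (fm : Matching f) {e : M → A}
  (e-inj : ∀ {m n} → e m ≡ e n → m ≡ n) (ν : M → M) (fe : ∀ m → f (e m) ≡ e (ν m)) where
  open Matching fm

  abstract
    image? : ∀ a → Dec (Σ M λ m → e m ≡ a)
    image? a = exists? FM λ m → Finite._≟ᶠ_ FA (e m) a

    private
      image-f : ∀ {a} → Σ M (λ m → e m ≡ f a) → Σ M λ m → e m ≡ a
      image-f (m , p) = ν m , trans (sym (fe m)) (trans (cong f p) (inv _))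

    reglue : (M → M) → A → A
    reglue ν' a with image? a
    ... | yes (m , _) = e (ν' m)
    ... | no _ = f a

    reglue-e : ∀ ν' m → reglue ν' (e m) ≡ e (ν' m)
    reglue-e ν' m with image? (e m)
    ... | yes (n , p) = cong (e ∘ ν') (e-inj p)
    ... | no np = ⊥-elim (np (m , refl))

    reglue-off : ∀ ν' {a} → ¬ Σ M (λ m → e m ≡ a) → reglue ν' a ≡ f a
    reglue-off ν' {a} np with image? a
    ... | yes p = ⊥-elim (np p)
    ... | no _ = refl

    reglue-inv : ∀ {ν'} → (∀ m → ν' (ν' m) ≡ m) → ∀ a → reglue ν' (reglue ν' a) ≡ a
    reglue-inv {ν'} h a with image? a
    ... | yes (m , p) = trans (reglue-e ν' _) (trans (cong e (h m)) p)
    ... | no np = trans (reglue-off ν' (λ p → np (image-f p))) (inv a)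

    reglue-matching : ∀ {ν'} → Matching ν' → Matching (reglue ν')
    reglue-matching {ν'} m = record { inv = reglue-inv (Matching.inv m) ; irr = irr' }
      where
      irr' : ∀ a → reglue ν' a ≢ a
      irr' a q with image? a
      ... | yes (n , p) = Matching.irr m n (e-inj (trans q (sym p)))
      ... | no np = irr a q

    reglue-preserves : ∀ {C : Set} (g : A → C) ν' → (∀ {a} → ¬ Σ M (λ m → e m ≡ a) → g (f a) ≡ g a) → (∀ m → g (e (ν' m)) ≡ g (e m)) → ∀ a → g (reglue ν' a) ≡ g a
    reglue-preserves g ν' h k a with image? a
    ... | yes (m , p) = trans (k m) (cong g p)
    ... | no np = h np

  cut : A → A
  cut = reglue id

  cut-fixed : ∀ a → cut a ≡ a → Σ M λ m → e m ≡ a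
  cut-fixed a q with image? a
  ... | yes p = p
  ... | no np = ⊥-elim (irr a (trans (sym (reglue-off id np)) q))

  cut-paths : ∀ {τ} → Matching τ → Paths τ cut e
  cut-paths τm = paths FA τm (reglue-inv (λ _ → refl)) e-inj (reglue-e id) cut-fixed

  module Tangle {τ : A → A} (P : Paths τ cut e) where
    open Paths P public

    -- However the loose ends are closed up, the ℓ loops stay, and all other classes are those of μ
    -- and ν' on the ends. Changes of f at the cut points are therefore computed on M alone.
    glued : ∀ {g ν'} → (∀ m → g (e m) ≡ e (ν' m)) → (∀ {a} → ¬ Σ M (λ m → e m ≡ a) → g a ≡ f a) →
      Equiv (gr τ ∪ gr g) ((gr μ ∪ gr ν') ⊎ʳ (∅ {Fin ℓ}))
    glued {g} {ν'} ge goff = Equiv-trans (Equiv-id there back) (equiv⁺ {R = R} (λ { (m , refl , refl) →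
        subst₂ (Cl _) (sym (to-e m)) (sym (to-e (ν' m))) [ inl (inj₂ refl) ] }) λ { {m} refl → [ inj₂ (m , refl , refl) ] })
      where
      R : Rel A
      R a b = Σ M λ m → e m ≡ a × e (ν' m) ≡ b
      there : ∀ {a b} → (gr τ ∪ gr g) a b → Cl ((gr τ ∪ gr cut) ∪ R) a b
      there (inj₁ p) = [ inj₁ (inj₁ p) ]
      there {a} (inj₂ refl) with image? a in eq
      ... | yes (m , refl) = [ inj₂ (m , refl , sym (ge m)) ]
      ... | no np = [ inj₁ (inj₂ (trans (reglue-off id np) (sym (goff np)))) ]
      back : ∀ {a b} → ((gr τ ∪ gr cut) ∪ R) a b → Cl (gr τ ∪ gr g) a b
      back (inj₁ (inj₁ p)) = [ inj₁ p ]
      back {a} (inj₁ (inj₂ refl)) with image? a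
      ... | yes (m , refl) = Cl-≡ (sym (reglue-e id m))
      ... | no np = [ inj₂ (trans (goff np) (sym (reglue-off id np))) ]
      back (inj₂ (m , refl , refl)) = [ inj₂ (ge m) ]

    glued-f : Equiv (gr τ ∪ gr f) ((gr μ ∪ gr ν) ⊎ʳ (∅ {Fin ℓ}))
    glued-f = glued fe λ _ → refl

    glued-re : ∀ ν' → Equiv (gr τ ∪ gr (reglue ν')) ((gr μ ∪ gr ν') ⊎ʳ (∅ {Fin ℓ}))
    glued-re ν' = glued (reglue-e ν') (reglue-off ν')

    cut-⊆ : ∀ {g} → (∀ {a} → ¬ Σ M (λ m → e m ≡ a) → g a ≡ f a) → ∀ {a b} → Cl (gr τ ∪ gr cut) a b → Cl (gr τ ∪ gr g) a b
    cut-⊆ {g} goff = Cl-bind λ { (inj₁ p) → [ inj₁ p ] ; {a} (inj₂ refl) → go a }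
      where
      go : ∀ a → Cl (gr τ ∪ gr g) a (cut a)
      go a with image? a
      ... | yes (m , refl) = Cl-≡ (sym (reglue-e id m))
      ... | no np = [ inj₂ (trans (goff np) (sym (reglue-off id np))) ]

    to-glued : ∀ {ν'} {g : A → A} (E : Equiv (gr τ ∪ gr g) ((gr μ ∪ gr ν') ⊎ʳ (∅ {Fin ℓ}))) {k} →
      NCl (gr μ ∪ gr ν') k → NCl (gr τ ∪ gr g) (k + ℓ)
    to-glued E N = NCl-Equiv (Equiv-sym E) (NCl-⊎ N (NCl-∅ (Fin-finite ℓ)))

record Enumeration {A : Set} (P : A → Set) : Set where
  field
    card     : ℕ
    elem     : Fin card → A
    elem-inj : ∀ {i j} → elem i ≡ elem j → i ≡ j
    elem-P   : ∀ i → P (elem i)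
    elem-all : ∀ a → P a → Σ (Fin card) λ i → elem i ≡ a

module _ {n : ℕ} {P : Fin (suc n) → Set} (E : Enumeration (P ∘ suc)) where
  private module E = Enumeration E

  enum-skip : ¬ P zero → Enumeration P
  enum-skip np = record
    { card = E.card ; elem = suc ∘ E.elem ; elem-inj = λ e → E.elem-inj (Finₚ.suc-injective e) ; elem-P = E.elem-P
    ; elem-all = λ { zero p → ⊥-elim (np p) ; (suc i) p → let j , e = E.elem-all i p in j , cong suc e } }

  enum-cons : P zero → Enumeration P
  enum-cons p₀ = record
    { card = suc E.card ; elem = el ; elem-inj = λ {i} {j} → inj i j ; elem-P = λ { zero → p₀ ; (suc i) → E.elem-P i }
    ; elem-all = λ { zero p → zero , refl ; (suc i) p → let j , e = E.elem-all i p in suc j , cong suc e } }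
    where
    el : Fin (suc E.card) → Fin (suc n)
    el zero = zero
    el (suc i) = suc (E.elem i)
    inj : ∀ i j → el i ≡ el j → i ≡ j
    inj zero zero _ = refl
    inj (suc i) (suc j) e = cong suc (E.elem-inj (Finₚ.suc-injective e))

enumerate-Fin : ∀ n {P : Fin n → Set} → (∀ i → Dec (P i)) → Enumeration P
enumerate-Fin zero P? = record { card = 0 ; elem = λ () ; elem-inj = λ { {()} } ; elem-P = λ () ; elem-all = λ () }
enumerate-Fin (suc n) P? with P? zero
... | no np = enum-skip (enumerate-Fin n (P? ∘ suc)) np
... | yes p = enum-cons (enumerate-Fin n (P? ∘ suc)) p

abstract
  enumerate : ∀ {A : Set} → Finite A → {P : A → Set} → (∀ a → Dec (P a)) → Enumeration P
  enumerate F {P} P? = record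
    { card = En.card ; elem = enum ∘ En.elem
    ; elem-inj = λ e → En.elem-inj (trans (sym (index-enum _)) (trans (cong index e) (index-enum _)))
    ; elem-P = En.elem-P
    ; elem-all = λ a p → let i , e = En.elem-all (index a) (subst P (sym (enum-index a)) p) in
                         i , trans (cong enum e) (enum-index a) }
    where
    open Finite F
    En : Enumeration (P ∘ enum)
    En = enumerate-Fin (Finite.size F) (P? ∘ enum)
    module En = Enumeration En

two-classes : ∀ {A : Set} {R : Rel A} {k} → NCl R k → ∀ a b → ¬ Cl R a b → 2 ≤ k
two-classes {k = k} N a b ne = injective⇒≤ {f = f} λ {i} {j} → inj i j
  where
  open NCl N
  f : Fin 2 → Fin k
  f zero = cls a
  f (suc zero) = cls b
  inj : ∀ i j → f i ≡ f j → i ≡ j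
  inj zero zero _ = refl
  inj zero (suc zero) e = ⊥-elim (ne (complete e))
  inj (suc zero) zero e = ⊥-elim (ne (complete (sym e)))
  inj (suc zero) (suc zero) _ = refl

one-class : ∀ {A : Set} {R : Rel A} {k} → NCl R k → A → 1 ≤ k
one-class {k = suc _} _ _ = s≤s z≤n
one-class {k = zero} N a with NCl.cls N a
... | ()

-- Closing up the rotations on the interface of two sides

Preserves : {A C : Set} → (A → C) → (A → A) → Set
Preserves col f = ∀ a → col (f a) ≡ col a

Cl-preserves : ∀ {A C : Set} {col : A → C} {f g} → Preserves col f → Preserves col g → ∀ {a b} → Cl (gr f ∪ gr g) a b → col a ≡ col b
Cl-preserves {col = col} p q = Cl-inv col λ { {a} (inj₁ refl) → sym (p a) ; {a} (inj₂ refl) → sym (q a) }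

isLeft : {A B : Set} → A ⊎ B → Bool
isLeft (inj₁ _) = true
isLeft (inj₂ _) = false

record Sides {A B : Set} (μ : A ⊎ B → A ⊎ B) : Set where
  field
    ρ₁ : A → A
    ρ₂ : B → B
    ρ₁m : Matching ρ₁
    ρ₂m : Matching ρ₂
    eq₁ : ∀ i → μ (inj₁ i) ≡ inj₁ (ρ₁ i)
    eq₂ : ∀ i → μ (inj₂ i) ≡ inj₂ (ρ₂ i)

abstract
  sides : ∀ {A B : Set} {μ : A ⊎ B → A ⊎ B} → Matching μ → Preserves isLeft μ → Sides μ
  sides {A} {B} {μ} μm pres = record
    { ρ₁ = λ i → proj₁ (left i) ; ρ₂ = λ i → proj₁ (right i)
    ; ρ₁m = record { inv = λ i → inj₁-injective (trans (sym (proj₂ (left _))) (trans (cong μ (sym (proj₂ (left i)))) (inv _)))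
                   ; irr = λ i e → irr _ (trans (proj₂ (left i)) (cong inj₁ e)) }
    ; ρ₂m = record { inv = λ i → inj₂-injective (trans (sym (proj₂ (right _))) (trans (cong μ (sym (proj₂ (right i)))) (inv _)))
                   ; irr = λ i e → irr _ (trans (proj₂ (right i)) (cong inj₂ e)) }
    ; eq₁ = λ i → proj₂ (left i) ; eq₂ = λ i → proj₂ (right i) }
    where
    open Matching μm
    left : ∀ i → Σ A λ j → μ (inj₁ i) ≡ inj₁ j
    left i with μ (inj₁ i) | pres (inj₁ i)
    ... | inj₁ j | _ = j , refl
    right : ∀ i → Σ B λ j → μ (inj₂ i) ≡ inj₂ j
    right i with μ (inj₂ i) | pres (inj₂ i)
    ... | inj₂ j | _ = j , refl

both : ∀ {c} → (Fin c → Fin c) → Fin c ⊎ Fin c → Fin c ⊎ Fin c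
both P = map⊎ P P

both-matching : ∀ {c} {P : Fin c → Fin c} → Matching P → Matching (both P)
both-matching {c} {P} m = record { inv = λ { (inj₁ i) → cong inj₁ (inv i) ; (inj₂ i) → cong inj₂ (inv i) } ; irr = irr' }
  where
  open Matching m
  irr' : ∀ x → both P x ≢ x
  irr' (inj₁ i) e = irr i (inj₁-injective e)
  irr' (inj₂ i) e = irr i (inj₂-injective e)

both-preserves : ∀ {c} {P : Fin c → Fin c} → Preserves isLeft (both P)
both-preserves (inj₁ _) = refl
both-preserves (inj₂ _) = refl

module _ {c : ℕ} {μ : Fin c ⊎ Fin c → Fin c ⊎ Fin c} (S : Sides μ) (T : Transversal (Sides.ρ₁ S) (Sides.ρ₂ S)) where
  private
    module S = Sides S
    module T = Transversal T

  both-conn : ∀ m n → isLeft m ≡ isLeft n → Cl (gr μ ∪ gr (both T.P)) m n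
  both-conn (inj₁ i) (inj₁ j) _ = Cl-map inj₁ (λ { (inj₁ refl) → [ inj₁ (S.eq₁ _) ] ; (inj₂ refl) → [ inj₂ refl ] }) (T.connˡ i j)
  both-conn (inj₂ i) (inj₂ j) _ = Cl-map inj₂ (λ { (inj₁ refl) → [ inj₁ (S.eq₂ _) ] ; (inj₂ refl) → [ inj₂ refl ] }) (T.connʳ i j)

family-bound : ∀ {A : Set} {R : Rel A} {β β₀ : A → A} {s k l} {p q : Fin s → A} → NCl (R ∪ gr β) k → NCl (R ∪ gr β₀) l →
  (∀ a → Cl ((R ∪ gr β) ∪ Family p q) a (β₀ a)) → k ≤ s + l
family-bound {s = s} {p = p} {q} N N₀ h = let _ , N' , k≤ = NCl-addFamily N p q in
  ≤-trans k≤ (+-monoʳ-≤ s (NCl-≤ N' N₀ id (λ { (inj₁ r) → [ inj₁ (inj₁ r) ] ; {a} (inj₂ refl) → h a }) id λ _ → ε))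

-- The two-coloured pairs of β, numbered by their point of colour `true`. K consists of both points
-- of all these pairs, and χ exchanges the points of a pair.
module CrossPairs {A : Set} (F : Finite A) {β : A → A} (βm : Matching β) {col : A → Bool}
  (Z : Enumeration λ a → col a ≡ true × col (β a) ≡ false) where
  module β = Matching βm
  module Z = Enumeration Z

  c : ℕ
  c = Z.card

  K : Set
  K = Fin c ⊎ Fin c
  FK : Finite K
  FK = ⊎-finite (Fin-finite c) (Fin-finite c)

  e : K → A
  e (inj₁ i) = Z.elem i
  e (inj₂ i) = β (Z.elem i)

  χ : K → K
  χ = swap⊎

  col-e : ∀ m → col (e m) ≡ isLeft m
  col-e (inj₁ i) = proj₁ (Z.elem-P i)
  col-e (inj₂ i) = proj₂ (Z.elem-P i)

  e-inj : ∀ {m n} → e m ≡ e n → m ≡ n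
  e-inj {inj₁ i} {inj₁ j} p = cong inj₁ (Z.elem-inj p)
  e-inj {inj₁ i} {inj₂ j} p with () ← trans (sym (col-e (inj₁ i))) (trans (cong col p) (col-e (inj₂ j)))
  e-inj {inj₂ i} {inj₁ j} p with () ← trans (sym (col-e (inj₂ i))) (trans (cong col p) (col-e (inj₁ j)))
  e-inj {inj₂ i} {inj₂ j} p = cong inj₂ (Z.elem-inj (β.inj p))

  β-e : ∀ m → β (e m) ≡ e (χ m)
  β-e (inj₁ i) = refl
  β-e (inj₂ i) = β.inv _

  module C₁ = Cut F FK βm e-inj χ β-e
  Im : A → Set
  Im a = Σ K λ m → e m ≡ a

  β-pure : ∀ {a} → ¬ Im a → col (β a) ≡ col a
  β-pure {a} ni with col a in p | col (β a) in q
  ... | true | true = refl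
  ... | false | false = refl
  ... | true | false = let i , r = Z.elem-all a (p , q) in ⊥-elim (ni (inj₁ i , r))
  ... | false | true = let i , r = Z.elem-all (β a) (q , trans (cong col (β.inv a)) p) in
                       ⊥-elim (ni (inj₂ i , trans (cong β r) (β.inv a)))

  reglue-pure : ∀ {ν} → Preserves isLeft ν → Preserves col (C₁.reglue ν)
  reglue-pure {ν} h = C₁.reglue-preserves col ν β-pure λ m → trans (col-e (ν m)) (trans (h m) (sym (col-e m)))

-- The matchings α, πA come from one side of a separation and β, πB from the other: α and β describe how
-- faces pass between the interface points A, and πA, πB how the rotations at the (at most two) common vertices do.
record Core {A : Set} (α β πA πB : A → A) (col : A → Bool) : Set where
  field
    πA' πB'     : A → A
    πA'm        : Matching πA'
    πB'm        : Matching πB'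
    πA'-pure    : Preserves col πA'
    πB'-pure    : Preserves col πB'
    connA       : ∀ a b → col a ≡ col b → Cl (gr πA ∪ gr πB') a b
    connB       : ∀ a b → col a ≡ col b → Cl (gr πB ∪ gr πA') a b

  -- On the side of α and πA the missing rotations πB are replaced by πB', on the other side πA by
  -- πA'. Then l and m count the faces of the separate sides, and k those of the common embedding,
  -- as far as they meet the interface.
  Gain : ℕ → Set
  Gain e = ∀ {k l m} → NCl (gr α ∪ gr β) k → NCl (gr α ∪ gr πB') l → NCl (gr β ∪ gr πA') m → k + e ≤ l + m

  field
    -- Colours are the common vertices, so a two-coloured pair of α or β is a stretch of a face from
    -- one of them to the other.
    result : (Σ ℕ λ e → (A → 1 ≤ e) × (∀ a b → col a ≢ col b → 2 ≤ e) × Gain e)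
           ⊎ ((Σ A λ a → col (α a) ≢ col a) × (Σ A λ a → col (β a) ≢ col a) × Gain 0)

Core-sym : ∀ {A : Set} {α β πA πB : A → A} {col : A → Bool} → Core β α πB πA col → Core α β πA πB col
Core-sym C = record
  { πA' = C.πB' ; πB' = C.πA' ; πA'm = C.πB'm ; πB'm = C.πA'm ; πA'-pure = C.πB'-pure ; πB'-pure = C.πA'-pure
  ; connA = C.connB ; connB = C.connA
  ; result = map⊎ (λ (e , p , q , g) → e , p , q , flip g) (λ (a , b , g) → b , a , flip g) C.result }
  where
  module C = Core C
  flip : ∀ {e} → C.Gain e → ∀ {k l m} → NCl _ k → NCl _ l → NCl _ m → k + e ≤ l + m
  flip g {l = l} {m} N₁ N₂ N₃ = ≤-trans (g (∪-comm N₁) N₃ N₂) (≤-reflexive (+-comm m l))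

module _ {A : Set} (F : Finite A) {α β πA πB : A → A} (αm : Matching α) (βm : Matching β) (πAm : Matching πA) (πBm : Matching πB)
  {col : A → Bool} (πA-pure : Preserves col πA) (πB-pure : Preserves col πB)
  (conn : ∀ a b → col a ≡ col b → Cl (gr πA ∪ gr πB) a b) where

  -- β itself closes up πA, after d reconnections that make every colour connected. They cost at
  -- most d of the k classes of α and β, whereas β and πA have d + e classes; this leaves a gain of
  -- e, and every colour present contributes to e.
  core-pure : Preserves col β → Core α β πA πB col
  core-pure β-pure = record
    { πA' = πA ; πB' = C.β' ; πA'm = πAm ; πB'm = C.matching ; πA'-pure = πA-pure ; πB'-pure = C.pure
    ; connA = C.conn ; connB = λ a b e → Cl-mono (λ { (inj₁ x) → inj₂ x ; (inj₂ x) → inj₁ x }) (conn a b e)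
    ; result = inj₁ (C.e , one-class C.count , (λ a b ne → two-classes C.count a b (λ p → ne (Cl-preserves πA-pure C.pure p)))
        , λ {k} {l} {m} N₁ N₂ N₃ → begin
            k + C.e ≤⟨ +-monoˡ-≤ C.e (C.bound αm N₁ N₂) ⟩
            C.d + l + C.e ≡⟨ lem C.d l C.e ⟩
            l + (C.d + C.e) ≡⟨ cong (l +_) (sym (C.total (∪-comm N₃))) ⟩
            l + m ∎) }
    where
    open ≤-Reasoning
    C : Joined col πA β
    C = connect F Bool._≟_ col πAm βm β-pure (proj₂ (NCl-gr₂ F πA β))
    module C = Joined C
    lem : ∀ d l e → d + l + e ≡ l + (d + e)
    lem = solve-∀

  -- Now β mixes the colours. Its c = 2s crossing pairs are cut and their ends rejoined within the
  -- colours by a transversal, which loses at most s classes, and reconnecting loses at most ℓ more.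
  -- In exchange one πA-pair is cut on each path between crossing points, and again a transversal
  -- rejoins the ends; with β this leaves at least s + ℓ classes.
  module Crossing {a₀ : A} (a₀-cross : col (β a₀) ≢ col a₀) (Z : Enumeration λ a → col a ≡ true × col (β a) ≡ false) where
    open CrossPairs F βm Z
    module πA = Matching πAm

    i₀ : Fin c
    i₀ with C₁.image? a₀
    ... | yes (inj₁ i , _) = i
    ... | yes (inj₂ i , _) = i
    ... | no ni = ⊥-elim (a₀-cross (β-pure ni))

    module Level₁ (P₁ : Paths πA C₁.cut e) where
      module T₁ = C₁.Tangle P₁
      module μ = Matching T₁.matching

      μ-sides : Preserves isLeft T₁.μ
      μ-sides m = trans (sym (col-e _)) (trans (sym (Cl-preserves πA-pure (reglue-pure (λ _ → refl)) (T₁.from-μ m))) (col-e m))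

      module Level₂ (S₁ : Sides T₁.μ) (V₁ : Transversal (Sides.ρ₁ S₁) (Sides.ρ₂ S₁)) where
        module V₁ = Transversal V₁
        PP : K → K
        PP = both V₁.P

        β₀ : A → A
        β₀ = C₁.reglue PP
        β₀m : Matching β₀
        β₀m = C₁.reglue-matching (both-matching V₁.matching)

        N-PP : NCl (gr T₁.μ ∪ gr PP) 2
        N-PP = record
          { cls = λ m → f (isLeft m) ; rep = λ { zero → inj₁ i₀ ; (suc zero) → inj₂ i₀ } ; cls-rep = λ { zero → refl ; (suc zero) → refl }
          ; sound = λ r → cong f (Cl-preserves μ-sides both-preserves [ r ])
          ; complete = λ {m} {n} p → both-conn S₁ V₁ m n (f-inj p) }
          where
          f : Bool → Fin 2
          f true = zero
          f false = suc zero
          f-inj : ∀ {x y} → f x ≡ f y → x ≡ y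
          f-inj {true} {true} _ = refl
          f-inj {false} {false} _ = refl

        -- Only the ends of colour `true` need additional pairs; the crossing pairs of β carry the
        -- connections over to colour `false`. So s pairs suffice.
        purify-bound : ∀ {k l} → NCl (gr α ∪ gr β) k → NCl (gr α ∪ gr β₀) l → k ≤ V₁.s + l
        purify-bound N N₀ = family-bound N N₀ go
          where
          R : Rel A
          R = (gr α ∪ gr β) ∪ Family (λ j → e (inj₁ (V₁.p j))) (λ j → e (inj₁ (V₁.P (V₁.p j))))
          cross : ∀ i → Cl R (e (inj₁ i)) (e (inj₂ i))
          cross i = [ inj₁ (inj₂ refl) ]
          edge : ∀ j → Cl R (e (inj₁ (V₁.p j))) (e (inj₁ (V₁.P (V₁.p j))))
          edge j = [ inj₂ (member j) ]
          left : ∀ i → Cl R (e (inj₁ i)) (e (inj₁ (V₁.P i)))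
          left i with V₁.p-idx i
          ... | inj₁ p = subst (λ w → Cl R (e (inj₁ w)) (e (inj₁ (V₁.P w)))) (sym p) (edge _)
          ... | inj₂ p = subst₂ (λ v w → Cl R (e (inj₁ v)) (e (inj₁ w))) (trans (cong V₁.P (sym p)) (Matching.inv V₁.matching i)) (sym p) (edge _ ⁻)
          go : ∀ a → Cl R a (β₀ a)
          go a with C₁.image? a
          ... | yes (inj₁ i , refl) = left i ∙ Cl-≡ (sym (C₁.reglue-e PP (inj₁ i)))
          ... | yes (inj₂ i , refl) = cross i ⁻ ∙ left i ∙ cross (V₁.P i) ∙ Cl-≡ (sym (C₁.reglue-e PP (inj₂ i)))
          ... | no np = [ inj₁ (inj₂ (sym (C₁.reglue-off PP np))) ]

        -- Every path of πA and β between two crossing points contributes one of its πA-edges: the one at the end of smaller index.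
        abstract
          First : K → Set
          First m = Finite.index FK m Fin.< Finite.index FK (T₁.μ m)

          first? : ∀ m → Dec (First m)
          first? m = Finite.index FK m <? Finite.index FK (T₁.μ m)

          first-μ : ∀ {m} → ¬ First m → First (T₁.μ m)
          first-μ {m} nf with <-cmp (Finite.index FK m) (Finite.index FK (T₁.μ m))
          ... | tri< x _ _ = ⊥-elim (nf x)
          ... | tri≈ _ x _ = ⊥-elim (μ.irr m (trans (sym (Finite.enum-index FK _)) (trans (cong (Finite.enum FK) (sym x)) (Finite.enum-index FK _))))
          ... | tri> _ _ x = subst (λ w → Finite.index FK (T₁.μ m) Fin.< Finite.index FK w) (sym (μ.inv m)) x

          μ-first : ∀ {m} → First m → ¬ First (T₁.μ m)
          μ-first {m} f g = Finₚ.<-asym f (subst (λ w → Finite.index FK (T₁.μ m) Fin.< Finite.index FK w) (μ.inv m) g)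

        -- The two points of the πA-pair that is cut on a path, each assigned to the end of the path
        -- that it stays connected with.
        e₂ : K → A
        e₂ m with first? m
        ... | yes _ = e m
        ... | no _ = πA (e (T₁.μ m))

        e₂-first : ∀ {m} → First m → e₂ m ≡ e m
        e₂-first {m} f with first? m
        ... | yes _ = refl
        ... | no nf = ⊥-elim (nf f)

        e₂-second : ∀ {m} → ¬ First m → e₂ m ≡ πA (e (T₁.μ m))
        e₂-second {m} nf with first? m
        ... | yes f = ⊥-elim (nf f)
        ... | no _ = refl

        R₁ : Rel A
        R₁ = gr πA ∪ gr C₁.cut

        e₂~e : ∀ m → Cl R₁ (e₂ m) (e m)
        e₂~e m with first? m
        ... | yes _ = ε
        ... | no _ = [ inj₁ refl ]⁻ ∙ (T₁.from-μ m) ⁻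

        col-e₂ : ∀ m → col (e₂ m) ≡ isLeft m
        col-e₂ m = trans (Cl-preserves πA-pure (reglue-pure (λ _ → refl)) (e₂~e m)) (col-e m)

        e₂-inj : ∀ {m n} → e₂ m ≡ e₂ n → m ≡ n
        e₂-inj {m} {n} p with T₁.ends {m} {n} ((e₂~e m) ⁻ ∙ Cl-≡ p ∙ e₂~e n)
        ... | inj₁ q = sym q
        ... | inj₂ refl with first? m
        ... | yes f = ⊥-elim (πA.irr (e m) (sym (trans p (trans (e₂-second (μ-first f)) (cong (πA ∘ e) (μ.inv m))))))
        ... | no nf = ⊥-elim (πA.irr (e (T₁.μ m)) (trans p (e₂-first (first-μ nf))))

        πA-e₂ : ∀ m → πA (e₂ m) ≡ e₂ (T₁.μ m)
        πA-e₂ m with first? m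
        ... | yes f = sym (trans (e₂-second (μ-first f)) (cong (πA ∘ e) (μ.inv m)))
        ... | no nf = trans (πA.inv _) (sym (e₂-first (first-μ nf)))

        module C₂ = Cut F FK πAm e₂-inj T₁.μ πA-e₂
        module Level₃ (P₂ : Paths β C₂.cut e₂) (P₃ : Paths πB C₂.cut e₂) where
          module T₂ = C₂.Tangle P₂
          module T₃ = C₂.Tangle P₃

          R₂ : Rel A
          R₂ = gr β ∪ gr C₂.cut

          -- If m is not the first end, the path is walked from `e m`. The only cut pair it can meet
          -- is that of its own path, and there it arrives at `e₂ m` before it could reach the other
          -- end.
          run : ∀ m → Cl R₂ (e m) (e₂ m)
          run m with first? m
          ... | yes _ = ε
          ... | no nf = walk ε ε (μ.irr m ∘ sym ∘ e-inj) (T₁.from-μ m)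
            where
            m' = T₁.μ m
            f' : First m'
            f' = first-μ nf
            Goal = Cl R₂ (e m) (πA (e m'))
            walk : ∀ {a} → Cl R₁ (e m) a → Cl R₂ (e m) a → a ≢ e m' → Cl R₁ a (e m') → Goal
            via-πA : ∀ {a b} → πA a ≡ b → Cl R₁ (e m) a → Cl R₂ (e m) a → a ≢ e m' → Cl R₁ b (e m') → Goal
            via-β : ∀ {a b} → C₁.cut a ≡ b → Cl R₁ (e m) a → Cl R₂ (e m) a → a ≢ e m' → Cl R₁ b (e m') → Goal
            walk p q ne ε = ⊥-elim (ne refl)
            walk p q ne (fwd (inj₁ x) r) = via-πA x p q ne r
            walk p q ne (bwd (inj₁ x) r) = via-πA (πA.flip x) p q ne r
            walk p q ne (fwd (inj₂ x) r) = via-β x p q ne r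
            walk p q ne (bwd (inj₂ x) r) = via-β (trans (cong C₁.cut (sym x)) (C₁.reglue-inv (λ _ → refl) _)) p q ne r
            via-πA {a} refl p q ne r with C₂.image? a
            ... | yes (n , x) with T₁.ends {m} {n} (p ∙ Cl-≡ (sym x) ∙ e₂~e n)
            ... | inj₁ refl = q ∙ Cl-≡ (trans (sym x) (e₂-second nf))
            ... | inj₂ refl = ⊥-elim (ne (trans (sym x) (e₂-first f')))
            via-πA {a} refl p q ne r | no ni = walk (p ∙ [ inj₁ refl ]) (q ∙ [ inj₂ (C₂.reglue-off id ni) ])
              (λ y → ni (m , trans (e₂-second nf) (trans (cong πA (sym y)) (πA.inv a)))) r
            via-β {a} refl p q ne r = walk (p ∙ [ inj₂ refl ]) (q ∙ joined-step) (λ y → ne (trans (sym (C₁.reglue-inv (λ _ → refl) a)) (trans (cong C₁.cut y) (C₁.reglue-e id m')))) r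
              where
              joined-step : Cl R₂ a (C₁.cut a)
              joined-step with C₁.image? a
              ... | yes (m , refl) = Cl-≡ (sym (C₁.reglue-e id m))
              ... | no np = [ inj₁ (sym (C₁.reglue-off id np)) ]

          -- With β whole and πA cut, the path from `e₂ m` runs to `e m`, across the crossing pair
          -- to `e (χ m)`, and on to `e₂ (χ m)`.
          μ₂≡χ : ∀ m → T₂.μ m ≡ χ m
          μ₂≡χ m with T₂.ends {m} {χ m} ((run m) ⁻ ∙ [ inj₁ (β-e m) ] ∙ run (χ m))
          ... | inj₂ p = sym p
          ... | inj₁ p with trans (sym (col-e (χ m))) (trans (cong (col ∘ e) p) (col-e m))
          μ₂≡χ (inj₁ _) | inj₁ p | ()
          μ₂≡χ (inj₂ _) | inj₁ p | ()

          -- The classes of πA and β are counted with β cut and with πA cut. Both cuts give the same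
          -- classes on K, so they leave equally many loops.
          ℓ≡ : T₁.ℓ ≡ T₂.ℓ
          ℓ≡ with NCl-gr₂ FK T₁.μ χ
          ... | x , N = ℕₚ.+-cancelˡ-≡ x _ _ (NCl-unique (T₁.to-glued T₁.glued-f N) (∪-comm (T₂.to-glued T₂.glued-f (NCl-Equiv
              (Equiv-id (λ { (inj₁ r) → [ inj₂ r ] ; (inj₂ r) → [ inj₁ (trans (μ₂≡χ _) r) ] })
                        (λ { (inj₁ r) → [ inj₂ (trans (sym (μ₂≡χ _)) r) ] ; (inj₂ r) → [ inj₁ r ] })) N))))

          cut₂-pure : Preserves col C₂.cut
          cut₂-pure = C₂.reglue-preserves col id (λ _ → πA-pure _) λ _ → refl

          μ₃-sides : Preserves isLeft T₃.μ
          μ₃-sides m = trans (sym (col-e₂ _)) (trans (sym (Cl-preserves πB-pure cut₂-pure (T₃.from-μ m))) (col-e₂ m))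

          module Level₄ (S₃ : Sides T₃.μ) (V₃ : Transversal (Sides.ρ₁ S₃) (Sides.ρ₂ S₃)) (CN : Joined col πA β₀) where
            module CN = Joined CN

            -- The transversal leaves two classes besides the ℓ loops, and after all reconnections
            -- at least two classes remain because there are two colours.
            d≤ℓ : CN.d ≤ T₁.ℓ
            d≤ℓ = +-cancelˡ-≤ 2 _ _ (begin
              2 + CN.d ≡⟨ +-comm 2 CN.d ⟩
              CN.d + 2 ≤⟨ +-monoʳ-≤ CN.d (two-classes CN.count a₀ (β a₀) (λ p → a₀-cross (sym (Cl-preserves πA-pure CN.pure p)))) ⟩
              CN.d + CN.e ≡⟨ sym (CN.total (T₁.to-glued (T₁.glued-re PP) N-PP)) ⟩
              2 + T₁.ℓ ∎)
              where open ≤-Reasoning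

            module V₃ = Transversal V₃
            PP₃ : K → K
            PP₃ = both V₃.P

            πA₃ : A → A
            πA₃ = C₂.reglue PP₃

            πA₃-pure : Preserves col πA₃
            πA₃-pure = C₂.reglue-preserves col PP₃ (λ _ → πA-pure _) λ m → trans (col-e₂ (PP₃ m)) (trans (both-preserves m) (sym (col-e₂ m)))

            -- A loop of πB and the cut πA would contain no cut point. But πA and πB connect each
            -- colour, and both colours contain cut points.
            in-K : ∀ a → Σ K λ m → T₃.to a ≡ inj₁ m
            in-K a = get (T₃.to a) (trans (Cl-inv isLeft (λ { (inl _) → refl ; (inr ()) }) (Equiv.to* T₃.glued-f
                        (Cl-mono (λ { (inj₁ x) → inj₂ x ; (inj₂ x) → inj₁ x }) (conn a (e₂ m₀) (sym (col-m₀))))))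
                      (cong isLeft (T₃.to-e m₀)))
              where
              get : ∀ x → isLeft x ≡ true → Σ K λ m → x ≡ inj₁ m
              get (inj₁ m) _ = m , refl
              pick : Bool → K
              pick true = inj₁ i₀
              pick false = inj₂ i₀
              m₀ = pick (col a)
              left-pick : ∀ b → isLeft (pick b) ≡ b
              left-pick true = refl
              left-pick false = refl
              col-m₀ : col (e₂ m₀) ≡ col a
              col-m₀ = trans (col-e₂ m₀) (left-pick (col a))

            connB : ∀ a b → col a ≡ col b → Cl (gr πB ∪ gr πA₃) a b
            connB a b p with in-K a | in-K b
            ... | m , x | n , y = Equiv.to-inv (T₃.glued-re PP₃) (subst₂ (Cl _) (sym x) (sym y)
                (Cl-map inj₁ (λ r → [ inl r ]) (both-conn S₃ V₃ m n (trans (left x) (trans p (sym (left y)))))))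
              where
              left : ∀ {a m} → T₃.to a ≡ inj₁ m → isLeft m ≡ col a
              left {a} {m} x = trans (sym (col-e₂ m)) (Cl-preserves πB-pure cut₂-pure (subst (λ w → Cl _ ([ e₂ , T₃.loop ]′ w) a) x (T₃.from-to a)))

            s≡ : V₁.s ≡ V₃.s
            s≡ = half (trans (sym V₁.size≡) V₃.size≡)
              where
              half : ∀ {m n} → m + m ≡ n + n → m ≡ n
              half {m} {n} p = ℕₚ.*-cancelˡ-≡ m n 2 (trans (dbl m) (trans p (sym (dbl n))))
                where
                dbl : ∀ m → 2 * m ≡ m + m
                dbl m = cong (m +_) (ℕₚ.+-identityʳ m)

            -- The number of the transversal pair is the same on both colours and invariant under χ
            -- and `PP₃`, so the s pairs lie in different classes.
            many : ∀ {w} → NCl (gr T₂.μ ∪ gr PP₃) w → V₃.s ≤ w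
            many N = injective⇒≤ {f = λ j → NCl.cls N (inj₁ (V₃.p j))} λ {i} {j} p →
              trans (sym (V₃.idx-p i)) (trans (Cl-inv idx sound (NCl.complete N p)) (V₃.idx-p j))
              where
              idx : K → Fin V₃.s
              idx (inj₁ i) = V₃.idx i
              idx (inj₂ i) = V₃.idx i
              idx-χ : ∀ m → idx (χ m) ≡ idx m
              idx-χ (inj₁ _) = refl
              idx-χ (inj₂ _) = refl
              idx-PP : ∀ m → idx (PP₃ m) ≡ idx m
              idx-PP (inj₁ i) = V₃.idx-P i
              idx-PP (inj₂ i) = V₃.idx-P i
              sound : ∀ {m n} → (gr T₂.μ ∪ gr PP₃) m n → idx m ≡ idx n
              sound {m} (inj₁ refl) = sym (trans (cong idx (μ₂≡χ m)) (idx-χ m))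
              sound {m} (inj₂ refl) = sym (idx-PP m)

            gain : ∀ {k l m} → NCl (gr α ∪ gr β) k → NCl (gr α ∪ gr CN.β') l → NCl (gr β ∪ gr πA₃) m → k + 0 ≤ l + m
            gain {k} {l} {m} N₁ N₂ N₃ with NCl-gr₂ F α β₀ | NCl-gr₂ FK T₂.μ PP₃
            ... | k₀ , N₀ | w , W = begin
              k + 0 ≡⟨ ℕₚ.+-identityʳ k ⟩
              k ≤⟨ purify-bound N₁ N₀ ⟩
              V₁.s + k₀ ≤⟨ +-mono-≤ (≤-trans (≤-reflexive s≡) (many W)) (≤-trans (CN.bound αm N₀ N₂) (+-monoˡ-≤ l d≤ℓ)) ⟩
              w + (T₁.ℓ + l) ≡⟨ lem w T₁.ℓ l ⟩
              l + (w + T₁.ℓ) ≡⟨ cong (λ u → l + (w + u)) ℓ≡ ⟩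
              l + (w + T₂.ℓ) ≡⟨ cong (l +_) (NCl-unique (T₂.to-glued (T₂.glued-re PP₃) W) N₃) ⟩
              l + m ∎
              where
              open ≤-Reasoning
              lem : ∀ w u l → w + (u + l) ≡ l + (w + u)
              lem = solve-∀

            result : (Σ A λ a → col (α a) ≢ col a) → Core α β πA πB col
            result α-cross = record
              { πA' = πA₃ ; πB' = CN.β' ; πA'm = C₂.reglue-matching (both-matching V₃.matching) ; πB'm = CN.matching
              ; πA'-pure = πA₃-pure ; πB'-pure = CN.pure ; connA = CN.conn ; connB = connB
              ; result = inj₂ (α-cross , (a₀ , a₀-cross) , gain) }

          level₃ : (Σ A λ a → col (α a) ≢ col a) → Core α β πA πB col
          level₃ = Level₄.result S₃ (transversal _ (Sides.ρ₁m S₃) (Sides.ρ₂m S₃))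
              (connect F Bool._≟_ col πAm β₀m (reglue-pure both-preserves) (T₁.to-glued (T₁.glued-re PP) N-PP))
            where
            S₃ : Sides T₃.μ
            S₃ = sides T₃.matching μ₃-sides

        level₂ : (Σ A λ a → col (α a) ≢ col a) → Core α β πA πB col
        level₂ = Level₃.level₃ (C₂.cut-paths βm) (C₂.cut-paths πBm)

      level₁ : (Σ A λ a → col (α a) ≢ col a) → Core α β πA πB col
      level₁ = Level₂.level₂ S₁ (transversal _ (Sides.ρ₁m S₁) (Sides.ρ₂m S₁))
        where
        S₁ : Sides T₁.μ
        S₁ = sides T₁.matching μ-sides

    level₀ : (Σ A λ a → col (α a) ≢ col a) → Core α β πA πB col
    level₀ = Level₁.level₁ (C₁.cut-paths πAm)

  core-crossing : (Σ A λ a → col (α a) ≢ col a) → (Σ A λ a → col (β a) ≢ col a) → Core α β πA πB col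
  core-crossing α-cross (a₀ , β-cross) =
    Crossing.level₀ β-cross (enumerate F λ a → (col a Bool.≟ true) ×-dec (col (β a) Bool.≟ false)) α-cross

  crossing? : (f : A → A) → (Σ A λ a → col (f a) ≢ col a) ⊎ Preserves col f
  crossing? f with exists? F (λ a → ¬? (col (f a) Bool.≟ col a))
  ... | yes p = inj₁ p
  ... | no np = inj₂ λ a → dec (col (f a) Bool.≟ col a) λ ne → np (a , ne)
    where
    dec : ∀ {P : Set} → Dec P → ¬ ¬ P → P
    dec (yes p) _ = p
    dec (no np) h = ⊥-elim (h np)

abstract
  core : ∀ {A : Set} (F : Finite A) {α β πA πB : A → A} → Matching α → Matching β → Matching πA → Matching πB →
    {col : A → Bool} → Preserves col πA → Preserves col πB → (∀ a b → col a ≡ col b → Cl (gr πA ∪ gr πB) a b) → Core α β πA πB col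
  core F {α} {β} αm βm πAm πBm πA-pure πB-pure conn
    with crossing? F αm βm πAm πBm πA-pure πB-pure conn α | crossing? F αm βm πAm πBm πA-pure πB-pure conn β
  ... | _ | inj₂ p = core-pure F αm βm πAm πBm πA-pure πB-pure conn p
  ... | inj₂ p | inj₁ _ = Core-sym (core-pure F βm αm πBm πAm πB-pure πA-pure
          (λ a b e → Cl-mono (λ { (inj₁ x) → inj₂ x ; (inj₂ x) → inj₁ x }) (conn a b e)) p)
  ... | inj₁ x | inj₁ y = core-crossing F αm βm πAm πBm πA-pure πB-pure conn x y

-- Taking an embedding apart at two vertices

module _ {Φ V : Set} (vert : Φ → V) (side : Φ → Bool) where
  Shared : V → Set
  Shared v = Σ Φ λ f → Σ Φ λ g → vert f ≡ v × vert g ≡ v × side f ≢ side g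

  record Separation (τ0 τ2 t : Φ → Φ) (x y : V) : Set where
    field
      t'       : Φ → Φ
      matching : Matching t'
      t'-vert  : Preserves vert t'
      t'-side  : Preserves side t'
      rotation : ∀ f g → vert f ≡ vert g → side f ≡ side g → Cl (gr τ2 ∪ gr t') f g

    Gain : ℕ → Set
    Gain e = ∀ {k k'} → NCl (gr τ0 ∪ gr t) k → NCl (gr τ0 ∪ gr t') k' → k + e ≤ k'

    field
      result : (Σ ℕ λ e → (Shared x → 1 ≤ e) × (Shared y → 1 ≤ e) × (x ≢ y → Shared x → Shared y → 2 ≤ e) × Gain e)
             ⊎ (x ≢ y × (∀ s → Σ Φ λ f → Σ Φ λ g → (side f ≡ s × vert f ≡ x) × (side g ≡ s × vert g ≡ y) × Cl (gr τ0 ∪ gr t') f g) × Gain 0)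

-- The edges of an embedded graph are divided into two sides having at most the vertices x and y in common.
-- Re-embedding the two sides independently gains a face for each common vertex, or else leaves x and y on
-- a common face of either side.
module Separate {Φ V : Set} (F : Finite Φ) (_≟ᵛ_ : (a b : V) → Dec (a ≡ b)) {τ0 τ2 t : Φ → Φ}
  (τ0m : Matching τ0) (τ2m : Matching τ2) (tm : Matching t) {vert : Φ → V} {side : Φ → Bool}
  (τ2-vert : Preserves vert τ2) (t-vert : Preserves vert t) (τ0-side : Preserves side τ0) (τ2-side : Preserves side τ2)
  (rot : ∀ f g → vert f ≡ vert g → Cl (gr τ2 ∪ gr t) f g) (x y : V)
  (shared : ∀ f g → vert f ≡ vert g → side f ≢ side g → vert f ≡ x ⊎ vert f ≡ y)
  (Z : Enumeration λ f → side f ≡ true × side (t f) ≡ false) where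

  open CrossPairs F tm Z

  vert-e : ∀ i → vert (e (inj₂ i)) ≡ vert (e (inj₁ i))
  vert-e i = t-vert _

  mixed-vert : ∀ i → vert (e (inj₁ i)) ≡ x ⊎ vert (e (inj₁ i)) ≡ y
  mixed-vert i = shared _ _ (sym (vert-e i)) λ p → contra (trans (sym (col-e (inj₁ i))) (trans p (col-e (inj₂ i))))
    where
    contra : true ≢ false
    contra ()

  -- Corners at which the side changes lie at x or at y, so one bit determines the vertex. If x and
  -- y coincide, the only colour is `true`.
  col : Fin c → Bool
  col i = isYes (vert (e (inj₁ i)) ≟ᵛ x)

  col-vert : ∀ i j → col i ≡ col j → vert (e (inj₁ i)) ≡ vert (e (inj₁ j))
  col-vert i j p with vert (e (inj₁ i)) ≟ᵛ x | vert (e (inj₁ j)) ≟ᵛ x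
  ... | yes a | yes b = trans a (sym b)
  ... | no a | no b with mixed-vert i | mixed-vert j
  ... | inj₁ q | _ = ⊥-elim (a q)
  ... | inj₂ _ | inj₁ r = ⊥-elim (b r)
  ... | inj₂ q | inj₂ r = trans q (sym r)

  vert-col : ∀ {i j} → vert (e (inj₁ i)) ≡ vert (e (inj₁ j)) → col i ≡ col j
  vert-col p = cong (λ v → isYes (v ≟ᵛ x)) p

  strip : K → Fin c
  strip (inj₁ i) = i
  strip (inj₂ i) = i

  vert-strip : ∀ m → vert (e m) ≡ vert (e (inj₁ (strip m)))
  vert-strip (inj₁ i) = refl
  vert-strip (inj₂ i) = vert-e i

  strip-χ : ∀ m → strip (χ m) ≡ strip m
  strip-χ (inj₁ _) = refl
  strip-χ (inj₂ _) = refl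

  cut-side : Preserves side C₁.cut
  cut-side = reglue-pure λ _ → refl

  cut-vert : Preserves vert C₁.cut
  cut-vert = C₁.reglue-preserves vert id (λ _ → t-vert _) λ _ → refl

  Mixed : V → Set
  Mixed v = Σ (Fin c) λ i → vert (e (inj₁ i)) ≡ v

  private
    -- τ2 keeps the side, so a rotation that meets both sides has to change between them at a pair
    -- of t.
    mixed-step : ∀ {f g} → Cl (gr τ2 ∪ gr t) f g → side f ≢ side g → Σ Φ λ h → vert h ≡ vert f × side (t h) ≢ side h
    mixed-step ε ne = ⊥-elim (ne refl)
    mixed-step {f} (fwd (inj₁ refl) p) ne = let h , q , r = mixed-step p (λ s → ne (trans (sym (τ2-side f)) s)) in
      h , trans q (τ2-vert f) , r
    mixed-step (bwd {b = b} (inj₁ refl) p) ne = let h , q , r = mixed-step p (λ s → ne (trans (τ2-side b) s)) in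
      h , trans q (sym (τ2-vert b)) , r
    mixed-step {f} (fwd (inj₂ refl) p) ne with side (t f) Bool.≟ side f
    ... | no r = f , refl , r
    ... | yes e = let h , q , r = mixed-step p (λ s → ne (trans (sym e) s)) in h , trans q (t-vert f) , r
    mixed-step (bwd {b = b} (inj₂ refl) p) ne with side (t b) Bool.≟ side b
    ... | no r = b , sym (t-vert b) , r
    ... | yes e = let h , q , r = mixed-step p (λ s → ne (trans e s)) in h , trans q (sym (t-vert b)) , r

  mixed : ∀ {v} → Shared vert side v → Mixed v
  mixed (f , g , p , q , ne) with mixed-step (rot f g (trans p (sym q))) ne
  ... | h , r , s with C₁.image? h
  ... | yes (m , u) = strip m , trans (sym (vert-strip m)) (trans (cong vert u) (trans r p))
  ... | no ni = ⊥-elim (s (β-pure ni))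

  module Level₁ (P₀ : Paths τ0 C₁.cut e) (P₂ : Paths τ2 C₁.cut e) where
    module T₀ = C₁.Tangle P₀
    module T₂ = C₁.Tangle P₂

    side-e : ∀ {m n} → Cl (gr τ2 ∪ gr C₁.cut) (e m) (e n) → isLeft m ≡ isLeft n
    side-e p = trans (sym (col-e _)) (trans (Cl-preserves τ2-side cut-side p) (col-e _))

    μ₀-sides : Preserves isLeft T₀.μ
    μ₀-sides m = trans (sym (col-e _)) (trans (sym (Cl-preserves τ0-side cut-side (T₀.from-μ m))) (col-e m))

    μ₂-sides : Preserves isLeft T₂.μ
    μ₂-sides m = sym (side-e (T₂.from-μ m))

    μ₂-vert : ∀ m → vert (e (T₂.μ m)) ≡ vert (e m)
    μ₂-vert m = sym (Cl-preserves τ2-vert cut-vert (T₂.from-μ m))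

    module Level₂ (S₀ : Sides T₀.μ) (S₂ : Sides T₂.μ) where
      open Sides S₀ using () renaming (ρ₁ to α; ρ₂ to β'; ρ₁m to αm; ρ₂m to βm')
      open Sides S₂ using () renaming (ρ₁ to πA; ρ₂ to πB; ρ₁m to πAm; ρ₂m to πBm)
      private
        module S₀ = Sides S₀
        module S₂ = Sides S₂

      πA-pure : Preserves col πA
      πA-pure i = vert-col (trans (cong (vert ∘ e) (sym (S₂.eq₁ i))) (μ₂-vert (inj₁ i)))

      πB-pure : Preserves col πB
      πB-pure i = vert-col (trans (sym (vert-e _)) (trans (cong (vert ∘ e) (sym (S₂.eq₂ i))) (trans (μ₂-vert (inj₂ i)) (vert-e i))))

      conn : ∀ i j → col i ≡ col j → Cl (gr πA ∪ gr πB) i j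
      conn i j p = subst₂ (λ v w → Cl _ (q v) (q w)) (T₂.to-e (inj₁ i)) (T₂.to-e (inj₁ j))
        (Cl-map q go (Equiv.to* T₂.glued-f (rot _ _ (col-vert i j p))))
        where
        q : K ⊎ Fin T₂.ℓ → Fin c
        q (inj₁ m) = strip m
        -- A default value: a loop is a class by itself and is never entered from a path.
        q (inj₂ _) = i
        go : ∀ {v w} → ((gr T₂.μ ∪ gr χ) ⊎ʳ ∅) v w → Cl (gr πA ∪ gr πB) (q v) (q w)
        go {inj₁ (inj₁ k)} (inl (inj₁ refl)) = [ inj₁ (cong strip (sym (S₂.eq₁ k))) ]
        go {inj₁ (inj₂ k)} (inl (inj₁ refl)) = [ inj₂ (cong strip (sym (S₂.eq₂ k))) ]
        go {inj₁ m} (inl (inj₂ refl)) = Cl-≡ (sym (strip-χ m))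

      module Level₃ (C : Core α β' πA πB col) where
        open Core C using (πA'; πB'; πA'm; πB'm; πA'-pure; πB'-pure)
        private module C = Core C

        -- The ends on side `true` carry α and πA and receive the substitute πB'; those on side
        -- `false` receive πA'.
        ν : K → K
        ν = map⊎ πB' πA'

        ν-matching : Matching ν
        ν-matching = record { inv = λ { (inj₁ i) → cong inj₁ (Matching.inv πB'm i) ; (inj₂ i) → cong inj₂ (Matching.inv πA'm i) } ; irr = irr' }
          where
          irr' : ∀ m → ν m ≢ m
          irr' (inj₁ i) p = Matching.irr πB'm i (inj₁-injective p)
          irr' (inj₂ i) p = Matching.irr πA'm i (inj₂-injective p)

        t' : Φ → Φ
        t' = C₁.reglue ν

        t'-side : Preserves side t'
        t'-side = reglue-pure λ { (inj₁ _) → refl ; (inj₂ _) → refl }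

        t'-vert : Preserves vert t'
        t'-vert = C₁.reglue-preserves vert ν (λ _ → t-vert _) λ
          { (inj₁ i) → col-vert _ _ (πB'-pure i) ; (inj₂ i) → trans (vert-e _) (trans (col-vert _ _ (πA'-pure i)) (sym (vert-e i))) }

        ν-conn : ∀ m n → isLeft m ≡ isLeft n → col (strip m) ≡ col (strip n) → Cl (gr T₂.μ ∪ gr ν) m n
        ν-conn (inj₁ i) (inj₁ j) _ p = Cl-map inj₁ (λ { (inj₁ refl) → [ inj₁ (S₂.eq₁ _) ] ; (inj₂ refl) → [ inj₂ refl ] }) (C.connA i j p)
        ν-conn (inj₂ i) (inj₂ j) _ p = Cl-map inj₂ (λ { (inj₁ refl) → [ inj₁ (S₂.eq₂ _) ] ; (inj₂ refl) → [ inj₂ refl ] }) (C.connB i j p)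

        module _ {f : Φ} where
          private
            from-to : ∀ {m} → T₂.to f ≡ inj₁ m → Cl (gr τ2 ∪ gr C₁.cut) (e m) f
            from-to p = subst (λ w → Cl _ ([ e , T₂.loop ]′ w) f) p (T₂.from-to f)
          to-side : ∀ {m} → T₂.to f ≡ inj₁ m → isLeft m ≡ side f
          to-side p = trans (sym (col-e _)) (Cl-preserves τ2-side cut-side (from-to p))
          to-vert : ∀ {m} → T₂.to f ≡ inj₁ m → vert (e (inj₁ (strip m))) ≡ vert f
          to-vert {m} p = trans (sym (vert-strip m)) (Cl-preserves τ2-vert cut-vert (from-to p))

        rotation : ∀ f g → vert f ≡ vert g → side f ≡ side g → Cl (gr τ2 ∪ gr t') f g
        rotation f g p q = Equiv.to-inv (T₂.glued-re ν) (go (T₂.to f) (T₂.to g) refl refl (Equiv.to* T₂.glued-f (rot f g p)))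
          where
          loops : K ⊎ Fin T₂.ℓ → Bool ⊎ Fin T₂.ℓ
          loops (inj₁ _) = inj₁ true
          loops (inj₂ l) = inj₂ l
          go : ∀ u v → T₂.to f ≡ u → T₂.to g ≡ v → Cl ((gr T₂.μ ∪ gr χ) ⊎ʳ ∅) (T₂.to f) (T₂.to g) →
               Cl ((gr T₂.μ ∪ gr ν) ⊎ʳ ∅) (T₂.to f) (T₂.to g)
          go u v a b r with Cl-inv loops (λ { (inl _) → refl ; (inr ()) }) r
          go (inj₁ m) (inj₁ n) a b r | _ = subst₂ (Cl _) (sym a) (sym b) (Cl-map inj₁ (λ s → [ inl s ])
            (ν-conn m n (trans (to-side a) (trans q (sym (to-side b)))) (vert-col (trans (to-vert a) (trans p (sym (to-vert b)))))))
          go (inj₂ k) (inj₂ l) a b r | s = Cl-≡ (trans a (trans (cong inj₂ (inj₂-injective (trans (cong loops (sym a)) (trans s (cong loops b))))) (sym b)))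
          go (inj₁ m) (inj₂ l) a b r | s with () ← trans (cong loops (sym a)) (trans s (cong loops b))
          go (inj₂ k) (inj₁ n) a b r | s with () ← trans (cong loops (sym a)) (trans s (cong loops b))

        -- An interface point is a corner seen from both sides. Contracting the pairs of χ turns the
        -- stretches of faces into α and β'.
        strip-equiv : Equiv (gr T₀.μ ∪ gr χ) (gr α ∪ gr β')
        strip-equiv = record
          { to = strip ; from = inj₁
          ; to-R = λ { {m} (inj₁ refl) → there m ; {m} (inj₂ refl) → Cl-≡ (sym (strip-χ m)) }
          ; from-S = λ { {i} (inj₁ refl) → [ inj₁ (S₀.eq₁ i) ]
                       ; {i} (inj₂ refl) → fwd (inj₂ refl) (fwd (inj₁ (S₀.eq₂ i)) [ inj₂ refl ]) }
          ; from-to = λ { (inj₁ _) → ε ; (inj₂ _) → [ inj₂ refl ] }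
          ; to-from = λ _ → ε }
          where
          there : ∀ m → Cl (gr α ∪ gr β') (strip m) (strip (T₀.μ m))
          there (inj₁ i) = [ inj₁ (sym (cong strip (S₀.eq₁ i))) ]
          there (inj₂ i) = [ inj₂ (sym (cong strip (S₀.eq₂ i))) ]

        split-equiv : Equiv ((gr α ∪ gr πB') ⊎ʳ (gr β' ∪ gr πA')) (gr T₀.μ ∪ gr ν)
        split-equiv = Equiv-id
          (λ { (inl (inj₁ refl)) → [ inj₁ (S₀.eq₁ _) ] ; (inl (inj₂ refl)) → [ inj₂ refl ]
             ; (inr (inj₁ refl)) → [ inj₁ (S₀.eq₂ _) ] ; (inr (inj₂ refl)) → [ inj₂ refl ] })
          λ { {m} (inj₁ refl) → go m ; {inj₁ i} (inj₂ refl) → [ inl (inj₂ refl) ] ; {inj₂ i} (inj₂ refl) → [ inr (inj₂ refl) ] }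
          where
          go : ∀ m → Cl ((gr α ∪ gr πB') ⊎ʳ (gr β' ∪ gr πA')) m (T₀.μ m)
          go (inj₁ i) = subst (Cl _ (inj₁ i)) (sym (S₀.eq₁ i)) [ inl (inj₁ refl) ]
          go (inj₂ i) = subst (Cl _ (inj₂ i)) (sym (S₀.eq₂ i)) [ inr (inj₁ refl) ]

        gain : ∀ {n} → C.Gain n → ∀ {k k'} → NCl (gr τ0 ∪ gr t) k → NCl (gr τ0 ∪ gr t') k' → k + n ≤ k'
        gain {n} G {k} {k'} N N' = begin
          k + n ≡⟨ cong (_+ n) (NCl-unique N (T₀.to-glued T₀.glued-f (NCl-Equiv (Equiv-sym strip-equiv) (proj₂ X)))) ⟩
          proj₁ X + T₀.ℓ + n ≡⟨ lem (proj₁ X) T₀.ℓ n ⟩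
          proj₁ X + n + T₀.ℓ ≤⟨ +-monoˡ-≤ T₀.ℓ (G (proj₂ X) (proj₂ Y) (proj₂ W)) ⟩
          proj₁ Y + proj₁ W + T₀.ℓ ≡⟨ NCl-unique (T₀.to-glued (T₀.glued-re ν) (NCl-Equiv split-equiv (NCl-⊎ (proj₂ Y) (proj₂ W)))) N' ⟩
          k' ∎
          where
          open ≤-Reasoning
          lem : ∀ x l n → x + l + n ≡ x + n + l
          lem = solve-∀
          X = NCl-gr₂ (Fin-finite c) α β'
          Y = NCl-gr₂ (Fin-finite c) α πB'
          W = NCl-gr₂ (Fin-finite c) β' πA'

        crossing-vert : ∀ {i j} → col i ≢ col j → (vert (e (inj₁ i)) ≡ x × vert (e (inj₁ j)) ≡ y) ⊎ (vert (e (inj₁ i)) ≡ y × vert (e (inj₁ j)) ≡ x)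
        crossing-vert {i} {j} ne with mixed-vert i | mixed-vert j
        ... | inj₁ p | inj₂ q = inj₁ (p , q)
        ... | inj₂ p | inj₁ q = inj₂ (p , q)
        ... | inj₁ p | inj₁ q = ⊥-elim (ne (vert-col (trans p (sym q))))
        ... | inj₂ p | inj₂ q = ⊥-elim (ne (vert-col (trans p (sym q))))

        -- A two-coloured pair of the face matching is a stretch of a face between x and y on one
        -- side. It uses no pair that is rejoined, so it survives the separation.
        cofacial : ∀ (s : Bool) (w : Fin c → K) → (∀ i → side (e (w i)) ≡ s) → (∀ i → vert (e (w i)) ≡ vert (e (inj₁ i))) →
          ∀ {i j} → col j ≢ col i → T₀.μ (w i) ≡ w j →
          Σ Φ λ f → Σ Φ λ g → (side f ≡ s × vert f ≡ x) × (side g ≡ s × vert g ≡ y) × Cl (gr τ0 ∪ gr t') f g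
        cofacial s w ws wv {i} {j} ne p = [ (λ (a , b) → e (w i) , e (w j) , (ws i , trans (wv i) a) , (ws j , trans (wv j) b) , path)
          , (λ (a , b) → e (w j) , e (w i) , (ws j , trans (wv j) b) , (ws i , trans (wv i) a) , path ⁻) ]′ (crossing-vert (ne ∘ sym))
          where
          path : Cl (gr τ0 ∪ gr t') (e (w i)) (e (w j))
          path = T₀.cut-⊆ (C₁.reglue-off ν) (subst (λ m → Cl _ (e (w i)) (e m)) p (T₀.from-μ (w i)))

        x≢y : ∀ {i j} → col i ≢ col j → x ≢ y
        x≢y ne refl with crossing-vert ne
        ... | inj₁ (a , b) = ne (vert-col (trans a (sym b)))
        ... | inj₂ (a , b) = ne (vert-col (trans a (sym b)))

        separation : Separation vert side τ0 τ2 t x y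
        separation = record
          { t' = t' ; matching = C₁.reglue-matching ν-matching ; t'-vert = t'-vert ; t'-side = t'-side ; rotation = rotation
          ; result = map⊎
              (λ (n , one , two , G) → n , (λ s → one (proj₁ (mixed s))) , (λ s → one (proj₁ (mixed s)))
                , (λ ne s₁ s₂ → two (proj₁ (mixed s₁)) (proj₁ (mixed s₂)) λ p →
                    ne (trans (sym (proj₂ (mixed s₁))) (trans (col-vert _ _ p) (proj₂ (mixed s₂)))))
                , gain G)
              (λ ((a , p) , (b , q) , G) → x≢y p
                , (λ { true → cofacial true inj₁ (λ i → col-e (inj₁ i)) (λ _ → refl) p (S₀.eq₁ a)
                     ; false → cofacial false inj₂ (λ i → col-e (inj₂ i)) vert-e q (S₀.eq₂ b) })
                , gain G) C.result }

      level₂ : Separation vert side τ0 τ2 t x y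
      level₂ = Level₃.separation (core (Fin-finite c) αm βm' πAm πBm πA-pure πB-pure conn)

    level₁ : Separation vert side τ0 τ2 t x y
    level₁ = Level₂.level₂ (sides T₀.matching μ₀-sides) (sides T₂.matching μ₂-sides)

  level₀ : Separation vert side τ0 τ2 t x y
  level₀ = Level₁.level₁ (C₁.cut-paths τ0m) (C₁.cut-paths τ2m)

abstract
  separate : ∀ {Φ V : Set} (F : Finite Φ) (_≟ᵛ_ : (a b : V) → Dec (a ≡ b)) {τ0 τ2 t : Φ → Φ} →
    Matching τ0 → Matching τ2 → Matching t → {vert : Φ → V} {side : Φ → Bool} →
    Preserves vert τ2 → Preserves vert t → Preserves side τ0 → Preserves side τ2 →
    (∀ f g → vert f ≡ vert g → Cl (gr τ2 ∪ gr t) f g) → ∀ x y →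
    (∀ f g → vert f ≡ vert g → side f ≢ side g → vert f ≡ x ⊎ vert f ≡ y) → Separation vert side τ0 τ2 t x y
  separate F _≟ᵛ_ {t = t} τ0m τ2m tm {side = side} τ2v tv τ0s τ2s rot x y sh =
    Separate.level₀ F _≟ᵛ_ τ0m τ2m tm τ2v tv τ0s τ2s rot x y sh
      (enumerate F λ f → (side f Bool.≟ true) ×-dec (side (t f) Bool.≟ false))

-- The Boolean definitions as propositions

T-∧⁺ : ∀ {a b} → T a → T b → T (a ∧ b)
T-∧⁺ p q = Equivalence.from T-∧ (p , q)

T-∧⁻ : ∀ {a b} → T (a ∧ b) → T a × T b
T-∧⁻ = Equivalence.to T-∧

T-∨⁺ : ∀ {a b} → T a ⊎ T b → T (a ∨ b)
T-∨⁺ = Equivalence.from T-∨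

T-∨⁻ : ∀ {a b} → T (a ∨ b) → T a ⊎ T b
T-∨⁻ = Equivalence.to T-∨

T-not⁺ : ∀ {a} → ¬ T a → T (not a)
T-not⁺ {true} h = h tt
T-not⁺ {false} _ = tt

T-not⁻ : ∀ {a} → T (not a) → ¬ T a
T-not⁻ {false} _ = id

eqF⁺ : ∀ {n} {i j : Fin n} → i ≡ j → T (eqF i j)
eqF⁺ = fromWitness

eqF⁻ : ∀ {n} {i j : Fin n} → T (eqF i j) → i ≡ j
eqF⁻ = toWitness

anyFin⁺ : ∀ {n} {p : Fin n → Bool} i → T (p i) → T (anyFin p)
anyFin⁺ zero t = T-∨⁺ (inj₁ t)
anyFin⁺ (suc i) t = T-∨⁺ (inj₂ (anyFin⁺ i t))

anyFin⁻ : ∀ {n} {p : Fin n → Bool} → T (anyFin p) → Σ (Fin n) λ i → T (p i)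
anyFin⁻ {suc n} {p} t with T-∨⁻ {p zero} t
... | inj₁ q = zero , q
... | inj₂ q = let i , r = anyFin⁻ q in suc i , r

allFinᵇ⁺ : ∀ {n} {p : Fin n → Bool} → (∀ i → T (p i)) → T (allFinᵇ p)
allFinᵇ⁺ {zero} h = tt
allFinᵇ⁺ {suc n} h = T-∧⁺ (h zero) (allFinᵇ⁺ (h ∘ suc))

allFinᵇ⁻ : ∀ {n} {p : Fin n → Bool} → T (allFinᵇ p) → ∀ i → T (p i)
allFinᵇ⁻ {suc n} {p} t i with T-∧⁻ {p zero} t
allFinᵇ⁻ t zero | q , _ = q
allFinᵇ⁻ t (suc i) | _ , r = allFinᵇ⁻ r i

countFin-card : ∀ n (p : Fin n → Bool) → Σ (Enumeration (T ∘ p)) λ E → countFin p ≡ Enumeration.card E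
countFin-card zero p = enumerate-Fin 0 (T? ∘ p) , refl
countFin-card (suc n) p with countFin-card n (p ∘ suc) | p zero in eq
... | E , e | false = enum-skip E (subst T eq) , e
... | E , e | true = enum-cons E (subst T (sym eq) tt) , cong suc e

card-≤ : ∀ {A : Set} {P : A → Set} (E E' : Enumeration P) → Enumeration.card E ≤ Enumeration.card E'
card-≤ E E' = injective⇒≤ {f = λ i → proj₁ (at i)} λ {i} {j} e →
  E.elem-inj (trans (sym (proj₂ (at i))) (trans (cong E'.elem e) (proj₂ (at j))))
  where
  module E = Enumeration E
  module E' = Enumeration E'
  at : ∀ i → Σ (Fin E'.card) λ j → E'.elem j ≡ E.elem i
  at i = E'.elem-all (E.elem i) (E.elem-P i)

countFin-enum : ∀ {n} {p : Fin n → Bool} (E : Enumeration (T ∘ p)) → countFin p ≡ Enumeration.card E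
countFin-enum {n} {p} E = let E' , e = countFin-card n p in trans e (ℕₚ.≤-antisym (card-≤ E' E) (card-≤ E E'))

countFin-none : ∀ {n} {p : Fin n → Bool} → (∀ i → ¬ T (p i)) → countFin p ≡ 0
countFin-none h = countFin-enum record { card = 0 ; elem = λ () ; elem-inj = λ { {()} } ; elem-P = λ () ; elem-all = λ i t → ⊥-elim (h i t) }

countFin-≤ : ∀ {n} (p : Fin n → Bool) → countFin p ≤ n
countFin-≤ {n} p = let E , e = countFin-card n p in subst (_≤ n) (sym e) (injective⇒≤ (Enumeration.elem-inj E))

private
  bit : Bool → ℕ
  bit b = if b then 1 else 0

  bit-mono : ∀ {a b} → (T a → T b) → bit a ≤ bit b
  bit-mono {false} _ = z≤n
  bit-mono {true} {true} _ = ≤-refl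
  bit-mono {true} {false} h = ⊥-elim (h tt)

  bit-< : ∀ {a b} → ¬ T a → T b → bit a < bit b
  bit-< {false} {true} _ _ = ≤-refl
  bit-< {true} h _ = ⊥-elim (h tt)

countFin-mono : ∀ {n} {p q : Fin n → Bool} → (∀ i → T (p i) → T (q i)) → countFin p ≤ countFin q
countFin-mono {zero} h = z≤n
countFin-mono {suc n} h = +-mono-≤ (bit-mono (h zero)) (countFin-mono (h ∘ suc))

countFin-< : ∀ {n} {p q : Fin n → Bool} → (∀ i → T (p i) → T (q i)) → ∀ i → ¬ T (p i) → T (q i) → countFin p < countFin q
countFin-< h zero np tq = ℕₚ.+-mono-<-≤ (bit-< np tq) (countFin-mono (h ∘ suc))
countFin-< h (suc i) np tq = ℕₚ.+-mono-≤-< (bit-mono (h zero)) (countFin-< (h ∘ suc) i np tq)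

TR : ∀ {n} → (Fin n → Fin n → Bool) → Rel (Fin n)
TR R a b = T (R a b)

module _ {n : ℕ} (R : Fin n → Fin n → Bool) where

  reach-sound : ∀ k {f g} → T (reachᵇ R k f g) → Cl (TR R) f g
  reach-sound zero t = Cl-≡ (eqF⁻ t)
  reach-sound (suc k) {f} {g} t with T-∨⁻ {reachᵇ R k f g} t
  ... | inj₁ p = reach-sound k p
  ... | inj₂ q with anyFin⁻ q
  ... | h , u with T-∧⁻ {reachᵇ R k f h} u
  ... | v , w with T-∨⁻ {R h g} w
  ... | inj₁ r = reach-sound k v ∙ [ r ]
  ... | inj₂ r = reach-sound k v ∙ [ r ]⁻

  private
    Closed : Fin n → ℕ → Set
    Closed f k = ∀ h g → T (reachᵇ R k f h) → T (R h g ∨ R g h) → T (reachᵇ R k f g)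

    closed-suc : ∀ {f k} → Closed f k → ∀ g → T (reachᵇ R (suc k) f g) → T (reachᵇ R k f g)
    closed-suc {f} {k} C g t with T-∨⁻ {reachᵇ R k f g} t
    ... | inj₁ p = p
    ... | inj₂ q with anyFin⁻ q
    ... | h , u with T-∧⁻ {reachᵇ R k f h} u
    ... | v , w = C h g v w

    up : ∀ k {f g} → T (reachᵇ R k f g) → T (reachᵇ R (suc k) f g)
    up k p = T-∨⁺ (inj₁ p)

    -- Until the set reached in k steps is closed it has at least k + 1 elements. For k = n this is
    -- impossible, so n rounds of `reachᵇ` are enough.
    grow : ∀ f k → Closed f k ⊎ suc k ≤ countFin (reachᵇ R k f)
    grow f zero = inj₂ (subst (_≤ countFin (eqF f)) (cong suc (countFin-none {n} {λ _ → false} λ _ x → x))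
                          (countFin-< {p = λ _ → false} (λ _ ()) f (λ x → x) (eqF⁺ refl)))
    grow f (suc k) with grow f k
    ... | inj₁ C = inj₁ λ h g t r → up k {f} (C h g (closed-suc {f} {k} C h t) r)
    ... | inj₂ le with any? (λ g → T? (reachᵇ R (suc k) f g) ×-dec ¬? (T? (reachᵇ R k f g)))
    ... | yes (g , a , b) = inj₂ (≤-trans (s≤s le) (countFin-< {p = reachᵇ R k f} (λ i → up k) g b a))
    ... | no none = inj₁ λ h g t r → T-∨⁺ {reachᵇ R k f g} (inj₂ (anyFin⁺ h (T-∧⁺ (drop h t) r)))
      where
      drop : ∀ h → T (reachᵇ R (suc k) f h) → T (reachᵇ R k f h)
      drop h t with T? (reachᵇ R k f h)
      ... | yes p = p
      ... | no np = ⊥-elim (none (h , t , np))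

  reach-refl : ∀ k {f} → T (reachᵇ R k f f)
  reach-refl zero = eqF⁺ refl
  reach-refl (suc k) {f} = up k (reach-refl k {f})

  sameClass-complete : ∀ {f g} → Cl (TR R) f g → T (sameClassᵇ R f g)
  sameClass-complete {f} = go (reach-refl n {f})
    where
    C : Closed f n
    C with grow f n
    ... | inj₁ C = C
    ... | inj₂ le = ⊥-elim (ℕₚ.<⇒≱ le (countFin-≤ (reachᵇ R n f)))
    go : ∀ {a b} → T (reachᵇ R n f a) → Cl (TR R) a b → T (reachᵇ R n f b)
    go t ε = t
    go {a} t (fwd {b = b} r p) = go (C a b t (T-∨⁺ (inj₁ r))) p
    go {a} t (bwd {b = b} r p) = go (C a b t (T-∨⁺ {R a b} (inj₂ r))) p

  sameClass-sound : ∀ {f g} → T (sameClassᵇ R f g) → Cl (TR R) f g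
  sameClass-sound = reach-sound n

least : ∀ {n} {P : Fin n → Set} → (∀ i → Dec (P i)) → Σ (Fin n) P → Σ (Fin n) λ i → P i × (∀ j → toℕ j < toℕ i → ¬ P j)
least {suc n} P? (i , p) with P? zero
... | yes q = zero , q , λ _ ()
least {suc n} P? (zero , p) | no nq = ⊥-elim (nq p)
least {suc n} P? (suc i , p) | no nq with least (P? ∘ suc) (i , p)
... | j , r , h = suc j , r , λ { zero _ → nq ; (suc k) (s≤s lt) → h k lt }

-- `classCount` counts the elements without a smaller one in their class, that is, the least
-- elements of the classes.
classCount-≡ : ∀ {n} {R : Fin n → Fin n → Bool} {k} → NCl (TR R) k → classCount n R ≡ k
classCount-≡ {n} {R} {k} N = countFin-enum record
  { card = k ; elem = el ; elem-inj = λ {i} {j} e → trans (sym (cls-el i)) (trans (cong cls e) (cls-el j))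
  ; elem-P = λ i → T-not⁺ λ t → let g , u = anyFin⁻ t ; v , w = T-∧⁻ {toℕ g <ᵇ toℕ (el i)} u in
      minimal i g (<ᵇ⇒< _ _ v) (trans (sound* (sameClass-sound R w)) (cls-el i))
  ; elem-all = λ a t → cls a , eq a (λ lt → T-not⁻ t (anyFin⁺ (el (cls a)) (T-∧⁺ (<⇒<ᵇ lt) (sameClass-complete R (complete (cls-el (cls a))))))) }
  where
  open NCl N
  min : ∀ i → Σ (Fin n) λ f → cls f ≡ i × (∀ g → toℕ g < toℕ f → cls g ≢ i)
  min i = least (λ f → cls f ≟ i) (rep i , cls-rep i)
  el : Fin k → Fin n
  el i = proj₁ (min i)
  cls-el : ∀ i → cls (el i) ≡ i
  cls-el i = proj₁ (proj₂ (min i))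
  minimal : ∀ i g → toℕ g < toℕ (el i) → cls g ≢ i
  minimal i = proj₂ (proj₂ (min i))
  eq : ∀ a → ¬ (toℕ (el (cls a)) < toℕ a) → el (cls a) ≡ a
  eq a nlt with ℕₚ.<-cmp (toℕ (el (cls a))) (toℕ a)
  ... | tri< lt _ _ = ⊥-elim (nlt lt)
  ... | tri≈ _ e _ = toℕ-injective e
  ... | tri> _ _ gt = ⊥-elim (minimal (cls a) a gt refl)

minList-≤ : ∀ {l a} → a ∈ l → minList l ≤ a
minList-≤ {a ∷ []} (Any.here refl) = ≤-refl
minList-≤ {a ∷ b ∷ l} (Any.here refl) = m⊓n≤m a _
minList-≤ {a ∷ b ∷ l} (Any.there p) = ≤-trans (m⊓n≤n a _) (minList-≤ p)

minList-∈ : ∀ a l → minList (a ∷ l) ∈ a ∷ l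
minList-∈ a [] = Any.here refl
minList-∈ a (b ∷ l) with minList-∈ b l | ⊓-sel a (minList (b ∷ l))
... | _ | inj₁ e = Any.here e
... | m | inj₂ e = Any.there (subst (_∈ b ∷ l) (sym e) m)

allFuns-∋ : ∀ N M (f : Fin N → Fin M) → Σ (Fin N → Fin M) λ g → g ∈ allFuns N M × (∀ i → g i ≡ f i)
allFuns-∋ zero M f = _ , Any.here refl , λ ()
allFuns-∋ (suc N) M f with allFuns-∋ N M (f ∘ suc)
... | g , m , h = _ , ∈-concatMap⁺ _ (Any.map (λ { refl → ∈-map⁺ _ (∈-allFin (f zero)) }) m) , λ { zero → refl ; (suc i) → h i }

-- `key` tells from which x an entry stems, so different blocks are disjoint.
concatMap-unique : ∀ {A B : Set} (f : A → List B) (key : B → A) → (∀ x {b} → b ∈ f x → key b ≡ x) → (∀ x → Unique (f x)) →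
  ∀ {xs} → Unique xs → Unique (concatMap f xs)
concatMap-unique f key k u {[]} _ = []
concatMap-unique f key k u {x ∷ xs} (x∉ ∷ uxs) = ++⁺ (u x) (concatMap-unique f key k u uxs) disjoint
  where
  disjoint : ∀ {b} → ¬ (b ∈ f x × b ∈ concatMap f xs)
  disjoint (p , q) = go x∉ (∈-concatMap⁻ f q)
    where
    go : ∀ {ys} → All.All (x ≢_) ys → ¬ Any (λ y → _ ∈ f y) ys
    go (ne All.∷ _) (Any.here r) = ne (trans (sym (k x p)) (k _ r))
    go (_ All.∷ nes) (Any.there r) = go nes r

lookup-injective : ∀ {A : Set} {xs : List A} → Unique xs → ∀ i j → lookup xs i ≡ lookup xs j → i ≡ j
lookup-injective {xs = x ∷ xs} _ zero zero _ = refl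
lookup-injective {xs = x ∷ xs} (ne ∷ _) zero (suc j) e = ⊥-elim (All.lookup ne (subst (_∈ xs) (sym e) (∈-lookup j)) refl)
lookup-injective {xs = x ∷ xs} (ne ∷ _) (suc i) zero e = ⊥-elim (All.lookup ne (subst (_∈ xs) e (∈-lookup i)) refl)
lookup-injective {xs = x ∷ xs} (_ ∷ u) (suc i) (suc j) e = cong suc (lookup-injective u i j e)

-- Flags of a graph

module _ (G : Graph) where
  E-sym : ∀ {p q} → T (E G p q) → T (E G q p)
  E-sym {p} {q} t with T-∧⁻ {not (eqF p q)} t
  ... | a , b with T-∨⁻ {adj G p q} b
  ... | inj₁ c = T-∧⁺ (T-not⁺ λ e → T-not⁻ a (eqF⁺ (sym (eqF⁻ e)))) (T-∨⁺ {adj G q p} (inj₂ c))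
  ... | inj₂ c = T-∧⁺ (T-not⁺ λ e → T-not⁻ a (eqF⁺ (sym (eqF⁻ e)))) (T-∨⁺ {adj G q p} (inj₁ c))

  E-irrefl : ∀ {p q} → T (E G p q) → p ≢ q
  E-irrefl {p} {q} t e = T-not⁻ (proj₁ (T-∧⁻ {not (eqF p q)} t)) (eqF⁺ e)

  private
    inner : Fin (n G) → Fin (n G) → List (Fin (n G) × Fin (n G))
    inner i j = if (toℕ i <ᵇ toℕ j) ∧ E G i j then (i , j) ∷ [] else []

    inner-∈ : ∀ i j {b} → b ∈ inner i j → b ≡ (i , j) × T ((toℕ i <ᵇ toℕ j) ∧ E G i j)
    inner-∈ i j p with (toℕ i <ᵇ toℕ j) ∧ E G i j
    inner-∈ i j (Any.here refl) | true = refl , tt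

    outer : Fin (n G) → List (Fin (n G) × Fin (n G))
    outer i = concatMap (inner i) (allFin (n G))

    outer-∈ : ∀ i {b} → b ∈ outer i → Σ (Fin (n G)) λ j → b ≡ (i , j) × T ((toℕ i <ᵇ toℕ j) ∧ E G i j)
    outer-∈ i p = let j , q = Any.satisfied (∈-concatMap⁻ (inner i) {xs = allFin (n G)} p) in j , inner-∈ i j q

  edge-∈ : ∀ {b} → b ∈ edgeList G → T (E G (proj₁ b) (proj₂ b)) × toℕ (proj₁ b) < toℕ (proj₂ b)
  edge-∈ p with Any.satisfied (∈-concatMap⁻ outer {xs = allFin (n G)} p)
  ... | i , q with outer-∈ i q
  ... | j , refl , t = proj₂ (T-∧⁻ {toℕ i <ᵇ toℕ j} t) , <ᵇ⇒< _ _ (proj₁ (T-∧⁻ {toℕ i <ᵇ toℕ j} t))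

  edge-∋ : ∀ {i j} → T (E G i j) → toℕ i < toℕ j → (i , j) ∈ edgeList G
  edge-∋ {i} {j} t lt = ∈-concatMap⁺ outer (Any.map (λ { refl → ∈-concatMap⁺ (inner i) (Any.map (λ { refl → here′ }) (∈-allFin j)) }) (∈-allFin i))
    where
    here′ : (i , j) ∈ inner i j
    here′ with (toℕ i <ᵇ toℕ j) ∧ E G i j | T-∧⁺ {toℕ i <ᵇ toℕ j} {E G i j} (<⇒<ᵇ lt) t
    ... | true | _ = Any.here refl

  edge-unique : Unique (edgeList G)
  edge-unique = concatMap-unique outer proj₁ (λ i p → let _ , e , _ = outer-∈ i p in cong proj₁ e)
    (λ i → concatMap-unique (inner i) proj₂ (λ j p → cong proj₂ (proj₁ (inner-∈ i j p))) (single i) (allFin⁺ (n G))) (allFin⁺ (n G))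
    where
    single : ∀ i j → Unique (inner i j)
    single i j with (toℕ i <ᵇ toℕ j) ∧ E G i j
    ... | true = All.[] ∷ []
    ... | false = []

  private
    fst snd : Fin (nEdges G) → Fin (n G)
    fst e = proj₁ (lookup (edgeList G) e)
    snd e = proj₂ (lookup (edgeList G) e)

    Dec3 : Set
    Dec3 = Fin (nEdges G) × Fin 2 × Fin 2

    enc : Dec3 → Flag G
    enc (e , a , s) = encode G e a s

    decode-enc : ∀ d → decode G (enc d) ≡ d
    decode-enc (e , a , s) = trans
      (cong (λ z → let b = remQuot {nEdges G} 2 (proj₁ z) in proj₁ b , proj₂ b , proj₂ z) (remQuot-combine (combine e a) s))
      (cong (λ z → proj₁ z , proj₂ z , s) (remQuot-combine e a))

    enc-decode : ∀ f → enc (decode G f) ≡ f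
    enc-decode f = trans
      (cong (λ z → combine z (proj₂ (remQuot {nEdges G * 2} 2 f))) (combine-remQuot {nEdges G} 2 (proj₁ (remQuot {nEdges G * 2} 2 f))))
      (combine-remQuot {nEdges G * 2} 2 f)

    τ0-dec : ∀ f → decode G (τ0 G f) ≡ (proj₁ (decode G f) , opposite (proj₁ (proj₂ (decode G f))) , proj₂ (proj₂ (decode G f)))
    τ0-dec f = decode-enc (proj₁ (decode G f) , opposite (proj₁ (proj₂ (decode G f))) , proj₂ (proj₂ (decode G f)))

    τ2-dec : ∀ f → decode G (τ2 G f) ≡ (proj₁ (decode G f) , proj₁ (proj₂ (decode G f)) , opposite (proj₂ (proj₂ (decode G f))))
    τ2-dec f = decode-enc (proj₁ (decode G f) , proj₁ (proj₂ (decode G f)) , opposite (proj₂ (proj₂ (decode G f))))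

    end : Fin 2 → Fin (nEdges G) → Fin (n G)
    end zero = fst
    end (suc _) = snd

    vertex-dec : ∀ f → flagVertex G f ≡ end (proj₁ (proj₂ (decode G f))) (proj₁ (decode G f))
    vertex-dec f with proj₁ (proj₂ (decode G f))
    ... | zero = refl
    ... | suc zero = refl

    dec-inj : ∀ {f g} → decode G f ≡ decode G g → f ≡ g
    dec-inj {f} {g} p = trans (sym (enc-decode f)) (trans (cong enc p) (enc-decode g))

    opp≢ : ∀ (a : Fin 2) → opposite a ≢ a
    opp≢ zero ()
    opp≢ (suc zero) ()

  flagSide : Flag G → Fin 2
  flagSide f = proj₂ (proj₂ (decode G f))

  abstract
    τ0-matching : Matching (τ0 G)
    τ0-matching = record
      { inv = λ f → dec-inj (trans (τ0-dec (τ0 G f)) (trans (cong (λ (e , a , s) → e , opposite a , s) (τ0-dec f))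
                (cong (λ a → proj₁ (decode G f) , a , flagSide f) (opposite-involutive _))))
      ; irr = λ f p → opp≢ _ (trans (sym (cong (proj₁ ∘ proj₂) (τ0-dec f))) (cong (proj₁ ∘ proj₂ ∘ decode G) p)) }

    τ2-matching : Matching (τ2 G)
    τ2-matching = record
      { inv = λ f → dec-inj (trans (τ2-dec (τ2 G f)) (trans (cong (λ (e , a , s) → e , a , opposite s) (τ2-dec f))
                (cong (λ s → proj₁ (decode G f) , proj₁ (proj₂ (decode G f)) , s) (opposite-involutive _))))
      ; irr = λ f p → opp≢ _ (trans (sym (cong (proj₂ ∘ proj₂) (τ2-dec f))) (cong (proj₂ ∘ proj₂ ∘ decode G) p)) }

    side-τ0 : ∀ f → flagSide (τ0 G f) ≡ flagSide f
    side-τ0 f = cong (proj₂ ∘ proj₂) (τ0-dec f)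

    side-τ2 : ∀ f → flagSide (τ2 G f) ≡ opposite (flagSide f)
    side-τ2 f = cong (proj₂ ∘ proj₂) (τ2-dec f)

    vertex-τ2 : ∀ f → flagVertex G (τ2 G f) ≡ flagVertex G f
    vertex-τ2 f = trans (vertex-dec _) (trans (cong (λ (e , a , _) → end a e) (τ2-dec f)) (sym (vertex-dec f)))

    private
      vertex-τ0 : ∀ f → flagVertex G (τ0 G f) ≡ end (opposite (proj₁ (proj₂ (decode G f)))) (proj₁ (decode G f))
      vertex-τ0 f = trans (vertex-dec _) (cong (λ (e , a , _) → end a e) (τ0-dec f))

    vertex-τ0τ2 : ∀ f → flagVertex G (τ0 G (τ2 G f)) ≡ flagVertex G (τ0 G f)
    vertex-τ0τ2 f = trans (vertex-τ0 (τ2 G f)) (trans (cong (λ (e , a , _) → end (opposite a) e) (τ2-dec f)) (sym (vertex-τ0 f)))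

    private
      lookup-edge : ∀ e → T (E G (fst e) (snd e)) × toℕ (fst e) < toℕ (snd e)
      lookup-edge e = edge-∈ (∈-lookup e)

    flag-edge : ∀ f → T (E G (flagVertex G f) (flagVertex G (τ0 G f)))
    flag-edge f = subst₂ (λ u v → T (E G u v)) (sym (vertex-dec f)) (sym (vertex-τ0 f)) (go (proj₁ (proj₂ (decode G f))))
      where
      go : ∀ a → T (E G (end a (proj₁ (decode G f))) (end (opposite a) (proj₁ (decode G f))))
      go zero = proj₁ (lookup-edge _)
      go (suc zero) = E-sym (proj₁ (lookup-edge _))

    flag-unique : ∀ {f g} → flagVertex G f ≡ flagVertex G g → flagVertex G (τ0 G f) ≡ flagVertex G (τ0 G g) → flagSide f ≡ flagSide g → f ≡ g
    flag-unique {f} {g} p q r = dec-inj (go (decode G f) (decode G g)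
        (trans (sym (vertex-dec f)) (trans p (vertex-dec g))) (trans (sym (vertex-τ0 f)) (trans q (vertex-τ0 g))) r)
      where
      same : ∀ {e e'} → fst e ≡ fst e' → snd e ≡ snd e' → e ≡ e'
      same u v = lookup-injective edge-unique _ _ (cong₂ _,_ u v)
      go : ∀ (d d' : Dec3) → end (proj₁ (proj₂ d)) (proj₁ d) ≡ end (proj₁ (proj₂ d')) (proj₁ d') →
           end (opposite (proj₁ (proj₂ d))) (proj₁ d) ≡ end (opposite (proj₁ (proj₂ d'))) (proj₁ d') → proj₂ (proj₂ d) ≡ proj₂ (proj₂ d') → d ≡ d'
      go (e , zero , s) (e' , zero , .s) u v refl = cong (λ e → e , zero , s) (same u v)
      go (e , suc zero , s) (e' , suc zero , .s) u v refl = cong (λ e → e , suc zero , s) (same v u)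
      -- Two opposite orientations of one edge are not both listed, since every entry has its
      -- smaller end first.
      go (e , zero , s) (e' , suc zero , .s) u v refl = ⊥-elim (ℕₚ.<-asym (proj₂ (lookup-edge e))
        (subst₂ _<_ (cong toℕ (sym v)) (cong toℕ (sym u)) (proj₂ (lookup-edge e'))))
      go (e , suc zero , s) (e' , zero , .s) u v refl = ⊥-elim (ℕₚ.<-asym (proj₂ (lookup-edge e))
        (subst₂ _<_ (cong toℕ (sym u)) (cong toℕ (sym v)) (proj₂ (lookup-edge e'))))

    mkFlag : ∀ {p q} → T (E G p q) → ∀ s → Σ (Flag G) λ f → flagVertex G f ≡ p × flagVertex G (τ0 G f) ≡ q × flagSide f ≡ s
    mkFlag {p} {q} t s with ℕₚ.<-cmp (toℕ p) (toℕ q)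
    ... | tri≈ _ e _ = ⊥-elim (E-irrefl t (toℕ-injective e))
    ... | tri< lt _ _ = at (Any.index m) (Anyₚ.lookup-index m)
      where
      m : (p , q) ∈ edgeList G
      m = edge-∋ t lt
      at : ∀ e → (p , q) ≡ lookup (edgeList G) e → Σ (Flag G) λ f → flagVertex G f ≡ p × flagVertex G (τ0 G f) ≡ q × flagSide f ≡ s
      at e u = enc (e , zero , s)
        , trans (vertex-dec _) (trans (cong (λ (e , a , _) → end a e) (decode-enc (e , zero , s))) (cong proj₁ (sym u)))
        , trans (vertex-τ0 _) (trans (cong (λ (e , a , _) → end (opposite a) e) (decode-enc (e , zero , s))) (cong proj₂ (sym u)))
        , cong (proj₂ ∘ proj₂) (decode-enc (e , zero , s))
    ... | tri> _ _ lt = at (Any.index m) (Anyₚ.lookup-index m)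
      where
      m : (q , p) ∈ edgeList G
      m = edge-∋ (E-sym t) lt
      at : ∀ e → (q , p) ≡ lookup (edgeList G) e → Σ (Flag G) λ f → flagVertex G f ≡ p × flagVertex G (τ0 G f) ≡ q × flagSide f ≡ s
      at e u = enc (e , suc zero , s)
        , trans (vertex-dec _) (trans (cong (λ (e , a , _) → end a e) (decode-enc (e , suc zero , s))) (cong proj₂ (sym u)))
        , trans (vertex-τ0 _) (trans (cong (λ (e , a , _) → end (opposite a) e) (decode-enc (e , suc zero , s))) (cong proj₁ (sym u)))
        , cong (proj₂ ∘ proj₂) (decode-enc (e , suc zero , s))

    edge-classes : NCl (gr (τ0 G) ∪ gr (τ2 G)) (nEdges G)
    edge-classes = record
      { cls = λ f → proj₁ (decode G f) ; rep = λ e → enc (e , zero , zero) ; cls-rep = λ e → cong proj₁ (decode-enc (e , zero , zero))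
      ; sound = λ { {f} (inj₁ refl) → sym (cong proj₁ (τ0-dec f)) ; {f} (inj₂ refl) → sym (cong proj₁ (τ2-dec f)) }
      ; complete = λ {f} {g} p → norm f ∙ Cl-≡ (cong (λ e → enc (e , zero , zero)) p) ∙ norm g ⁻ }
      where
      R : Rel (Flag G)
      R = gr (τ0 G) ∪ gr (τ2 G)
      flip0 : ∀ e s → Cl R (enc (e , suc zero , s)) (enc (e , zero , s))
      flip0 e s = [ inj₁ (dec-inj (trans (τ0-dec _) (trans (cong (λ (e , a , s) → e , opposite a , s) (decode-enc (e , suc zero , s))) (sym (decode-enc (e , zero , s)))))) ]
      flip2 : ∀ e a → Cl R (enc (e , a , suc zero)) (enc (e , a , zero))
      flip2 e a = [ inj₂ (dec-inj (trans (τ2-dec _) (trans (cong (λ (e , a , s) → e , a , opposite s) (decode-enc (e , a , suc zero))) (sym (decode-enc (e , a , zero)))))) ]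
      norm′ : ∀ e a s → Cl R (enc (e , a , s)) (enc (e , zero , zero))
      norm′ e zero zero = ε
      norm′ e zero (suc zero) = flip2 e zero
      norm′ e (suc zero) zero = flip0 e zero
      norm′ e (suc zero) (suc zero) = flip0 e (suc zero) ∙ flip2 e zero
      norm : ∀ f → Cl R f (enc (proj₁ (decode G f) , zero , zero))
      norm f = subst (λ g → Cl R g (enc (proj₁ (decode G f) , zero , zero))) (enc-decode f) (norm′ (proj₁ (decode G f)) (proj₁ (proj₂ (decode G f))) (flagSide f))

-- Embeddings and their Euler genus

record IsEmb {Φ V : Set} (a2 : Φ → Φ) (v : Φ → V) (t : Φ → Φ) : Set where
  field
    matching : Matching t
    pure     : Preserves v t
    rot      : ∀ f g → v f ≡ v g → Cl (gr a2 ∪ gr t) f g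

-- On such graphs the Euler genus of an embedding is 2 - |V| + |E| - |F|.
record Nice (G : Graph) : Set where
  field
    conn : ∀ a b → Cl (TR (E G)) a b
    nbr  : ∀ v → Σ (Fin (n G)) λ u → T (E G v u)

module _ (G : Graph) (N : Nice G) where
  private module N = Nice N

  components-1 : components G ≡ 1
  components-1 = classCount-≡ record
    { cls = λ _ → zero ; rep = λ _ → x G ; cls-rep = λ { zero → refl } ; sound = λ _ → refl ; complete = λ _ → N.conn _ _ }

  isolated-0 : isolated G ≡ 0
  isolated-0 = countFin-none λ i t → T-not⁻ t (let u , e = N.nbr i in anyFin⁺ u e)

  embGenus-≡ : ∀ {t F} → NCl (gr (τ0 G) ∪ gr t) F → embGenus G t ≡ (2 + nEdges G) ∸ (n G + F)
  embGenus-≡ {t} {F} P = cong₂ _∸_ (cong (λ c → 2 * c + nEdges G) components-1)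
      (trans (cong (n G + faces G t +_) isolated-0) (trans (+-identityʳ _) (cong (n G +_) faces-≡)))
    where
    faces-≡ : faces G t ≡ F
    faces-≡ = classCount-≡ (NCl-Equiv (Equiv-id
      (λ { (inj₁ e) → [ T-∨⁺ (inj₁ (eqF⁺ e)) ] ; {a} {b} (inj₂ e) → [ T-∨⁺ {eqF (τ0 G a) b} (inj₂ (eqF⁺ e)) ] })
      (λ {a} {b} r → [ map⊎ eqF⁻ eqF⁻ (T-∨⁻ {eqF (τ0 G a) b} r) ])) P)

  private
    genRel⁺ : ∀ {t : Flag G → Flag G} {a b} → Cl (gr (τ2 G) ∪ gr t) a b → Cl (TR (genRel t (τ2 G))) a b
    genRel⁺ {t} = Cl-mono λ { {a} {b} (inj₁ e) → T-∨⁺ {eqF (t a) b} (inj₂ (eqF⁺ e)) ; (inj₂ e) → T-∨⁺ (inj₁ (eqF⁺ e)) }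

    genRel⁻ : ∀ {t : Flag G → Flag G} {a b} → Cl (TR (genRel t (τ2 G))) a b → Cl (gr (τ2 G) ∪ gr t) a b
    genRel⁻ {t} = Cl-mono λ {a} {b} r → [ (λ e → inj₂ (eqF⁻ e)) , (λ e → inj₁ (eqF⁻ e)) ]′ (T-∨⁻ {eqF (t a) b} r)

  valid⇒emb : ∀ {t} → T (validEmb G t) → IsEmb (τ2 G) (flagVertex G) t
  valid⇒emb {t} v with T-∧⁻ {allFinᵇ (λ f → eqF (t (t f)) f ∧ not (eqF (t f) f) ∧ eqF (flagVertex G (t f)) (flagVertex G f))} v
  ... | a , b = record
    { matching = record { inv = λ f → eqF⁻ (proj₁ (at f)) ; irr = λ f e → T-not⁻ (proj₁ (T-∧⁻ {not (eqF (t f) f)} (proj₂ (at f)))) (eqF⁺ e) }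
    ; pure = λ f → eqF⁻ (proj₂ (T-∧⁻ {not (eqF (t f) f)} (proj₂ (at f))))
    ; rot = λ f g e → [ (λ r → ⊥-elim (T-not⁻ r (eqF⁺ e))) , (λ r → genRel⁻ (sameClass-sound (genRel t (τ2 G)) r)) ]′
              (T-∨⁻ {not (eqF (flagVertex G f) (flagVertex G g))} (allFinᵇ⁻ (allFinᵇ⁻ b f) g)) }
    where
    at : ∀ f → T (eqF (t (t f)) f) × T (not (eqF (t f) f) ∧ eqF (flagVertex G (t f)) (flagVertex G f))
    at f = T-∧⁻ {eqF (t (t f)) f} (allFinᵇ⁻ a f)

  emb⇒valid : ∀ {t} → IsEmb (τ2 G) (flagVertex G) t → T (validEmb G t)
  emb⇒valid {t} e = T-∧⁺ (allFinᵇ⁺ λ f → T-∧⁺ (eqF⁺ (inv f)) (T-∧⁺ (T-not⁺ λ p → irr f (eqF⁻ p)) (eqF⁺ (E.pure f))))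
                         (allFinᵇ⁺ λ f → allFinᵇ⁺ λ g → same f g)
    where
    module E = IsEmb e
    open Matching E.matching
    same : ∀ f g → T (not (eqF (flagVertex G f) (flagVertex G g)) ∨ sameClassᵇ (genRel t (τ2 G)) f g)
    same f g with flagVertex G f ≟ flagVertex G g
    ... | yes p = sameClass-complete (genRel t (τ2 G)) (genRel⁺ (E.rot f g p))
    ... | no _ = tt

  flag-at : ∀ v → Σ (Flag G) λ f → flagVertex G f ≡ v
  flag-at v = let u , e = N.nbr v ; f , p , _ = mkFlag G e zero in f , p

  module _ {t : Flag G → Flag G} (e : IsEmb (τ2 G) (flagVertex G) t) where
    private module e = IsEmb e

    vertex-classes : NCl (gr (τ2 G) ∪ gr t) (n G)
    vertex-classes = record
      { cls = flagVertex G ; rep = λ v → proj₁ (flag-at v) ; cls-rep = λ v → proj₂ (flag-at v)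
      ; sound = λ r → Cl-preserves (vertex-τ2 G) e.pure [ r ] ; complete = λ p → e.rot _ _ p }

    connected-flags : ∀ f g → Cl ((gr (τ0 G) ∪ gr (τ2 G)) ∪ gr t) f g
    connected-flags f g = go f (N.conn (flagVertex G f) (flagVertex G g))
      where
      R = (gr (τ0 G) ∪ gr (τ2 G)) ∪ gr t
      rot : ∀ {f g} → flagVertex G f ≡ flagVertex G g → Cl R f g
      rot p = Cl-mono (λ { (inj₁ r) → inj₁ (inj₂ r) ; (inj₂ r) → inj₂ r }) (e.rot _ _ p)
      edge-step : ∀ {p q} → T (E G p q) → ∀ f → flagVertex G f ≡ p → Σ (Flag G) λ h → flagVertex G h ≡ q × Cl R f h
      edge-step t f a = let h , b , c , _ = mkFlag G t zero in τ0 G h , c , rot (trans a (sym b)) ∙ [ inj₁ (inj₁ refl) ]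
      walk : ∀ {p q} → Cl (TR (E G)) p q → ∀ f → flagVertex G f ≡ p → Σ (Flag G) λ h → flagVertex G h ≡ q × Cl R f h
      walk ε f a = f , a , ε
      walk (fwd r p) f a = let h , b , c = edge-step r f a ; k , d , u = walk p h b in k , d , c ∙ u
      walk (bwd r p) f a = let h , b , c = edge-step (E-sym G r) f a ; k , d , u = walk p h b in k , d , c ∙ u
      go : ∀ f → Cl (TR (E G)) (flagVertex G f) (flagVertex G g) → Cl R f g
      go f p = let h , b , c = walk p f refl in c ∙ rot b

    -- The inequality for three matchings on 4|E| flags with a single component; the three numbers
    -- of classes are those of edges, vertices and faces. It makes the truncated subtraction in
    -- `embGenus` exact.
    euler-genus : ∀ {F} → NCl (gr (τ0 G) ∪ gr t) F → n G + F ≤ 2 + nEdges G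
    euler-genus {F} P = +-cancelˡ-≤ (nEdges G) _ _ (*-cancelˡ-≤ 2 (begin
      2 * (nEdges G + (n G + F)) ≡⟨ cong (2 *_) (sym (ℕₚ.+-assoc (nEdges G) (n G) F)) ⟩
      2 * (nEdges G + n G + F) ≤⟨ euler (nFlags G) (τ0-matching G) (τ2-matching G) e.matching (edge-classes G) vertex-classes P one ⟩
      nEdges G * 2 * 2 + 4 * 1 ≡⟨ lem (nEdges G) ⟩
      2 * (nEdges G + (2 + nEdges G)) ∎))
      where
      open ≤-Reasoning
      lem : ∀ e → e * 2 * 2 + 4 * 1 ≡ 2 * (e + (2 + e))
      lem = solve-∀
      one : NCl ((gr (τ0 G) ∪ gr (τ2 G)) ∪ gr t) 1
      one = record { cls = λ _ → zero ; rep = λ _ → proj₁ (flag-at (x G)) ; cls-rep = λ { zero → refl } ; sound = λ _ → refl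
                   ; complete = λ _ → connected-flags _ _ }

  private
    candidates : List ℕ
    candidates = map (embGenus G) (filterᵇ (validEmb G) (allFuns (nFlags G) (nFlags G)))

    emb-≗ : ∀ {t s : Flag G → Flag G} → (∀ i → s i ≡ t i) → IsEmb (τ2 G) (flagVertex G) t → IsEmb (τ2 G) (flagVertex G) s
    emb-≗ {t} {s} h e = record
      { matching = record { inv = λ f → trans (h _) (trans (cong t (h f)) (inv f)) ; irr = λ f p → irr f (trans (sym (h f)) p) }
      ; pure = λ f → trans (cong (flagVertex G) (h f)) (E.pure f)
      ; rot = λ f g p → Cl-mono (λ { (inj₁ r) → inj₁ r ; {a} (inj₂ r) → inj₂ (trans (h a) r) }) (E.rot f g p) }
      where
      module E = IsEmb e
      open Matching E.matching

    -- `allFuns` contains t only up to pointwise equality, so everything is transferred to the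
    -- listed copy s.
    listed : ∀ {t} → IsEmb (τ2 G) (flagVertex G) t → ∀ {F} → NCl (gr (τ0 G) ∪ gr t) F →
      ((2 + nEdges G) ∸ (n G + F)) ∈ candidates
    listed {t} e P with allFuns-∋ (nFlags G) (nFlags G) t
    ... | s , m , h = subst (_∈ candidates) (embGenus-≡ {s} (NCl-Equiv (Equiv-id
            (λ { (inj₁ r) → [ inj₁ r ] ; {a} (inj₂ r) → [ inj₂ (trans (h a) r) ] })
            (λ { (inj₁ r) → [ inj₁ r ] ; {a} (inj₂ r) → [ inj₂ (trans (sym (h a)) r) ] })) P))
          (∈-map⁺ (embGenus G) (∈-filter⁺ (T? ∘ validEmb G) m (emb⇒valid (emb-≗ h e))))

  eg-bound : ∀ {t F g} → IsEmb (τ2 G) (flagVertex G) t → NCl (gr (τ0 G) ∪ gr t) F → 2 + nEdges G ≤ n G + F + g → eg G ≤ g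
  eg-bound {F = F} {g} e P le = ≤-trans (minList-≤ (listed e P)) (m≤n+o⇒m∸n≤o (2 + nEdges G) (n G + F) le)

  record Optimal : Set where
    field
      t     : Flag G → Flag G
      emb   : IsEmb (τ2 G) (flagVertex G) t
      F     : ℕ
      count : NCl (gr (τ0 G) ∪ gr t) F
      genus : n G + F + eg G ≡ 2 + nEdges G

  -- The search space is not empty: starting from τ2 itself, rotations are merged until each vertex has only one.
  optimal : Optimal
  optimal = from-∈ (candidates) refl (listed emb₀ (proj₂ P₀))
    where
    C = connect (Fin-finite _) _≟_ (flagVertex G) (τ2-matching G) (τ2-matching G) (vertex-τ2 G) (proj₂ (NCl-gr₂ (Fin-finite _) (τ2 G) (τ2 G)))
    module C = Joined C
    emb₀ : IsEmb (τ2 G) (flagVertex G) C.β'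
    emb₀ = record { matching = C.matching ; pure = C.pure ; rot = C.conn }
    P₀ = NCl-gr₂ (Fin-finite _) (τ0 G) C.β'
    from-eq : ∀ {t} → T (validEmb G t) → embGenus G t ≡ eg G → Optimal
    from-eq {t} v q = record
      { t = t ; emb = valid⇒emb v ; F = proj₁ P ; count = proj₂ P
      ; genus = trans (cong (n G + proj₁ P +_) (trans (sym q) (embGenus-≡ (proj₂ P)))) (m+[n∸m]≡n (euler-genus (valid⇒emb v) (proj₂ P))) }
      where P = NCl-gr₂ (Fin-finite _) (τ0 G) t
    from-∈ : ∀ l {a} → l ≡ candidates → a ∈ l → Optimal
    from-∈ (b ∷ l) eq _ with ∈-map⁻ (embGenus G) (subst (minList (b ∷ l) ∈_) eq (minList-∈ b l))
    ... | t , m , p = from-eq (proj₂ (∈-filter⁻ (T? ∘ validEmb G) {xs = allFuns (nFlags G) (nFlags G)} m)) (trans (sym p) (cong minList eq))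

-- Flag spaces that represent a graph

record Space {Φ V : Set} (a0 a2 : Φ → Φ) (v : Φ → V) (sd : Φ → Fin 2) : Set where
  field
    a0m    : Matching a0
    a2m    : Matching a2
    v-a2   : ∀ f → v (a2 f) ≡ v f
    v-a0a2 : ∀ f → v (a0 (a2 f)) ≡ v (a0 f)
    sd-a0  : ∀ f → sd (a0 f) ≡ sd f
    sd-a2  : ∀ f → sd (a2 f) ≡ opposite (sd f)

flag-space : ∀ G → Space (τ0 G) (τ2 G) (flagVertex G) (flagSide G)
flag-space G = record { a0m = τ0-matching G ; a2m = τ2-matching G ; v-a2 = vertex-τ2 G ; v-a0a2 = vertex-τ0τ2 G ; sd-a0 = side-τ0 G ; sd-a2 = side-τ2 G }

TE : (G : Graph) → Rel (Fin (n G))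
TE G p q = T (E G p q)

-- Flags of a graph on a type of one's own choice. For sums and for additional edges this type is a
-- disjoint union, and the numbering of edges by `edgeList` is never met.
record Represents {Φ V : Set} (Adj : Rel V) (a0 a2 : Φ → Φ) (v : Φ → V) (sd : Φ → Fin 2) : Set where
  field
    space  : Space a0 a2 v sd
    edge   : ∀ f → Adj (v f) (v (a0 f))
    unique : ∀ {f g} → v f ≡ v g → v (a0 f) ≡ v (a0 g) → sd f ≡ sd g → f ≡ g
    cover  : ∀ {p q} → Adj p q → ∀ s → Σ Φ λ f → v f ≡ p × v (a0 f) ≡ q × sd f ≡ s

module Represented (G : Graph) {Φ : Set} {a0 a2 : Φ → Φ} {v : Φ → Fin (n G)} {sd : Φ → Fin 2} (R : Represents (TE G) a0 a2 v sd) where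
  open Represents R
  open Space space

  private
    mk : ∀ f → Σ (Flag G) λ g → flagVertex G g ≡ v f × flagVertex G (τ0 G g) ≡ v (a0 f) × flagSide G g ≡ sd f
    mk f = mkFlag G (edge f) (sd f)

  h : Φ → Flag G
  h f = proj₁ (mk f)

  h-v : ∀ f → flagVertex G (h f) ≡ v f
  h-v f = proj₁ (proj₂ (mk f))

  h-v0 : ∀ f → flagVertex G (τ0 G (h f)) ≡ v (a0 f)
  h-v0 f = proj₁ (proj₂ (proj₂ (mk f)))

  h-sd : ∀ f → flagSide G (h f) ≡ sd f
  h-sd f = proj₂ (proj₂ (proj₂ (mk f)))

  h-a0 : ∀ f → h (a0 f) ≡ τ0 G (h f)
  h-a0 f = flag-unique G (trans (h-v _) (sym (h-v0 f)))
    (trans (h-v0 _) (trans (cong v (Matching.inv a0m f)) (trans (sym (h-v f)) (cong (flagVertex G) (sym (Matching.inv (τ0-matching G) _))))))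
    (trans (h-sd _) (trans (sd-a0 f) (trans (sym (h-sd f)) (sym (side-τ0 G _)))))

  h-a2 : ∀ f → h (a2 f) ≡ τ2 G (h f)
  h-a2 f = flag-unique G (trans (h-v _) (trans (v-a2 f) (trans (sym (h-v f)) (sym (vertex-τ2 G _)))))
    (trans (h-v0 _) (trans (v-a0a2 f) (trans (sym (h-v0 f)) (sym (vertex-τ0τ2 G _)))))
    (trans (h-sd _) (trans (sd-a2 f) (trans (cong opposite (sym (h-sd f))) (sym (side-τ2 G _)))))

  private
    back : ∀ g → Σ Φ λ f → v f ≡ flagVertex G g × v (a0 f) ≡ flagVertex G (τ0 G g) × sd f ≡ flagSide G g
    back g = cover (flag-edge G g) (flagSide G g)

  k : Flag G → Φ
  k g = proj₁ (back g)

  hk : ∀ g → h (k g) ≡ g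
  hk g = let _ , p , q , r = back g in flag-unique G (trans (h-v _) p) (trans (h-v0 _) q) (trans (h-sd _) r)

  kh : ∀ f → k (h f) ≡ f
  kh f = let _ , p , q , r = back (h f) in unique (trans p (h-v f)) (trans q (h-v0 f)) (trans r (h-sd f))

  finite : Finite Φ
  finite = record { size = nFlags G ; enum = k ; index = h ; enum-index = kh ; index-enum = hk }

  conj : (Φ → Φ) → Flag G → Flag G
  conj t g = h (t (k g))

  conj-Equiv : ∀ {a : Φ → Φ} {b : Flag G → Flag G} (t : Φ → Φ) → (∀ f → h (a f) ≡ b (h f)) → Equiv (gr a ∪ gr t) (gr b ∪ gr (conj t))
  conj-Equiv {a} {b} t ab = record
    { to = h ; from = k
    ; to-R = λ { {f} (inj₁ refl) → [ inj₁ (sym (ab f)) ] ; {f} (inj₂ refl) → [ inj₂ (cong (h ∘ t) (kh f)) ] }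
    ; from-S = λ { {g} (inj₁ refl) → [ inj₁ (trans (sym (kh _)) (cong k (trans (ab (k g)) (cong b (hk g))))) ]
                 ; {g} (inj₂ refl) → [ inj₂ (sym (kh _)) ] }
    ; from-to = λ f → Cl-≡ (kh f) ; to-from = λ g → Cl-≡ (hk g) }

  conj-emb : ∀ {t} → IsEmb a2 v t → IsEmb (τ2 G) (flagVertex G) (conj t)
  conj-emb {t} e = record
    { matching = record { inv = λ g → trans (cong (h ∘ t) (kh _)) (trans (cong h (inv _)) (hk g))
                        ; irr = λ g p → irr (k g) (trans (sym (kh _)) (cong k p)) }
    ; pure = λ g → trans (h-v _) (trans (E.pure _) (trans (sym (h-v _)) (cong (flagVertex G) (hk g))))
    ; rot = λ f g p → Equiv.from-inv (conj-Equiv t h-a2) (E.rot _ _ (trans (sym (h-v _)) (trans (cong (flagVertex G) (hk f))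
              (trans p (trans (sym (cong (flagVertex G) (hk g))) (h-v _)))))) }
    where
    module E = IsEmb e
    open Matching E.matching

  eg-bound′ : Nice G → ∀ {t F g} → IsEmb a2 v t → NCl (gr a0 ∪ gr t) F → 2 + nEdges G ≤ n G + F + g → eg G ≤ g
  eg-bound′ N {t} e P = eg-bound G N (conj-emb e) (NCl-Equiv (conj-Equiv t h-a0) P)

  record Optimal′ : Set where
    field
      t     : Φ → Φ
      emb   : IsEmb a2 v t
      F     : ℕ
      count : NCl (gr a0 ∪ gr t) F
      genus : n G + F + eg G ≡ 2 + nEdges G

  optimal′ : Nice G → Optimal′
  optimal′ N = record
    { t = t′ ; emb = record
        { matching = record { inv = λ f → trans (cong (k ∘ O.t) (hk _)) (trans (cong k (inv _)) (kh f))
                            ; irr = λ f p → irr (h f) (trans (sym (hk _)) (cong h p)) }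
        ; pure = λ f → trans (sym (h-v _)) (trans (cong (flagVertex G) (hk _)) (trans (E.pure _) (h-v f)))
        ; rot = λ f g p → Equiv.to-inv (eqv h-a2) (E.rot _ _ (trans (h-v f) (trans p (sym (h-v g))))) }
    ; F = O.F ; count = NCl-Equiv (Equiv-sym (eqv h-a0)) O.count ; genus = O.genus }
    where
    module O = Optimal (optimal G N)
    module E = IsEmb O.emb
    open Matching E.matching
    t′ : Φ → Φ
    t′ f = k (O.t (h f))
    eqv : ∀ {a : Φ → Φ} {b : Flag G → Flag G} → (∀ f → h (a f) ≡ b (h f)) → Equiv (gr a ∪ gr t′) (gr b ∪ gr O.t)
    eqv ab = Equiv-trans (conj-Equiv t′ ab) (Equiv-id
      (λ { (inj₁ r) → [ inj₁ r ] ; {g} (inj₂ refl) → [ inj₂ (sym (trans (hk _) (cong O.t (hk g)))) ] })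
      (λ { (inj₁ r) → [ inj₁ r ] ; {g} (inj₂ refl) → [ inj₂ (trans (hk _) (cong O.t (hk g))) ] }))

-- Gluing corners, deleting and adding an edge

-- The corners {a , t a} and {c , t c} of two vertices are merged, which merges the vertices.
record Glued {Φ : Set} (a0 a2 t : Φ → Φ) (a c : Φ) : Set₁ where
  field
    t'       : Φ → Φ
    matching : Matching t'
    keeps    : ∀ {C : Set} (g : Φ → C) → g a ≡ g c → Preserves g t → Preserves g t'
    rot⊆     : ∀ {f g} → Cl (gr a2 ∪ gr t) f g → Cl (gr a2 ∪ gr t') f g
    rot-ac   : Cl (gr a2 ∪ gr t') a c
    count    : ∀ {F} → NCl (gr a0 ∪ gr t) F → Σ ℕ λ F' → NCl (gr a0 ∪ gr t') F' × F ≤ suc F'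
    merge    : ¬ Cl (gr a0 ∪ gr t) a c → ∀ {f g} → Cl (gr a0 ∪ gr t) f g → Cl (gr a0 ∪ gr t') f g
    t'-a     : t' a ≡ c
    t'-off   : ∀ {z} → z ≢ a → z ≢ c → z ≢ t a → z ≢ t c → t' z ≡ t z

module _ {Φ : Set} (F : Finite Φ) {a0 a2 t : Φ → Φ} (a0m : Matching a0) (a2m : Matching a2) (tm : Matching t) where

  module _ {C : Set} (L : Φ → C) (La2 : Preserves L a2) (Lt : Preserves L t) {a c : Φ} (La≢Lc : L a ≢ L c) where
    private
      a≢c : a ≢ c
      a≢c e = La≢Lc (cong L e)
      ta≢c : t a ≢ c
      ta≢c e = La≢Lc (trans (sym (Lt a)) (cong L e))
      module S = Swap F tm a≢c ta≢c
      apart : ¬ Cl (gr a2 ∪ gr t) a c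
      apart p = La≢Lc (Cl-preserves La2 Lt p)

    abstract
      glue : Glued a0 a2 t a c
      glue = record
        { t' = S.swap ; matching = S.swap-matching ; keeps = λ g e p → S.swap-preserves g e p
        ; rot⊆ = proj₁ (S.Outcome.swap-merge a2m apart) ; rot-ac = [ inj₂ S.swap-a ]
        ; count = λ N → let _ , N' = NCl-gr₂ F a0 S.swap in _ , N' , S.swap-≤1 N N'
        ; merge = λ ne → proj₁ (S.Outcome.swap-merge a0m ne)
        ; t'-a = S.swap-a ; t'-off = λ p q r s → S.swap-off (S.off p q r s) }

      glue-split : Cl (gr a0 ∪ gr S.cut) a c → ∀ {k} → NCl (gr a0 ∪ gr t) k → NCl (gr a0 ∪ gr (Glued.t' glue)) (suc k)
      glue-split = S.Outcome.swap-split a0m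

      cut-off : ∀ {z} → z ≢ a → z ≢ c → z ≢ t a → z ≢ t c → S.cut z ≡ t z
      cut-off p q r s = S.cut-off (S.off p q r s)

  abstract
    -- Of the two orientations in which the corner at c can be glued to the corner at a, one splits
    -- the common face; accordingly c' is c or `t c`.
    glue-cofacial : ∀ {C : Set} (L : Φ → C) → Preserves L a2 → Preserves L t → ∀ {a c} → L a ≢ L c → Cl (gr a0 ∪ gr t) a c →
      Σ Φ λ c' → (∀ {D : Set} (g : Φ → D) → Preserves g t → g c' ≡ g c) ×
        Σ (Glued a0 a2 t a c') λ G → ∀ {k} → NCl (gr a0 ∪ gr t) k → NCl (gr a0 ∪ gr (Glued.t' G)) (suc k)
    glue-cofacial L La2 Lt {a} {c} ne p with swap-either F a0m tm (λ e → ne (cong L e)) (λ e → ne (trans (sym (Lt a)) (cong L e))) p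
    ... | inj₁ q = c , (λ _ _ → refl) , glue L La2 Lt ne , q
    ... | inj₂ q = t c , (λ g h → h c) , glue L La2 Lt (λ e → ne (trans e (Lt c))) , q

Quad : Set
Quad = Fin 2 × Fin 2

q0 q2 : Quad → Quad
q0 (e , s) = opposite e , s
q2 (e , s) = e , opposite s

opposite≢ : (a : Fin 2) → opposite a ≢ a
opposite≢ zero ()
opposite≢ (suc zero) ()

q0-matching : Matching q0
q0-matching = record { inv = λ (e , s) → cong (_, s) (opposite-involutive e) ; irr = λ (e , s) p → opposite≢ e (cong proj₁ p) }

q2-matching : Matching q2
q2-matching = record { inv = λ (e , s) → cong (e ,_) (opposite-involutive s) ; irr = λ (e , s) p → opposite≢ s (cong proj₂ p) }

⊎-matching : ∀ {A B : Set} {f : A → A} {g : B → B} → Matching f → Matching g → Matching (map⊎ f g)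
⊎-matching {A} {B} {f} {g} fm gm = record
  { inv = λ { (inj₁ a) → cong inj₁ (Matching.inv fm a) ; (inj₂ b) → cong inj₂ (Matching.inv gm b) } ; irr = irr' }
  where
  irr' : ∀ z → map⊎ f g z ≢ z
  irr' (inj₁ a) e = Matching.irr fm a (inj₁-injective e)
  irr' (inj₂ b) e = Matching.irr gm b (inj₂-injective e)

⊎-Equiv : ∀ {A B : Set} {f f' : A → A} {g g' : B → B} → Equiv ((gr f ∪ gr f') ⊎ʳ (gr g ∪ gr g')) (gr (map⊎ f g) ∪ gr (map⊎ f' g'))
⊎-Equiv = Equiv-id
  (λ { (inl (inj₁ refl)) → [ inj₁ refl ] ; (inl (inj₂ refl)) → [ inj₂ refl ] ; (inr (inj₁ refl)) → [ inj₁ refl ] ; (inr (inj₂ refl)) → [ inj₂ refl ] })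
  λ { {inj₁ _} (inj₁ refl) → [ inl (inj₁ refl) ] ; {inj₁ _} (inj₂ refl) → [ inl (inj₂ refl) ]
    ; {inj₂ _} (inj₁ refl) → [ inr (inj₁ refl) ] ; {inj₂ _} (inj₂ refl) → [ inr (inj₂ refl) ] }

Quad-finite : Finite Quad
Quad-finite = record
  { size = 4
  ; enum = λ { zero → zero , zero ; (suc zero) → zero , suc zero ; (suc (suc zero)) → suc zero , zero ; (suc (suc (suc zero))) → suc zero , suc zero }
  ; index = λ { (zero , zero) → zero ; (zero , suc zero) → suc zero ; (suc zero , zero) → suc (suc zero) ; (suc zero , suc zero) → suc (suc (suc zero)) }
  ; enum-index = λ { (zero , zero) → refl ; (zero , suc zero) → refl ; (suc zero , zero) → refl ; (suc zero , suc zero) → refl }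
  ; index-enum = λ { zero → refl ; (suc zero) → refl ; (suc (suc zero)) → refl ; (suc (suc (suc zero))) → refl } }

ends : ∀ {V : Set} → V → V → Quad → V
ends u w (zero , _) = u
ends u w (suc _ , _) = w

elim-preserves : ∀ {A A' C : Set} {a b : A} (r : Removal A' a b) {τ : A → A} (τm : Matching τ) (g : A → C) → Preserves g τ → g a ≡ g b →
  ∀ k → g (Removal.ins r (Elim.τ' r τm k)) ≡ g (Removal.ins r k)
elim-preserves r {τ} τm g p e k with Elim.spec r τm k
... | inj₁ f = trans (cong g (sym f)) (p _)
... | inj₂ (inj₁ (f , h)) = trans (cong g h) (trans (p _) (trans (sym e) (trans (cong g (sym f)) (p _))))
... | inj₂ (inj₂ (f , h)) = trans (cong g h) (trans (p _) (trans e (trans (cong g (sym f)) (p _))))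

-- Edges e with ends u and w are added to or deleted from a space Φ of flags; the flags of e are the elements of Quad.
module Edge {Φ V : Set} (FΦ : Finite Φ) {a0 a2 : Φ → Φ} (a0m : Matching a0) (a2m : Matching a2) {v : Φ → V} (v-a2 : Preserves v a2)
  (u w : V) where

  Φ⁺ : Set
  Φ⁺ = Φ ⊎ Quad

  a0⁺ a2⁺ : Φ⁺ → Φ⁺
  a0⁺ = map⊎ a0 q0
  a2⁺ = map⊎ a2 q2

  v⁺ : Φ⁺ → V
  v⁺ = [ v , ends u w ]′

  F⁺ : Finite Φ⁺
  F⁺ = ⊎-finite FΦ Quad-finite

  v⁺-a2 : Preserves v⁺ a2⁺
  v⁺-a2 (inj₁ f) = v-a2 f
  v⁺-a2 (inj₂ (zero , _)) = refl
  v⁺-a2 (inj₂ (suc _ , _)) = refl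

  a0⁺m : Matching a0⁺
  a0⁺m = ⊎-matching a0m q0-matching

  a2⁺m : Matching a2⁺
  a2⁺m = ⊎-matching a2m q2-matching

  module Delete {t⁺ : Φ⁺ → Φ⁺} (emb : IsEmb a2⁺ v⁺ t⁺) (u≢w : u ≢ w) {f₀ f₁ : Φ} (vf₀ : v f₀ ≡ u) (vf₁ : v f₁ ≡ w) where
    private
      module emb = IsEmb emb
      e₀₀ e₀₁ e₁₀ e₁₁ : Φ⁺
      e₀₀ = inj₂ (zero , zero)
      e₀₁ = inj₂ (zero , suc zero)
      e₁₀ = inj₂ (suc zero , zero)
      e₁₁ = inj₂ (suc zero , suc zero)

      -- The two flags at u are taken out of the rotation here, those at w afterwards by `r₂`.
      r₁ : Removal (Φ ⊎ Fin 2) e₀₀ e₀₁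
      r₁ = record
        { ins = map⊎ id (suc zero ,_)
        ; ins-inj = λ { {inj₁ _} {inj₁ _} refl → refl ; {inj₂ _} {inj₂ _} refl → refl }
        ; ins≢a = λ { {inj₁ _} () ; {inj₂ _} () } ; ins≢b = λ { {inj₁ _} () ; {inj₂ _} () }
        ; cover = λ { (inj₁ f) → inj₂ (inj₂ (inj₁ f , refl)) ; (inj₂ (zero , zero)) → inj₁ refl
                    ; (inj₂ (zero , suc zero)) → inj₂ (inj₁ refl) ; (inj₂ (suc zero , s)) → inj₂ (inj₂ (inj₂ s , refl)) }
        ; a≢b = λ () }
      module r₁ = Removal r₁
      module E₁ = Elim r₁ emb.matching

      r₂ : Removal {Φ ⊎ Fin 2} Φ (inj₂ zero) (inj₂ (suc zero))
      r₂ = record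
        { ins = inj₁ ; ins-inj = inj₁-injective ; ins≢a = λ () ; ins≢b = λ ()
        ; cover = λ { (inj₁ f) → inj₂ (inj₂ (f , refl)) ; (inj₂ zero) → inj₁ refl ; (inj₂ (suc zero)) → inj₂ (inj₁ refl) }
        ; a≢b = λ () }
      module E₂ = Elim r₂ E₁.τ'-matching

    t : Φ → Φ
    t = E₂.τ'

    private
      closed : ∀ {A : Set} {R : Rel A} (q : A → Bool) → (∀ {a b} → R a b → q a ≡ q b) → ∀ {a b} → Cl R a b → q a ≡ true → q b ≡ true
      closed q h p e = trans (sym (Cl-inv q h p)) e

      -- Otherwise the deleted edge would be the whole rotation at u, where `f₀` lies too.
      no-loop₁ : t⁺ e₀₀ ≢ e₀₁
      no-loop₁ l with closed q (λ { {a} (inj₁ refl) → sym (qa a) ; {a} (inj₂ refl) → sym (qt a) }) (emb.rot e₀₀ (inj₁ f₀) (sym vf₀)) refl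
        where
        q : Φ⁺ → Bool
        q (inj₂ (zero , _)) = true
        q _ = false
        qa : ∀ a → q (a2⁺ a) ≡ q a
        qa (inj₁ _) = refl
        qa (inj₂ (zero , _)) = refl
        qa (inj₂ (suc zero , _)) = refl
        q-true : ∀ a → q a ≡ true → a ≡ e₀₀ ⊎ a ≡ e₀₁
        q-true (inj₂ (zero , zero)) _ = inj₁ refl
        q-true (inj₂ (zero , suc zero)) _ = inj₂ refl
        hit : ∀ a → q a ≡ true → q (t⁺ a) ≡ true
        hit a p with q-true a p
        ... | inj₁ refl = cong q l
        ... | inj₂ refl = cong q (Matching.flip emb.matching l)
        qt : ∀ a → q (t⁺ a) ≡ q a
        qt a with q a in p | q (t⁺ a) in p'
        ... | true | true = refl
        ... | false | false = refl
        ... | true | false = trans (sym p') (hit a p)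
        ... | false | true = trans (sym (hit (t⁺ a) p')) (trans (cong q (Matching.inv emb.matching a)) p)
      ... | ()

      a2' : Φ ⊎ Fin 2 → Φ ⊎ Fin 2
      a2' = map⊎ a2 opposite

      a2-ins₁ : ∀ k → a2⁺ (r₁.ins k) ≡ r₁.ins (a2' k)
      a2-ins₁ (inj₁ _) = refl
      a2-ins₁ (inj₂ _) = refl

      Eq₁ : Equiv (gr t⁺ ∪ gr a2⁺) (gr E₁.τ' ∪ gr a2')
      Eq₁ = join-equiv (⊎-finite FΦ (Fin-finite 2)) r₁ emb.matching refl refl a2-ins₁ no-loop₁

      comm : ∀ {A : Set} {R S : Rel A} {a b} → Cl (R ∪ S) a b → Cl (S ∪ R) a b
      comm = Cl-mono λ { (inj₁ r) → inj₂ r ; (inj₂ s) → inj₁ s }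

      rot₁ : ∀ f g → v⁺ (r₁.ins f) ≡ v⁺ (r₁.ins g) → Cl (gr E₁.τ' ∪ gr a2') f g
      rot₁ f g p = Equiv.from-inv Eq₁ (comm (emb.rot _ _ p))

      no-loop₂ : E₁.τ' (inj₂ zero) ≢ inj₂ (suc zero)
      no-loop₂ l with closed q (λ { {a} (inj₁ refl) → sym (qt a) ; {a} (inj₂ refl) → sym (qa a) }) (rot₁ (inj₂ zero) (inj₁ f₁) (sym vf₁)) refl
        where
        q : Φ ⊎ Fin 2 → Bool
        q (inj₂ _) = true
        q _ = false
        qa : ∀ a → q (a2' a) ≡ q a
        qa (inj₁ _) = refl
        qa (inj₂ _) = refl
        q-true : ∀ a → q a ≡ true → a ≡ inj₂ zero ⊎ a ≡ inj₂ (suc zero)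
        q-true (inj₂ zero) _ = inj₁ refl
        q-true (inj₂ (suc zero)) _ = inj₂ refl
        hit : ∀ a → q a ≡ true → q (E₁.τ' a) ≡ true
        hit a p with q-true a p
        ... | inj₁ refl = cong q l
        ... | inj₂ refl = cong q (Matching.flip E₁.τ'-matching l)
        qt : ∀ a → q (E₁.τ' a) ≡ q a
        qt a with q a in p | q (E₁.τ' a) in p'
        ... | true | true = refl
        ... | false | false = refl
        ... | true | false = trans (sym p') (hit a p)
        ... | false | true = trans (sym (hit (E₁.τ' a) p')) (trans (cong q (Matching.inv E₁.τ'-matching a)) p)
      ... | ()

      Eq₂ : Equiv (gr E₁.τ' ∪ gr a2') (gr t ∪ gr a2)
      Eq₂ = join-equiv FΦ r₂ E₁.τ'-matching refl refl (λ _ → refl) no-loop₂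

    deleted : IsEmb a2 v t
    deleted = record
      { matching = E₂.τ'-matching
      ; pure = elim-preserves r₂ E₁.τ'-matching (v⁺ ∘ r₁.ins) (elim-preserves r₁ emb.matching v⁺ emb.pure refl) refl
      ; rot = λ f g p → comm (Equiv.from-inv Eq₂ (rot₁ (inj₁ f) (inj₁ g) p)) }

    -- One pair joining the two sides of the edge makes all its flags equivalent, and then the old
    -- rotation contains the new one.
    delete-faces : ∀ {k l} → NCl (gr a0⁺ ∪ gr t⁺) k → NCl (gr a0 ∪ gr t) l → k ≤ suc l
    delete-faces N M = NCl-≤1 N M e₀₀ e₀₁ inj₁ (λ { (inj₁ refl) → [ inj₁ (inj₁ refl) ] ; {f} (inj₂ refl) → t-path f })
        [ id , (λ _ → proj₁ other) ]′ (λ { (inj₁ f) → ε ; (inj₂ q) → Cl-≡ (sym (proj₂ other)) ∙ bwd (inj₁ (inj₂ refl)) (all q ⁻) })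
      where
      R : Rel Φ⁺
      R = (gr a0⁺ ∪ gr t⁺) ∪ Pair e₀₀ e₀₁
      all : ∀ q → Cl R (inj₂ q) e₀₀
      all (zero , zero) = ε
      all (zero , suc zero) = [ inj₂ pair ]⁻
      all (suc zero , zero) = [ inj₁ (inj₁ refl) ]
      all (suc zero , suc zero) = fwd (inj₁ (inj₁ refl)) [ inj₂ pair ]⁻
      other : Σ Φ λ f → t⁺ e₀₀ ≡ inj₁ f
      other with t⁺ e₀₀ in eq
      ... | inj₁ f = f , refl
      ... | inj₂ (zero , zero) = ⊥-elim (Matching.irr emb.matching e₀₀ eq)
      ... | inj₂ (zero , suc zero) = ⊥-elim (no-loop₁ eq)
      ... | inj₂ (suc zero , s) = ⊥-elim (u≢w (trans (sym (emb.pure e₀₀)) (cong v⁺ eq)))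
      S : Rel (Φ ⊎ Fin 2)
      S a b = Cl R (r₁.ins a) (r₁.ins b)
      lift : ∀ {a b} → gr t⁺ a b → R a b
      lift e = inj₁ (inj₂ e)
      up₁ : ∀ {a b} → Cl (gr t⁺ ∪ R) a b → Cl R a b
      up₁ = Cl-mono λ { (inj₁ e) → lift e ; (inj₂ r) → r }
      up₂ : ∀ {a b} → Cl (gr E₁.τ' ∪ S) a b → Cl R (r₁.ins a) (r₁.ins b)
      up₂ = Cl-map r₁.ins λ { {a} (inj₁ refl) → up₁ (E₁.from-τ' [ inj₂ (inj₂ pair) ] a) ; (inj₂ s) → s }
      t-path : ∀ f → Cl R (inj₁ f) (inj₁ (t f))
      t-path f = up₂ (E₂.from-τ' [ inj₂ (all (suc zero , zero) ∙ (all (suc zero , suc zero)) ⁻) ] f)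

  module Add {t : Φ → Φ} (emb : IsEmb a2 v t) where
    private
      module emb = IsEmb emb
      -- The edge starts as a component of its own, a sphere with a single face, and is glued on at
      -- its ends.
      t⁰ : Φ⁺ → Φ⁺
      t⁰ = map⊎ t q2
      t⁰m : Matching t⁰
      t⁰m = ⊎-matching emb.matching q2-matching
      e₀ e₁ : Φ⁺
      e₀ = inj₂ (zero , zero)
      e₁ = inj₂ (suc zero , zero)

      quad : NCl (gr q0 ∪ gr q2) 1
      quad = record { cls = λ _ → zero ; rep = λ _ → zero , zero ; cls-rep = λ { zero → refl } ; sound = λ _ → refl
                    ; complete = λ {a} {b} _ → base a ∙ base b ⁻ }
        where
        base : ∀ a → Cl (gr q0 ∪ gr q2) a (zero , zero)
        base (zero , zero) = ε
        base (zero , suc zero) = [ inj₂ refl ]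
        base (suc zero , zero) = [ inj₁ refl ]
        base (suc zero , suc zero) = fwd (inj₁ refl) [ inj₂ refl ]

      faces⁰ : ∀ {k} → NCl (gr a0 ∪ gr t) k → NCl (gr a0⁺ ∪ gr t⁰) (suc k)
      faces⁰ {k} N = NCl-Equiv ⊎-Equiv (subst (NCl _) (+-comm k 1) (NCl-⊎ N quad))

      lift : ∀ {f g} → Cl (gr a0 ∪ gr t) f g → Cl (gr a0⁺ ∪ gr t⁰) (inj₁ f) (inj₁ g)
      lift = Cl-map inj₁ λ { (inj₁ refl) → [ inj₁ refl ] ; (inj₂ refl) → [ inj₂ refl ] }

      L : Φ⁺ → Bool
      L (inj₁ _) = true
      L (inj₂ _) = false

      L-pres : ∀ {f g} → Preserves L (map⊎ f g)
      L-pres (inj₁ _) = refl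
      L-pres (inj₂ _) = refl

      v⁰ : Preserves v⁺ t⁰
      v⁰ (inj₁ f) = emb.pure f
      v⁰ (inj₂ (zero , _)) = refl
      v⁰ (inj₂ (suc _ , _)) = refl

      con⁰ : ∀ f g → v f ≡ v g → Cl (gr a2⁺ ∪ gr t⁰) (inj₁ f) (inj₁ g)
      con⁰ f g p = Cl-map inj₁ (λ { (inj₁ refl) → [ inj₁ refl ] ; (inj₂ refl) → [ inj₂ refl ] }) (emb.rot f g p)

    record Pendant (b : Φ) : Set where
      field
        t⁺     : Φ⁺ → Φ⁺
        isEmb  : IsEmb a2⁺ v⁺ t⁺
        count  : ∀ {k} → NCl (gr a0 ∪ gr t) k → Σ ℕ λ k' → NCl (gr a0⁺ ∪ gr t⁺) k' × k ≤ k'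
        joined : Cl (gr a0⁺ ∪ gr t⁺) (inj₁ b) e₀
        kept   : ∀ {f g} → Cl (gr a0 ∪ gr t) f g → Cl (gr a0⁺ ∪ gr t⁺) (inj₁ f) (inj₁ g)

    -- Gluing one end of the lone edge loses at most its own face.
    add-pendant : u ≢ w → (∀ f → v f ≢ u) → ∀ b → v b ≡ w → Pendant b
    add-pendant u≢w free b vb = record
      { t⁺ = G.t' ; isEmb = record
          { matching = G.matching ; pure = G.keeps v⁺ vb v⁰
          ; rot = rot }
      ; count = λ N → let k' , N' , le = G.count (faces⁰ N) in k' , N' , ≤-pred le
      ; joined = fwd (inj₂ G.t'-a) [ inj₁ refl ]
      ; kept = λ p → G.merge (λ q → true≢false (Cl-preserves {col = L} L-pres L-pres q)) (lift p) }
      where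
      true≢false : true ≢ false
      true≢false ()
      G : Glued a0⁺ a2⁺ t⁰ (inj₁ b) e₁
      G = glue F⁺ a0⁺m a2⁺m t⁰m L L-pres L-pres true≢false
      module G = Glued G
      at-w : ∀ f → v⁺ f ≡ w → Cl (gr a2⁺ ∪ gr G.t') f e₁
      at-w (inj₁ f) p = G.rot⊆ (con⁰ f b (trans p (sym vb))) ∙ G.rot-ac
      at-w (inj₂ (suc zero , zero)) p = ε
      at-w (inj₂ (suc zero , suc zero)) p = [ inj₁ refl ]
      at-w (inj₂ (zero , _)) p = ⊥-elim (u≢w p)
      at-u : ∀ f → v⁺ f ≡ u → Cl (gr a2⁺ ∪ gr G.t') f e₀
      at-u (inj₁ f) p = ⊥-elim (free f p)
      at-u (inj₂ (zero , zero)) p = ε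
      at-u (inj₂ (zero , suc zero)) p = [ inj₁ refl ]
      at-u (inj₂ (suc _ , _)) p = ⊥-elim (u≢w (sym p))
      rot : ∀ f g → v⁺ f ≡ v⁺ g → Cl (gr a2⁺ ∪ gr G.t') f g
      rot (inj₁ f) (inj₁ g) p = G.rot⊆ (con⁰ f g p)
      rot (inj₂ (zero , s)) g p = at-u (inj₂ (zero , s)) refl ∙ at-u g (sym p) ⁻
      rot (inj₂ (suc zero , s)) g p = at-w (inj₂ (suc zero , s)) refl ∙ at-w g (sym p) ⁻
      rot f (inj₂ (zero , s)) p = at-u f p ∙ at-u (inj₂ (zero , s)) refl ⁻
      rot f (inj₂ (suc zero , s)) p = at-w f p ∙ at-w (inj₂ (suc zero , s)) refl ⁻

    record Added (a b : Φ) : Set where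
      field
        t⁺       : Φ⁺ → Φ⁺
        isEmb    : IsEmb a2⁺ v⁺ t⁺
        count    : ∀ {k} → NCl (gr a0 ∪ gr t) k → Σ ℕ λ k' → NCl (gr a0⁺ ∪ gr t⁺) k' × k ≤ suc k'

    module _ (u≢w : u ≢ w) (a b : Φ) (va : v a ≡ u) (vb : v b ≡ w) where
      private
        true≢false : true ≢ false
        true≢false ()
        G₁ : Glued a0⁺ a2⁺ t⁰ (inj₁ a) e₀
        G₁ = glue F⁺ a0⁺m a2⁺m t⁰m L L-pres L-pres true≢false
        module G₁ = Glued G₁

        -- After the first gluing the end at w still is a vertex by itself; this labelling tells it
        -- from all the rest, as the second gluing requires.
        L₁ : Φ⁺ → Bool
        L₁ (inj₂ (suc _ , _)) = false
        L₁ _ = true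

        L₁-a2 : Preserves L₁ a2⁺
        L₁-a2 (inj₁ _) = refl
        L₁-a2 (inj₂ (zero , _)) = refl
        L₁-a2 (inj₂ (suc zero , _)) = refl

        L₁-t¹ : Preserves L₁ G₁.t'
        L₁-t¹ = G₁.keeps L₁ refl λ { (inj₁ _) → refl ; (inj₂ (zero , _)) → refl ; (inj₂ (suc zero , _)) → refl }

        face-ab : Cl (gr a0 ∪ gr t) a b → Cl (gr a0⁺ ∪ gr G₁.t') (inj₁ b) e₁
        face-ab p = G₁.merge (λ q → true≢false (Cl-preserves {col = L} L-pres L-pres q)) (lift (p ⁻)) ∙ fwd (inj₂ G₁.t'-a) [ inj₁ refl ]

        module Finish {c : Φ⁺} (vc : v⁺ c ≡ w) (G₂ : Glued a0⁺ a2⁺ G₁.t' (inj₁ b) c) (c-e₁ : Cl (gr a2⁺ ∪ gr (Glued.t' G₂)) c e₁) where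
          module G₂ = Glued G₂
          at-w : ∀ f → v⁺ f ≡ w → Cl (gr a2⁺ ∪ gr G₂.t') f e₁
          at-w (inj₁ f) p = G₂.rot⊆ (G₁.rot⊆ (con⁰ f b (trans p (sym vb)))) ∙ G₂.rot-ac ∙ c-e₁
          at-w (inj₂ (suc zero , zero)) p = ε
          at-w (inj₂ (suc zero , suc zero)) p = [ inj₁ refl ]
          at-w (inj₂ (zero , _)) p = ⊥-elim (u≢w p)
          at-u : ∀ f → v⁺ f ≡ u → Cl (gr a2⁺ ∪ gr G₂.t') f e₀
          at-u (inj₁ f) p = G₂.rot⊆ (G₁.rot⊆ (con⁰ f a (trans p (sym va))) ∙ G₁.rot-ac)
          at-u (inj₂ (zero , zero)) p = ε
          at-u (inj₂ (zero , suc zero)) p = [ inj₁ refl ]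
          at-u (inj₂ (suc _ , _)) p = ⊥-elim (u≢w (sym p))
          isEmb : IsEmb a2⁺ v⁺ G₂.t'
          isEmb = record
            { matching = G₂.matching ; pure = G₂.keeps v⁺ (trans vb (sym vc)) (G₁.keeps v⁺ va v⁰) ; rot = rot }
            where
            rot : ∀ f g → v⁺ f ≡ v⁺ g → Cl (gr a2⁺ ∪ gr G₂.t') f g
            rot (inj₁ f) (inj₁ g) p = G₂.rot⊆ (G₁.rot⊆ (con⁰ f g p))
            rot (inj₂ (zero , s)) g p = at-u (inj₂ (zero , s)) refl ∙ at-u g (sym p) ⁻
            rot (inj₂ (suc zero , s)) g p = at-w (inj₂ (suc zero , s)) refl ∙ at-w g (sym p) ⁻
            rot f (inj₂ (zero , s)) p = at-u f p ∙ at-u (inj₂ (zero , s)) refl ⁻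
            rot f (inj₂ (suc zero , s)) p = at-w f p ∙ at-w (inj₂ (suc zero , s)) refl ⁻

      -- Two gluings turn k + 1 faces into at least k - 1. If a and b lie on different faces, both
      -- gluings merge faces, so all earlier connections persist and a and b become cofacial.
      add-edge : Σ (Added a b) λ A → (¬ Cl (gr a0 ∪ gr t) a b → Cl (gr a0⁺ ∪ gr (Added.t⁺ A)) (inj₁ a) (inj₁ b)
        × (∀ {f g} → Cl (gr a0 ∪ gr t) f g → Cl (gr a0⁺ ∪ gr (Added.t⁺ A)) (inj₁ f) (inj₁ g)))
      add-edge = record
        { t⁺ = G₂.t' ; isEmb = Finish.isEmb refl G₂ ε
        ; count = λ N → let _ , N₁ , l₁ = G₁.count (faces⁰ N) ; k , N₂ , l₂ = G₂.count N₁ in k , N₂ , ≤-trans (≤-pred l₁) l₂ }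
        , λ ne → let keep = λ {f} {g} (p : Cl (gr a0 ∪ gr t) f g) →
                        G₂.merge (sep ne) (G₁.merge (λ q → true≢false (Cl-preserves {col = L} L-pres L-pres q)) (lift p)) in
            (G₂.merge (sep ne) (fwd (inj₂ G₁.t'-a) [ inj₁ refl ]) ∙ [ inj₂ G₂.t'-a ]⁻) , keep
        where
        G₂ : Glued a0⁺ a2⁺ G₁.t' (inj₁ b) e₁
        G₂ = glue F⁺ a0⁺m a2⁺m G₁.matching L₁ L₁-a2 L₁-t¹ true≢false
        module G₂ = Glued G₂
        sep : ¬ Cl (gr a0 ∪ gr t) a b → ¬ Cl (gr a0⁺ ∪ gr G₁.t') (inj₁ b) e₁
        sep ne p = ne ((NCl.complete N (Cl-preserves {col = cl} a0-cl t¹-cl p)) ⁻)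
          where
          N = proj₂ (NCl-gr₂ FΦ a0 t)
          -- The flags of the new edge are assigned to the face of a, into which the first gluing
          -- has put them.
          cl : Φ⁺ → Fin (proj₁ (NCl-gr₂ FΦ a0 t))
          cl (inj₁ f) = NCl.cls N f
          cl (inj₂ _) = NCl.cls N a
          t¹-cl : Preserves cl G₁.t'
          t¹-cl = G₁.keeps cl refl λ { (inj₁ f) → sym (NCl.sound N (inj₂ refl)) ; (inj₂ _) → refl }
          a0-cl : Preserves cl a0⁺
          a0-cl (inj₁ f) = sym (NCl.sound N (inj₁ refl))
          a0-cl (inj₂ _) = refl

      -- The first gluing puts the edge into the face of a, which also contains b; the second one
      -- can then be chosen to split this face.
      add-cofacial : Cl (gr a0 ∪ gr t) a b → ∀ {k} → NCl (gr a0 ∪ gr t) k → Σ (Added a b) λ A → Σ ℕ λ k' → NCl (gr a0⁺ ∪ gr (Added.t⁺ A)) k' × suc k ≤ k'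
      add-cofacial p N =
        let c , same , G₂ , grow = glue-cofacial F⁺ a0⁺m a2⁺m G₁.matching L₁ L₁-a2 L₁-t¹ {inj₁ b} {e₁} true≢false (face-ab p)
            k₁ , N₁ , l₁ = G₁.count (faces⁰ N)
        in added (same v⁺ (G₁.keeps v⁺ va v⁰)) (same L₁ L₁-t¹) G₂ , suc k₁ , grow N₁ , l₁
        where
        c-e₁ : ∀ c → v⁺ c ≡ w → L₁ c ≡ false → Cl (gr a2⁺ ∪ gr G₁.t') c e₁
        c-e₁ (inj₂ (suc zero , zero)) _ _ = ε
        c-e₁ (inj₂ (suc zero , suc zero)) _ _ = [ inj₁ refl ]
        added : ∀ {c} → v⁺ c ≡ w → L₁ c ≡ false → Glued a0⁺ a2⁺ G₁.t' (inj₁ b) c → Added a b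
        added {c} vc Lc G₂ = record
          { t⁺ = Glued.t' G₂ ; isEmb = Finish.isEmb vc G₂ (Glued.rot⊆ G₂ (c-e₁ c vc Lc))
          ; count = λ M → let _ , M₁ , m₁ = G₁.count (faces⁰ M) ; k , M₂ , m₂ = Glued.count G₂ M₁ in k , M₂ , ≤-trans (≤-pred m₁) m₂ }

-- Representing additional edges and sums; numbers of edges

flag-represents : ∀ G → Represents (TE G) (τ0 G) (τ2 G) (flagVertex G) (flagSide G)
flag-represents G = record
  { space = flag-space G ; edge = flag-edge G ; unique = flag-unique G
  ; cover = λ t s → mkFlag G t s }

represents-cong : ∀ {Φ V : Set} {Adj Adj' : Rel V} {a0 a2 : Φ → Φ} {v sd} → (∀ {p q} → Adj p q → Adj' p q) → (∀ {p q} → Adj' p q → Adj p q) →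
  Represents Adj a0 a2 v sd → Represents Adj' a0 a2 v sd
represents-cong h k R = record { space = space ; edge = λ f → h (edge f) ; unique = unique ; cover = λ t → cover (k t) }
  where open Represents R

Link : {V : Set} → V → V → Rel V
Link u w p q = (p ≡ u × q ≡ w) ⊎ (p ≡ w × q ≡ u)

add-represents : ∀ {Φ V : Set} {Adj : Rel V} {a0 a2 : Φ → Φ} {v sd} → Represents Adj a0 a2 v sd → ∀ {u w} → u ≢ w → ¬ Adj u w → ¬ Adj w u →
  Represents (Adj ∪ Link u w) (map⊎ a0 q0) (map⊎ a2 q2) [ v , ends u w ]′ [ sd , proj₂ ]′
add-represents {Φ} {V} {Adj} {a0} {a2} {v} {sd} R {u} {w} u≢w nuw nwu = record
  { space = record
    { a0m = ⊎-matching S.a0m q0-matching ; a2m = ⊎-matching S.a2m q2-matching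
    ; v-a2 = λ { (inj₁ f) → S.v-a2 f ; (inj₂ (zero , _)) → refl ; (inj₂ (suc _ , _)) → refl }
    ; v-a0a2 = λ { (inj₁ f) → S.v-a0a2 f ; (inj₂ (zero , _)) → refl ; (inj₂ (suc zero , _)) → refl }
    ; sd-a0 = λ { (inj₁ f) → S.sd-a0 f ; (inj₂ _) → refl } ; sd-a2 = λ { (inj₁ f) → S.sd-a2 f ; (inj₂ _) → refl } }
  ; edge = λ { (inj₁ f) → inj₁ (R.edge f) ; (inj₂ (zero , _)) → inj₂ (inj₁ (refl , refl)) ; (inj₂ (suc zero , _)) → inj₂ (inj₂ (refl , refl)) }
  ; unique = λ {f} {g} → uni f g
  ; cover = λ { (inj₁ t) s → let f , p = R.cover t s in inj₁ f , p
              ; (inj₂ (inj₁ (p , q))) s → inj₂ (zero , s) , sym p , sym q , refl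
              ; (inj₂ (inj₂ (p , q))) s → inj₂ (suc zero , s) , sym p , sym q , refl } }
  where
  module R = Represents R
  module S = Space R.space
  v⁺ : Φ ⊎ Quad → V
  v⁺ = [ v , ends u w ]′
  clash : ∀ f q → v f ≡ v⁺ (inj₂ q) → v (a0 f) ≡ v⁺ (inj₂ (q0 q)) → ⊥
  clash f (zero , _) a b = nuw (subst₂ Adj a b (R.edge f))
  clash f (suc zero , _) a b = nwu (subst₂ Adj a b (R.edge f))
  uni : ∀ f g → v⁺ f ≡ v⁺ g → v⁺ (map⊎ a0 q0 f) ≡ v⁺ (map⊎ a0 q0 g) → [ sd , proj₂ ]′ f ≡ [ sd , proj₂ ]′ g → f ≡ g
  uni (inj₁ f) (inj₁ g) a b c = cong inj₁ (R.unique a b c)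
  uni (inj₁ f) (inj₂ q) a b c = ⊥-elim (clash f q a b)
  uni (inj₂ q) (inj₁ f) a b c = ⊥-elim (clash f q (sym a) (sym b))
  uni (inj₂ (zero , s)) (inj₂ (zero , .s)) a b refl = refl
  uni (inj₂ (zero , s)) (inj₂ (suc zero , _)) a b c = ⊥-elim (u≢w a)
  uni (inj₂ (suc zero , s)) (inj₂ (zero , _)) a b c = ⊥-elim (u≢w (sym a))
  uni (inj₂ (suc zero , s)) (inj₂ (suc zero , .s)) a b refl = refl

SumAdj : {V V₁ V₂ : Set} → (V₁ → V) → (V₂ → V) → Rel V₁ → Rel V₂ → Rel V
SumAdj {V₁ = V₁} {V₂} ι₁ ι₂ Adj₁ Adj₂ p q =
  Σ V₁ (λ a → Σ V₁ λ b → ι₁ a ≡ p × ι₁ b ≡ q × Adj₁ a b) ⊎ Σ V₂ (λ a → Σ V₂ λ b → ι₂ a ≡ p × ι₂ b ≡ q × Adj₂ a b)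

sum-represents : ∀ {Φ₁ Φ₂ V V₁ V₂ : Set} {ι₁ : V₁ → V} {ι₂ : V₂ → V} {Adj₁ : Rel V₁} {Adj₂ : Rel V₂} {a0 a2 : Φ₁ → Φ₁} {b0 b2 : Φ₂ → Φ₂} {v₁ v₂ sd₁ sd₂} →
  (∀ {a b} → ι₁ a ≡ ι₁ b → a ≡ b) → (∀ {a b} → ι₂ a ≡ ι₂ b → a ≡ b) →
  (∀ {a a' b b'} → Adj₁ a a' → Adj₂ b b' → ι₁ a ≡ ι₂ b → ι₁ a' ≡ ι₂ b' → ⊥) →
  Represents Adj₁ a0 a2 v₁ sd₁ → Represents Adj₂ b0 b2 v₂ sd₂ →
  Represents (SumAdj ι₁ ι₂ Adj₁ Adj₂) (map⊎ a0 b0) (map⊎ a2 b2) [ ι₁ ∘ v₁ , ι₂ ∘ v₂ ]′ [ sd₁ , sd₂ ]′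
sum-represents {ι₁ = ι₁} {ι₂} {a0 = a0} {b0 = b0} {v₁ = v₁} {v₂} {sd₁} {sd₂} inj₁' inj₂' apart R₁ R₂ = record
  { space = record
    { a0m = ⊎-matching S₁.a0m S₂.a0m ; a2m = ⊎-matching S₁.a2m S₂.a2m
    ; v-a2 = λ { (inj₁ f) → cong ι₁ (S₁.v-a2 f) ; (inj₂ f) → cong ι₂ (S₂.v-a2 f) }
    ; v-a0a2 = λ { (inj₁ f) → cong ι₁ (S₁.v-a0a2 f) ; (inj₂ f) → cong ι₂ (S₂.v-a0a2 f) }
    ; sd-a0 = λ { (inj₁ f) → S₁.sd-a0 f ; (inj₂ f) → S₂.sd-a0 f } ; sd-a2 = λ { (inj₁ f) → S₁.sd-a2 f ; (inj₂ f) → S₂.sd-a2 f } }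
  ; edge = λ { (inj₁ f) → inj₁ (_ , _ , refl , refl , R₁.edge f) ; (inj₂ f) → inj₂ (_ , _ , refl , refl , R₂.edge f) }
  ; unique = λ {f} {g} → uni f g
  ; cover = λ { (inj₁ (a , b , p , q , t)) s → let f , x , y , z = R₁.cover t s in inj₁ f , trans (cong ι₁ x) p , trans (cong ι₁ y) q , z
              ; (inj₂ (a , b , p , q , t)) s → let f , x , y , z = R₂.cover t s in inj₂ f , trans (cong ι₂ x) p , trans (cong ι₂ y) q , z } }
  where
  module R₁ = Represents R₁
  module R₂ = Represents R₂
  module S₁ = Space R₁.space
  module S₂ = Space R₂.space
  uni : ∀ f g → [ ι₁ ∘ v₁ , ι₂ ∘ v₂ ]′ f ≡ [ ι₁ ∘ v₁ , ι₂ ∘ v₂ ]′ g →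
    [ ι₁ ∘ v₁ , ι₂ ∘ v₂ ]′ (map⊎ a0 b0 f) ≡ [ ι₁ ∘ v₁ , ι₂ ∘ v₂ ]′ (map⊎ a0 b0 g) → [ sd₁ , sd₂ ]′ f ≡ [ sd₁ , sd₂ ]′ g → f ≡ g
  uni (inj₁ f) (inj₁ g) a b c = cong inj₁ (R₁.unique (inj₁' a) (inj₁' b) c)
  uni (inj₂ f) (inj₂ g) a b c = cong inj₂ (R₂.unique (inj₂' a) (inj₂' b) c)
  uni (inj₁ f) (inj₂ g) a b c = ⊥-elim (apart (R₁.edge f) (R₂.edge g) a b)
  uni (inj₂ f) (inj₁ g) a b c = ⊥-elim (apart (R₁.edge g) (R₂.edge f) (sym a) (sym b))

-- Numbers of edges are compared through the sizes of flag types, with four flags to an edge.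
quarter : ∀ {m n} → m * 2 * 2 ≡ n * 2 * 2 → m ≡ n
quarter {m} {n} e = ℕₚ.*-cancelʳ-≡ m n 2 (ℕₚ.*-cancelʳ-≡ (m * 2) (n * 2) 2 e)

size-represents : ∀ (G : Graph) {Φ : Set} {a0 a2 : Φ → Φ} {v sd} → Represents (TE G) a0 a2 v sd → (F : Finite Φ) → size F ≡ nEdges G * 2 * 2
size-represents G R F = size-unique F (Represented.finite G R) id id (λ _ → refl) (λ _ → refl)

edges-add : ∀ (K G : Graph) {Φ : Set} {a0 a2 : Φ → Φ} {v v' sd sd'} {b0 b2 : Φ ⊎ Quad → Φ ⊎ Quad} →
  Represents (TE K) a0 a2 v sd → Represents (TE G) b0 b2 v' sd' → nEdges G ≡ suc (nEdges K)
edges-add K G R S = quarter (trans (sym (size-represents G S (⊎-finite (Represented.finite K R) Quad-finite)))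
  (trans (cong (_+ 4) (size-represents K R (Represented.finite K R))) (lem (nEdges K))))
  where
  lem : ∀ n → n * 2 * 2 + 4 ≡ suc n * 2 * 2
  lem = solve-∀

edges-sum : ∀ (K L G : Graph) {Φ Ψ : Set} {a0 a2 : Φ → Φ} {b0 b2 : Ψ → Ψ} {c0 c2 : Φ ⊎ Ψ → Φ ⊎ Ψ} {v v' v″ sd sd' sd″} →
  Represents (TE K) a0 a2 v sd → Represents (TE L) b0 b2 v' sd' → Represents (TE G) c0 c2 v″ sd″ → nEdges G ≡ nEdges K + nEdges L
edges-sum K L G R R' S = quarter (trans (sym (size-represents G S (⊎-finite (Represented.finite K R) (Represented.finite L R'))))
  (trans (cong₂ _+_ (size-represents K R (Represented.finite K R)) (size-represents L R' (Represented.finite L R'))) (lem (nEdges K) (nEdges L))))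
  where
  lem : ∀ m n → m * 2 * 2 + n * 2 * 2 ≡ (m + n) * 2 * 2
  lem = solve-∀

same-edges : ∀ (K G : Graph) {Φ : Set} {a0 a2 b0 b2 : Φ → Φ} {v v' sd sd'} →
  Represents (TE K) a0 a2 v sd → Represents (TE G) b0 b2 v' sd' → nEdges G ≡ nEdges K
same-edges K G R S = quarter (trans (sym (size-represents G S (Represented.finite G S))) (size-represents K R (Represented.finite G S)))

reach-Cl : ∀ {G a b} → Reach G a b → Cl (TE G) a b
reach-Cl here = ε
reach-Cl (step t r) = fwd t (reach-Cl r)

nice : ∀ G → x G ≢ y G → Connected G → Nice G
nice G x≢y conn = record { conn = λ a b → reach-Cl (conn a b) ; nbr = nbr }
  where
  first : ∀ {a b} → a ≢ b → Reach G a b → Σ (Fin (n G)) λ u → T (E G a u)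
  first ne here = ⊥-elim (ne refl)
  first ne (step t _) = _ , t
  nbr : ∀ v → Σ (Fin (n G)) λ u → T (E G v u)
  nbr v with v ≟ x G
  ... | yes refl = first x≢y (conn (x G) (y G))
  ... | no ne = first ne (conn v (x G))

-- The effect of the edge xy on the genus

module _ (G : Graph) (x≢y : x G ≢ y G) where
  plus⁺ : ∀ {p q} → (TE G ∪ Link (x G) (y G)) p q → TE (plus G) p q
  plus⁺ {p} {q} (inj₁ t) with T-∧⁻ {Bool.not (eqF p q)} t
  ... | a , b with T-∨⁻ {adj G p q} b
  ... | inj₁ c = T-∧⁺ a (T-∨⁺ (inj₁ (T-∨⁺ (inj₁ c))))
  ... | inj₂ c = T-∧⁺ a (T-∨⁺ {adj (plus G) p q} (inj₂ (T-∨⁺ (inj₁ c))))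
  plus⁺ (inj₂ (inj₁ (refl , refl))) = T-∧⁺ (T-not⁺ λ e → x≢y (eqF⁻ e))
    (T-∨⁺ (inj₁ (T-∨⁺ {adj G (x G) (y G)} (inj₂ (T-∧⁺ (eqF⁺ {i = x G} refl) (eqF⁺ {i = y G} refl))))))
  plus⁺ (inj₂ (inj₂ (refl , refl))) = T-∧⁺ (T-not⁺ λ e → x≢y (sym (eqF⁻ e)))
    (T-∨⁺ {adj (plus G) (y G) (x G)} (inj₂ (T-∨⁺ {adj G (x G) (y G)} (inj₂ (T-∧⁺ (eqF⁺ {i = x G} refl) (eqF⁺ {i = y G} refl))))))

  plus⁻ : ∀ {p q} → TE (plus G) p q → (TE G ∪ Link (x G) (y G)) p q
  plus⁻ {p} {q} t with T-∧⁻ {Bool.not (eqF p q)} t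
  ... | a , b with T-∨⁻ {adj (plus G) p q} b
  plus⁻ {p} {q} t | a , b | inj₁ c with T-∨⁻ {adj G p q} c
  ... | inj₁ d = inj₁ (T-∧⁺ a (T-∨⁺ (inj₁ d)))
  ... | inj₂ d = let e , f = T-∧⁻ {eqF p (x G)} d in inj₂ (inj₁ (eqF⁻ e , eqF⁻ f))
  plus⁻ {p} {q} t | a , b | inj₂ c with T-∨⁻ {adj G q p} c
  ... | inj₁ d = inj₁ (T-∧⁺ a (T-∨⁺ {adj G p q} (inj₂ d)))
  ... | inj₂ d = let e , f = T-∧⁻ {eqF q (x G)} d in inj₂ (inj₂ (eqF⁻ f , eqF⁻ e))

  nice-plus : Nice G → Nice (plus G)
  nice-plus N = record { conn = λ a b → Cl-mono (λ t → plus⁺ (inj₁ t)) (Nice.conn N a b)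
                       ; nbr = λ v → let u , t = Nice.nbr N v in u , plus⁺ (inj₁ t) }

  plus-represents : ¬ TE G (x G) (y G) → ∀ {Φ} {a0 a2 : Φ → Φ} {v sd} → Represents (TE G) a0 a2 v sd →
    Represents (TE (plus G)) (map⊎ a0 q0) (map⊎ a2 q2) [ v , ends (x G) (y G) ]′ [ sd , proj₂ ]′
  plus-represents noxy R = represents-cong plus⁺ plus⁻ (add-represents R x≢y noxy (noxy ∘ E-sym G))

  plus-same : TE G (x G) (y G) → ∀ {Φ} {a0 a2 : Φ → Φ} {v sd} → Represents (TE G) a0 a2 v sd → Represents (TE (plus G)) a0 a2 v sd
  plus-same xy R = represents-cong (plus⁺ ∘ inj₁) (λ t → [ id , (λ { (inj₁ (refl , refl)) → xy ; (inj₂ (refl , refl)) → E-sym G xy }) ]′ (plus⁻ t)) R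

-- Graphs with the same vertices and edges have the same genus.
eg-same : ∀ {V a b} {x y x' y' : Fin V} → let K = graph V a x y ; G = graph V b x' y' in
  (∀ {p q} → TE K p q → TE G p q) → (∀ {p q} → TE G p q → TE K p q) → Nice K → Nice G → eg G ≤ eg K
eg-same {V} {a} {b} {x} {y} {x'} {y'} h k NK NG = Represented.eg-bound′ (graph V b x' y') R NG O.emb O.count
  (≤-reflexive (trans (cong (2 +_) (same-edges (graph V a x y) (graph V b x' y') (flag-represents (graph V a x y)) R)) (sym O.genus)))
  where
  R : Represents (TE (graph V b x' y')) _ _ _ _
  R = represents-cong h k (flag-represents (graph V a x y))
  module O = Optimal (optimal (graph V a x y) NK)

module Terminal (G : Graph) (x≢y : x G ≢ y G) (N : Nice G) where
  private
    module Ed = Edge (Fin-finite (nFlags G)) (τ0-matching G) (τ2-matching G) {flagVertex G} (vertex-τ2 G) (x G) (y G)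
    fx = proj₁ (flag-at G N (x G))
    vx = proj₂ (flag-at G N (x G))
    fy = proj₁ (flag-at G N (y G))
    vy = proj₂ (flag-at G N (y G))
    same : TE G (x G) (y G) → Represents (TE (plus G)) (τ0 G) (τ2 G) (flagVertex G) (flagSide G)
    same xy = plus-same G x≢y xy (flag-represents G)
    more : ¬ TE G (x G) (y G) → Represents (TE (plus G)) Ed.a0⁺ Ed.a2⁺ Ed.v⁺ [ flagSide G , proj₂ ]′
    more nxy = plus-represents G x≢y nxy (flag-represents G)

  -- Deleting xy from an optimal embedding removes one edge and at most one face. The edge may also
  -- be present already, as a contraction can create it; then the flags are the same.
  eg≤eg⁺ : eg G ≤ eg⁺ G
  eg≤eg⁺ = go (T? (E G (x G) (y G)))
    where
    go : Dec (TE G (x G) (y G)) → eg G ≤ eg⁺ G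
    go (yes xy) = eg-bound G N O.emb O.count (≤-reflexive (trans (cong (2 +_) (sym (same-edges G (plus G) (flag-represents G) (same xy)))) (sym O.genus)))
      where
      O = Represented.optimal′ (plus G) (same xy) (nice-plus G x≢y N)
      module O = Represented.Optimal′ O
    go (no nxy) = eg-bound G N D.deleted (proj₂ count) (ℕₚ.≤-pred (begin
        suc (2 + nEdges G) ≡⟨ cong (2 +_) (sym (edges-add G (plus G) (flag-represents G) (more nxy))) ⟩
        2 + nEdges (plus G) ≡⟨ sym O.genus ⟩
        n G + O.F + eg⁺ G ≤⟨ +-monoˡ-≤ (eg⁺ G) (+-monoʳ-≤ (n G) (D.delete-faces O.count (proj₂ count))) ⟩
        n G + suc (proj₁ count) + eg⁺ G ≡⟨ cong (_+ eg⁺ G) (ℕₚ.+-suc (n G) (proj₁ count)) ⟩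
        suc (n G + proj₁ count + eg⁺ G) ∎))
      where
      open ≤-Reasoning
      O = Represented.optimal′ (plus G) (more nxy) (nice-plus G x≢y N)
      module O = Represented.Optimal′ O
      module D = Ed.Delete O.emb x≢y {fx} {fy} vx vy
      count = NCl-gr₂ (Fin-finite (nFlags G)) (τ0 G) D.t

  -- An embedding of G in which x and y lie on a common face extends to G plus the edge xy.
  cofacial-bound : ∀ {t F g} → IsEmb (τ2 G) (flagVertex G) t → NCl (gr (τ0 G) ∪ gr t) F →
    ∀ {f h} → flagVertex G f ≡ x G → flagVertex G h ≡ y G → Cl (gr (τ0 G) ∪ gr t) f h → 2 + nEdges G ≤ n G + F + g → eg⁺ G ≤ g
  cofacial-bound {t} {F} {g} e P {f} {h} vf vh p le = go (T? (E G (x G) (y G)))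
    where
    go : Dec (TE G (x G) (y G)) → eg⁺ G ≤ g
    go (yes xy) = Represented.eg-bound′ (plus G) (same xy) (nice-plus G x≢y N) e P (≤-trans (≤-reflexive (cong (2 +_) (same-edges G (plus G) (flag-represents G) (same xy)))) le)
    go (no nxy) = let A , k , P' , F<k = Ed.Add.add-cofacial e x≢y f h vf vh p P in Represented.eg-bound′ (plus G) (more nxy) (nice-plus G x≢y N) (Ed.Add.Added.isEmb A) P' (begin
        2 + nEdges (plus G) ≡⟨ cong (2 +_) (edges-add G (plus G) (flag-represents G) (more nxy)) ⟩
        suc (2 + nEdges G) ≤⟨ s≤s le ⟩
        suc (n G + F + g) ≡⟨ cong (_+ g) (sym (ℕₚ.+-suc (n G) F)) ⟩
        n G + suc F + g ≤⟨ +-monoˡ-≤ g (+-monoʳ-≤ (n G) F<k) ⟩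
        n G + k + g ∎)
      where open ≤-Reasoning

  -- A new edge xy, drawn between arbitrary corners, adds one edge and loses at most one face.
  eg⁺≤eg+2 : eg⁺ G ≤ eg G + 2
  eg⁺≤eg+2 = go (T? (E G (x G) (y G)))
    where
    go : Dec (TE G (x G) (y G)) → eg⁺ G ≤ eg G + 2
    go (yes xy) = Represented.eg-bound′ (plus G) (same xy) (nice-plus G x≢y N) O.emb O.count (begin
        2 + nEdges (plus G) ≡⟨ cong (2 +_) (same-edges G (plus G) (flag-represents G) (same xy)) ⟩
        2 + nEdges G ≡⟨ sym O.genus ⟩
        n G + O.F + eg G ≤⟨ +-monoʳ-≤ (n G + O.F) (ℕₚ.m≤m+n (eg G) 2) ⟩
        n G + O.F + (eg G + 2) ∎)
      where
      open ≤-Reasoning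
      module O = Optimal (optimal G N)
    go (no nxy) = Represented.eg-bound′ (plus G) (more nxy) (nice-plus G x≢y N) (Ed.Add.Added.isEmb A) (proj₁ (proj₂ cnt)) (begin
        2 + nEdges (plus G) ≡⟨ cong (2 +_) (edges-add G (plus G) (flag-represents G) (more nxy)) ⟩
        suc (2 + nEdges G) ≡⟨ cong suc (sym O.genus) ⟩
        suc (n G + O.F + eg G) ≤⟨ s≤s (+-monoˡ-≤ (eg G) (+-monoʳ-≤ (n G) (proj₂ (proj₂ cnt)))) ⟩
        suc (n G + suc (proj₁ cnt) + eg G) ≡⟨ lem (n G) (proj₁ cnt) (eg G) ⟩
        n G + proj₁ cnt + (eg G + 2) ∎)
      where
      open ≤-Reasoning
      module O = Optimal (optimal G N)
      A = proj₁ (Ed.Add.add-edge O.emb x≢y fx fy vx vy)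
      cnt = Ed.Add.Added.count A O.count
      lem : ∀ n k g → suc (n + suc k + g) ≡ n + k + (g + 2)
      lem = solve-∀
 

-- The genus of an xy-sum

-- Two embeddings, of the sides of Φ, are glued at a corner of x and at a corner of y.
module TwoSided {Φ V : Set} (F : Finite Φ) (_≟ᵛ_ : (a b : V) → Dec (a ≡ b)) {a0 a2 t : Φ → Φ} (a0m : Matching a0) (a2m : Matching a2) (tm : Matching t)
  (side : Φ → Bool) (side-a2 : Preserves side a2) (side-t : Preserves side t)
  (v : Φ → V) (v-a2 : Preserves v a2) (v-t : Preserves v t) (rot : ∀ f g → v f ≡ v g → side f ≡ side g → Cl (gr a2 ∪ gr t) f g)
  (x y : V) (x≢y : x ≢ y) (shared : ∀ f g → v f ≡ v g → side f ≢ side g → v f ≡ x ⊎ v f ≡ y)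
  {a c b d : Φ} (va : v a ≡ x) (vc : v c ≡ x) (vb : v b ≡ y) (vd : v d ≡ y)
  (sa : side a ≡ true) (sc : side c ≡ false) (sb : side b ≡ true) (sd : side d ≡ false) where
  private
    true≢false : true ≢ false
    true≢false ()

    -- Once the sides share x, the label `side` is no longer respected. This one is constant at x
    -- and still separates the two corners at y.
    L : Φ → Bool
    L f = isYes (v f ≟ᵛ x) ∨ side f

    L-x : ∀ {f} → v f ≡ x → L f ≡ true
    L-x {f} p with v f ≟ᵛ x
    ... | yes _ = refl
    ... | no np = ⊥-elim (np p)

    L-y : ∀ {f} → v f ≡ y → L f ≡ side f
    L-y {f} p with v f ≟ᵛ x
    ... | yes q = ⊥-elim (x≢y (trans (sym q) p))
    ... | no _ = refl

    L-pres : ∀ {g} → Preserves v g → Preserves side g → Preserves L g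
    L-pres p q f = cong₂ (λ w s → isYes (w ≟ᵛ x) ∨ s) (p f) (q f)

    ac : side a ≢ side c
    ac e = true≢false (trans (sym sa) (trans e sc))

  G₁ : Glued a0 a2 t a c
  G₁ = glue F a0m a2m tm side side-a2 side-t ac
  module G₁ = Glued G₁

  private
    L-t : Preserves L G₁.t'
    L-t = G₁.keeps L (trans (L-x va) (sym (L-x vc))) (L-pres v-t side-t)
    L-a2 : Preserves L a2
    L-a2 = L-pres v-a2 side-a2
    bd : L b ≢ L d
    bd e = true≢false (trans (sym sb) (trans (sym (L-y vb)) (trans e (trans (L-y vd) sd))))

  G₂ : Glued a0 a2 G₁.t' b d
  G₂ = glue F a0m a2m G₁.matching L L-a2 L-t bd
  module G₂ = Glued G₂

  isEmb : IsEmb a2 v G₂.t'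
  isEmb = record { matching = G₂.matching ; pure = G₂.keeps v (trans vb (sym vd)) (G₁.keeps v (trans va (sym vc)) v-t) ; rot = rot' }
    where
    R = gr a2 ∪ gr G₂.t'
    old : ∀ f g → v f ≡ v g → side f ≡ side g → Cl R f g
    old f g p q = G₂.rot⊆ (G₁.rot⊆ (rot f g p q))
    hub : ∀ {p q} → v p ≡ v q → side p ≡ true → side q ≡ false → Cl R p q → ∀ f → v f ≡ v p → Cl R f p
    hub {p} {q} e sp sq pq f vf with side f in s
    ... | true = old f p vf (trans s (sym sp))
    ... | false = old f q (trans vf e) (trans s (sym sq)) ∙ pq ⁻
    rot' : ∀ f g → v f ≡ v g → Cl R f g
    rot' f g p with side f Bool.≟ side g
    ... | yes q = old f g p q
    ... | no ne with shared f g p ne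
    ... | inj₁ e = hub′ f e ∙ hub′ g (trans (sym p) e) ⁻
      where
      hub′ : ∀ f → v f ≡ x → Cl R f a
      hub′ f e = hub (trans va (sym vc)) sa sc (G₂.rot⊆ G₁.rot-ac) f (trans e (sym va))
    ... | inj₂ e = hub′ f e ∙ hub′ g (trans (sym p) e) ⁻
      where
      hub′ : ∀ f → v f ≡ y → Cl R f b
      hub′ f e = hub (trans vb (sym vd)) sb sd G₂.rot-ac f (trans e (sym vb))

  glued-faces : ∀ {k} → NCl (gr a0 ∪ gr t) k → Σ ℕ λ k' → NCl (gr a0 ∪ gr G₂.t') k' × k ≤ 2 + k'
  glued-faces N = let _ , N₁ , l₁ = G₁.count N ; k , N₂ , l₂ = G₂.count N₁ in k , N₂ , ≤-trans l₁ (s≤s l₂)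

  -- If a and c are the ends at x, and b and d those at y, of two edges, these edges become parallel and bound a face.
  parallel-faces : a0 a ≡ b → a0 c ≡ d → a ≢ G₁.t' b → a ≢ G₁.t' d → ∀ {k} → NCl (gr a0 ∪ gr t) k → Σ ℕ λ k' → NCl (gr a0 ∪ gr G₂.t') k' × k ≤ k'
  parallel-faces ab cd a≢tb a≢td N = let k , N₁ , l₁ = G₁.count N in suc k
    -- The stretch b, a, c, d runs along both edges; the first gluing has made a and c neighbours,
    -- so it lies in one face, which the second gluing splits.
    , glue-split F a0m a2m G₁.matching L L-a2 L-t bd (bwd (inj₁ ab) (fwd (inj₂ (trans (cut-off F a0m a2m G₁.matching L L-a2 L-t bd a≢b a≢d a≢tb a≢td) G₁.t'-a)) [ inj₁ cd ])) N₁
    , l₁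
    where
    a≢b : a ≢ b
    a≢b e = x≢y (trans (sym va) (trans (cong v e) vb))
    a≢d : a ≢ d
    a≢d e = x≢y (trans (sym va) (trans (cong v e) vd))

inl-Cl : ∀ {A B : Set} {R : Rel A} {S : Rel B} {a b} → Cl (R ⊎ʳ S) (inj₁ a) (inj₁ b) → Cl R a b
inl-Cl {a = a} = Cl-map [ id , (λ _ → a) ]′ λ { (inl r) → [ r ] ; (inr _) → ε }

inr-Cl : ∀ {A B : Set} {R : Rel A} {S : Rel B} {a b} → Cl (R ⊎ʳ S) (inj₂ a) (inj₂ b) → Cl S a b
inr-Cl {a = a} = Cl-map [ (λ _ → a) , id ]′ λ { (inl _) → ε ; (inr r) → [ r ] }

module SumGenus (G G₁ G₂ : Graph) {ι₁ : Fin (n G₁) → Fin (n G)} {ι₂ : Fin (n G₂) → Fin (n G)}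
  (x≢y₁ : x G₁ ≢ y G₁) (x≢y₂ : x G₂ ≢ y G₂) (S : IsXYSum G G₁ G₂ ι₁ ι₂) (N₁ : Nice G₁) (N₂ : Nice G₂) (noXY₂ : NoXY G₂) where

  ι₁-inj : ∀ {a b} → ι₁ a ≡ ι₁ b → a ≡ b
  ι₁-inj = proj₁ S
  ι₂-inj : ∀ {a b} → ι₂ a ≡ ι₂ b → a ≡ b
  ι₂-inj = proj₁ (proj₂ S)
  ι₁x : ι₁ (x G₁) ≡ x G
  ι₁x = proj₁ (proj₂ (proj₂ S))
  ι₁y : ι₁ (y G₁) ≡ y G
  ι₁y = proj₁ (proj₂ (proj₂ (proj₂ S)))
  ι₂x : ι₂ (x G₂) ≡ x G
  ι₂x = proj₁ (proj₂ (proj₂ (proj₂ (proj₂ S))))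
  ι₂y : ι₂ (y G₂) ≡ y G
  ι₂y = proj₁ (proj₂ (proj₂ (proj₂ (proj₂ (proj₂ S)))))
  onto : ∀ p → Σ (Fin (n G₁)) (λ a → ι₁ a ≡ p) ⊎ Σ (Fin (n G₂)) (λ b → ι₂ b ≡ p)
  onto = proj₁ (proj₂ (proj₂ (proj₂ (proj₂ (proj₂ (proj₂ S))))))
  meet : ∀ a b → ι₁ a ≡ ι₂ b → (a ≡ x G₁ × b ≡ x G₂) ⊎ (a ≡ y G₁ × b ≡ y G₂)
  meet = proj₁ (proj₂ (proj₂ (proj₂ (proj₂ (proj₂ (proj₂ (proj₂ S)))))))
  sum⁻ : ∀ {p q} → TE G p q → SumAdj ι₁ ι₂ (TE G₁) (TE G₂) p q
  sum⁻ {p} {q} = Equivalence.to (proj₂ (proj₂ (proj₂ (proj₂ (proj₂ (proj₂ (proj₂ (proj₂ S))))))) p q)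
  sum⁺ : ∀ {p q} → SumAdj ι₁ ι₂ (TE G₁) (TE G₂) p q → TE G p q
  sum⁺ {p} {q} = Equivalence.from (proj₂ (proj₂ (proj₂ (proj₂ (proj₂ (proj₂ (proj₂ (proj₂ S))))))) p q)

  x≢y : x G ≢ y G
  x≢y e = x≢y₁ (ι₁-inj (trans ι₁x (trans e (sym ι₁y))))

  N : Nice G
  N = record { conn = λ p q → to-x p ∙ to-x q ⁻ ; nbr = nbr }
    where
    conn₁ : ∀ {a b} → Cl (TE G₁) a b → Cl (TE G) (ι₁ a) (ι₁ b)
    conn₁ = Cl-map ι₁ λ t → [ sum⁺ (inj₁ (_ , _ , refl , refl , t)) ]
    conn₂ : ∀ {a b} → Cl (TE G₂) a b → Cl (TE G) (ι₂ a) (ι₂ b)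
    conn₂ = Cl-map ι₂ λ t → [ sum⁺ (inj₂ (_ , _ , refl , refl , t)) ]
    to-x : ∀ p → Cl (TE G) p (x G)
    to-x p with onto p
    ... | inj₁ (a , refl) = conn₁ (Nice.conn N₁ a (x G₁)) ∙ Cl-≡ ι₁x
    ... | inj₂ (b , refl) = conn₂ (Nice.conn N₂ b (x G₂)) ∙ Cl-≡ ι₂x
    nbr : ∀ p → Σ (Fin (n G)) λ u → T (E G p u)
    nbr p with onto p
    ... | inj₁ (a , refl) = let u , t = Nice.nbr N₁ a in ι₁ u , sum⁺ (inj₁ (_ , _ , refl , refl , t))
    ... | inj₂ (b , refl) = let u , t = Nice.nbr N₂ b in ι₂ u , sum⁺ (inj₂ (_ , _ , refl , refl , t))

  -- The vertices of G are those of the disjoint union after two identifications, each of which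
  -- merges distinct classes.
  vertices : n G₁ + n G₂ ≡ 2 + n G
  vertices with NCl-addPair (NCl-∅ (⊎-finite (Fin-finite (n G₁)) (Fin-finite (n G₂)))) (inj₁ (x G₁)) (inj₂ (x G₂))
  ... | inj₁ (p , _) with () ← Cl-inv isLeft (λ ()) p
  ... | inj₂ (_ , k , e , M) with NCl-addPair M (inj₁ (y G₁)) (inj₂ (y G₂))
  ... | inj₁ (p , _) = ⊥-elim (true≢false (trans (sym laby) (Cl-inv lab (λ { (inj₁ ()) ; (inj₂ pair) → labx }) p)))
    where
    true≢false : true ≢ false
    true≢false ()
    lab : Fin (n G₁) ⊎ Fin (n G₂) → Bool
    lab (inj₁ a) = isYes (a ≟ y G₁)
    lab (inj₂ _) = false
    labx : isYes (x G₁ ≟ y G₁) ≡ false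
    labx with x G₁ ≟ y G₁
    ... | yes p = ⊥-elim (x≢y₁ p)
    ... | no _ = refl
    laby : isYes (y G₁ ≟ y G₁) ≡ true
    laby with y G₁ ≟ y G₁
    ... | yes _ = refl
    ... | no np = ⊥-elim (np refl)
  ... | inj₂ (_ , l , e' , M') = trans e (cong suc (trans e' (cong suc (NCl-unique M' final))))
    where
    ι : Fin (n G₁) ⊎ Fin (n G₂) → Fin (n G)
    ι = [ ι₁ , ι₂ ]′
    pre : ∀ p → Σ (Fin (n G₁) ⊎ Fin (n G₂)) λ z → ι z ≡ p
    pre p with onto p
    ... | inj₁ (a , e) = inj₁ a , e
    ... | inj₂ (b , e) = inj₂ b , e
    across : ∀ a b → ι₁ a ≡ ι₂ b → Cl ((∅ ∪ Pair (inj₁ (x G₁)) (inj₂ (x G₂))) ∪ Pair (inj₁ (y G₁)) (inj₂ (y G₂))) (inj₁ a) (inj₂ b)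
    across a b q with meet a b q
    ... | inj₁ (refl , refl) = [ inj₁ (inj₂ pair) ]
    ... | inj₂ (refl , refl) = [ inj₂ pair ]
    final : NCl ((∅ ∪ Pair (inj₁ (x G₁)) (inj₂ (x G₂))) ∪ Pair (inj₁ (y G₁)) (inj₂ (y G₂))) (n G)
    final = record
      { cls = ι ; rep = λ p → proj₁ (pre p) ; cls-rep = λ p → proj₂ (pre p)
      ; sound = λ { (inj₁ (inj₂ pair)) → trans ι₁x (sym ι₂x) ; (inj₂ pair) → trans ι₁y (sym ι₂y) }
      ; complete = λ { {inj₁ a} {inj₁ b} q → Cl-≡ (cong inj₁ (ι₁-inj q)) ; {inj₂ a} {inj₂ b} q → Cl-≡ (cong inj₂ (ι₂-inj q))
                     ; {inj₁ a} {inj₂ b} q → across a b q ; {inj₂ b} {inj₁ a} q → (across a b (sym q)) ⁻ } }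

  -- A common edge would join x and y. Its absence from G₂ alone excludes this, so the sum formula
  -- also covers `plus G₁` and minors of G₁ in which xy has appeared.
  apart : ∀ {a a' b b'} → T (E G₂ b b') → ι₁ a ≡ ι₂ b → ι₁ a' ≡ ι₂ b' → ⊥
  apart {a} {a'} {b} {b'} t p q with meet a b p | meet a' b' q
  ... | inj₁ (_ , refl) | inj₁ (_ , refl) = E-irrefl G₂ t refl
  ... | inj₂ (_ , refl) | inj₂ (_ , refl) = E-irrefl G₂ t refl
  ... | inj₁ (_ , refl) | inj₂ (_ , refl) = noXY₂ t
  ... | inj₂ (_ , refl) | inj₁ (_ , refl) = noXY₂ (E-sym G₂ t)

  R : Represents (TE G) (map⊎ (τ0 G₁) (τ0 G₂)) (map⊎ (τ2 G₁) (τ2 G₂)) [ ι₁ ∘ flagVertex G₁ , ι₂ ∘ flagVertex G₂ ]′ [ flagSide G₁ , flagSide G₂ ]′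
  R = represents-cong sum⁺ sum⁻ (sum-represents ι₁-inj ι₂-inj (λ _ t → apart t) (flag-represents G₁) (flag-represents G₂))

  edges : nEdges G ≡ nEdges G₁ + nEdges G₂
  edges = edges-sum G₁ G₂ G (flag-represents G₁) (flag-represents G₂) R


  Φ : Set
  Φ = Flag G₁ ⊎ Flag G₂
  FΦ : Finite Φ
  FΦ = ⊎-finite (Fin-finite _) (Fin-finite _)
  b0 b2 : Φ → Φ
  b0 = map⊎ (τ0 G₁) (τ0 G₂)
  b2 = map⊎ (τ2 G₁) (τ2 G₂)
  b0m : Matching b0
  b0m = ⊎-matching (τ0-matching G₁) (τ0-matching G₂)
  b2m : Matching b2
  b2m = ⊎-matching (τ2-matching G₁) (τ2-matching G₂)
  vΦ : Φ → Fin (n G)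
  vΦ = [ ι₁ ∘ flagVertex G₁ , ι₂ ∘ flagVertex G₂ ]′

  vΦ-b2 : Preserves vΦ b2
  vΦ-b2 (inj₁ f) = cong ι₁ (vertex-τ2 G₁ f)
  vΦ-b2 (inj₂ f) = cong ι₂ (vertex-τ2 G₂ f)

  left-pres : ∀ {A B : Set} {f : A → A} {g : B → B} → Preserves isLeft (map⊎ f g)
  left-pres (inj₁ _) = refl
  left-pres (inj₂ _) = refl

  meet-v : ∀ a b → ι₁ a ≡ ι₂ b → ι₁ a ≡ x G ⊎ ι₁ a ≡ y G
  meet-v a b e with meet a b e
  ... | inj₁ (refl , _) = inj₁ ι₁x
  ... | inj₂ (refl , _) = inj₂ ι₁y

  shared : ∀ f g → vΦ f ≡ vΦ g → isLeft f ≢ isLeft g → vΦ f ≡ x G ⊎ vΦ f ≡ y G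
  shared (inj₁ f) (inj₁ g) _ ne = ⊥-elim (ne refl)
  shared (inj₂ f) (inj₂ g) _ ne = ⊥-elim (ne refl)
  shared (inj₁ f) (inj₂ g) e _ = meet-v _ _ e
  shared (inj₂ f) (inj₁ g) e _ with meet-v _ _ (sym e)
  ... | inj₁ p = inj₁ (trans e p)
  ... | inj₂ p = inj₂ (trans e p)

  module Upper₀ (O₁ : Optimal G₁ N₁) (O₂ : Optimal G₂ N₂) where
    module O₁ = Optimal O₁
    module O₂ = Optimal O₂
    module e₁ = IsEmb O₁.emb
    module e₂ = IsEmb O₂.emb
    ax = flag-at G₁ N₁ (x G₁)
    ay = flag-at G₁ N₁ (y G₁)
    cx = flag-at G₂ N₂ (x G₂)
    cy = flag-at G₂ N₂ (y G₂)
    rot : ∀ f g → vΦ f ≡ vΦ g → isLeft f ≡ isLeft g → Cl (gr b2 ∪ gr (map⊎ O₁.t O₂.t)) f g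
    rot (inj₁ f) (inj₁ g) p _ = Cl-map inj₁ (λ { (inj₁ refl) → [ inj₁ refl ] ; (inj₂ refl) → [ inj₂ refl ] }) (e₁.rot f g (ι₁-inj p))
    rot (inj₂ f) (inj₂ g) p _ = Cl-map inj₂ (λ { (inj₁ refl) → [ inj₁ refl ] ; (inj₂ refl) → [ inj₂ refl ] }) (e₂.rot f g (ι₂-inj p))
    pure : Preserves vΦ (map⊎ O₁.t O₂.t)
    pure (inj₁ f) = cong ι₁ (e₁.pure f)
    pure (inj₂ f) = cong ι₂ (e₂.pure f)
    module TS = TwoSided FΦ _≟_ b0m b2m (⊎-matching e₁.matching e₂.matching) isLeft left-pres left-pres vΦ vΦ-b2
      pure rot (x G) (y G) x≢y shared
      {inj₁ (proj₁ ax)} {inj₂ (proj₁ cx)} {inj₁ (proj₁ ay)} {inj₂ (proj₁ cy)}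
      (trans (cong ι₁ (proj₂ ax)) ι₁x) (trans (cong ι₂ (proj₂ cx)) ι₂x) (trans (cong ι₁ (proj₂ ay)) ι₁y) (trans (cong ι₂ (proj₂ cy)) ι₂y)
      refl refl refl refl
    cnt : Σ ℕ λ k' → NCl (gr b0 ∪ gr TS.G₂.t') k' × O₁.F + O₂.F ≤ 2 + k'
    cnt = TS.glued-faces (NCl-Equiv ⊎-Equiv (NCl-⊎ O₁.count O₂.count))
    lem₁ : ∀ a b → 2 + (2 + (a + b)) ≡ (2 + a) + (2 + b)
    lem₁ = solve-∀
    lem₂ : ∀ a b c d e f → (a + b + c) + (d + e + f) ≡ (a + d) + (b + e) + (c + f)
    lem₂ = solve-∀
    lem₃ : ∀ a b c → (2 + a) + (2 + b) + c ≡ 2 + (a + b + (c + 2))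
    lem₃ = solve-∀
    bound : eg G ≤ eg G₁ + eg G₂ + 2
    bound = Represented.eg-bound′ G R N TS.isEmb (proj₁ (proj₂ cnt)) (+-cancelˡ-≤ 2 _ _ (begin
        2 + (2 + nEdges G) ≡⟨ cong (λ e → 2 + (2 + e)) edges ⟩
        2 + (2 + (nEdges G₁ + nEdges G₂)) ≡⟨ lem₁ (nEdges G₁) (nEdges G₂) ⟩
        (2 + nEdges G₁) + (2 + nEdges G₂) ≡⟨ cong₂ _+_ (sym O₁.genus) (sym O₂.genus) ⟩
        (n G₁ + O₁.F + eg G₁) + (n G₂ + O₂.F + eg G₂) ≡⟨ lem₂ (n G₁) O₁.F (eg G₁) (n G₂) O₂.F (eg G₂) ⟩
        (n G₁ + n G₂) + (O₁.F + O₂.F) + (eg G₁ + eg G₂) ≤⟨ +-monoˡ-≤ (eg G₁ + eg G₂) (+-mono-≤ (≤-reflexive vertices) (proj₂ (proj₂ cnt))) ⟩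
        (2 + n G) + (2 + proj₁ cnt) + (eg G₁ + eg G₂) ≡⟨ lem₃ (n G) (proj₁ cnt) (eg G₁ + eg G₂) ⟩
        2 + (n G + proj₁ cnt + (eg G₁ + eg G₂ + 2)) ∎))
      where open ≤-Reasoning

  -- Two vertices and at most two faces disappear, so the Euler characteristic is at most 4 below
  -- the sum of the two. As two components with constant 2 become one, the excess of the genus is at
  -- most 2.
  upper₀ : eg G ≤ eg G₁ + eg G₂ + 2
  upper₀ = Upper₀.bound (optimal G₁ N₁) (optimal G₂ N₂)

  module Lower {t : Φ → Φ} {F : ℕ} (count : NCl (gr b0 ∪ gr t) F) (genus : n G + F + eg G ≡ 2 + nEdges G)
    (Sep : Separation vΦ isLeft b0 b2 t (x G) (y G)) (Sd : Sides (Separation.t' Sep)) where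
    open ≤-Reasoning
    module Sep = Separation Sep
    module Sd = Sides Sd
    eqv : ∀ {c0 : Flag G₁ → Flag G₁} {d0 : Flag G₂ → Flag G₂} → Equiv (gr (map⊎ c0 d0) ∪ gr Sep.t') ((gr c0 ∪ gr Sd.ρ₁) ⊎ʳ (gr d0 ∪ gr Sd.ρ₂))
    eqv = Equiv-trans (Equiv-id (λ { (inj₁ r) → [ inj₁ r ] ; {f} (inj₂ refl) → [ inj₂ (sym (agree f)) ] })
                                (λ { (inj₁ r) → [ inj₁ r ] ; {f} (inj₂ refl) → [ inj₂ (agree f) ] })) (Equiv-sym ⊎-Equiv)
      where
      agree : ∀ f → Sep.t' f ≡ map⊎ Sd.ρ₁ Sd.ρ₂ f
      agree (inj₁ f) = Sd.eq₁ f
      agree (inj₂ f) = Sd.eq₂ f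
    em₁ : IsEmb (τ2 G₁) (flagVertex G₁) Sd.ρ₁
    em₁ = record { matching = Sd.ρ₁m ; pure = λ f → ι₁-inj (trans (cong vΦ (sym (Sd.eq₁ f))) (Sep.t'-vert (inj₁ f)))
                 ; rot = λ f g p → inl-Cl (Equiv.to* eqv (Sep.rotation (inj₁ f) (inj₁ g) (cong ι₁ p) refl)) }
    em₂ : IsEmb (τ2 G₂) (flagVertex G₂) Sd.ρ₂
    em₂ = record { matching = Sd.ρ₂m ; pure = λ f → ι₂-inj (trans (cong vΦ (sym (Sd.eq₂ f))) (Sep.t'-vert (inj₂ f)))
                 ; rot = λ f g p → inr-Cl (Equiv.to* eqv (Sep.rotation (inj₂ f) (inj₂ g) (cong ι₂ p) refl)) }
    C₁ : Σ ℕ (NCl (gr (τ0 G₁) ∪ gr Sd.ρ₁))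
    C₁ = NCl-gr₂ (Fin-finite _) (τ0 G₁) Sd.ρ₁
    C₂ : Σ ℕ (NCl (gr (τ0 G₂) ∪ gr Sd.ρ₂))
    C₂ = NCl-gr₂ (Fin-finite _) (τ0 G₂) Sd.ρ₂
    F₁ F₂ : ℕ
    F₁ = proj₁ C₁
    F₂ = proj₁ C₂
    C : NCl (gr b0 ∪ gr Sep.t') (F₁ + F₂)
    C = NCl-Equiv (Equiv-sym eqv) (NCl-⊎ (proj₂ C₁) (proj₂ C₂))
    nonneg₁ : Σ ℕ λ g → n G₁ + F₁ + g ≡ 2 + nEdges G₁
    nonneg₁ = ℕₚ.m≤n⇒∃[o]m+o≡n (euler-genus G₁ N₁ em₁ (proj₂ C₁))
    nonneg₂ : Σ ℕ λ g → n G₂ + F₂ + g ≡ 2 + nEdges G₂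
    nonneg₂ = ℕₚ.m≤n⇒∃[o]m+o≡n (euler-genus G₂ N₂ em₂ (proj₂ C₂))
    g₁ g₂ : ℕ
    g₁ = proj₁ nonneg₁
    g₂ = proj₁ nonneg₂
    -- The two vertices restored by the separation balance the second constant 2 of the Euler
    -- formulas; hence every face that is gained lowers the sum of the two genera by one.
    total : ∀ {e} → F + e ≤ F₁ + F₂ → g₁ + g₂ + e ≤ eg G
    total {e} le = +-cancelˡ-≤ (2 + n G + F) _ _ (begin
      2 + n G + F + (g₁ + g₂ + e) ≡⟨ lem₁ (2 + n G) F (g₁ + g₂) e ⟩
      2 + n G + (F + e) + (g₁ + g₂) ≤⟨ +-monoˡ-≤ (g₁ + g₂) (+-mono-≤ (≤-reflexive (sym vertices)) le) ⟩
      n G₁ + n G₂ + (F₁ + F₂) + (g₁ + g₂) ≡⟨ lem₂ (n G₁) (n G₂) F₁ F₂ g₁ g₂ ⟩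
      (n G₁ + F₁ + g₁) + (n G₂ + F₂ + g₂) ≡⟨ cong₂ _+_ (proj₂ nonneg₁) (proj₂ nonneg₂) ⟩
      (2 + nEdges G₁) + (2 + nEdges G₂) ≡⟨ lem₃ (nEdges G₁) (nEdges G₂) ⟩
      2 + (2 + (nEdges G₁ + nEdges G₂)) ≡⟨ cong (λ e → 2 + (2 + e)) (sym edges) ⟩
      2 + (2 + nEdges G) ≡⟨ cong (2 +_) (sym genus) ⟩
      2 + n G + F + eg G ∎)
      where
      lem₁ : ∀ v f g e → v + f + (g + e) ≡ v + (f + e) + g
      lem₁ = solve-∀
      lem₂ : ∀ a b c d e f → a + b + (c + d) + (e + f) ≡ (a + c + e) + (b + d + f)
      lem₂ = solve-∀
      lem₃ : ∀ a b → (2 + a) + (2 + b) ≡ 2 + (2 + (a + b))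
      lem₃ = solve-∀
    sharedAt : ∀ {v} a b → ι₁ a ≡ v → ι₂ b ≡ v → Shared vΦ isLeft v
    sharedAt a b p q = inj₁ (proj₁ (flag-at G₁ N₁ a)) , inj₂ (proj₁ (flag-at G₂ N₂ b))
      , trans (cong ι₁ (proj₂ (flag-at G₁ N₁ a))) p , trans (cong ι₂ (proj₂ (flag-at G₂ N₂ b))) q , λ ()
    conclude : (Σ ℕ λ e → (Shared vΦ isLeft (x G) → 1 ≤ e) × (Shared vΦ isLeft (y G) → 1 ≤ e) × (x G ≢ y G → Shared vΦ isLeft (x G) → Shared vΦ isLeft (y G) → 2 ≤ e) × Sep.Gain e)
             ⊎ (x G ≢ y G × (∀ s → Σ Φ λ f → Σ Φ λ g → (isLeft f ≡ s × vΦ f ≡ x G) × (isLeft g ≡ s × vΦ g ≡ y G) × Cl (gr b0 ∪ gr Sep.t') f g) × Sep.Gain 0) →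
      eg G₁ + eg G₂ + 2 ≤ eg G ⊎ eg⁺ G₁ + eg⁺ G₂ ≤ eg G
    conclude (inj₁ (e , _ , _ , two , gain)) = inj₁ (≤-trans (+-mono-≤ (+-mono-≤
      (eg-bound G₁ N₁ em₁ (proj₂ C₁) (≤-reflexive (sym (proj₂ nonneg₁)))) (eg-bound G₂ N₂ em₂ (proj₂ C₂) (≤-reflexive (sym (proj₂ nonneg₂)))))
      (two x≢y (sharedAt _ _ ι₁x ι₂x) (sharedAt _ _ ι₁y ι₂y))) (total {e} (gain count C)))
    conclude (inj₂ (_ , cof , gain)) = inj₂ (≤-trans (+-mono-≤ (first (cof true)) (second (cof false)))
        (≤-trans (≤-reflexive (sym (ℕₚ.+-identityʳ _))) (total {0} (gain count C))))
      where
      first : (Σ Φ λ f → Σ Φ λ g → (isLeft f ≡ true × vΦ f ≡ x G) × (isLeft g ≡ true × vΦ g ≡ y G) × Cl (gr b0 ∪ gr Sep.t') f g) → eg⁺ G₁ ≤ g₁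
      first (inj₁ f , inj₁ g , (_ , p) , (_ , q) , r) = (Terminal.cofacial-bound G₁ x≢y₁ N₁) em₁ (proj₂ C₁)
        (ι₁-inj (trans p (sym ι₁x))) (ι₁-inj (trans q (sym ι₁y))) (inl-Cl (Equiv.to* eqv r)) (≤-reflexive (sym (proj₂ nonneg₁)))
      second : (Σ Φ λ f → Σ Φ λ g → (isLeft f ≡ false × vΦ f ≡ x G) × (isLeft g ≡ false × vΦ g ≡ y G) × Cl (gr b0 ∪ gr Sep.t') f g) → eg⁺ G₂ ≤ g₂
      second (inj₂ f , inj₂ g , (_ , p) , (_ , q) , r) = (Terminal.cofacial-bound G₂ x≢y₂ N₂) em₂ (proj₂ C₂)
        (ι₂-inj (trans p (sym ι₂x))) (ι₂-inj (trans q (sym ι₂y))) (inr-Cl (Equiv.to* eqv r)) (≤-reflexive (sym (proj₂ nonneg₂)))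

  lower : eg G₁ + eg G₂ + 2 ≤ eg G ⊎ eg⁺ G₁ + eg⁺ G₂ ≤ eg G
  lower = separated (Represented.optimal′ G R N)
    where
    separated : Represented.Optimal′ G R → eg G₁ + eg G₂ + 2 ≤ eg G ⊎ eg⁺ G₁ + eg⁺ G₂ ≤ eg G
    separated O = sided (separate FΦ _≟_ b0m b2m em.matching vΦ-b2 em.pure left-pres left-pres em.rot (x G) (y G) shared)
      where
      module O = Represented.Optimal′ O
      module em = IsEmb O.emb
      sided : Separation vΦ isLeft b0 b2 O.t (x G) (y G) → eg G₁ + eg G₂ + 2 ≤ eg G ⊎ eg⁺ G₁ + eg⁺ G₂ ≤ eg G
      sided Sep = Lower.conclude O.count O.genus Sep (sides (Separation.matching Sep) (Separation.t'-side Sep)) (Separation.result Sep)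

  -- The edge xy of `plus G₂` is glued to that of G₁ without loss of faces, and then deleted. Its
  -- flags come with G₂, but must be the last summand for `Edge.Delete`; hence the re-association by
  -- `to` and `from`.
  module Upper₁ (xy : TE G₁ (x G₁) (y G₁)) (O₁ : Optimal G₁ N₁)
    (O₂ : Represented.Optimal′ (plus G₂) (plus-represents G₂ x≢y₂ noXY₂ (flag-represents G₂))) where
    module O₁ = Optimal O₁
    module O₂ = Represented.Optimal′ O₂
    module e₁ = IsEmb O₁.emb
    module e₂ = IsEmb O₂.emb
    module Ed = Edge FΦ b0m b2m {vΦ} vΦ-b2 (x G) (y G)

    Ψ : Set
    Ψ = Flag G₁ ⊎ (Flag G₂ ⊎ Quad)

    to : Ψ → Ed.Φ⁺
    to = assoc⊎
    from : Ed.Φ⁺ → Ψ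
    from = unassoc⊎

    from-to : ∀ z → from (to z) ≡ z
    from-to (inj₁ _) = refl
    from-to (inj₂ (inj₁ _)) = refl
    from-to (inj₂ (inj₂ _)) = refl

    to-from : ∀ z → to (from z) ≡ z
    to-from (inj₁ (inj₁ _)) = refl
    to-from (inj₁ (inj₂ _)) = refl
    to-from (inj₂ _) = refl

    t⁰ : Ed.Φ⁺ → Ed.Φ⁺
    t⁰ z = to (map⊎ O₁.t O₂.t (from z))

    side⁺ : Ed.Φ⁺ → Bool
    side⁺ z = isLeft (from z)

    v₂ : Flag G₂ ⊎ Quad → Fin (n G₂)
    v₂ = [ flagVertex G₂ , ends (x G₂) (y G₂) ]′

    v-to : ∀ z → Ed.v⁺ (to z) ≡ [ ι₁ ∘ flagVertex G₁ , ι₂ ∘ v₂ ]′ z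
    v-to (inj₁ _) = refl
    v-to (inj₂ (inj₁ _)) = refl
    v-to (inj₂ (inj₂ (zero , _))) = sym ι₂x
    v-to (inj₂ (inj₂ (suc _ , _))) = sym ι₂y

    v-from : ∀ z → Ed.v⁺ z ≡ [ ι₁ ∘ flagVertex G₁ , ι₂ ∘ v₂ ]′ (from z)
    v-from z = trans (cong Ed.v⁺ (sym (to-from z))) (v-to (from z))

    t⁰m : Matching t⁰
    t⁰m = record
      { inv = λ z → trans (cong (to ∘ map⊎ O₁.t O₂.t) (from-to (map⊎ O₁.t O₂.t (from z)))) (trans (cong to (inv (from z))) (to-from z))
      ; irr = λ z p → irr (from z) (trans (sym (from-to (map⊎ O₁.t O₂.t (from z)))) (cong from p)) }
      where open Matching (⊎-matching e₁.matching e₂.matching)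

    t⁰-side : Preserves side⁺ t⁰
    t⁰-side z = trans (cong isLeft (from-to (map⊎ O₁.t O₂.t (from z)))) (left-pres (from z))

    b2-from : ∀ z → from (Ed.a2⁺ z) ≡ map⊎ (τ2 G₁) (map⊎ (τ2 G₂) q2) (from z)
    b2-from (inj₁ (inj₁ _)) = refl
    b2-from (inj₁ (inj₂ _)) = refl
    b2-from (inj₂ _) = refl

    b0-from : ∀ z → from (Ed.a0⁺ z) ≡ map⊎ (τ0 G₁) (map⊎ (τ0 G₂) q0) (from z)
    b0-from (inj₁ (inj₁ _)) = refl
    b0-from (inj₁ (inj₂ _)) = refl
    b0-from (inj₂ _) = refl

    a2-side : Preserves side⁺ Ed.a2⁺
    a2-side z = trans (cong isLeft (b2-from z)) (left-pres (from z))

    t⁰-v : Preserves Ed.v⁺ t⁰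
    t⁰-v z = trans (v-to (map⊎ O₁.t O₂.t (from z))) (trans (go (from z)) (sym (v-from z)))
      where
      go : ∀ w → [ ι₁ ∘ flagVertex G₁ , ι₂ ∘ v₂ ]′ (map⊎ O₁.t O₂.t w) ≡ [ ι₁ ∘ flagVertex G₁ , ι₂ ∘ v₂ ]′ w
      go (inj₁ f) = cong ι₁ (e₁.pure f)
      go (inj₂ f) = cong ι₂ (e₂.pure f)

    transfer : ∀ {c : Ψ → Ψ} {d : Ed.Φ⁺ → Ed.Φ⁺} → (∀ z → from (d z) ≡ c (from z)) → Equiv (gr c ∪ gr (map⊎ O₁.t O₂.t)) (gr d ∪ gr t⁰)
    transfer {c} {d} h = record
      { to = to ; from = from
      ; to-R = λ { {z} (inj₁ refl) → [ inj₁ (trans (sym (to-from _)) (cong to (trans (h (to z)) (cong c (from-to z))))) ]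
                 ; {z} (inj₂ refl) → [ inj₂ (cong (to ∘ map⊎ O₁.t O₂.t) (from-to z)) ] }
      ; from-S = λ { {z} (inj₁ refl) → [ inj₁ (sym (h z)) ] ; {z} (inj₂ refl) → [ inj₂ (sym (from-to _)) ] }
      ; from-to = λ z → Cl-≡ (from-to z) ; to-from = λ z → Cl-≡ (to-from z) }

    rot⁰ : ∀ f g → Ed.v⁺ f ≡ Ed.v⁺ g → side⁺ f ≡ side⁺ g → Cl (gr Ed.a2⁺ ∪ gr t⁰) f g
    rot⁰ f g p q = Equiv.from-inv (transfer b2-from) (go (from f) (from g) (trans (sym (v-from f)) (trans p (v-from g))) q)
      where
      go : ∀ f g → [ ι₁ ∘ flagVertex G₁ , ι₂ ∘ v₂ ]′ f ≡ [ ι₁ ∘ flagVertex G₁ , ι₂ ∘ v₂ ]′ g → isLeft f ≡ isLeft g →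
        Cl (gr (map⊎ (τ2 G₁) (map⊎ (τ2 G₂) q2)) ∪ gr (map⊎ O₁.t O₂.t)) f g
      go (inj₁ f) (inj₁ g) p _ = Cl-map inj₁ (λ { (inj₁ refl) → [ inj₁ refl ] ; (inj₂ refl) → [ inj₂ refl ] }) (e₁.rot f g (ι₁-inj p))
      go (inj₂ f) (inj₂ g) p _ = Cl-map inj₂ (λ { (inj₁ refl) → [ inj₁ refl ] ; (inj₂ refl) → [ inj₂ refl ] }) (e₂.rot f g (ι₂-inj p))

    shared⁺ : ∀ f g → Ed.v⁺ f ≡ Ed.v⁺ g → side⁺ f ≢ side⁺ g → Ed.v⁺ f ≡ x G ⊎ Ed.v⁺ f ≡ y G
    shared⁺ f g p ne = go (from f) (from g) refl refl
      where
      p' = trans (sym (v-from f)) (trans p (v-from g))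
      back : ∀ {w} → [ ι₁ ∘ flagVertex G₁ , ι₂ ∘ v₂ ]′ (from f) ≡ w → Ed.v⁺ f ≡ w
      back = trans (v-from f)
      go : ∀ u w → from f ≡ u → from g ≡ w → Ed.v⁺ f ≡ x G ⊎ Ed.v⁺ f ≡ y G
      go (inj₁ _) (inj₁ _) a b = ⊥-elim (ne (trans (cong isLeft a) (sym (cong isLeft b))))
      go (inj₂ _) (inj₂ _) a b = ⊥-elim (ne (trans (cong isLeft a) (sym (cong isLeft b))))
      go (inj₁ u) (inj₂ w) a b with meet-v _ _ (subst₂ (λ s t → [ ι₁ ∘ flagVertex G₁ , ι₂ ∘ v₂ ]′ s ≡ [ ι₁ ∘ flagVertex G₁ , ι₂ ∘ v₂ ]′ t) a b p')
      ... | inj₁ r = inj₁ (back (trans (cong [ ι₁ ∘ flagVertex G₁ , ι₂ ∘ v₂ ]′ a) r))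
      ... | inj₂ r = inj₂ (back (trans (cong [ ι₁ ∘ flagVertex G₁ , ι₂ ∘ v₂ ]′ a) r))
      go (inj₂ u) (inj₁ w) a b with meet-v _ _ (sym (subst₂ (λ s t → [ ι₁ ∘ flagVertex G₁ , ι₂ ∘ v₂ ]′ s ≡ [ ι₁ ∘ flagVertex G₁ , ι₂ ∘ v₂ ]′ t) a b p'))
      ... | inj₁ r = inj₁ (back (trans p' (trans (cong [ ι₁ ∘ flagVertex G₁ , ι₂ ∘ v₂ ]′ b) r)))
      ... | inj₂ r = inj₂ (back (trans p' (trans (cong [ ι₁ ∘ flagVertex G₁ , ι₂ ∘ v₂ ]′ b) r)))

    e : Flag G₁
    e = proj₁ (mkFlag G₁ xy zero)
    e-x : ι₁ (flagVertex G₁ e) ≡ x G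
    e-x = trans (cong ι₁ (proj₁ (proj₂ (mkFlag G₁ xy zero)))) ι₁x
    e-y : ι₁ (flagVertex G₁ (τ0 G₁ e)) ≡ y G
    e-y = trans (cong ι₁ (proj₁ (proj₂ (proj₂ (mkFlag G₁ xy zero))))) ι₁y

    module TS = TwoSided Ed.F⁺ _≟_ Ed.a0⁺m Ed.a2⁺m t⁰m side⁺ a2-side t⁰-side Ed.v⁺ Ed.v⁺-a2 t⁰-v rot⁰ (x G) (y G) x≢y shared⁺
      {inj₁ (inj₁ e)} {inj₂ (zero , zero)} {inj₁ (inj₁ (τ0 G₁ e))} {inj₂ (suc zero , zero)} e-x refl e-y refl refl refl refl refl
    module D = Ed.Delete TS.isEmb x≢y {inj₁ e} {inj₁ (τ0 G₁ e)} e-x e-y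

    t¹-v : Preserves Ed.v⁺ TS.G₁.t'
    t¹-v = TS.G₁.keeps Ed.v⁺ e-x t⁰-v

    glued : Σ ℕ λ k' → NCl (gr Ed.a0⁺ ∪ gr TS.G₂.t') k' × O₁.F + O₂.F ≤ k'
    glued = TS.parallel-faces refl refl
      (λ p → x≢y (trans (sym e-x) (trans (cong Ed.v⁺ p) (trans (t¹-v _) e-y))))
      (λ p → x≢y (trans (sym e-x) (trans (cong Ed.v⁺ p) (t¹-v _))))
      (NCl-Equiv (transfer b0-from) (NCl-Equiv ⊎-Equiv (NCl-⊎ O₁.count O₂.count)))

    rest : Σ ℕ (NCl (gr b0 ∪ gr D.t))
    rest = NCl-gr₂ FΦ b0 D.t

    bound : eg G ≤ eg G₁ + eg⁺ G₂
    -- The 3 consists of the second constant 2 in the two Euler formulas and the additional edge of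
    -- `plus G₂`.
    bound = Represented.eg-bound′ G R N D.deleted (proj₂ rest) (+-cancelˡ-≤ 3 _ _ (begin
        3 + (2 + nEdges G) ≡⟨ cong (λ e → 3 + (2 + e)) edges ⟩
        3 + (2 + (nEdges G₁ + nEdges G₂)) ≡⟨ lem₁ (nEdges G₁) (nEdges G₂) ⟩
        (2 + nEdges G₁) + (2 + suc (nEdges G₂)) ≡⟨ cong₂ _+_ (sym O₁.genus) (trans (cong (2 +_) (sym (edges-add G₂ (plus G₂) (flag-represents G₂)
            (plus-represents G₂ x≢y₂ noXY₂ (flag-represents G₂))))) (sym O₂.genus)) ⟩
        (n G₁ + O₁.F + eg G₁) + (n G₂ + O₂.F + eg⁺ G₂) ≡⟨ lem₂ (n G₁) O₁.F (eg G₁) (n G₂) O₂.F (eg⁺ G₂) ⟩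
        (n G₁ + n G₂) + (O₁.F + O₂.F) + (eg G₁ + eg⁺ G₂) ≤⟨ +-monoˡ-≤ (eg G₁ + eg⁺ G₂) (+-mono-≤ (≤-reflexive vertices)
            (≤-trans (proj₂ (proj₂ glued)) (D.delete-faces (proj₁ (proj₂ glued)) (proj₂ rest)))) ⟩
        (2 + n G) + suc (proj₁ rest) + (eg G₁ + eg⁺ G₂) ≡⟨ lem₃ (n G) (proj₁ rest) (eg G₁ + eg⁺ G₂) ⟩
        3 + (n G + proj₁ rest + (eg G₁ + eg⁺ G₂)) ∎))
      where
      open ≤-Reasoning
      lem₁ : ∀ a b → 3 + (2 + (a + b)) ≡ (2 + a) + (2 + suc b)
      lem₁ = solve-∀
      lem₂ : ∀ a b c d e f → (a + b + c) + (d + e + f) ≡ (a + d) + (b + e) + (c + f)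
      lem₂ = solve-∀
      lem₃ : ∀ a b c → (2 + a) + suc b + c ≡ 3 + (a + b + c)
      lem₃ = solve-∀

  upper₁ : TE G₁ (x G₁) (y G₁) → eg G ≤ eg G₁ + eg⁺ G₂
  upper₁ xy = Upper₁.bound xy (optimal G₁ N₁) (Represented.optimal′ (plus G₂) _ (nice-plus G₂ x≢y₂ N₂))

  S⁺ : IsXYSum (plus G) (plus G₁) G₂ ι₁ ι₂
  S⁺ = ι₁-inj , ι₂-inj , ι₁x , ι₁y , ι₂x , ι₂y , onto , meet , λ p q → mk⇔
    (λ t → [ (λ t → map₁⊎ (λ (a , b , u , w , t) → a , b , u , w , plus⁺ G₁ x≢y₁ (inj₁ t)) (sum⁻ t))
           , (λ { (inj₁ (p , q)) → inj₁ (x G₁ , y G₁ , trans ι₁x (sym p) , trans ι₁y (sym q) , plus⁺ G₁ x≢y₁ (inj₂ (inj₁ (refl , refl))))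
                ; (inj₂ (p , q)) → inj₁ (y G₁ , x G₁ , trans ι₁y (sym p) , trans ι₁x (sym q) , plus⁺ G₁ x≢y₁ (inj₂ (inj₂ (refl , refl)))) }) ]′ (plus⁻ G x≢y t))
    λ { (inj₂ s) → plus⁺ G x≢y (inj₁ (sum⁺ (inj₂ s)))
      ; (inj₁ (a , b , u , w , t)) → [ (λ t → plus⁺ G x≢y (inj₁ (sum⁺ (inj₁ (a , b , u , w , t)))))
          , (λ { (inj₁ (refl , refl)) → plus⁺ G x≢y (inj₂ (inj₁ (trans (sym u) ι₁x , trans (sym w) ι₁y)))
               ; (inj₂ (refl , refl)) → plus⁺ G x≢y (inj₂ (inj₂ (trans (sym u) ι₁y , trans (sym w) ι₁x))) }) ]′ (plus⁻ G₁ x≢y₁ t) }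

-- `plus G` is the sum of `plus G₁` and G₂, and its first summand contains an edge xy along which to
-- glue. Dropping xy again does not increase the genus.
joined-bound : (G G₁ G₂ : Graph) {ι₁ : Fin (n G₁) → Fin (n G)} {ι₂ : Fin (n G₂) → Fin (n G)}
  (x≢y₁ : x G₁ ≢ y G₁) (x≢y₂ : x G₂ ≢ y G₂) (S : IsXYSum G G₁ G₂ ι₁ ι₂) (N₁ : Nice G₁) (N₂ : Nice G₂) (noXY₂ : NoXY G₂) → eg G ≤ eg⁺ G₁ + eg⁺ G₂
joined-bound G G₁ G₂ {ι₁} {ι₂} x≢y₁ x≢y₂ S N₁ N₂ noXY₂ =
  ≤-trans (Terminal.eg≤eg⁺ G (SumGenus.x≢y G G₁ G₂ {ι₁} {ι₂} x≢y₁ x≢y₂ S N₁ N₂ noXY₂) (SumGenus.N G G₁ G₂ {ι₁} {ι₂} x≢y₁ x≢y₂ S N₁ N₂ noXY₂))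
    (SumGenus.upper₁ (plus G) (plus G₁) G₂ {ι₁} {ι₂} x≢y₁ x≢y₂ (SumGenus.S⁺ G G₁ G₂ {ι₁} {ι₂} x≢y₁ x≢y₂ S N₁ N₂ noXY₂)
      (nice-plus G₁ x≢y₁ N₁) N₂ noXY₂ (plus⁺ G₁ x≢y₁ (inj₂ (inj₁ (refl , refl)))))

-- Embedding a bridge in place of its contraction

≢⇒≡ : ∀ {a b c : Bool} → a ≢ c → b ≢ c → a ≡ b
≢⇒≡ {true} {true} _ _ = refl
≢⇒≡ {false} {false} _ _ = refl
≢⇒≡ {true} {false} {true} p _ = ⊥-elim (p refl)
≢⇒≡ {true} {false} {false} _ q = ⊥-elim (q refl)
≢⇒≡ {false} {true} {true} _ q = ⊥-elim (q refl)
≢⇒≡ {false} {true} {false} p _ = ⊥-elim (p refl)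

MergeAdj : {V W : Set} → (V → W) → Rel V → Rel W
MergeAdj {V} f Adj c d = Σ V λ p → Σ V λ q → f p ≡ c × f q ≡ d × Adj p q

-- B is a graph with two components, containing u and v respectively; f identifies u and v.
module Bridge {k : ℕ} {aB : Fin (suc k) → Fin (suc k) → Bool} {xB yB : Fin (suc k)}
  {u v : Fin (suc k)} (f : Fin (suc k) → Fin k) (f-uv : f u ≡ f v)
  (f-inj : ∀ p q → f p ≡ f q → p ≡ q ⊎ Link u v p q)
  (side : Fin (suc k) → Bool) (side-edge : ∀ {p q} → TE (graph (suc k) aB xB yB) p q → side p ≡ side q)
  (component : ∀ p q → side p ≡ side q → Cl (TE (graph (suc k) aB xB yB)) p q) (su≢sv : side u ≢ side v) where

  B : Graph
  B = graph (suc k) aB xB yB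

  u≢v : u ≢ v
  u≢v e = su≢sv (cong side e)

  no-cross : ∀ {p q} → side p ≢ side q → ¬ TE B p q
  no-cross ne t = ne (side-edge t)

  recover-vertex : ∀ {p q} → f p ≡ f q → side p ≡ side q → p ≡ q
  recover-vertex {p} {q} e s with f-inj p q e
  ... | inj₁ r = r
  ... | inj₂ (inj₁ (refl , refl)) = ⊥-elim (su≢sv s)
  ... | inj₂ (inj₂ (refl , refl)) = ⊥-elim (su≢sv (sym s))

  -- Every edge of B keeps to its side, so identifying u and v makes no two edges parallel, and the
  -- flags of B also represent the contracted graph.
  merged-represents : Represents (MergeAdj f (TE B)) (τ0 B) (τ2 B) (f ∘ flagVertex B) (flagSide B)
  merged-represents = record
    { space = record { a0m = S.a0m ; a2m = S.a2m ; v-a2 = λ g → cong f (S.v-a2 g) ; v-a0a2 = λ g → cong f (S.v-a0a2 g) ; sd-a0 = S.sd-a0 ; sd-a2 = S.sd-a2 }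
    ; edge = λ g → _ , _ , refl , refl , flag-edge B g
    ; unique = λ {g} {h} p q r → uni g h p q r (side (flagVertex B g) Bool.≟ side (flagVertex B h))
    ; cover = λ { (p , q , refl , refl , t) s → let g , a , b , c = mkFlag B t s in g , cong f a , cong f b , c } }
    where
    module S = Space (flag-space B)
    uni : ∀ g h → f (flagVertex B g) ≡ f (flagVertex B h) → f (flagVertex B (τ0 B g)) ≡ f (flagVertex B (τ0 B h)) →
      flagSide B g ≡ flagSide B h → Dec (side (flagVertex B g) ≡ side (flagVertex B h)) → g ≡ h
    uni g h p q r (yes s) = flag-unique B (recover-vertex p s)
      (recover-vertex q (trans (sym (side-edge (flag-edge B g))) (trans s (side-edge (flag-edge B h))))) r
    uni g h p q r (no s) = cases (f-inj _ _ p) (f-inj _ _ q)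
      where
      cases : flagVertex B g ≡ flagVertex B h ⊎ Link u v (flagVertex B g) (flagVertex B h) →
        flagVertex B (τ0 B g) ≡ flagVertex B (τ0 B h) ⊎ Link u v (flagVertex B (τ0 B g)) (flagVertex B (τ0 B h)) → g ≡ h
      cases (inj₁ e) _ = ⊥-elim (s (cong side e))
      cases (inj₂ _) (inj₁ e) = ⊥-elim (s (trans (side-edge (flag-edge B g)) (trans (cong side e) (sym (side-edge (flag-edge B h))))))
      cases (inj₂ (inj₁ (a , _))) (inj₂ (inj₁ (b , _))) = ⊥-elim (E-irrefl B (flag-edge B g) (trans a (sym b)))
      cases (inj₂ (inj₂ (a , _))) (inj₂ (inj₂ (b , _))) = ⊥-elim (E-irrefl B (flag-edge B g) (trans a (sym b)))
      cases (inj₂ (inj₁ (a , _))) (inj₂ (inj₂ (b , _))) = ⊥-elim (no-cross su≢sv (subst₂ (TE B) a b (flag-edge B g)))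
      cases (inj₂ (inj₂ (a , _))) (inj₂ (inj₁ (b , _))) = ⊥-elim (no-cross (su≢sv ∘ sym) (subst₂ (TE B) a b (flag-edge B g)))

  Flag-at : Fin (suc k) → Set
  Flag-at p = Σ (Flag B) λ g → flagVertex B g ≡ p

  flag-to : ∀ {p q} → TE B p q → Flag-at p
  flag-to t = let g , e , _ = mkFlag B t zero in g , e

  flag-at? : ∀ p → Flag-at p ⊎ (∀ g → flagVertex B g ≢ p)
  flag-at? p with any? (λ q → T? (E B p q))
  ... | yes (q , t) = inj₁ (flag-to t)
  ... | no none = inj₂ λ { g refl → none (_ , flag-edge B g) }

  first-flag : ∀ {p q} → p ≢ q → side p ≡ side q → Flag-at p
  first-flag {p} {q} ne s = go (component p q s) ne
    where
    go : ∀ {p q} → Cl (TE B) p q → p ≢ q → Flag-at p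
    go ε ne = ⊥-elim (ne refl)
    go (fwd t _) _ = flag-to t
    go (bwd t _) _ = flag-to (E-sym B t)

  sideΦ : Flag B → Bool
  sideΦ = side ∘ flagVertex B

  sideΦ-τ0 : Preserves sideΦ (τ0 B)
  sideΦ-τ0 g = sym (side-edge (flag-edge B g))

  sideΦ-τ2 : Preserves sideΦ (τ2 B)
  sideΦ-τ2 g = cong side (vertex-τ2 B g)

  FB : Finite (Flag B)
  FB = Fin-finite _


  -- The embedding of B obtained by separating the two sides of an embedding of the merged graph.
  record Split {t : Flag B → Flag B} : Set where
    field
      t'    : Flag B → Flag B
      isEmb : IsEmb (τ2 B) (flagVertex B) t'
      keeps : Preserves sideΦ t'
      gain  : ∀ {F} → NCl (gr (τ0 B) ∪ gr t) F → Σ ℕ λ F' → NCl (gr (τ0 B) ∪ gr t') F' × F ≤ F' × (Flag-at u → Flag-at v → suc F ≤ F')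

  -- Both common vertices of the separation are taken to be `f u`. The cofacial alternative demands
  -- distinct vertices and is thereby excluded.
  split : ∀ {t} → IsEmb (τ2 B) (f ∘ flagVertex B) t → Split {t}
  split {t} e = from-sep (separate FB _≟_ (τ0-matching B) (τ2-matching B) e.matching {f ∘ flagVertex B} {sideΦ}
      (λ g → cong f (vertex-τ2 B g)) e.pure sideΦ-τ0 sideΦ-τ2 e.rot (f u) (f u) shared)
    where
    module e = IsEmb e
    shared : ∀ g h → f (flagVertex B g) ≡ f (flagVertex B h) → sideΦ g ≢ sideΦ h → f (flagVertex B g) ≡ f u ⊎ f (flagVertex B g) ≡ f u
    shared g h p ne = cases (f-inj _ _ p)
      where
      cases : flagVertex B g ≡ flagVertex B h ⊎ Link u v (flagVertex B g) (flagVertex B h) → f (flagVertex B g) ≡ f u ⊎ f (flagVertex B g) ≡ f u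
      cases (inj₁ q) = ⊥-elim (ne (cong side q))
      cases (inj₂ (inj₁ (q , _))) = inj₁ (cong f q)
      cases (inj₂ (inj₂ (q , _))) = inj₁ (trans (cong f q) (sym f-uv))
    from-sep : Separation (f ∘ flagVertex B) sideΦ (τ0 B) (τ2 B) t (f u) (f u) → Split {t}
    from-sep S = record
      { t' = S.t'
      ; isEmb = record { matching = S.matching ; pure = λ g → recover-vertex (S.t'-vert g) (S.t'-side g)
                       ; rot = λ g h p → S.rotation g h (cong f p) (cong side p) }
      ; keeps = S.t'-side
      ; gain = λ N → let F' , N' = NCl-gr₂ FB (τ0 B) S.t' in F' , N' , bounds S.result N N' }
      where
      module S = Separation S
      bounds : (Σ ℕ λ n → (Shared (f ∘ flagVertex B) sideΦ (f u) → 1 ≤ n) × (Shared (f ∘ flagVertex B) sideΦ (f u) → 1 ≤ n)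
          × (f u ≢ f u → Shared (f ∘ flagVertex B) sideΦ (f u) → Shared (f ∘ flagVertex B) sideΦ (f u) → 2 ≤ n) × S.Gain n)
        ⊎ (f u ≢ f u × (∀ s → Σ (Flag B) λ g → Σ (Flag B) λ h → (sideΦ g ≡ s × f (flagVertex B g) ≡ f u) × (sideΦ h ≡ s × f (flagVertex B h) ≡ f u) × Cl (gr (τ0 B) ∪ gr S.t') g h) × S.Gain 0) →
        ∀ {F F'} → NCl (gr (τ0 B) ∪ gr t) F → NCl (gr (τ0 B) ∪ gr S.t') F' → F ≤ F' × (Flag-at u → Flag-at v → suc F ≤ F')
      bounds (inj₂ (ne , _)) = ⊥-elim (ne refl)
      bounds (inj₁ (n , one , _ , _ , gain)) {F} N N' = ≤-trans (m≤m+n F n) (gain N N') , λ (g , p) (h , q) →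
        ≤-trans (≤-trans (≤-reflexive (+-comm 1 F)) (+-monoʳ-≤ F (one (g , h , cong f p , trans (cong f q) (sym f-uv) ,
          λ r → su≢sv (trans (cong side (sym p)) (trans r (cong side q))))))) (gain N N')

  module Contracted {aK : Fin k → Fin k → Bool} {xK yK : Fin k} (NK : Nice (graph k aK xK yK)) where
    K : Graph
    K = graph k aK xK yK

    module Simple (K⁺ : ∀ {c d} → MergeAdj f (TE B) c d → TE K c d) (K⁻ : ∀ {c d} → TE K c d → MergeAdj f (TE B) c d) where
      RK : Represents (TE K) (τ0 B) (τ2 B) (f ∘ flagVertex B) (flagSide B)
      RK = represents-cong K⁺ K⁻ merged-represents

      other-flag : (∀ g → flagVertex B g ≢ u) → Flag-at v
      other-flag free with Nice.nbr NK (f u)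
      ... | d , t with K⁻ t
      ... | p , q , e , _ , s with f-inj p u e
      ... | inj₁ refl = let g , r = flag-to s in ⊥-elim (free g r)
      ... | inj₂ (inj₁ (refl , _)) = let g , r = flag-to s in ⊥-elim (free g r)
      ... | inj₂ (inj₂ (refl , _)) = flag-to s

      module _ {aT : Fin (suc k) → Fin (suc k) → Bool} {xT yT : Fin (suc k)} (NT : Nice (graph (suc k) aT xT yT)) where
        private
          T' : Graph
          T' = graph (suc k) aT xT yT

        module _ (T⁺ : ∀ {p q} → (TE B ∪ Link u v) p q → TE T' p q) (T⁻ : ∀ {p q} → TE T' p q → (TE B ∪ Link u v) p q)
          (O : Represented.Optimal′ K RK) where
          private
            module O = Represented.Optimal′ O
            Sp : Split {O.t}
            Sp = split O.emb
            module Sp = Split Sp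
            RT : Represents (TE T') ((Edge.a0⁺ FB (τ0-matching B) (τ2-matching B) {flagVertex B} (vertex-τ2 B)) u v) ((Edge.a2⁺ FB (τ0-matching B) (τ2-matching B) {flagVertex B} (vertex-τ2 B)) u v) ((Edge.v⁺ FB (τ0-matching B) (τ2-matching B) {flagVertex B} (vertex-τ2 B)) u v) [ flagSide B , proj₂ ]′
            RT = represents-cong T⁺ T⁻ (add-represents (flag-represents B) u≢v (no-cross su≢sv) (no-cross (su≢sv ∘ sym)))

            finish : ∀ {F' t⁺} → IsEmb ((Edge.a2⁺ FB (τ0-matching B) (τ2-matching B) {flagVertex B} (vertex-τ2 B)) u v) ((Edge.v⁺ FB (τ0-matching B) (τ2-matching B) {flagVertex B} (vertex-τ2 B)) u v) t⁺ → NCl (gr ((Edge.a0⁺ FB (τ0-matching B) (τ2-matching B) {flagVertex B} (vertex-τ2 B)) u v) ∪ gr t⁺) F' → O.F ≤ F' → eg T' ≤ eg K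
            finish {F'} e N le = Represented.eg-bound′ T' RT NT e N (begin
              2 + nEdges T' ≡⟨ cong (2 +_) (edges-add K T' RK RT) ⟩
              suc (2 + nEdges K) ≡⟨ cong suc (sym O.genus) ⟩
              suc (k + O.F + eg K) ≤⟨ s≤s (+-monoˡ-≤ (eg K) (+-monoʳ-≤ k le)) ⟩
              suc k + F' + eg K ∎)
              where open ≤-Reasoning

          -- Separating u from v gains a face, and drawing the edge uv costs at most one; the
          -- additional vertex balances the additional edge.
          bridge-both : Flag-at u → Flag-at v → eg T' ≤ eg K
          bridge-both (g , p) (h , q) =
            let F' , N' , _ , le = Sp.gain O.count
                A , _ = (Edge.Add.add-edge FB (τ0-matching B) (τ2-matching B) {flagVertex B} (vertex-τ2 B)) u v Sp.isEmb u≢v g h p q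
                F″ , N″ , le′ = Edge.Add.Added.count A N'
            in finish (Edge.Add.Added.isEmb A) N″ (ℕₚ.≤-pred (≤-trans (le (g , p) (h , q)) le′))

          -- With u isolated in B the separation need not gain a face, but a pendant edge costs
          -- none.
          bridge-leaf : (∀ g → flagVertex B g ≢ u) → eg T' ≤ eg K
          bridge-leaf free =
            let F' , N' , le , _ = Sp.gain O.count
                h , q = other-flag free
                A = (Edge.Add.add-pendant FB (τ0-matching B) (τ2-matching B) {flagVertex B} (vertex-τ2 B)) u v Sp.isEmb u≢v free h q
                F″ , N″ , le′ = Edge.Add.Pendant.count A N'
            in finish (Edge.Add.Pendant.isEmb A) N″ (≤-trans le le′)

  -- Contracting the bridge uv of a graph to which an edge ab across the bridge has been added.
  module BridgePlus
    {a b : Fin (suc k)} (sa : side a ≡ side u) (sb : side b ≡ side v)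
    {aK : Fin k → Fin k → Bool} {xK yK : Fin k} (NK : Nice (graph k aK xK yK))
    {aT : Fin (suc k) → Fin (suc k) → Bool} {xT yT : Fin (suc k)} (NT : Nice (graph (suc k) aT xT yT)) where

    K T' : Graph
    K = graph k aK xK yK
    T' = graph (suc k) aT xT yT

    a≢b : a ≢ b
    a≢b e = su≢sv (trans (sym sa) (trans (cong side e) sb))

    module Simple (a≢u : a ≢ u) (fab : ¬ MergeAdj f (TE B) (f a) (f b))
      (K⁺ : ∀ {c d} → (MergeAdj f (TE B) ∪ Link (f a) (f b)) c d → TE K c d) (K⁻ : ∀ {c d} → TE K c d → (MergeAdj f (TE B) ∪ Link (f a) (f b)) c d)
      (T⁺ : ∀ {p q} → ((TE B ∪ Link a b) ∪ Link u v) p q → TE T' p q) (T⁻ : ∀ {p q} → TE T' p q → ((TE B ∪ Link a b) ∪ Link u v) p q) where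

      Φ : Set
      Φ = Flag B ⊎ Quad
      FΦ : Finite Φ
      FΦ = ⊎-finite FB Quad-finite
      a0 a2 : Φ → Φ
      a0 = map⊎ (τ0 B) q0
      a2 = map⊎ (τ2 B) q2
      a0m : Matching a0
      a0m = ⊎-matching (τ0-matching B) q0-matching
      a2m : Matching a2
      a2m = ⊎-matching (τ2-matching B) q2-matching

      fa≢fb : f a ≢ f b
      fa≢fb e = cases (f-inj a b e)
        where
        cases : a ≡ b ⊎ Link u v a b → ⊥
        cases (inj₁ p) = a≢b p
        cases (inj₂ (inj₁ (p , _))) = a≢u p
        cases (inj₂ (inj₂ (p , _))) = su≢sv (trans (sym sa) (cong side p))

      sym-merge : ∀ {c d} → MergeAdj f (TE B) c d → MergeAdj f (TE B) d c
      sym-merge (p , q , x , y , t) = q , p , y , x , E-sym B t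

      RK : Represents (TE K) a0 a2 [ f ∘ flagVertex B , ends (f a) (f b) ]′ [ flagSide B , proj₂ ]′
      RK = represents-cong K⁺ K⁻ (add-represents merged-represents fa≢fb fab (fab ∘ sym-merge))

      vK : Φ → Fin k
      vK = [ f ∘ flagVertex B , ends (f a) (f b) ]′

      v̂ : Φ → Fin (suc k)
      v̂ = [ flagVertex B , ends a b ]′

      -- The whole edge ab is assigned to the side of v. Then the two sides have in common the
      -- vertex made of u and v, and a.
      s : Φ → Bool
      s = [ sideΦ , (λ _ → side v) ]′

      vK≡ : ∀ z → vK z ≡ f (v̂ z)
      vK≡ (inj₁ _) = refl
      vK≡ (inj₂ (zero , _)) = refl
      vK≡ (inj₂ (suc _ , _)) = refl

      v̂-a2 : Preserves v̂ a2
      v̂-a2 (inj₁ g) = vertex-τ2 B g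
      v̂-a2 (inj₂ (zero , _)) = refl
      v̂-a2 (inj₂ (suc zero , _)) = refl

      vK-a2 : Preserves vK a2
      vK-a2 z = trans (vK≡ (a2 z)) (trans (cong f (v̂-a2 z)) (sym (vK≡ z)))

      s-a2 : Preserves s a2
      s-a2 (inj₁ g) = sideΦ-τ2 g
      s-a2 (inj₂ _) = refl

      s-a0 : Preserves s a0
      s-a0 (inj₁ g) = sideΦ-τ0 g
      s-a0 (inj₂ _) = refl

      -- Only the end at a of the edge ab lies on the other side than its vertex.
      s-v̂ : ∀ z → s z ≡ side (v̂ z) ⊎ (s z ≡ side v × v̂ z ≡ a)
      s-v̂ (inj₁ _) = inj₁ refl
      s-v̂ (inj₂ (zero , _)) = inj₂ (refl , refl)
      s-v̂ (inj₂ (suc zero , _)) = inj₁ (sym sb)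

      off-a : ∀ z → v̂ z ≢ a → s z ≡ side (v̂ z)
      off-a z ne = cases (s-v̂ z)
        where
        cases : s z ≡ side (v̂ z) ⊎ (s z ≡ side v × v̂ z ≡ a) → s z ≡ side (v̂ z)
        cases (inj₁ p) = p
        cases (inj₂ (_ , p)) = ⊥-elim (ne p)

      v≢a : v ≢ a
      v≢a e = su≢sv (trans (sym sa) (sym (cong side e)))

      at-u : ∀ z → v̂ z ≡ u → s z ≡ side u
      at-u z p = trans (off-a z (λ q → a≢u (trans (sym q) p))) (cong side p)

      at-v : ∀ z → v̂ z ≡ v → s z ≡ side v
      at-v z p = trans (off-a z (λ q → v≢a (trans (sym p) q))) (cong side p)

      recover : ∀ {z w} → vK z ≡ vK w → s z ≡ s w → v̂ z ≡ v̂ w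
      recover {z} {w} p q = cases (f-inj _ _ (trans (sym (vK≡ z)) (trans p (vK≡ w))))
        where
        cases : v̂ z ≡ v̂ w ⊎ Link u v (v̂ z) (v̂ w) → v̂ z ≡ v̂ w
        cases (inj₁ r) = r
        cases (inj₂ (inj₁ (x , y))) = ⊥-elim (su≢sv (trans (sym (at-u z x)) (trans q (at-v w y))))
        cases (inj₂ (inj₂ (x , y))) = ⊥-elim (su≢sv (trans (sym (at-u w y)) (trans (sym q) (at-v z x))))

      apart : ∀ {z w} → v̂ z ≡ v̂ w → s z ≢ s w → v̂ z ≡ a
      apart {z} {w} p ne = cases (s-v̂ z) (s-v̂ w)
        where
        cases : s z ≡ side (v̂ z) ⊎ (s z ≡ side v × v̂ z ≡ a) → s w ≡ side (v̂ w) ⊎ (s w ≡ side v × v̂ w ≡ a) → v̂ z ≡ a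
        cases (inj₂ (_ , q)) _ = q
        cases (inj₁ _) (inj₂ (_ , q)) = trans p q
        cases (inj₁ q) (inj₁ r) = ⊥-elim (ne (trans q (trans (cong side p) (sym r))))

      shared : ∀ z w → vK z ≡ vK w → s z ≢ s w → vK z ≡ f u ⊎ vK z ≡ f a
      shared z w p ne = cases (f-inj _ _ (trans (sym (vK≡ z)) (trans p (vK≡ w))))
        where
        cases : v̂ z ≡ v̂ w ⊎ Link u v (v̂ z) (v̂ w) → vK z ≡ f u ⊎ vK z ≡ f a
        cases (inj₁ q) = inj₂ (trans (vK≡ z) (cong f (apart {z} {w} q ne)))
        cases (inj₂ (inj₁ (q , _))) = inj₁ (trans (vK≡ z) (cong f q))
        cases (inj₂ (inj₂ (q , _))) = inj₁ (trans (vK≡ z) (trans (cong f q) (sym f-uv)))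

      fu≢fa : f u ≢ f a
      fu≢fa e = cases (f-inj u a e)
        where
        cases : u ≡ a ⊎ Link u v u a → ⊥
        cases (inj₁ p) = a≢u (sym p)
        cases (inj₂ (inj₁ (_ , p))) = v≢a (sym p)
        cases (inj₂ (inj₂ (p , _))) = u≢v p

      flag-u : Flag-at u
      flag-u = first-flag (a≢u ∘ sym) (sym sa)
      flag-a : Flag-at a
      flag-a = first-flag a≢u sa

      z-u z-a : Φ
      z-u = inj₁ (proj₁ flag-u)
      z-a = inj₁ (proj₁ flag-a)

      -- If v = b, this vertex may be isolated in B, and the flag is taken from the edge ab.
      z-v : Σ Φ λ z → v̂ z ≡ v
      z-v with v ≟ b
      ... | yes e = inj₂ (suc zero , zero) , sym e
      ... | no ne = let g , p = first-flag ne (sym sb) in inj₁ g , p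

      s-zu : s z-u ≡ side u
      s-zu = cong side (proj₂ flag-u)
      s-za : s z-a ≡ side u
      s-za = trans (cong side (proj₂ flag-a)) sa

      RT : Represents (TE T') (map⊎ a0 q0) (map⊎ a2 q2) [ v̂ , ends u v ]′ [ [ flagSide B , proj₂ ]′ , proj₂ ]′
      RT = represents-cong T⁺ T⁻ (add-represents (add-represents (flag-represents B) a≢b (no-cross ab) (no-cross (ab ∘ sym))) u≢v
          (λ { (inj₁ t) → no-cross su≢sv t ; (inj₂ (inj₁ (p , _))) → a≢u (sym p) ; (inj₂ (inj₂ (_ , p))) → v≢a p })
          (λ { (inj₁ t) → no-cross (su≢sv ∘ sym) t ; (inj₂ (inj₁ (p , _))) → v≢a p ; (inj₂ (inj₂ (_ , p))) → a≢u (sym p) }))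
        where
        ab : side a ≢ side b
        ab e = su≢sv (trans (sym sa) (trans e sb))

      module Ed = Edge FΦ a0m a2m {v̂} v̂-a2 u v

      finish : ∀ {F F' t⁺} → k + F + eg K ≡ 2 + nEdges K → IsEmb Ed.a2⁺ Ed.v⁺ t⁺ → NCl (gr Ed.a0⁺ ∪ gr t⁺) F' → F ≤ F' → eg T' ≤ eg K
      finish {F} {F'} genus e N le = Represented.eg-bound′ T' RT NT e N (begin
        2 + nEdges T' ≡⟨ cong (2 +_) (edges-add K T' RK RT) ⟩
        suc (2 + nEdges K) ≡⟨ cong suc (sym genus) ⟩
        suc (k + F + eg K) ≤⟨ s≤s (+-monoˡ-≤ (eg K) (+-monoʳ-≤ k le)) ⟩
        suc k + F' + eg K ∎)
        where open ≤-Reasoning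

      module Separated {t : Φ → Φ} {F : ℕ} (count : NCl (gr a0 ∪ gr t) F) (genus : k + F + eg K ≡ 2 + nEdges K)
        (S : Separation vK s a0 a2 t (f u) (f a)) where
        module S = Separation S

        t'-v̂ : Preserves v̂ S.t'
        t'-v̂ z = recover {S.t' z} {z} (S.t'-vert z) (S.t'-side z)

        vK-cong : ∀ {z w} → v̂ z ≡ v̂ w → vK z ≡ vK w
        vK-cong {z} {w} p = trans (vK≡ z) (trans (cong f p) (sym (vK≡ w)))

        -- The separation has detached the edge ab from a. It is glued back at corners p and q that
        -- are chosen according to the alternative at hand.
        module Reattach {p q : Φ} (vp : v̂ p ≡ a) (vq : v̂ q ≡ a) (sp≢sq : s p ≢ s q) where
          G : Glued a0 a2 S.t' p q
          G = glue FΦ a0m a2m S.matching s s-a2 S.t'-side sp≢sq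
          module G = Glued G

          isEmb : IsEmb a2 v̂ G.t'
          isEmb = record { matching = G.matching ; pure = G.keeps v̂ (trans vp (sym vq)) t'-v̂ ; rot = rot }
            where
            old : ∀ {z w} → v̂ z ≡ v̂ w → s z ≡ s w → Cl (gr a2 ∪ gr G.t') z w
            old {z} {w} e r = G.rot⊆ (S.rotation z w (vK-cong {z} {w} e) r)
            hub : ∀ z → v̂ z ≡ a → Cl (gr a2 ∪ gr G.t') z p
            hub z e = cases (s z Bool.≟ s p)
              where
              cases : Dec (s z ≡ s p) → Cl (gr a2 ∪ gr G.t') z p
              cases (yes r) = old {z} {p} (trans e (sym vp)) r
              cases (no ne) = old {z} {q} (trans e (sym vq)) (≢⇒≡ ne (sp≢sq ∘ sym)) ∙ G.rot-ac ⁻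
            rot : ∀ z w → v̂ z ≡ v̂ w → Cl (gr a2 ∪ gr G.t') z w
            rot z w e = cases (s z Bool.≟ s w)
              where
              cases : Dec (s z ≡ s w) → Cl (gr a2 ∪ gr G.t') z w
              cases (yes r) = old {z} {w} e r
              cases (no ne) = hub z (apart {z} {w} e ne) ∙ hub w (trans (sym e) (apart {z} {w} e ne)) ⁻

        zu≁zv : s z-u ≢ s (proj₁ z-v)
        zu≁zv e = su≢sv (trans (sym s-zu) (trans e (at-v (proj₁ z-v) (proj₂ z-v))))

        za≁end : s z-a ≢ side v
        za≁end e = su≢sv (trans (sym s-za) e)

        C : Σ ℕ (NCl (gr a0 ∪ gr S.t'))
        C = NCl-gr₂ FΦ a0 S.t'

        -- Two gained faces pay for the gluing at a and for the edge uv.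
        apart-case : 2 + F ≤ proj₁ C → eg T' ≤ eg K
        apart-case le =
          let F₁ , N₁ , l₁ = R.G.count (proj₂ C)
              A , _ = Ed.Add.add-edge R.isEmb u≢v z-u (proj₁ z-v) (proj₂ flag-u) (proj₂ z-v)
              F₂ , N₂ , l₂ = Ed.Add.Added.count A N₁
          in finish genus (Ed.Add.Added.isEmb A) N₂ (ℕₚ.≤-pred (ℕₚ.≤-pred (≤-trans le (≤-trans l₁ (s≤s l₂)))))
          where module R = Reattach {z-a} {inj₂ (zero , zero)} (proj₂ flag-a) refl za≁end

        -- On the side of u, u and a are cofacial; on the other side, v and the end of ab. Gluing at
        -- just these corners merges the two faces into one that contains u and v, and the edge uv
        -- splits it again.
        cofacial-case : F ≤ proj₁ C → (∀ c → Σ Φ λ z → Σ Φ λ w → (s z ≡ c × vK z ≡ f u) × (s w ≡ c × vK w ≡ f a) × Cl (gr a0 ∪ gr S.t') z w) → eg T' ≤ eg K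
        cofacial-case le cof = go (cof (side u)) (cof (side v))
          where
          go : (Σ Φ λ z → Σ Φ λ w → (s z ≡ side u × vK z ≡ f u) × (s w ≡ side u × vK w ≡ f a) × Cl (gr a0 ∪ gr S.t') z w) →
               (Σ Φ λ z → Σ Φ λ w → (s z ≡ side v × vK z ≡ f u) × (s w ≡ side v × vK w ≡ f a) × Cl (gr a0 ∪ gr S.t') z w) → eg T' ≤ eg K
          go (g , p , (sg , vg) , (sp , vp) , gp) (h , q , (sh , vh) , (sq , vq) , hq) =
            let F₁ , N₁ , l₁ = R.G.count (proj₂ C)
                A , F₂ , N₂ , l₂ = Ed.Add.add-cofacial R.isEmb u≢v g h
                  (trans (recover {g} {z-u} (trans vg (sym (vK-at z-u (proj₂ flag-u)))) (trans sg (sym s-zu))) (proj₂ flag-u))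
                  (trans (recover {h} {proj₁ z-v} (trans vh (trans f-uv (sym (vK-at (proj₁ z-v) (proj₂ z-v))))) (trans sh (sym (at-v (proj₁ z-v) (proj₂ z-v))))) (proj₂ z-v))
                  (R.G.merge pq gp ∙ fwd (inj₂ R.G.t'-a) (R.G.merge pq hq ⁻)) N₁
            in finish genus (Ed.Add.Added.isEmb A) N₂ (≤-trans le (≤-trans l₁ l₂))
            where
            vK-at : ∀ z {w} → v̂ z ≡ w → vK z ≡ f w
            vK-at z e = trans (vK≡ z) (cong f e)
            sp≢sq : s p ≢ s q
            sp≢sq e = su≢sv (trans (sym sp) (trans e sq))
            module R = Reattach {p} {q}
              (trans (recover {p} {z-a} (trans vp (sym (vK-at z-a (proj₂ flag-a)))) (trans sp (sym s-za))) (proj₂ flag-a))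
              (recover {q} {inj₂ (zero , zero)} vq sq) sp≢sq
            pq : ¬ Cl (gr a0 ∪ gr S.t') p q
            pq r = sp≢sq (Cl-preserves s-a0 S.t'-side r)

        conclude : (Σ ℕ λ n → (Shared vK s (f u) → 1 ≤ n) × (Shared vK s (f a) → 1 ≤ n) × (f u ≢ f a → Shared vK s (f u) → Shared vK s (f a) → 2 ≤ n) × S.Gain n)
          ⊎ (f u ≢ f a × (∀ c → Σ Φ λ z → Σ Φ λ w → (s z ≡ c × vK z ≡ f u) × (s w ≡ c × vK w ≡ f a) × Cl (gr a0 ∪ gr S.t') z w) × S.Gain 0) → eg T' ≤ eg K
        conclude (inj₁ (n , _ , _ , two , gain)) = apart-case (≤-trans (≤-reflexive (+-comm 2 F)) (≤-trans (+-monoʳ-≤ F (two fu≢fa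
            (z-u , proj₁ z-v , cong f (proj₂ flag-u) , trans (vK≡ (proj₁ z-v)) (trans (cong f (proj₂ z-v)) (sym f-uv)) , zu≁zv)
            (z-a , inj₂ (zero , zero) , cong f (proj₂ flag-a) , refl , za≁end))) (gain count (proj₂ C))))
        conclude (inj₂ (_ , cof , gain)) = cofacial-case (≤-trans (≤-reflexive (sym (ℕₚ.+-identityʳ F))) (gain count (proj₂ C))) cof

      simple-bound : eg T' ≤ eg K
      simple-bound = go (Represented.optimal′ K RK NK)
        where
        go : Represented.Optimal′ K RK → eg T' ≤ eg K
        go O = go′ (separate FΦ _≟_ a0m a2m em.matching vK-a2 em.pure s-a0 s-a2 em.rot (f u) (f a) shared)
          where
          module O = Represented.Optimal′ O
          module em = IsEmb O.emb
          go′ : Separation vK s a0 a2 O.t (f u) (f a) → eg T' ≤ eg K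
          go′ S = Separated.conclude O.count O.genus S (Separation.result S)

    -- If a = u and vb is an edge, then contracting uv makes ab parallel to vb.
    module Parallel (vb : TE B v b) (K⁺ : ∀ {c d} → MergeAdj f (TE B) c d → TE K c d) (K⁻ : ∀ {c d} → TE K c d → MergeAdj f (TE B) c d)
      (T⁺ : ∀ {p q} → ((TE B ∪ Link u v) ∪ Link u b) p q → TE T' p q) (T⁻ : ∀ {p q} → TE T' p q → ((TE B ∪ Link u v) ∪ Link u b) p q) where

      RK : Represents (TE K) (τ0 B) (τ2 B) (f ∘ flagVertex B) (flagSide B)
      RK = represents-cong K⁺ K⁻ merged-represents

      u≢b : u ≢ b
      u≢b e = su≢sv (trans (cong side e) sb)

      Ru : Represents (TE B ∪ Link u v) ((Edge.a0⁺ FB (τ0-matching B) (τ2-matching B) {flagVertex B} (vertex-τ2 B)) u v) ((Edge.a2⁺ FB (τ0-matching B) (τ2-matching B) {flagVertex B} (vertex-τ2 B)) u v) ((Edge.v⁺ FB (τ0-matching B) (τ2-matching B) {flagVertex B} (vertex-τ2 B)) u v) [ flagSide B , proj₂ ]′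
      Ru = add-represents (flag-represents B) u≢v (no-cross su≢sv) (no-cross (su≢sv ∘ sym))

      RT : Represents (TE T') (map⊎ ((Edge.a0⁺ FB (τ0-matching B) (τ2-matching B) {flagVertex B} (vertex-τ2 B)) u v) q0) (map⊎ ((Edge.a2⁺ FB (τ0-matching B) (τ2-matching B) {flagVertex B} (vertex-τ2 B)) u v) q2) [ (Edge.v⁺ FB (τ0-matching B) (τ2-matching B) {flagVertex B} (vertex-τ2 B)) u v , ends u b ]′ [ [ flagSide B , proj₂ ]′ , proj₂ ]′
      RT = represents-cong T⁺ T⁻ (add-represents Ru u≢b
          (λ { (inj₁ t) → no-cross ub t ; (inj₂ (inj₁ (_ , p))) → b≢v p ; (inj₂ (inj₂ (p , _))) → u≢v p })
          (λ { (inj₁ t) → no-cross (ub ∘ sym) t ; (inj₂ (inj₁ (p , _))) → u≢b (sym p) ; (inj₂ (inj₂ (p , _))) → b≢v p }))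
        where
        ub : side u ≢ side b
        ub e = su≢sv (trans e sb)
        b≢v : b ≢ v
        b≢v e = E-irrefl B vb (sym e)

      module Ed = Edge ((Edge.F⁺ FB (τ0-matching B) (τ2-matching B) {flagVertex B} (vertex-τ2 B)) u v) ((Edge.a0⁺m FB (τ0-matching B) (τ2-matching B) {flagVertex B} (vertex-τ2 B)) u v) ((Edge.a2⁺m FB (τ0-matching B) (τ2-matching B) {flagVertex B} (vertex-τ2 B)) u v) {(Edge.v⁺ FB (τ0-matching B) (τ2-matching B) {flagVertex B} (vertex-τ2 B)) u v} ((Edge.v⁺-a2 FB (τ0-matching B) (τ2-matching B) {flagVertex B} (vertex-τ2 B)) u v) u b

      h : Flag B
      h = proj₁ (mkFlag B vb zero)
      h-v : flagVertex B h ≡ v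
      h-v = proj₁ (proj₂ (mkFlag B vb zero))
      h-b : flagVertex B (τ0 B h) ≡ b
      h-b = proj₁ (proj₂ (proj₂ (mkFlag B vb zero)))

      -- Contracting uv removes uv itself, and ub becomes parallel to vb.
      edges : nEdges T' ≡ 2 + nEdges K
      edges = quarter (trans (sym (size-represents T' RT (⊎-finite (⊎-finite FB Quad-finite) Quad-finite)))
        (trans (cong (λ m → m + 4 + 4) (size-represents K RK FB)) (lem (nEdges K))))
        where
        lem : ∀ n → n * 2 * 2 + 4 + 4 ≡ (2 + n) * 2 * 2
        lem = solve-∀

      finish : ∀ {F F' t⁺} → k + F + eg K ≡ 2 + nEdges K → IsEmb Ed.a2⁺ Ed.v⁺ t⁺ → NCl (gr Ed.a0⁺ ∪ gr t⁺) F' → suc F ≤ F' → eg T' ≤ eg K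
      finish {F} {F'} genus e N le = Represented.eg-bound′ T' RT NT e N (begin
        2 + nEdges T' ≡⟨ cong (2 +_) edges ⟩
        2 + (2 + nEdges K) ≡⟨ cong (2 +_) (sym genus) ⟩
        2 + (k + F + eg K) ≡⟨ lem k F (eg K) ⟩
        suc k + suc F + eg K ≤⟨ +-monoˡ-≤ (eg K) (+-monoʳ-≤ (suc k) le) ⟩
        suc k + F' + eg K ∎)
        where
        open ≤-Reasoning
        lem : ∀ a b c → 2 + (a + b + c) ≡ suc a + suc b + c
        lem = solve-∀

      module WithSplit {t : Flag B → Flag B} {F : ℕ} (count : NCl (gr (τ0 B) ∪ gr t) F) (genus : k + F + eg K ≡ 2 + nEdges K) (Sp : Split {t}) where
        module Sp = Split Sp

        -- The split gains a face, and uv then joins the faces of u and v. The resulting face also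
        -- contains b, along vb, so ub can be drawn in it and splits it.
        both-flags : Flag-at u → eg T' ≤ eg K
        both-flags (g , p) =
          let F₁ , N₁ , _ , le = Sp.gain count
              A , joined = (Edge.Add.add-edge FB (τ0-matching B) (τ2-matching B) {flagVertex B} (vertex-τ2 B)) u v Sp.isEmb u≢v g h p h-v
              F₂ , N₂ , l₂ = Edge.Add.Added.count A N₁
              A' , F₃ , N₃ , l₃ = Ed.Add.add-cofacial (Edge.Add.Added.isEmb A) u≢b (inj₁ g) (inj₁ (τ0 B h)) p h-b
                (proj₁ (joined gh) ∙ [ inj₁ refl ]) N₂
          in finish genus (Ed.Add.Added.isEmb A') N₃ (≤-trans (le (g , p) (h , h-v)) (≤-trans l₂ l₃))
          where
          gh : ¬ Cl (gr (τ0 B) ∪ gr Sp.t') g h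
          gh r = su≢sv (trans (cong side (sym p)) (trans (Cl-preserves {col = sideΦ} sideΦ-τ0 Sp.keeps r) (cong side h-v)))

        leaf : (∀ g → flagVertex B g ≢ u) → eg T' ≤ eg K
        leaf free =
          let F₁ , N₁ , le , _ = Sp.gain count
              A = (Edge.Add.add-pendant FB (τ0-matching B) (τ2-matching B) {flagVertex B} (vertex-τ2 B)) u v Sp.isEmb u≢v free h h-v
              F₂ , N₂ , l₂ = Edge.Add.Pendant.count A N₁
              A' , F₃ , N₃ , l₃ = Ed.Add.add-cofacial (Edge.Add.Pendant.isEmb A) u≢b (inj₂ (zero , zero)) (inj₁ (τ0 B h)) refl h-b
                ((Edge.Add.Pendant.joined A) ⁻ ∙ [ inj₁ refl ]) N₂
          in finish genus (Ed.Add.Added.isEmb A') N₃ (≤-trans (s≤s (≤-trans le l₂)) l₃)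

      parallel-bound : eg T' ≤ eg K
      parallel-bound = go (Represented.optimal′ K RK NK)
        where
        go : Represented.Optimal′ K RK → eg T' ≤ eg K
        go O = [ W.both-flags , W.leaf ]′ (flag-at? u)
          where
          module O = Represented.Optimal′ O
          module W = WithSplit O.count O.genus (split O.emb)

-- Deletion and contraction in a graph and in a summand

nice-conn : ∀ G → x G ≢ y G → (∀ a b → Cl (TE G) a b) → Nice G
nice-conn G x≢y conn = record { conn = conn ; nbr = nbr }
  where
  first : ∀ {a b} → Cl (TE G) a b → a ≢ b → Σ (Fin (n G)) λ u → T (E G a u)
  first ε ne = ⊥-elim (ne refl)
  first (fwd t _) _ = _ , t
  first (bwd t _) _ = _ , E-sym G t
  nbr : ∀ v → Σ (Fin (n G)) λ u → T (E G v u)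
  nbr v with v ≟ x G
  ... | yes refl = first (conn (x G) (y G)) x≢y
  ... | no ne = first (conn v (x G)) ne

Link-sym : {V : Set} {u w p q : V} → Link u w p q → Link u w q p
Link-sym (inj₁ (a , b)) = inj₂ (b , a)
Link-sym (inj₂ (a , b)) = inj₁ (b , a)

Link-flip : {V : Set} {u w p q : V} → Link u w p q → Link w u p q
Link-flip (inj₁ e) = inj₂ e
Link-flip (inj₂ e) = inj₁ e

module Deletion (G : Graph) (u v : Fin (n G)) where
  private
    hit : Fin (n G) → Fin (n G) → Bool
    hit p q = (eqF p u ∧ eqF q v) ∨ (eqF p v ∧ eqF q u)

    hit⁻ : ∀ {p q} → T (hit p q) → Link u v p q
    hit⁻ {p} {q} t with T-∨⁻ {eqF p u ∧ eqF q v} t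
    ... | inj₁ r = let a , b = T-∧⁻ {eqF p u} r in inj₁ (eqF⁻ a , eqF⁻ b)
    ... | inj₂ r = let a , b = T-∧⁻ {eqF p v} r in inj₂ (eqF⁻ a , eqF⁻ b)

    hit⁺ : ∀ {p q} → Link u v p q → T (hit p q)
    hit⁺ (inj₁ (refl , refl)) = T-∨⁺ (inj₁ (T-∧⁺ (eqF⁺ {i = u} refl) (eqF⁺ {i = v} refl)))
    hit⁺ (inj₂ (refl , refl)) = T-∨⁺ {eqF v u ∧ eqF u v} (inj₂ (T-∧⁺ (eqF⁺ {i = v} refl) (eqF⁺ {i = u} refl)))

  delete⁻ : ∀ {p q} → TE (delete G u v) p q → TE G p q × ¬ Link u v p q
  delete⁻ {p} {q} t with T-∧⁻ {not (eqF p q)} t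
  ... | a , b with T-∨⁻ {adj (delete G u v) p q} b
  ... | inj₁ c = let d , e = T-∧⁻ {adj G p q} c in T-∧⁺ a (T-∨⁺ (inj₁ d)) , λ l → T-not⁻ e (hit⁺ l)
  ... | inj₂ c = let d , e = T-∧⁻ {adj G q p} c in T-∧⁺ a (T-∨⁺ {adj G p q} (inj₂ d)) , λ l → T-not⁻ e (hit⁺ (Link-sym l))

  delete⁺ : ∀ {p q} → TE G p q → ¬ Link u v p q → TE (delete G u v) p q
  delete⁺ {p} {q} t nl with T-∧⁻ {not (eqF p q)} t
  ... | a , b with T-∨⁻ {adj G p q} b
  ... | inj₁ c = T-∧⁺ a (T-∨⁺ (inj₁ (T-∧⁺ c (T-not⁺ λ h → nl (hit⁻ h)))))
  ... | inj₂ c = T-∧⁺ a (T-∨⁺ {adj (delete G u v) p q} (inj₂ (T-∧⁺ c (T-not⁺ λ h → nl (Link-sym (hit⁻ h))))))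

  Link? : ∀ p q → Dec (Link u v p q)
  Link? p q with T? (hit p q)
  ... | yes t = yes (hit⁻ t)
  ... | no nt = no (nt ∘ hit⁺)

  restore : TE G u v → ∀ {p q} → (TE (delete G u v) ∪ Link u v) p q → TE G p q
  restore uv (inj₁ t) = proj₁ (delete⁻ t)
  restore uv (inj₂ (inj₁ (refl , refl))) = uv
  restore uv (inj₂ (inj₂ (refl , refl))) = E-sym G uv

  decompose : ∀ {p q} → TE G p q → (TE (delete G u v) ∪ Link u v) p q
  decompose {p} {q} t with Link? p q
  ... | yes l = inj₂ l
  ... | no nl = inj₁ (delete⁺ t nl)

module Contraction {k : ℕ} (ad : Fin (suc k) → Fin (suc k) → Bool) (xx yy : Fin (suc k)) {u v : Fin (suc k)} (u≢v : u ≢ v) where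
  H C : Graph
  H = graph (suc k) ad xx yy
  C = contractWith k ad xx yy u v u≢v

  f : Fin (suc k) → Fin k
  f = mergeMap u v u≢v

  f-uv : f u ≡ f v
  f-uv = merge-uv u v u≢v

  f-inj : ∀ p q → f p ≡ f q → p ≡ q ⊎ Link u v p q
  f-inj = merge-inj u v u≢v

  f-link : ∀ {p q} → Link u v p q → f p ≡ f q
  f-link (inj₁ (refl , refl)) = f-uv
  f-link (inj₂ (refl , refl)) = sym f-uv

  g : Fin k → Fin (suc k)
  g = punchIn v

  fg : ∀ c → f (g c) ≡ c
  fg = merge-punchIn u v u≢v

  private
    raw⁻ : ∀ {c d} → T (adj C c d) → MergeAdj f (TE H) c d
    raw⁻ {c} {d} t with anyFin⁻ (proj₂ (T-∧⁻ {not (eqF c d)} t))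
    ... | p , s with anyFin⁻ s
    ... | q , r with T-∧⁻ {E H p q} r
    ... | e , w with T-∧⁻ {eqF (f p) c} w
    ... | a , b = p , q , eqF⁻ a , eqF⁻ b , e

  contract⁻ : ∀ {c d} → TE C c d → c ≢ d × MergeAdj f (TE H) c d
  contract⁻ {c} {d} t with T-∧⁻ {not (eqF c d)} t
  ... | a , b with T-∨⁻ {adj C c d} b
  ... | inj₁ r = (λ e → T-not⁻ a (eqF⁺ e)) , raw⁻ r
  ... | inj₂ r = let p , q , x , y , e = raw⁻ r in (λ e → T-not⁻ a (eqF⁺ e)) , (q , p , y , x , E-sym H e)

  contract⁺ : ∀ {c d} → c ≢ d → MergeAdj f (TE H) c d → TE C c d
  contract⁺ {c} {d} ne (p , q , a , b , e) = T-∧⁺ nt (T-∨⁺ (inj₁ (T-∧⁺ nt (anyFin⁺ {p = hit₁} p (anyFin⁺ {p = hit p} q (T-∧⁺ e (T-∧⁺ (eqF⁺ a) (eqF⁺ b))))))))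
    where
    nt : T (not (eqF c d))
    nt = T-not⁺ λ t → ne (eqF⁻ t)
    hit : Fin (suc k) → Fin (suc k) → Bool
    hit p q = Eraw ad p q ∧ eqF (f p) c ∧ eqF (f q) d
    hit₁ : Fin (suc k) → Bool
    hit₁ p = anyFin (hit p)

  contract-conn : (∀ a b → Cl (TE H) a b) → ∀ c d → Cl (TE C) c d
  contract-conn conn c d = subst₂ (Cl (TE C)) (fg c) (fg d) (Cl-map f edge (conn (g c) (g d)))
    where
    edge : ∀ {p q} → TE H p q → Cl (TE C) (f p) (f q)
    edge {p} {q} t with f p ≟ f q
    ... | yes e = Cl-≡ e
    ... | no ne = [ contract⁺ ne (p , q , refl , refl , t) ]

  module _ (uv : TE H u v) (noxy : NoXY H) where
    no-link : ¬ Link u v xx yy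
    no-link (inj₁ (refl , refl)) = noxy uv
    no-link (inj₂ (refl , refl)) = noxy (E-sym H uv)

    contract-x≢y : xx ≢ yy → x C ≢ y C
    contract-x≢y ne e with f-inj xx yy e
    ... | inj₁ p = ne p
    ... | inj₂ l = no-link l

contract-≡ : ∀ {k ad} {xx yy u v : Fin (suc k)} → u ≢ v → Σ (u ≢ v) λ ne → contract (graph (suc k) ad xx yy) u v ≡ contractWith k ad xx yy u v ne
contract-≡ {u = u} {v} ne with u ≟ v
... | yes e = ⊥-elim (ne e)
... | no ne' = ne' , refl

delete-sum : ∀ {G G₁ G₂ : Graph} {ι₁ : Fin (n G₁) → Fin (n G)} {ι₂ : Fin (n G₂) → Fin (n G)} → IsXYSum G G₁ G₂ ι₁ ι₂ →
  ∀ u v → TE G₁ u v → NoXY G₁ → IsXYSum (delete G (ι₁ u) (ι₁ v)) (delete G₁ u v) G₂ ι₁ ι₂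
delete-sum {G} {G₁} {G₂} {ι₁} {ι₂} (i₁ , i₂ , x₁ , y₁ , x₂ , y₂ , onto , meet , edges) u v uv noXY₁ =
  i₁ , i₂ , x₁ , y₁ , x₂ , y₂ , onto , meet , λ p q → mk⇔ (there p q) (back p q)
  where
  module D = Deletion G (ι₁ u) (ι₁ v)
  module D₁ = Deletion G₁ u v
  lift : ∀ {a b} → Link u v a b → Link (ι₁ u) (ι₁ v) (ι₁ a) (ι₁ b)
  lift (inj₁ (refl , refl)) = inj₁ (refl , refl)
  lift (inj₂ (refl , refl)) = inj₂ (refl , refl)
  lower-link : ∀ {a b} → Link (ι₁ u) (ι₁ v) (ι₁ a) (ι₁ b) → Link u v a b
  lower-link (inj₁ (p , q)) = inj₁ (i₁ p , i₁ q)
  lower-link (inj₂ (p , q)) = inj₂ (i₁ p , i₁ q)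
  terminals : ∀ {a b} → u ≡ a → v ≡ b → (a ≡ x G₁ ⊎ a ≡ y G₁) → (b ≡ x G₁ ⊎ b ≡ y G₁) → ⊥
  terminals refl refl (inj₁ refl) (inj₁ refl) = E-irrefl G₁ uv refl
  terminals refl refl (inj₁ refl) (inj₂ refl) = noXY₁ uv
  terminals refl refl (inj₂ refl) (inj₁ refl) = noXY₁ (E-sym G₁ uv)
  terminals refl refl (inj₂ refl) (inj₂ refl) = E-irrefl G₁ uv refl
  at : ∀ {w b} → ι₂ b ≡ ι₁ w → w ≡ x G₁ ⊎ w ≡ y G₁
  at {w} {b} e with meet w b (sym e)
  ... | inj₁ (p , _) = inj₁ p
  ... | inj₂ (p , _) = inj₂ p
  there : ∀ p q → TE (delete G (ι₁ u) (ι₁ v)) p q → SumAdj ι₁ ι₂ (TE (delete G₁ u v)) (TE G₂) p q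
  there p q t with D.delete⁻ t
  ... | e , nl with Equivalence.to (edges p q) e
  ... | inj₁ (a , b , refl , refl , s) = inj₁ (a , b , refl , refl , D₁.delete⁺ s (nl ∘ lift))
  ... | inj₂ r = inj₂ r
  back : ∀ p q → SumAdj ι₁ ι₂ (TE (delete G₁ u v)) (TE G₂) p q → TE (delete G (ι₁ u) (ι₁ v)) p q
  back p q (inj₁ (a , b , refl , refl , t)) = let s , nl = D₁.delete⁻ t in
    D.delete⁺ (Equivalence.from (edges p q) (inj₁ (a , b , refl , refl , s))) (nl ∘ lower-link)
  back p q (inj₂ (a , b , refl , refl , t)) = D.delete⁺ (Equivalence.from (edges p q) (inj₂ (a , b , refl , refl , t)))
    λ { (inj₁ (e , f)) → terminals refl refl (at e) (at f) ; (inj₂ (e , f)) → terminals refl refl (at f) (at e) }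

-- The vertices of the smaller summand are lifted by `punchIn` before they are mapped on, and `j₁-f`
-- shows that the lift does not matter. G₂ stays embedded injectively because u and v cannot both be
-- terminals: G₁ lacks xy.
contract-sum : ∀ {k k₁ ad ad₁} {xx yy : Fin (suc k)} {x₁ y₁ : Fin (suc k₁)} {G₂ : Graph} {ι₁ : Fin (suc k₁) → Fin (suc k)} {ι₂ : Fin (n G₂) → Fin (suc k)}
  → IsXYSum (graph (suc k) ad xx yy) (graph (suc k₁) ad₁ x₁ y₁) G₂ ι₁ ι₂ → ∀ {u v} (u≢v : u ≢ v) (U≢V : ι₁ u ≢ ι₁ v)
  → TE (graph (suc k₁) ad₁ x₁ y₁) u v → NoXY (graph (suc k₁) ad₁ x₁ y₁)
  → Σ (Fin k₁ → Fin k) λ j₁ → Σ (Fin (n G₂) → Fin k) λ j₂ → IsXYSum (contractWith k ad xx yy (ι₁ u) (ι₁ v) U≢V) (contractWith k₁ ad₁ x₁ y₁ u v u≢v) G₂ j₁ j₂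
contract-sum {k} {k₁} {ad} {ad₁} {xx} {yy} {x₁} {y₁} {G₂} {ι₁} {ι₂} (i₁ , i₂ , ex₁ , ey₁ , ex₂ , ey₂ , onto , meet , edges) {u} {v} u≢v U≢V uv noXY₁ =
  j₁ , j₂ , j₁-inj , j₂-inj , trans (j₁-f _) (cong C.f ex₁) , trans (j₁-f _) (cong C.f ey₁) , cong C.f ex₂ , cong C.f ey₂
  , onto' , meet' , λ c d → mk⇔ there back
  where
  module C = Contraction ad xx yy U≢V
  module C₁ = Contraction ad₁ x₁ y₁ u≢v
  j₁ : Fin k₁ → Fin k
  j₁ c = C.f (ι₁ (C₁.g c))
  j₂ : Fin (n G₂) → Fin k
  j₂ b = C.f (ι₂ b)
  lift : ∀ {a b} → Link u v a b → C.f (ι₁ a) ≡ C.f (ι₁ b)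
  lift (inj₁ (refl , refl)) = C.f-uv
  lift (inj₂ (refl , refl)) = sym C.f-uv
  j₁-f : ∀ p → j₁ (C₁.f p) ≡ C.f (ι₁ p)
  j₁-f p with C₁.f-inj (C₁.g (C₁.f p)) p (C₁.fg (C₁.f p))
  ... | inj₁ e = cong (C.f ∘ ι₁) e
  ... | inj₂ l = lift l
  down : ∀ {a b} → C.f (ι₁ a) ≡ C.f (ι₁ b) → C₁.f a ≡ C₁.f b
  down {a} {b} e with C.f-inj (ι₁ a) (ι₁ b) e
  ... | inj₁ p = cong C₁.f (i₁ p)
  ... | inj₂ (inj₁ (p , q)) = C₁.f-link (inj₁ (i₁ p , i₁ q))
  ... | inj₂ (inj₂ (p , q)) = C₁.f-link (inj₂ (i₁ p , i₁ q))
  j₁-inj : Injective j₁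
  j₁-inj {c} {d} e = trans (sym (C₁.fg c)) (trans (down e) (C₁.fg d))
  terminal : ∀ {w b} → ι₂ b ≡ ι₁ w → (w ≡ x₁ × b ≡ x G₂) ⊎ (w ≡ y₁ × b ≡ y G₂)
  terminal e = meet _ _ (sym e)
  no-both : ∀ {b b'} → ι₂ b ≡ ι₁ u → ι₂ b' ≡ ι₁ v → ⊥
  no-both e e' with terminal e | terminal e'
  ... | inj₁ (refl , _) | inj₁ (refl , _) = u≢v refl
  ... | inj₂ (refl , _) | inj₂ (refl , _) = u≢v refl
  ... | inj₁ (refl , _) | inj₂ (refl , _) = noXY₁ uv
  ... | inj₂ (refl , _) | inj₁ (refl , _) = noXY₁ (E-sym C₁.H uv)
  j₂-inj : Injective j₂
  j₂-inj {b} {b'} e with C.f-inj (ι₂ b) (ι₂ b') e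
  ... | inj₁ p = i₂ p
  ... | inj₂ (inj₁ (p , q)) = ⊥-elim (no-both p q)
  ... | inj₂ (inj₂ (p , q)) = ⊥-elim (no-both q p)
  onto' : ∀ p → Σ (Fin k₁) (λ a → j₁ a ≡ p) ⊎ Σ (Fin (n G₂)) (λ b → j₂ b ≡ p)
  onto' p with onto (C.g p)
  ... | inj₁ (a , e) = inj₁ (C₁.f a , trans (j₁-f a) (trans (cong C.f e) (C.fg p)))
  ... | inj₂ (b , e) = inj₂ (b , trans (cong C.f e) (C.fg p))
  meet' : ∀ a b → j₁ a ≡ j₂ b → (a ≡ C₁.f x₁ × b ≡ x G₂) ⊎ (a ≡ C₁.f y₁ × b ≡ y G₂)
  meet' a b e with C.f-inj _ _ e
  ... | inj₁ p = at refl (meet _ b p)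
    where
    at : ∀ {w} → C₁.f w ≡ C₁.f (C₁.g a) → (w ≡ x₁ × b ≡ x G₂) ⊎ (w ≡ y₁ × b ≡ y G₂) → (a ≡ C₁.f x₁ × b ≡ x G₂) ⊎ (a ≡ C₁.f y₁ × b ≡ y G₂)
    at r (inj₁ (refl , s)) = inj₁ (trans (sym (C₁.fg a)) (sym r) , s)
    at r (inj₂ (refl , s)) = inj₂ (trans (sym (C₁.fg a)) (sym r) , s)
  ... | inj₂ (inj₁ (p , q)) = at (trans (sym C₁.f-uv) (cong C₁.f (sym (i₁ p)))) (terminal q)
    where
    at : ∀ {w} → C₁.f w ≡ C₁.f (C₁.g a) → (w ≡ x₁ × b ≡ x G₂) ⊎ (w ≡ y₁ × b ≡ y G₂) → (a ≡ C₁.f x₁ × b ≡ x G₂) ⊎ (a ≡ C₁.f y₁ × b ≡ y G₂)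
    at r (inj₁ (refl , s)) = inj₁ (trans (sym (C₁.fg a)) (sym r) , s)
    at r (inj₂ (refl , s)) = inj₂ (trans (sym (C₁.fg a)) (sym r) , s)
  ... | inj₂ (inj₂ (p , q)) = at (trans C₁.f-uv (cong C₁.f (sym (i₁ p)))) (terminal q)
    where
    at : ∀ {w} → C₁.f w ≡ C₁.f (C₁.g a) → (w ≡ x₁ × b ≡ x G₂) ⊎ (w ≡ y₁ × b ≡ y G₂) → (a ≡ C₁.f x₁ × b ≡ x G₂) ⊎ (a ≡ C₁.f y₁ × b ≡ y G₂)
    at r (inj₁ (refl , s)) = inj₁ (trans (sym (C₁.fg a)) (sym r) , s)
    at r (inj₂ (refl , s)) = inj₂ (trans (sym (C₁.fg a)) (sym r) , s)
  there : ∀ {c d} → TE C.C c d → SumAdj j₁ j₂ (TE C₁.C) (TE G₂) c d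
  there {c} {d} t with C.contract⁻ {c} {d} t
  ... | ne , p , q , refl , refl , e with Equivalence.to (edges p q) e
  ... | inj₁ (a , b , refl , refl , s) = inj₁ (C₁.f a , C₁.f b , j₁-f a , j₁-f b
      , C₁.contract⁺ (λ r → ne (trans (sym (j₁-f a)) (trans (cong j₁ r) (j₁-f b)))) (a , b , refl , refl , s))
  ... | inj₂ (a , b , refl , refl , s) = inj₂ (a , b , refl , refl , s)
  back : ∀ {c d} → SumAdj j₁ j₂ (TE C₁.C) (TE G₂) c d → TE C.C c d
  back (inj₁ (a , b , refl , refl , t)) with C₁.contract⁻ {a} {b} t
  ... | ne , p , q , refl , refl , s = C.contract⁺ (λ r → ne (j₁-inj r))
        (ι₁ p , ι₁ q , sym (j₁-f p) , sym (j₁-f q) , Equivalence.from (edges _ _) (inj₁ (p , q , refl , refl , s)))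
  back (inj₂ (a , b , refl , refl , t)) = C.contract⁺ (λ r → E-irrefl G₂ t (j₂-inj r))
        (ι₂ a , ι₂ b , refl , refl , Equivalence.from (edges _ _) (inj₂ (a , b , refl , refl , t)))

-- No contraction of a bridge lowers either genus

-- The added edge ab joins the two sides of the bridge uv.
module Separating {k : ℕ} {aB : Fin (suc k) → Fin (suc k) → Bool} {xB yB : Fin (suc k)}
  {u v : Fin (suc k)} (f : Fin (suc k) → Fin k) (f-uv : f u ≡ f v)
  (f-inj : ∀ p q → f p ≡ f q → p ≡ q ⊎ Link u v p q)
  (side : Fin (suc k) → Bool) (side-edge : ∀ {p q} → TE (graph (suc k) aB xB yB) p q → side p ≡ side q)
  (component : ∀ p q → side p ≡ side q → Cl (TE (graph (suc k) aB xB yB)) p q) (su≢sv : side u ≢ side v)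
  {a b : Fin (suc k)} (sa : side a ≡ side u) (sb : side b ≡ side v) (nuv : ¬ Link u v a b)
  {aK : Fin k → Fin k → Bool} {xK yK : Fin k} (NK : Nice (graph k aK xK yK))
  {aT : Fin (suc k) → Fin (suc k) → Bool} {xT yT : Fin (suc k)} (NT : Nice (graph (suc k) aT xT yT)) where

  private
    B T' : Graph
    B = graph (suc k) aB xB yB
    T' = graph (suc k) aT xT yT
    K : Graph
    K = graph k aK xK yK

  module _
    (K⁺ : ∀ {c d} → (MergeAdj f (TE B) ∪ Link (f a) (f b)) c d → TE K c d)
    (K⁻ : ∀ {c d} → TE K c d → (MergeAdj f (TE B) ∪ Link (f a) (f b)) c d)
    (T⁺ : ∀ {p q} → ((TE B ∪ Link a b) ∪ Link u v) p q → TE T' p q)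
    (T⁻ : ∀ {p q} → TE T' p q → ((TE B ∪ Link a b) ∪ Link u v) p q) where

    f-inj′ : ∀ p q → f p ≡ f q → p ≡ q ⊎ Link v u p q
    f-inj′ p q e = map₂ Link-flip (f-inj p q e)

    swap-merge : ∀ {c d} → MergeAdj f (TE B) c d → MergeAdj f (TE B) d c
    swap-merge (p , q , i , j , t) = q , p , j , i , E-sym B t

    -- The construction requires that a is not the end u of the bridge. If it is, then b differs
    -- from v and the two sides exchange their roles.
    simple-case : ¬ MergeAdj f (TE B) (f a) (f b) → Dec (a ≡ u) → Dec (b ≡ v) → eg T' ≤ eg K
    simple-case nab (no a≢u) _ = Bridge.BridgePlus.Simple.simple-bound {k} {aB} {xB} {yB} {u} {v} f f-uv f-inj side side-edge component su≢sv {a} {b} sa sb {aK} {xK} {yK} NK {aT} {xT} {yT} NT a≢u nab K⁺ K⁻ T⁺ T⁻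
    simple-case nab (yes _) (no b≢v) = Bridge.BridgePlus.Simple.simple-bound {k} {aB} {xB} {yB} {v} {u} f (sym f-uv) f-inj′ side side-edge component (su≢sv ∘ sym) {b} {a} sb sa {aK} {xK} {yK} NK {aT} {xT} {yT} NT b≢v (nab ∘ swap-merge)
      (λ { (inj₁ m) → K⁺ (inj₁ m) ; (inj₂ l) → K⁺ (inj₂ (Link-flip l)) })
      (λ t → map₂ Link-flip (K⁻ t))
      (λ { (inj₁ (inj₁ t)) → T⁺ (inj₁ (inj₁ t)) ; (inj₁ (inj₂ l)) → T⁺ (inj₁ (inj₂ (Link-flip l))) ; (inj₂ l) → T⁺ (inj₂ (Link-flip l)) })
      (λ t → flip (T⁻ t))
      where
      flip : ∀ {p q} → ((TE B ∪ Link a b) ∪ Link u v) p q → ((TE B ∪ Link b a) ∪ Link v u) p q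
      flip (inj₁ (inj₁ t)) = inj₁ (inj₁ t)
      flip (inj₁ (inj₂ l)) = inj₁ (inj₂ (Link-flip l))
      flip (inj₂ l) = inj₂ (Link-flip l)
    simple-case nab (yes refl) (yes refl) = ⊥-elim (nuv (inj₁ (refl , refl)))

    module Merged (m : MergeAdj f (TE B) (f a) (f b)) where
      K⁼ : ∀ {c d} → TE K c d → MergeAdj f (TE B) c d
      K⁼ {c} {d} t with K⁻ {c} {d} t
      ... | inj₁ r = r
      ... | inj₂ (inj₁ (refl , refl)) = m
      ... | inj₂ (inj₂ (refl , refl)) = swap-merge m

      parallel-case : eg T' ≤ eg K
      parallel-case = go m
        where
        exchange : ∀ {p q} → ((TE B ∪ Link a b) ∪ Link u v) p q → ((TE B ∪ Link u v) ∪ Link a b) p q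
        exchange (inj₁ (inj₁ t)) = inj₁ (inj₁ t)
        exchange (inj₁ (inj₂ l)) = inj₂ l
        exchange (inj₂ l) = inj₁ (inj₂ l)
        exchange⁻ : ∀ {p q} → ((TE B ∪ Link u v) ∪ Link a b) p q → ((TE B ∪ Link a b) ∪ Link u v) p q
        exchange⁻ (inj₁ (inj₁ t)) = inj₁ (inj₁ t)
        exchange⁻ (inj₂ l) = inj₁ (inj₂ l)
        exchange⁻ (inj₁ (inj₂ l)) = inj₂ l
        reverse : ∀ {p q} → ((TE B ∪ Link u v) ∪ Link a b) p q → ((TE B ∪ Link v u) ∪ Link b a) p q
        reverse (inj₁ (inj₁ t)) = inj₁ (inj₁ t)
        reverse (inj₁ (inj₂ l)) = inj₁ (inj₂ (Link-flip l))
        reverse (inj₂ l) = inj₂ (Link-flip l)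
        reverse⁻ : ∀ {p q} → ((TE B ∪ Link v u) ∪ Link b a) p q → ((TE B ∪ Link u v) ∪ Link a b) p q
        reverse⁻ (inj₁ (inj₁ t)) = inj₁ (inj₁ t)
        reverse⁻ (inj₁ (inj₂ l)) = inj₁ (inj₂ (Link-flip l))
        reverse⁻ (inj₂ l) = inj₂ (Link-flip l)
        cross : ∀ {p q} → side p ≡ side u → side q ≡ side v → ¬ TE B p q
        cross i j t = su≢sv (trans (sym i) (trans (side-edge t) j))
        -- The edge pq of B stays on one side, whereas a lies with u and b with v. So exactly one of
        -- its ends has been moved by the identification, and this end is v or u.
        cases : ∀ {p q} → TE B p q → p ≡ a ⊎ Link u v p a → q ≡ b ⊎ Link u v q b → eg T' ≤ eg K
        cases t (inj₁ refl) (inj₁ refl) = ⊥-elim (cross sa sb t)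
        cases t (inj₂ (inj₁ (_ , refl))) _ = ⊥-elim (su≢sv (sym sa))
        cases t (inj₂ (inj₂ _)) (inj₂ (inj₂ (_ , refl))) = ⊥-elim (su≢sv sb)
        cases t (inj₁ _) (inj₂ (inj₂ (_ , refl))) = ⊥-elim (su≢sv sb)
        cases t (inj₂ (inj₂ (refl , refl))) (inj₂ (inj₁ (refl , _))) = ⊥-elim (su≢sv (sym (side-edge t)))
        cases t (inj₂ (inj₂ (refl , refl))) (inj₁ refl) = Bridge.BridgePlus.Parallel.parallel-bound {k} {aB} {xB} {yB} {u} {v} f f-uv f-inj side side-edge component su≢sv {u} {b} refl sb {aK} {xK} {yK} NK {aT} {xT} {yT} NT t (λ r → K⁺ (inj₁ r)) K⁼ (T⁺ ∘ exchange⁻) (exchange ∘ T⁻)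
        cases t (inj₁ refl) (inj₂ (inj₁ (refl , refl))) = Bridge.BridgePlus.Parallel.parallel-bound {k} {aB} {xB} {yB} {v} {u} f (sym f-uv) f-inj′ side side-edge component (su≢sv ∘ sym) {v} {a} refl sa {aK} {xK} {yK} NK {aT} {xT} {yT} NT (E-sym B t) (λ r → K⁺ (inj₁ r)) K⁼ (T⁺ ∘ exchange⁻ ∘ reverse⁻) (reverse ∘ exchange ∘ T⁻)
        go : MergeAdj f (TE B) (f a) (f b) → eg T' ≤ eg K
        go (p , q , i , j , t) = cases t (f-inj p a i) (f-inj q b j)

    separating-bound : Dec (MergeAdj f (TE B) (f a) (f b)) → eg T' ≤ eg K
    separating-bound (yes m) = Merged.parallel-case m
    separating-bound (no nm) = simple-case nm (a ≟ u) (b ≟ v)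

Link-turn : ∀ {V W : Set} (h : V → W) {a b c d p q} → Link c d a b → Link (h a) (h b) p q → Link (h c) (h d) p q
Link-turn h (inj₁ (refl , refl)) l = l
Link-turn h (inj₂ (refl , refl)) l = Link-flip l

Link-turn⁻ : ∀ {V W : Set} (h : V → W) {a b c d p q} → Link c d a b → Link (h c) (h d) p q → Link (h a) (h b) p q
Link-turn⁻ h (inj₁ (refl , refl)) l = l
Link-turn⁻ h (inj₂ (refl , refl)) l = Link-flip l

Link-move : ∀ {V : Set} {a b c d p q : V} → Link c d a b → Link p q a b → Link p q c d
Link-move (inj₁ (refl , refl)) l = l
Link-move (inj₂ (refl , refl)) l = Link-sym l

module ContractBridge {k : ℕ} {ad : Fin (suc k) → Fin (suc k) → Bool} {xx yy u v : Fin (suc k)} (u≢v : u ≢ v) (xx≢yy : xx ≢ yy) where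
  open Contraction ad xx yy u≢v
  open Deletion H u v

  B : Graph
  B = delete H u v

  side : Fin (suc k) → Bool
  side p = sameClassᵇ (E B) u p

  module _ (N : Nice H) (uv : TE H u v) (noxy : NoXY H) (bridge : ¬ Cl (TE B) u v) where
    private
      T-eq : ∀ {a b} → (T a → T b) → (T b → T a) → a ≡ b
      T-eq {true} {true} _ _ = refl
      T-eq {false} {false} _ _ = refl
      T-eq {true} {false} h _ = ⊥-elim (h tt)
      T-eq {false} {true} _ h = ⊥-elim (h tt)

      side⁻ : ∀ {p} → T (side p) → Cl (TE B) u p
      side⁻ = sameClass-sound (E B)
      side⁺ : ∀ {p} → Cl (TE B) u p → T (side p)
      side⁺ = sameClass-complete (E B)

      side-edge : ∀ {p q} → TE B p q → side p ≡ side q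
      side-edge t = T-eq (λ s → side⁺ (side⁻ s ∙ [ t ])) (λ s → side⁺ (side⁻ s ∙ [ t ]⁻))

      su≢sv : side u ≢ side v
      su≢sv e = bridge (side⁻ (subst T e (side⁺ ε)))

      reach-uv : ∀ {p} → Cl (TE H) p u → Cl (TE B) u p ⊎ Cl (TE B) v p
      reach-uv = λ { ε → inj₁ ε ; (fwd t r) → extend t (reach-uv r) ; (bwd t r) → extend (E-sym H t) (reach-uv r) }
        where
        extend : ∀ {p q} → TE H p q → Cl (TE B) u q ⊎ Cl (TE B) v q → Cl (TE B) u p ⊎ Cl (TE B) v p
        extend t r with decompose t
        ... | inj₂ (inj₁ (refl , _)) = inj₁ ε
        ... | inj₂ (inj₂ (refl , _)) = inj₂ ε
        extend t (inj₁ r) | inj₁ s = inj₁ (r ∙ [ s ]⁻)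
        extend t (inj₂ r) | inj₁ s = inj₂ (r ∙ [ s ]⁻)

      component : ∀ p q → side p ≡ side q → Cl (TE B) p q
      component p q e with reach-uv (Nice.conn N p u) | reach-uv (Nice.conn N q u)
      ... | inj₁ r | inj₁ s = r ⁻ ∙ s
      ... | inj₂ r | inj₂ s = r ⁻ ∙ s
      ... | inj₁ r | inj₂ _ = r ⁻ ∙ side⁻ (subst T e (side⁺ r))
      ... | inj₂ _ | inj₁ s = (side⁻ (subst T (sym e) (side⁺ s))) ⁻ ∙ s

      NC : Nice C
      NC = nice-conn C (contract-x≢y uv noxy xx≢yy) (contract-conn (Nice.conn N))

      f-inj′ : ∀ p q → f p ≡ f q → p ≡ q ⊎ Link v u p q
      f-inj′ p q e = map₂ Link-flip (f-inj p q e)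

    -- The two cases in which the bridge is a leaf are exchanged by swapping u and v.
    simple : ∀ {aB xB yB aK xK yK aT xT yT} → let B' = graph (suc k) aB xB yB ; K = graph k aK xK yK ; T' = graph (suc k) aT xT yT in
      (∀ {p q} → TE B' p q → side p ≡ side q) → (∀ p q → side p ≡ side q → Cl (TE B') p q) → Nice K → Nice T' →
      (∀ {c d} → MergeAdj f (TE B') c d → TE K c d) → (∀ {c d} → TE K c d → MergeAdj f (TE B') c d) →
      (∀ {p q} → (TE B' ∪ Link u v) p q → TE T' p q) → (∀ {p q} → TE T' p q → (TE B' ∪ Link u v) p q) → eg T' ≤ eg K
    simple {aB} {xB} {yB} {aK} {xK} {yK} {aT} {xT} {yT} se co NK NT K⁺ K⁻ T⁺ T⁻ = go (Bridge.flag-at? {k} {aB} {xB} {yB} {u} {v} f f-uv f-inj side se co su≢sv u) (Bridge.flag-at? {k} {aB} {xB} {yB} {u} {v} f f-uv f-inj side se co su≢sv v)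
      where
      B' : Graph
      B' = graph (suc k) aB xB yB
      at : Fin (suc k) → Set
      at p = (Σ (Flag B') λ g → flagVertex B' g ≡ p) ⊎ (∀ g → flagVertex B' g ≢ p)
      go : at u → at v → eg (graph (suc k) aT xT yT) ≤ eg (graph k aK xK yK)
      go (inj₁ p) (inj₁ q) = Bridge.Contracted.Simple.bridge-both {k} {aB} {xB} {yB} {u} {v} f f-uv f-inj side se co su≢sv {aK} {xK} {yK} NK K⁺ K⁻ {aT} {xT} {yT} NT T⁺ T⁻ O p q
        where O = Represented.optimal′ (graph k aK xK yK) (Bridge.Contracted.Simple.RK {k} {aB} {xB} {yB} {u} {v} f f-uv f-inj side se co su≢sv {aK} {xK} {yK} NK K⁺ K⁻) NK
      go (inj₂ free) _ = Bridge.Contracted.Simple.bridge-leaf {k} {aB} {xB} {yB} {u} {v} f f-uv f-inj side se co su≢sv {aK} {xK} {yK} NK K⁺ K⁻ {aT} {xT} {yT} NT T⁺ T⁻ O free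
        where O = Represented.optimal′ (graph k aK xK yK) (Bridge.Contracted.Simple.RK {k} {aB} {xB} {yB} {u} {v} f f-uv f-inj side se co su≢sv {aK} {xK} {yK} NK K⁺ K⁻) NK
      go _ (inj₂ free) = Bridge.Contracted.Simple.bridge-leaf {k} {aB} {xB} {yB} {v} {u} f (sym f-uv) f-inj′ side se co (su≢sv ∘ sym) {aK} {xK} {yK} NK K⁺ K⁻ {aT} {xT} {yT} NT
        (λ { (inj₁ t) → T⁺ (inj₁ t) ; (inj₂ l) → T⁺ (inj₂ (Link-flip l)) }) (λ t → map₂ Link-flip (T⁻ t)) O free
        where O = Represented.optimal′ (graph k aK xK yK) (Bridge.Contracted.Simple.RK {k} {aB} {xB} {yB} {v} {u} f (sym f-uv) f-inj′ side se co (su≢sv ∘ sym) {aK} {xK} {yK} NK K⁺ K⁻) NK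

    merge⁺ : ∀ {c d} → MergeAdj f (TE B) c d → TE C c d
    merge⁺ (p , q , refl , refl , t) = let s , nl = delete⁻ t in
      contract⁺ (λ e → [ E-irrefl H s , nl ]′ (f-inj p q e)) (p , q , refl , refl , s)

    merge⁻ : ∀ {c d} → TE C c d → MergeAdj f (TE B) c d
    merge⁻ {c} {d} t with contract⁻ {c} {d} t
    ... | ne , p , q , refl , refl , s = p , q , refl , refl , delete⁺ s (ne ∘ f-link)

    contract-eg : eg H ≤ eg C
    contract-eg = simple {aB = adj B} {xx} {yy} {adj C} {f xx} {f yy} {ad} {xx} {yy} side-edge component NC N merge⁺ merge⁻ (restore uv) decompose

    private
      xC≢yC : x C ≢ y C
      xC≢yC = contract-x≢y uv noxy xx≢yy

      pH⁺ : ∀ {p q} → ((TE B ∪ Link xx yy) ∪ Link u v) p q → TE (plus H) p q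
      pH⁺ (inj₁ (inj₁ t)) = plus⁺ H xx≢yy (inj₁ (restore uv (inj₁ t)))
      pH⁺ (inj₁ (inj₂ l)) = plus⁺ H xx≢yy (inj₂ l)
      pH⁺ (inj₂ l) = plus⁺ H xx≢yy (inj₁ (restore uv (inj₂ l)))

      pH⁻ : ∀ {p q} → TE (plus H) p q → ((TE B ∪ Link xx yy) ∪ Link u v) p q
      pH⁻ {p} {q} t with plus⁻ H xx≢yy {p} {q} t
      ... | inj₂ l = inj₁ (inj₂ l)
      ... | inj₁ s with decompose {p} {q} s
      ... | inj₁ r = inj₁ (inj₁ r)
      ... | inj₂ l = inj₂ l

      pC⁺ : ∀ {c d} → (MergeAdj f (TE B) ∪ Link (f xx) (f yy)) c d → TE (plus C) c d
      pC⁺ {c} {d} (inj₁ m) = plus⁺ C xC≢yC {c} {d} (inj₁ (merge⁺ m))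
      pC⁺ (inj₂ l) = plus⁺ C xC≢yC (inj₂ l)

      pC⁻ : ∀ {c d} → TE (plus C) c d → (MergeAdj f (TE B) ∪ Link (f xx) (f yy)) c d
      pC⁻ {c} {d} t with plus⁻ C xC≢yC {c} {d} t
      ... | inj₁ s = inj₁ (merge⁻ {c} {d} s)
      ... | inj₂ l = inj₂ l

      module D⁺ = Deletion (plus H) u v

      -- With x and y on one side, the edge xy can be counted with B, and uv is a bridge of `plus H`
      -- too.
      module Nonseparating (sxy : side xx ≡ side yy) where
        B⁺⁻ : ∀ {p q} → TE (delete (plus H) u v) p q → (TE B ∪ Link xx yy) p q
        B⁺⁻ {p} {q} t with D⁺.delete⁻ {p} {q} t
        ... | s , nl with pH⁻ {p} {q} s
        ... | inj₁ r = r
        ... | inj₂ l = ⊥-elim (nl l)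

        B⁺⁺ : ∀ {p q} → (TE B ∪ Link xx yy) p q → TE (delete (plus H) u v) p q
        B⁺⁺ (inj₁ t) = D⁺.delete⁺ (pH⁺ (inj₁ (inj₁ t))) (proj₂ (delete⁻ t))
        B⁺⁺ (inj₂ l) = D⁺.delete⁺ (pH⁺ (inj₁ (inj₂ l))) (avoid l)
          where
          avoid : ∀ {p q} → Link xx yy p q → ¬ Link u v p q
          avoid (inj₁ (refl , refl)) l = no-link uv noxy l
          avoid (inj₂ (refl , refl)) l = no-link uv noxy (Link-sym l)

        bound : eg (plus H) ≤ eg (plus C)
        bound = simple {adj (delete (plus H) u v)} {xx} {yy} {adj (plus C)} {f xx} {f yy} {adj (plus H)} {xx} {yy}
          (λ t → [ side-edge , (λ { (inj₁ (refl , refl)) → sxy ; (inj₂ (refl , refl)) → sym sxy }) ]′ (B⁺⁻ t))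
          (λ p q e → Cl-mono (λ t → B⁺⁺ (inj₁ t)) (component p q e)) (nice-plus C xC≢yC NC) (nice-plus H xx≢yy N)
          (λ (p , q , a , b , t) → pC⁺ ([ (λ s → inj₁ (p , q , a , b , s))
            , (λ { (inj₁ (refl , refl)) → inj₂ (inj₁ (sym a , sym b)) ; (inj₂ (refl , refl)) → inj₂ (inj₂ (sym a , sym b)) }) ]′ (B⁺⁻ t)))
          (λ t → [ (λ (p , q , a , b , s) → p , q , a , b , B⁺⁺ (inj₁ s))
            , (λ { (inj₁ (a , b)) → xx , yy , sym a , sym b , B⁺⁺ (inj₂ (inj₁ (refl , refl)))
                 ; (inj₂ (a , b)) → yy , xx , sym a , sym b , B⁺⁺ (inj₂ (inj₂ (refl , refl))) }) ]′ (pC⁻ t))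
          (D⁺.restore (pH⁺ (inj₂ (inj₁ (refl , refl))))) D⁺.decompose

      -- The edge xy now crosses the bridge; a is the terminal on the side of u, whichever it is.
      module Separates {a b : Fin (suc k)} (ab : Link xx yy a b) (sa : side a ≡ side u) (sb : side b ≡ side v) where
        NC⁺ : Nice (plus C)
        NC⁺ = nice-plus C xC≢yC NC
        NH⁺ : Nice (plus H)
        NH⁺ = nice-plus H xx≢yy N

        T⁺ : ∀ {p q} → ((TE B ∪ Link a b) ∪ Link u v) p q → TE (plus H) p q
        T⁺ (inj₁ (inj₁ t)) = pH⁺ (inj₁ (inj₁ t))
        T⁺ (inj₁ (inj₂ l)) = pH⁺ (inj₁ (inj₂ (Link-turn id ab l)))
        T⁺ (inj₂ l) = pH⁺ (inj₂ l)

        T⁻ : ∀ {p q} → TE (plus H) p q → ((TE B ∪ Link a b) ∪ Link u v) p q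
        T⁻ {p} {q} t with pH⁻ {p} {q} t
        ... | inj₁ (inj₁ s) = inj₁ (inj₁ s)
        ... | inj₁ (inj₂ l) = inj₁ (inj₂ (Link-turn⁻ id ab l))
        ... | inj₂ l = inj₂ l

        K⁺ : ∀ {c d} → (MergeAdj f (TE B) ∪ Link (f a) (f b)) c d → TE (plus C) c d
        K⁺ {c} {d} (inj₁ m) = pC⁺ {c} {d} (inj₁ m)
        K⁺ (inj₂ l) = pC⁺ (inj₂ (Link-turn f ab l))

        K⁻ : ∀ {c d} → TE (plus C) c d → (MergeAdj f (TE B) ∪ Link (f a) (f b)) c d
        K⁻ {c} {d} t with pC⁻ {c} {d} t
        ... | inj₁ m = inj₁ m
        ... | inj₂ l = inj₂ (Link-turn⁻ f ab l)

        bound : eg (plus H) ≤ eg (plus C)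
        bound = Separating.separating-bound {k} {adj B} {xx} {yy} {u} {v} f f-uv f-inj side side-edge component su≢sv {a} {b} sa sb
          not-uv {adj (plus C)} {f xx} {f yy} NC⁺ {adj (plus H)} {xx} {yy} NH⁺ K⁺ K⁻ T⁺ T⁻ (dec (T? (E C (f a) (f b))))
          where
          not-uv : ¬ Link u v a b
          not-uv l = no-link uv noxy (Link-move ab l)
          dec : Dec (T (E C (f a) (f b))) → Dec (MergeAdj f (TE B) (f a) (f b))
          dec (yes t) = yes (merge⁻ {f a} {f b} t)
          dec (no nt) = no λ m → nt (merge⁺ m)

    contract-eg⁺ : eg (plus H) ≤ eg (plus C)
    contract-eg⁺ = go (side xx Bool.≟ side yy) (side xx Bool.≟ side u)
      where
      opposite-side : ∀ {p q} → side p ≢ side q → side p ≡ side u → side q ≡ side v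
      opposite-side ne e = ≢⇒≡ (λ r → ne (trans e (sym r))) (su≢sv ∘ sym)
      go : Dec (side xx ≡ side yy) → Dec (side xx ≡ side u) → eg (plus H) ≤ eg (plus C)
      go (yes s) _ = Nonseparating.bound s
      go (no ne) (yes e) = Separates.bound (inj₁ (refl , refl)) e (opposite-side ne e)
      go (no ne) (no ne') = let e = ≢⇒≡ (ne ∘ sym) (ne' ∘ sym) in
        Separates.bound (inj₂ (refl , refl)) e (opposite-side (ne ∘ sym) e)

nice-delete : ∀ G {u v} → Nice G → x G ≢ y G → Cl (TE (delete G u v)) u v → Nice (delete G u v)
nice-delete G {u} {v} N x≢y joined = nice-conn (delete G u v) x≢y λ a b → Cl-bind edge (Nice.conn N a b)
  where
  module D = Deletion G u v
  edge : ∀ {p q} → TE G p q → Cl (TE (delete G u v)) p q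
  edge {p} {q} t with D.decompose {p} {q} t
  ... | inj₁ s = [ s ]
  ... | inj₂ (inj₁ (refl , refl)) = joined
  ... | inj₂ (inj₂ (refl , refl)) = joined ⁻

Bridge? : (G : Graph) → Dec (Σ (Fin (n G)) λ u → Σ (Fin (n G)) λ v → T (E G u v) × ¬ Cl (TE (delete G u v)) u v)
Bridge? G = any? λ u → any? λ v → T? (E G u v) ×-dec ¬? (map′ (sameClass-sound (E (delete G u v))) (sameClass-complete (E (delete G u v))) (T? (sameClassᵇ (E (delete G u v)) u v)))

-- Arithmetic of the minimum

record SumFormula (a a⁺ b b⁺ g : ℕ) : Set where
  constructor minimum
  field
    ≤-apart  : g ≤ a + b + 2
    ≤-joined : g ≤ a⁺ + b⁺
    attained : a + b + 2 ≤ g ⊎ a⁺ + b⁺ ≤ g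

-- The minimum of a + b + 2 and a⁺ + b⁺ decreases when a and a⁺ become a' and a'⁺; h is (a⁺ ∸ a) + (b⁺ ∸ b).
record Drop (h a a⁺ a' a'⁺ : ℕ) : Set where
  constructor _&_
  field
    below-joined : a' + 3 ≤ a + h ⊎ a'⁺ + 1 ≤ a⁺
    below-apart  : a' + 1 ≤ a ⊎ a'⁺ + suc h ≤ a⁺ + 2

shift : ∀ c d {m n p q} → c + p ≡ d + m → c + q ≡ d + n → m ≤ n → p ≤ q
shift c d {m} {n} {p} {q} e e' le = ℕₚ.+-cancelˡ-≤ c p q (subst₂ _≤_ (sym e) (sym e') (ℕₚ.+-monoʳ-≤ d le))

-- To lie below a minimum is to lie below both of its terms, each time by one of the two new terms.
-- Comparing a' with a⁺ leaves s + r after b is cancelled; comparing a'⁺ with a leaves r, and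
-- writing a by means of a⁺ adds s. Hence only the sum s + r occurs.
drop⇔ : ∀ {a a⁺ s b b⁺ r g a' a'⁺ g'} → a⁺ ≡ a + s → b⁺ ≡ b + r → SumFormula a a⁺ b b⁺ g → SumFormula a' a'⁺ b b⁺ g' →
  g' < g ⇔ Drop (s + r) a a⁺ a' a'⁺
drop⇔ {a} {_} {s} {b} {_} {r} {g} {a'} {a'⁺} {g'} refl refl (minimum g≤₁ g≤₂ ≤g) (minimum g'≤₁ g'≤₂ ≤g') = mk⇔ (there ≤g') (back ≤g)
  where
  c₁ : ∀ a' b → b + (a' + 3) ≡ 0 + suc (a' + b + 2)
  c₁ = solve-∀
  c₂ : ∀ a s b r → b + (a + (s + r)) ≡ 0 + (a + s + (b + r))
  c₂ = solve-∀
  c₃ : ∀ z b r → (b + r) + (z + 1) ≡ 0 + suc (z + (b + r))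
  c₃ = solve-∀
  c₄ : ∀ a s b r → (b + r) + (a + s) ≡ 0 + (a + s + (b + r))
  c₄ = solve-∀
  c₅ : ∀ a' b → (b + 2) + (a' + 1) ≡ 0 + suc (a' + b + 2)
  c₅ = solve-∀
  c₆ : ∀ a b → (b + 2) + a ≡ 0 + (a + b + 2)
  c₆ = solve-∀
  c₇ : ∀ z s b r → b + (z + suc (s + r)) ≡ s + suc (z + (b + r))
  c₇ = solve-∀
  c₈ : ∀ a s b → b + (a + s + 2) ≡ s + (a + b + 2)
  c₈ = solve-∀
  there : (a' + b + 2 ≤ g' ⊎ a'⁺ + (b + r) ≤ g') → g' < g → Drop (s + r) a (a + s) a' a'⁺
  there (inj₁ le) lt = inj₁ (shift b 0 (c₁ a' b) (c₂ a s b r) (ℕₚ.≤-trans (s≤s le) (ℕₚ.≤-trans lt g≤₂)))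
    & inj₁ (shift (b + 2) 0 (c₅ a' b) (c₆ a b) (ℕₚ.≤-trans (s≤s le) (ℕₚ.≤-trans lt g≤₁)))
  there (inj₂ le) lt = inj₂ (shift (b + r) 0 (c₃ a'⁺ b r) (c₄ a s b r) (ℕₚ.≤-trans (s≤s le) (ℕₚ.≤-trans lt g≤₂)))
    & inj₂ (shift b s (c₇ a'⁺ s b r) (c₈ a s b) (ℕₚ.≤-trans (s≤s le) (ℕₚ.≤-trans lt g≤₁)))
  unshift : ∀ c d {m n p q} → c + p ≡ d + m → c + q ≡ d + n → p ≤ q → m ≤ n
  unshift c d e e' = shift d c (sym e) (sym e')
  back : (a + b + 2 ≤ g ⊎ a + s + (b + r) ≤ g) → Drop (s + r) a (a + s) a' a'⁺ → g' < g
  back (inj₁ le) (_ & inj₁ d) = ℕₚ.≤-trans (s≤s g'≤₁) (ℕₚ.≤-trans (unshift (b + 2) 0 (c₅ a' b) (c₆ a b) d) le)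
  back (inj₁ le) (_ & inj₂ d) = ℕₚ.≤-trans (s≤s g'≤₂) (ℕₚ.≤-trans (unshift b s (c₇ a'⁺ s b r) (c₈ a s b) d) le)
  back (inj₂ le) (inj₁ d & _) = ℕₚ.≤-trans (s≤s g'≤₁) (ℕₚ.≤-trans (unshift b 0 (c₁ a' b) (c₂ a s b r) d) le)
  back (inj₂ le) (inj₂ d & _) = ℕₚ.≤-trans (s≤s g'≤₂) (ℕₚ.≤-trans (unshift (b + r) 0 (c₃ a'⁺ b r) (c₄ a s b r) d) le)

no-drop : ∀ {h a a⁺ a' a'⁺} → a ≤ a' → a⁺ ≤ a'⁺ → ¬ Drop h a a⁺ a' a'⁺
no-drop {h} {a} {a⁺} {a'} {a'⁺} le le⁺ (inj₂ d & _) = ℕₚ.<-irrefl refl (ℕₚ.≤-trans (ℕₚ.≤-reflexive (ℕₚ.+-comm 1 a'⁺)) (ℕₚ.≤-trans d le⁺))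
no-drop {h} {a} {a⁺} {a'} {a'⁺} le le⁺ (_ & inj₁ d) = ℕₚ.<-irrefl refl (ℕₚ.≤-trans (ℕₚ.≤-reflexive (ℕₚ.+-comm 1 a')) (ℕₚ.≤-trans d le))
-- The mixed case would require both 3 ≤ h and h + 1 ≤ 2.
no-drop {h} {a} {a⁺} {a'} {a'⁺} le le⁺ (inj₁ d & inj₂ d⁺) = 3≰1 (ℕₚ.≤-trans
    (ℕₚ.+-cancelˡ-≤ a' 3 h (ℕₚ.≤-trans d (ℕₚ.+-monoˡ-≤ h le)))
    (ℕₚ.≤-pred (ℕₚ.+-cancelˡ-≤ a'⁺ (suc h) 2 (ℕₚ.≤-trans d⁺ (ℕₚ.+-monoˡ-≤ 2 le⁺)))))
  where
  3≰1 : ¬ 3 ≤ 1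
  3≰1 (s≤s ())

add-≤ : ∀ {m} i k {n} → m + i ≤ n → m + (i + k) ≤ n + k
add-≤ {m} i k le = ℕₚ.≤-trans (ℕₚ.≤-reflexive (sym (ℕₚ.+-assoc m i k))) (ℕₚ.+-monoˡ-≤ k le)

sub-≤ : ∀ {m} i k {n} → m + (i + k) ≤ n + k → m + i ≤ n
sub-≤ {m} i k {n} le = ℕₚ.+-cancelʳ-≤ k (m + i) n (ℕₚ.≤-trans (ℕₚ.≤-reflexive (ℕₚ.+-assoc m i k)) le)

weaken-≤ : ∀ {m} i {j n} → j ≤ i → m + i ≤ n → m + j ≤ n
weaken-≤ {m} i le = ℕₚ.≤-trans (ℕₚ.+-monoʳ-≤ m le)

module _ {a a⁺ a' a'⁺ : ℕ} where
  drop-low : ∀ {h} → h ≤ 2 → a'⁺ + 1 ≤ a⁺ → Drop h a a⁺ a' a'⁺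
  drop-low h≤2 d = inj₂ d & inj₂ (weaken-≤ 3 (s≤s h≤2) (add-≤ 1 2 d))

  drop-high : ∀ {h} → 2 ≤ h → a' + 1 ≤ a → Drop h a a⁺ a' a'⁺
  drop-high 2≤h d = inj₁ (ℕₚ.≤-trans (add-≤ 1 2 d) (ℕₚ.+-monoʳ-≤ a 2≤h)) & inj₁ d

  drop₁ : a'⁺ + 1 ≤ a⁺ ⊎ a' + 2 ≤ a → Drop 1 a a⁺ a' a'⁺
  drop₁ (inj₁ d) = drop-low (s≤s z≤n) d
  drop₁ (inj₂ d) = inj₁ (add-≤ 2 1 d) & inj₁ (weaken-≤ 2 (s≤s z≤n) d)

  drop₂ : a' + 1 ≤ a ⊎ a'⁺ + 1 ≤ a⁺ → Drop 2 a a⁺ a' a'⁺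
  drop₂ (inj₁ d) = drop-high ℕₚ.≤-refl d
  drop₂ (inj₂ d) = drop-low ℕₚ.≤-refl d

  drop₃ : a' + 1 ≤ a ⊎ a'⁺ + 2 ≤ a⁺ → Drop 3 a a⁺ a' a'⁺
  drop₃ (inj₁ d) = drop-high (s≤s (s≤s z≤n)) d
  drop₃ (inj₂ d) = inj₂ (weaken-≤ 2 (s≤s z≤n) d) & inj₂ (add-≤ 2 2 d)

  -- For h = 0 the other way to drop, a' + 3 ≤ a, implies this one, because the edge xy never lowers
  -- the genus and raises it by at most 2.
  drop₀⁻ : a ≤ a⁺ → a'⁺ ≤ a' + 2 → Drop 0 a a⁺ a' a'⁺ → a'⁺ + 1 ≤ a⁺
  drop₀⁻ le le' (inj₂ d & _) = d
  drop₀⁻ le le' (inj₁ d & _) = begin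
    a'⁺ + 1 ≤⟨ ℕₚ.+-monoˡ-≤ 1 le' ⟩
    a' + 2 + 1 ≡⟨ ℕₚ.+-assoc a' 2 1 ⟩
    a' + 3 ≤⟨ d ⟩
    a + 0 ≡⟨ ℕₚ.+-identityʳ a ⟩
    a ≤⟨ le ⟩
    a⁺ ∎
    where open ℕₚ.≤-Reasoning

  drop₁⁻ : Drop 1 a a⁺ a' a'⁺ → a'⁺ + 1 ≤ a⁺ ⊎ a' + 2 ≤ a
  drop₁⁻ (inj₁ d & _) = inj₂ (sub-≤ 2 1 d)
  drop₁⁻ (inj₂ d & _) = inj₁ d

  drop₂⁻ : Drop 2 a a⁺ a' a'⁺ → a' + 1 ≤ a ⊎ a'⁺ + 1 ≤ a⁺
  drop₂⁻ (_ & inj₁ d) = inj₁ d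
  drop₂⁻ (_ & inj₂ d) = inj₂ (sub-≤ 1 2 d)

  drop₃⁻ : Drop 3 a a⁺ a' a'⁺ → a' + 1 ≤ a ⊎ a'⁺ + 2 ≤ a⁺
  drop₃⁻ (_ & inj₁ d) = inj₁ d
  drop₃⁻ (_ & inj₂ d) = inj₂ (sub-≤ 2 2 d)

  -- The counterpart for h = 4: the other way to drop amounts to a'⁺ + 3 ≤ a⁺, and of these 3 at
  -- most 2 are due to the edge xy.
  drop₄⁻ : a⁺ ≤ a + 2 → a' ≤ a'⁺ → Drop 4 a a⁺ a' a'⁺ → a' + 1 ≤ a
  drop₄⁻ le le' (_ & inj₁ d) = d
  drop₄⁻ le le' (_ & inj₂ d) = sub-≤ 1 2 (ℕₚ.≤-trans (ℕₚ.+-monoˡ-≤ 3 le') (ℕₚ.≤-trans (sub-≤ 3 2 d) le))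

-- Tightness and the five classes

Drops : ℕ → Graph → Set
Drops h G = ∀ o u v → IsOp G o u v → Drop h (eg G) (eg⁺ G) (eg (apply o G u v)) (eg⁺ (apply o G u v))

isOp? : ∀ G o u v → Dec (IsOp G o u v)
isOp? G o u v = T? (E G u v) ×-dec (is-con o →-dec ¬? ((u ≟ x G ×-dec v ≟ y G) ⊎-dec (u ≟ y G ×-dec v ≟ x G)))
  where
  is-con : ∀ o → Dec (o ≡ con)
  is-con del = no λ ()
  is-con con = yes refl

critical? : ∀ P G → Dec (Critical P G)
critical? P G = map′ (λ (d , c) → λ { del → d ; con → c }) (λ f → f del , f con) (each del ×-dec each con)
  where
  each : ∀ o → Dec (∀ u v → IsOp G o u v → D 1 P G o u v)
  each o = all? λ u → all? λ v → isOp? G o u v →-dec (P (apply o G u v) + 1 ≤? P G)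

critO? : ∀ P G → NoXY G → Dec (CritO P G)
critO? P G noXY = map′ (noXY ,_) proj₂ (critical? P G)

Classes : ℕ → Graph → Set
Classes h G =
  (h ≡ 0 → CritO eg⁺ G)
  × (h ≡ 1 → CritO eg⁺ G ⊎ HopW G)
  × (h ≡ 2 → CritO eg⁺ G ⊎ CritO eg G ⊎ Cascade G)
  × (h ≡ 3 → CritO eg G ⊎ HopW⁺ G)
  × (h ≡ 4 → CritO eg G)

classes⇒drops : ∀ {h G} → h ≤ 4 → Classes h G → Drops h G
classes⇒drops {0} _ (c , _) o u v op = drop-low z≤n (proj₂ (c refl) o u v op)
classes⇒drops {1} _ (_ , c , _) o u v op = drop₁ ([ (λ p → inj₁ (proj₂ p o u v op)) , (λ p → proj₂ (proj₂ p) o u v op) ]′ (c refl))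
classes⇒drops {2} _ (_ , _ , c , _) o u v op = drop₂ ([ (λ p → inj₂ (proj₂ p o u v op)) , [ (λ p → inj₁ (proj₂ p o u v op)) , (λ p → proj₁ (proj₂ p) o u v op) ]′ ]′ (c refl))
classes⇒drops {3} _ (_ , _ , _ , c , _) o u v op = drop₃ ([ (λ p → inj₁ (proj₂ p o u v op)) , (λ p → proj₂ (proj₂ p) o u v op) ]′ (c refl))
classes⇒drops {4} _ (_ , _ , _ , _ , c) o u v op = drop-high (s≤s (s≤s z≤n)) (proj₂ (c refl) o u v op)
classes⇒drops {suc (suc (suc (suc (suc _))))} (s≤s (s≤s (s≤s (s≤s ()))))

-- Cascades and weak hoppers exclude critical graphs by definition, so criticality has to be decided
-- first; this is possible since there are finitely many operations. In the extreme cases 0 and 4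
-- the bounds on eg⁺ before and after the operation reduce the drop to one of the two genera.
drops⇒classes : ∀ {h G} → x G ≢ y G → Nice G → NoXY G →
  (∀ o u v → IsOp G o u v → x (apply o G u v) ≢ y (apply o G u v) × Nice (apply o G u v)) → Drops h G → Classes h G
drops⇒classes {h} {G} x≢y N noXY good drops =
    (λ { refl → noXY , λ o u v op → let ne , M = good o u v op in
        drop₀⁻ (Terminal.eg≤eg⁺ G x≢y N) (Terminal.eg⁺≤eg+2 (apply o G u v) ne M) (drops o u v op) })
  , (λ { refl → one (critO? eg⁺ G noXY) refl })
  , (λ { refl → two (critO? eg⁺ G noXY) (critO? eg G noXY) refl })
  , (λ { refl → three (critO? eg G noXY) refl })
  , (λ { refl → noXY , λ o u v op → let ne , M = good o u v op in
        drop₄⁻ (Terminal.eg⁺≤eg+2 G x≢y N) (Terminal.eg≤eg⁺ (apply o G u v) ne M) (drops o u v op) })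
  where
  one : Dec (CritO eg⁺ G) → h ≡ 1 → CritO eg⁺ G ⊎ HopW G
  one (yes c) _ = inj₁ c
  one (no nc) refl = inj₂ (noXY , nc , λ o u v op → drop₁⁻ (drops o u v op))
  two : Dec (CritO eg⁺ G) → Dec (CritO eg G) → h ≡ 2 → CritO eg⁺ G ⊎ CritO eg G ⊎ Cascade G
  two (yes c) _ _ = inj₁ c
  two (no _) (yes c) _ = inj₂ (inj₁ c)
  two (no nc⁺) (no nc) refl = inj₂ (inj₂ (noXY , (λ o u v op → drop₂⁻ (drops o u v op)) , nc , nc⁺))
  three : Dec (CritO eg G) → h ≡ 3 → CritO eg G ⊎ HopW⁺ G
  three (yes c) _ = inj₁ c
  three (no nc) refl = inj₂ (noXY , nc , λ o u v op → drop₃⁻ (drops o u v op))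

MinorSum : Kind → (G G₁ G₂ : Graph) → Fin (n G) → Fin (n G) → Fin (n G₁) → Fin (n G₁) → Set
MinorSum o G G₁ G₂ p q u v = Σ (Fin (n (apply o G₁ u v)) → Fin (n (apply o G p q))) λ j₁ → Σ (Fin (n G₂) → Fin (n (apply o G p q))) λ j₂ →
  IsXYSum (apply o G p q) (apply o G₁ u v) G₂ j₁ j₂

contract-minor-sum : ∀ {G G₁ G₂ : Graph} {ι₁ : Fin (n G₁) → Fin (n G)} {ι₂ : Fin (n G₂) → Fin (n G)} → IsXYSum G G₁ G₂ ι₁ ι₂ →
  ∀ u v → TE G₁ u v → NoXY G₁ → MinorSum con G G₁ G₂ (ι₁ u) (ι₁ v) u v
contract-minor-sum {graph zero _ _ _} {ι₁ = ι₁} S u v uv noXY₁ with ι₁ u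
... | ()
contract-minor-sum {graph (suc k) ad xx yy} {graph (suc k₁) ad₁ x₁ y₁} {G₂} {ι₁} {ι₂} S u v uv noXY₁ =
  subst₂ (λ A B → Σ (Fin (n B) → Fin (n A)) λ j₁ → Σ (Fin (n G₂) → Fin (n A)) λ j₂ → IsXYSum A B G₂ j₁ j₂)
    (sym (proj₂ e)) (sym (proj₂ e₁)) (contract-sum {k} {k₁} {ad} {ad₁} {xx} {yy} {x₁} {y₁} {G₂} {ι₁} {ι₂} S (proj₁ e₁) (proj₁ e) uv noXY₁)
  where
  u≢v : u ≢ v
  u≢v = E-irrefl (graph (suc k₁) ad₁ x₁ y₁) uv
  e = contract-≡ {ad = ad} {xx} {yy} {ι₁ u} {ι₁ v} (u≢v ∘ proj₁ S)
  e₁ = contract-≡ {ad = ad₁} {x₁} {y₁} {u} {v} u≢v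

minor-sum : ∀ {G G₁ G₂ : Graph} {ι₁ : Fin (n G₁) → Fin (n G)} {ι₂ : Fin (n G₂) → Fin (n G)} → IsXYSum G G₁ G₂ ι₁ ι₂ →
  ∀ o u v → TE G₁ u v → NoXY G₁ → MinorSum o G G₁ G₂ (ι₁ u) (ι₁ v) u v
minor-sum {G} {G₁} {G₂} {ι₁} {ι₂} S del u v uv noXY₁ = ι₁ , ι₂ , delete-sum {G} {G₁} {G₂} {ι₁} {ι₂} S u v uv noXY₁
minor-sum {G} {G₁} {G₂} {ι₁} {ι₂} S con u v uv noXY₁ = contract-minor-sum {G} {G₁} {G₂} {ι₁} {ι₂} S u v uv noXY₁

contract-good : ∀ G → x G ≢ y G → Nice G → NoXY G → ∀ u v → TE G u v → x (contract G u v) ≢ y (contract G u v) × Nice (contract G u v)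
contract-good (graph zero _ () _)
contract-good (graph (suc k) ad xx yy) x≢y N noXY u v uv = subst (λ A → x A ≢ y A × Nice A) (sym (proj₂ e))
    (ne , nice-conn C.C ne (C.contract-conn (Nice.conn N)))
  where
  e = contract-≡ {ad = ad} {xx} {yy} {u} {v} (E-irrefl (graph (suc k) ad xx yy) uv)
  module C = Contraction ad xx yy (proj₁ e)
  ne : x C.C ≢ y C.C
  ne = C.contract-x≢y uv noXY x≢y

bridge-contraction : ∀ G → x G ≢ y G → Nice G → NoXY G → ∀ u v → TE G u v → ¬ Cl (TE (delete G u v)) u v →
  eg G ≤ eg (apply con G u v) × eg⁺ G ≤ eg⁺ (apply con G u v)
bridge-contraction (graph zero _ () _)
bridge-contraction (graph (suc k) ad xx yy) x≢y N noXY u v uv bridge =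
  subst (λ A → eg (graph (suc k) ad xx yy) ≤ eg A × eg⁺ (graph (suc k) ad xx yy) ≤ eg⁺ A) (sym e′)
    (B.contract-eg N uv noXY bridge , B.contract-eg⁺ N uv noXY bridge)
  where
  e = contract-≡ {ad = ad} {xx} {yy} {u} {v} (E-irrefl (graph (suc k) ad xx yy) uv)
  e′ : apply con (graph (suc k) ad xx yy) u v ≡ contractWith k ad xx yy u v (proj₁ e)
  e′ = proj₂ e
  module B = ContractBridge {ad = ad} {xx} {yy} (proj₁ e) x≢y

module _ {G G₁ G₂ : Graph} {ι₁ : Fin (n G₁) → Fin (n G)} {ι₂ : Fin (n G₂) → Fin (n G)} (x≢y₁ : x G₁ ≢ y G₁) (x≢y₂ : x G₂ ≢ y G₂)
  (S : IsXYSum G G₁ G₂ ι₁ ι₂) (N₁ : Nice G₁) (N₂ : Nice G₂) (noXY₁ : NoXY G₁) (noXY₂ : NoXY G₂) where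

  private
    formula : ∀ {G G₁ : Graph} {ι₁ : Fin (n G₁) → Fin (n G)} {ι₂ : Fin (n G₂) → Fin (n G)} → x G₁ ≢ y G₁ → Nice G₁ → IsXYSum G G₁ G₂ ι₁ ι₂ →
      SumFormula (eg G₁) (eg⁺ G₁) (eg G₂) (eg⁺ G₂) (eg G)
    formula {G} {G₁} {ι₁} {ι₂} ne N S = minimum (SumGenus.upper₀ G G₁ G₂ {ι₁} {ι₂} ne x≢y₂ S N N₂ noXY₂) (joined-bound G G₁ G₂ {ι₁} {ι₂} ne x≢y₂ S N N₂ noXY₂) (SumGenus.lower G G₁ G₂ {ι₁} {ι₂} ne x≢y₂ S N N₂ noXY₂)

    θ-eq : ∀ H → x H ≢ y H → Nice H → eg⁺ H ≡ eg H + θ H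
    θ-eq H ne N = sym (ℕₚ.m+[n∸m]≡n (Terminal.eg≤eg⁺ H ne N))

    θ≤2 : ∀ H → x H ≢ y H → Nice H → θ H ≤ 2
    θ≤2 H ne N = ℕₚ.m≤n+o⇒m∸n≤o (eg⁺ H) (eg H) (Terminal.eg⁺≤eg+2 H ne N)

  η≤4 : η G₁ G₂ ≤ 4
  η≤4 = ℕₚ.+-mono-≤ (θ≤2 G₁ x≢y₁ N₁) (θ≤2 G₂ x≢y₂ N₂)

  op-drop⇔ : ∀ o u v → TE G₁ u v → x (apply o G₁ u v) ≢ y (apply o G₁ u v) → Nice (apply o G₁ u v) →
    eg (apply o G (ι₁ u) (ι₁ v)) < eg G ⇔ Drop (η G₁ G₂) (eg G₁) (eg⁺ G₁) (eg (apply o G₁ u v)) (eg⁺ (apply o G₁ u v))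
  op-drop⇔ o u v uv ne N = drop⇔ {eg G₁} {eg⁺ G₁} {θ G₁} {eg G₂} {eg⁺ G₂} {θ G₂} {eg G} {eg (apply o G₁ u v)} {eg⁺ (apply o G₁ u v)} {eg (apply o G (ι₁ u) (ι₁ v))} (θ-eq G₁ x≢y₁ N₁) (θ-eq G₂ x≢y₂ N₂) (formula {G} {G₁} {ι₁} {ι₂} x≢y₁ N₁ S)
    (minor-formula (minor-sum {G} {G₁} {G₂} {ι₁} {ι₂} S o u v uv noXY₁))
    where
    minor-formula : MinorSum o G G₁ G₂ (ι₁ u) (ι₁ v) u v →
      SumFormula (eg (apply o G₁ u v)) (eg⁺ (apply o G₁ u v)) (eg G₂) (eg⁺ G₂) (eg (apply o G (ι₁ u) (ι₁ v)))
    minor-formula (j₁ , j₂ , S′) = formula {apply o G (ι₁ u) (ι₁ v)} {apply o G₁ u v} {j₁} {j₂} ne N S′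

  tight⇔classes : Tight eg G G₁ ι₁ ⇔ Classes (η G₁ G₂) G₁
  tight⇔classes = go (Bridge? G₁)
    where
    with-bridge : ∀ {u v} → TE G₁ u v → ¬ Cl (TE (delete G₁ u v)) u v → Tight eg G G₁ ι₁ ⇔ Classes (η G₁ G₂) G₁
    with-bridge {u} {v} uv bridge = mk⇔
        (λ tight → ⊥-elim (none (Equivalence.to (op-drop⇔ con u v uv (proj₁ good) (proj₂ good)) (tight con u v op))))
        (λ classes → ⊥-elim (none (classes⇒drops {η G₁ G₂} {G₁} η≤4 classes con u v op)))
      where
      good : x (apply con G₁ u v) ≢ y (apply con G₁ u v) × Nice (apply con G₁ u v)
      good = contract-good G₁ x≢y₁ N₁ noXY₁ u v uv
      op : IsOp G₁ con u v
      op = uv , λ _ → λ { (inj₁ (refl , refl)) → noXY₁ uv ; (inj₂ (refl , refl)) → noXY₁ (E-sym G₁ uv) }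
      none : ¬ Drop (η G₁ G₂) (eg G₁) (eg⁺ G₁) (eg (apply con G₁ u v)) (eg⁺ (apply con G₁ u v))
      none = let le , le⁺ = bridge-contraction G₁ x≢y₁ N₁ noXY₁ u v uv bridge in no-drop {η G₁ G₂} {eg G₁} {eg⁺ G₁} {eg (apply con G₁ u v)} {eg⁺ (apply con G₁ u v)} le le⁺
    bridgeless : (∀ {u v} → TE G₁ u v → Cl (TE (delete G₁ u v)) u v) → Tight eg G G₁ ι₁ ⇔ Classes (η G₁ G₂) G₁
    bridgeless joined = mk⇔
        (λ tight → drops⇒classes {η G₁ G₂} {G₁} x≢y₁ N₁ noXY₁ good λ o u v op → Equivalence.to (at o u v op) (tight o u v op))
        (λ classes o u v op → Equivalence.from (at o u v op) (classes⇒drops {η G₁ G₂} {G₁} η≤4 classes o u v op))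
      where
      good : ∀ o u v → IsOp G₁ o u v → x (apply o G₁ u v) ≢ y (apply o G₁ u v) × Nice (apply o G₁ u v)
      good del u v (uv , _) = x≢y₁ , nice-delete G₁ N₁ x≢y₁ (joined uv)
      good con u v (uv , _) = contract-good G₁ x≢y₁ N₁ noXY₁ u v uv
      at : ∀ o u v → IsOp G₁ o u v →
        eg (apply o G (ι₁ u) (ι₁ v)) < eg G ⇔ Drop (η G₁ G₂) (eg G₁) (eg⁺ G₁) (eg (apply o G₁ u v)) (eg⁺ (apply o G₁ u v))
      at o u v op = let ne , N = good o u v op in op-drop⇔ o u v (proj₁ op) ne N
    go : Dec (Σ (Fin (n G₁)) λ u → Σ (Fin (n G₁)) λ v → T (E G₁ u v) × ¬ Cl (TE (delete G₁ u v)) u v) → Tight eg G G₁ ι₁ ⇔ Classes (η G₁ G₂) G₁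
    go (yes (_ , _ , uv , bridge)) = with-bridge uv bridge
    go (no none) = bridgeless λ {u} {v} uv → connected uv (T? (sameClassᵇ (E (delete G₁ u v)) u v))
      where
      connected : ∀ {u v} → TE G₁ u v → Dec (T (sameClassᵇ (E (delete G₁ u v)) u v)) → Cl (TE (delete G₁ u v)) u v
      connected {u} {v} _ (yes t) = sameClass-sound (E (delete G₁ u v)) t
      connected {u} {v} uv (no nt) = ⊥-elim (none (u , v , uv , λ r → nt (sameClass-complete (E (delete G₁ u v)) r)))

theorem4p8 : (G G₁ G₂ : Graph) (ι₁ : Fin (n G₁) → Fin (n G)) (ι₂ : Fin (n G₂) → Fin (n G))
  → x G₁ ≢ y G₁ → x G₂ ≢ y G₂
  → IsXYSum G G₁ G₂ ι₁ ι₂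
  → Connected G₁ → Connected G₂
  → NoXY G₁ → NoXY G₂
  → (Tight eg G G₁ ι₁ ⇔
      ((η G₁ G₂ ≡ 0 → CritO eg⁺ G₁)
       × (η G₁ G₂ ≡ 1 → CritO eg⁺ G₁ ⊎ HopW G₁)
       × (η G₁ G₂ ≡ 2 → CritO eg⁺ G₁ ⊎ CritO eg G₁ ⊎ Cascade G₁)
       × (η G₁ G₂ ≡ 3 → CritO eg G₁ ⊎ HopW⁺ G₁)
       × (η G₁ G₂ ≡ 4 → CritO eg G₁)))
theorem4p8 G G₁ G₂ ι₁ ι₂ x≢y₁ x≢y₂ S conn₁ conn₂ noXY₁ noXY₂ =
  tight⇔classes {G} {G₁} {G₂} {ι₁} {ι₂} x≢y₁ x≢y₂ S (nice G₁ x≢y₁ conn₁) (nice G₂ x≢y₂ conn₂) noXY₁ noXY₂
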